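{- Let $q$ be a prime power and let $\mathcal C,\Pi_i,\Pi_e,\mathcal N$ be the sets of planes of ${\rm PG}(5,q)$ defined below. Then $\mathcal C\cup\Pi_i\cup\Pi_e\cup\mathcal N$ consists of $q^3(q^2-1)(q-1)/3+(q^2+1)(q^2+q+1)$ planes, any two of which intersect in at most one point.
   Context: A quadric of ${\rm PG}(2,q)$ is the zero locus of a nonzero quadratic form $a_{11}X_1^2+a_{22}X_2^2+a_{33}X_3^2+a_{12}X_1X_2+a_{13}X_1X_3+a_{23}X_2X_3$ over ${\rm GF}(q)$; the Veronese map $v$ sends it to the point $(a_{11},a_{22},a_{33},a_{12},a_{13},a_{23})$ of ${\rm PG}(5,q)$. Degenerate quadrics are: repeated lines; bi-lines (two distinct lines of ${\rm PG}(2,q)$); imaginary bi-lines (two distinct lines of ${\rm PG}(2,q^2)$ conjugate under $x\mapsto x^q$); a (imaginary) bi-line is centered at the intersection of its two lines. Non-degenerate quadrics are conics. Let $G={\rm PGL}(3,q)$, let $S$ be a Singer cyclic subgroup of $G$ (cyclic of order $q^2+q+1$, regular on points of ${\rm PG}(2,q)$), which fixes a unique triangle of ${\rm PG}(2,q^3)$, and let $\mathcal B$ be the circumscribed bundle left invariant by $S$: the set of conics of ${\rm PG}(2,q)$ whose extension to ${\rm PG}(2,q^3)$ contains the three vertices of that triangle. Definitions: (i) $\mathcal C=\{v(\mathcal B'):\mathcal B'\in\mathcal B^G\}$, where $\mathcal B^G$ is the orbit of $\mathcal B$ under $G$; each $v(\mathcal B')$ is a plane. (ii) $\mathcal N=\{\pi_A: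 A\in{\rm PG}(2,q)\}$, where $\pi_A$ is the plane formed by the images under $v$ of the repeated lines through $A$ and of the bi-lines and imaginary bi-lines centered at $A$. (iii) $\Pi_e$ is the set of planes spanned by $\{v(\beta):\beta\in b,\ \beta\text{ centered at a point of }C\}$, for $b$ an $S$-orbit on bi-lines and $C\in\mathcal B$. (iv) $\Pi_i$ is the set of planes spanned by $\{v(\beta):\beta\in b',\ \beta\text{ centered at a point of }C\}$, for $b'$ an $S$-orbit on imaginary bi-lines and $C\in\mathcal B$. -}

module Defs where

open import Data.Nat as ℕ using (ℕ; zero; suc)
open import Data.Nat.Primality using (Prime)
open import Data.Fin using (Fin; zero; suc)
open import Data.Bool using (Bool; true; false; if_then_else_)
open import Data.List using (List; []; _∷_; length; lookup)
open import Data.List.Relation.Unary.All using (All)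
open import Data.Product using (Σ; ∃; _×_; _,_; proj₁; proj₂)
open import Data.Sum using (_⊎_)
open import Relation.Binary.PropositionalEquality using (_≡_; _≢_)
open import Relation.Nullary using (¬_)
open import Algebra.Structures using (IsCommutativeRing)
open import Level using (0ℓ)
import Data.Fin
import Relation.Nullary
import Data.Nat.DivMod

IsPrimePower : ℕ → Set
IsPrimePower q = Σ ℕ λ p → Σ ℕ λ k → Prime p × q ≡ p ℕ.^ suc k

-- A finite field with exactly q elements, realised on the carrier Fin q
-- (every finite field of order q is isomorphic to one of these).

record FiniteField (q : ℕ) : Set where
  infixl 6 _+_
  infixl 7 _*_
  field
    _+_ _*_     : Fin q → Fin q → Fin q
    -_          : Fin q → Fin q
    0# 1#       : Fin q
    isCommutativeRing : IsCommutativeRing _≡_ _+_ _*_ -_ 0# 1#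
    0≢1         : 0# ≢ 1#
    inverse     : ∀ x → x ≢ 0# → Σ (Fin q) λ y → x * y ≡ 1#

record FieldHom {q r : ℕ} (F : FiniteField q) (K : FiniteField r) : Set where
  private
    module F = FiniteField F
    module K = FiniteField K
  field
    ⟦_⟧      : Fin q → Fin r
    pres-+   : ∀ x y → ⟦ x F.+ y ⟧ ≡ ⟦ x ⟧ K.+ ⟦ y ⟧
    pres-*   : ∀ x y → ⟦ x F.* y ⟧ ≡ ⟦ x ⟧ K.* ⟦ y ⟧
    pres-0   : ⟦ F.0# ⟧ ≡ K.0#
    pres-1   : ⟦ F.1# ⟧ ≡ K.1#

-- Index set of the monomials X_iX_j (i ≤ j) of a ternary quadratic form,
-- in the order (a11,a22,a33,a12,a13,a23) used by the Veronese map.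

data Pair : Set where
  p11 p22 p33 p12 p13 p23 : Pair

fstP sndP : Pair → Fin 3
fstP p11 = zero
fstP p22 = suc zero
fstP p33 = suc (suc zero)
fstP p12 = zero
fstP p13 = zero
fstP p23 = suc zero
sndP p11 = zero
sndP p22 = suc zero
sndP p33 = suc (suc zero)
sndP p12 = suc zero
sndP p13 = suc (suc zero)
sndP p23 = suc (suc zero)

diag : Pair → Bool
diag p11 = true
diag p22 = true
diag p33 = true
diag _   = false

module LinAlg {q : ℕ} (F : FiniteField q) where
  open FiniteField F public

  C : Set
  C = Fin q

  _^_ : C → ℕ → C
  x ^ zero  = 1#
  x ^ suc k = x * (x ^ k)

  Vec3 : Set
  Vec3 = Fin 3 → C

  -- a quadratic form = its coefficient vector = a vector of GF(q)^6
  Form : Set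
  Form = Pair → C

  Mat : Set
  Mat = Fin 3 → Fin 3 → C

  sum3 : (Fin 3 → C) → C
  sum3 f = f zero + (f (suc zero) + f (suc (suc zero)))

  sumP : (Pair → C) → C
  sumP f = f p11 + (f p22 + (f p33 + (f p12 + (f p13 + f p23))))

  _·_ : Vec3 → Vec3 → C
  ℓ · x = sum3 λ i → ℓ i * x i

  eval : Form → Vec3 → C
  eval a x = sumP λ p → a p * (x (fstP p) * x (sndP p))

  prodLin : Vec3 → Vec3 → Form
  prodLin ℓ m p =
    if diag p then ℓ (fstP p) * m (fstP p)
    else ℓ (fstP p) * m (sndP p) + ℓ (sndP p) * m (fstP p)

  -- coefficient vector of the form X ↦ a(MX)
  substForm : Form → Mat → Form
  substForm a M kl = sumP λ ij →
    a ij * (if diag kl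
            then M (fstP ij) k * M (sndP ij) k
            else M (fstP ij) k * M (sndP ij) l + M (fstP ij) l * M (sndP ij) k)
    where k = fstP kl
          l = sndP kl

  _∙M_ : Mat → Mat → Mat
  (M ∙M N) i j = sum3 λ k → M i k * N k j

  idM : Mat
  idM i j with i Data.Fin.≟ j
  ... | Relation.Nullary.yes _ = 1#
  ... | Relation.Nullary.no _  = 0#

  _^M_ : Mat → ℕ → Mat
  M ^M zero  = idM
  M ^M suc k = M ∙M (M ^M k)

  apply : Mat → Vec3 → Vec3
  apply M x i = sum3 λ j → M i j * x j

  Invertible : Mat → Set
  Invertible M = Σ Mat λ N → ∀ i j → (M ∙M N) i j ≡ idM i j

  IsScalarMat : Mat → Set
  IsScalarMat M = Σ C λ c → ∀ i j → M i j ≡ c * idM i j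

  NonZero3 : Vec3 → Set
  NonZero3 x = Σ (Fin 3) λ i → x i ≢ 0#

  Prop3 : Vec3 → Vec3 → Set
  Prop3 x y = Σ C λ c → c ≢ 0# × (∀ i → y i ≡ c * x i)

  NonZeroForm : Form → Set
  NonZeroForm a = Σ Pair λ p → a p ≢ 0#

  PropForm : Form → Form → Set
  PropForm a b = Σ C λ c → c ≢ 0# × (∀ p → b p ≡ c * a p)

  _≗F_ : Form → Form → Set
  a ≗F b = ∀ p → a p ≡ b p

  scaleF : C → Form → Form
  scaleF c a p = c * a p

  zeroF : Form
  zeroF _ = 0#

  _+F_ : Form → Form → Form
  (a +F b) p = a p + b p

  Subset6 : Set₁
  Subset6 = Form → Set

  lincomb : List (C × Form) → Form
  lincomb []             = zeroF
  lincomb ((c , w) ∷ xs) = scaleF c w +F lincomb xs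

  Span : Subset6 → Subset6
  Span S v = Σ (List (C × Form)) λ xs →
               All (λ cw → S (proj₂ cw)) xs × v ≗F lincomb xs

  _≐_ : Subset6 → Subset6 → Set
  W ≐ W' = ∀ v → (W v → W' v) × (W' v → W v)

  Independent3 : Form → Form → Form → Set
  Independent3 u v w = ∀ a b c →
    (scaleF a u +F (scaleF b v +F scaleF c w)) ≗F zeroF →
    (a ≡ 0#) × (b ≡ 0#) × (c ≡ 0#)

  -- W is a plane of PG(5,q), i.e. a 3-dimensional subspace of GF(q)^6
  IsPlane : Subset6 → Set
  IsPlane W = Σ Form λ u → Σ Form λ v → Σ Form λ w →
    Independent3 u v w × (W ≐ Span (λ x → x ≗F u ⊎ (x ≗F v ⊎ x ≗F w)))

  MeetInAtMostOnePoint : Subset6 → Subset6 → Set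
  MeetInAtMostOnePoint W W' = ∀ x y → NonZeroForm x → NonZeroForm y →
    W x → W' x → W y → W' y → PropForm x y

  IsQuadric : Form → Set
  IsQuadric = NonZeroForm

  RepeatedLineThrough : Vec3 → Form → Set
  RepeatedLineThrough A Q = Σ C λ c → Σ Vec3 λ ℓ →
    c ≢ 0# × NonZero3 ℓ × Q ≗F scaleF c (prodLin ℓ ℓ) × ℓ · A ≡ 0#

  RepeatedLine : Form → Set
  RepeatedLine Q = Σ C λ c → Σ Vec3 λ ℓ →
    c ≢ 0# × NonZero3 ℓ × Q ≗F scaleF c (prodLin ℓ ℓ)

  BiLine : Form → Set
  BiLine Q = Σ C λ c → Σ Vec3 λ ℓ → Σ Vec3 λ m →
    c ≢ 0# × NonZero3 ℓ × NonZero3 m × ¬ Prop3 ℓ m ×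
    Q ≗F scaleF c (prodLin ℓ m)

  BiLineCenteredAt : Vec3 → Form → Set
  BiLineCenteredAt A Q = Σ C λ c → Σ Vec3 λ ℓ → Σ Vec3 λ m →
    c ≢ 0# × NonZero3 ℓ × NonZero3 m × ¬ Prop3 ℓ m ×
    Q ≗F scaleF c (prodLin ℓ m) × ℓ · A ≡ 0# × m · A ≡ 0#

module Geometry {q : ℕ}
  (F : FiniteField q)
  (L : FiniteField (q ℕ.^ 2)) (ιL : FieldHom F L)
  (K : FiniteField (q ℕ.^ 3)) (ιK : FieldHom F K) where

  open LinAlg F public
  module LA = LinAlg L
  module KA = LinAlg K
  open FieldHom ιL renaming (⟦_⟧ to ιL⟦_⟧)
  open FieldHom ιK renaming (⟦_⟧ to ιK⟦_⟧)

  n : ℕ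
  n = q ℕ.* q ℕ.+ q ℕ.+ 1

  -- g generates a Singer cyclic subgroup of PGL(3,q):
  -- its image in PGL(3,q) has order q²+q+1 and ⟨g⟩ is transitive
  -- (hence regular) on the points of PG(2,q).
  IsSingerGenerator : Mat → Set
  IsSingerGenerator g =
    Invertible g × IsScalarMat (g ^M n) ×
    (∀ k → 0 ℕ.< k → k ℕ.< n → ¬ IsScalarMat (g ^M k)) ×
    (∀ P Q → NonZero3 P → NonZero3 Q →
       Σ ℕ λ k → Prop3 (apply (g ^M k) P) Q)

  σ : LA.Vec3 → LA.Vec3
  σ ℓ i = ℓ i LA.^ q

  ImBiLineCenteredAt : Vec3 → Form → Set
  ImBiLineCenteredAt A Q = Σ LA.C λ c → Σ LA.Vec3 λ ℓ →
    c ≢ LA.0# × LA.NonZero3 ℓ × ¬ LA.Prop3 ℓ (σ ℓ) ×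
    (∀ p → ιL⟦ Q p ⟧ ≡ LA.scaleF c (LA.prodLin ℓ (σ ℓ)) p) ×
    ℓ LA.· (λ i → ιL⟦ A i ⟧) ≡ LA.0# × σ ℓ LA.· (λ i → ιL⟦ A i ⟧) ≡ LA.0#

  ImBiLine : Form → Set
  ImBiLine Q = Σ LA.C λ c → Σ LA.Vec3 λ ℓ →
    c ≢ LA.0# × LA.NonZero3 ℓ × ¬ LA.Prop3 ℓ (σ ℓ) ×
    (∀ p → ιL⟦ Q p ⟧ ≡ LA.scaleF c (LA.prodLin ℓ (σ ℓ)) p)

  Conic : Form → Set
  Conic Q = IsQuadric Q × ¬ RepeatedLine Q × ¬ BiLine Q × ¬ ImBiLine Q

  OnQ : Form → Vec3 → Set
  OnQ Q A = NonZero3 A × eval Q A ≡ 0#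

  module _ (g : Mat) where

    -- points of PG(2,q³) fixed by S = ⟨g⟩ (the vertices of the fixed triangle)
    FixedK : KA.Vec3 → Set
    FixedK T = KA.NonZero3 T ×
      KA.Prop3 T (KA.apply (λ i j → ιK⟦ g i j ⟧) T)

    -- the circumscribed bundle ℬ left invariant by S
    InB : Form → Set
    InB Q = Conic Q ×
      (∀ T → FixedK T → KA.eval (λ p → ιK⟦ Q p ⟧) T ≡ KA.0#)

    InC : Subset6 → Set
    InC W = Σ Mat λ M → Invertible M ×
      (W ≐ Span (λ v → Σ Form λ Q → InB Q × v ≗F substForm Q M))

    InΠe : Subset6 → Set
    InΠe W = Σ Form λ β₀ → BiLine β₀ × Σ Form λ Cn → InB Cn ×
      (W ≐ Span (λ v → Σ ℕ λ k → v ≗F substForm β₀ (g ^M k) ×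
           Σ Vec3 λ A → OnQ Cn A × BiLineCenteredAt A (substForm β₀ (g ^M k))))

    InΠi : Subset6 → Set
    InΠi W = Σ Form λ β₀ → ImBiLine β₀ × Σ Form λ Cn → InB Cn ×
      (W ≐ Span (λ v → Σ ℕ λ k → v ≗F substForm β₀ (g ^M k) ×
           Σ Vec3 λ A → OnQ Cn A × ImBiLineCenteredAt A (substForm β₀ (g ^M k))))

    InN : Subset6 → Set
    InN W = Σ Vec3 λ A → NonZero3 A ×
      (W ≐ Span (λ v → RepeatedLineThrough A v ⊎
                       (BiLineCenteredAt A v ⊎ ImBiLineCenteredAt A v)))

    InUnion : Subset6 → Set
    InUnion W = InC W ⊎ (InΠi W ⊎ (InΠe W ⊎ InN W))

    count : ℕ
    count = (q ℕ.^ 3 ℕ.* (q ℕ.^ 2 ℕ.∸ 1) ℕ.* (q ℕ.∸ 1)) Data.Nat.DivMod./ 3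
            ℕ.+ (q ℕ.^ 2 ℕ.+ 1) ℕ.* (q ℕ.^ 2 ℕ.+ q ℕ.+ 1)

    Conclusion : Set₁
    Conclusion = Σ (List Subset6) λ Ws →
      length Ws ≡ count ×
      (∀ i → InUnion (lookup Ws i)) ×
      (∀ W → InUnion W → Σ _ λ i → W ≐ lookup Ws i) ×
      (∀ i j → i ≢ j → ¬ (lookup Ws i ≐ lookup Ws j)) ×
      (∀ i → IsPlane (lookup Ws i)) ×
      (∀ i j → i ≢ j → MeetInAtMostOnePoint (lookup Ws i) (lookup Ws j))

{-# OPTIONS --safe #-}
-- Write x′ = x^q on GF(q³). An eigenvector T of the Singer generator g over GF(q³) has independent
-- coordinates over GF(q), and in the coordinates X, X′, X″ dual to T, T′, T″ every quadratic form over
-- GF(q) is Tr(αX²) + Tr(βXX′) for a unique pair (α, β); X identifies GF(q)³ with GF(q³) and g acts as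
-- a multiplication. The bundle is α = 0, and its images under PGL(3,q) are the nets of conics through
-- an independent point S and its conjugates, one for each of the q³(q²−1)(q−1)/3 such triangles. The
-- degenerate forms singular at A form the plane π_A. If B is a bi-line or imaginary bi-line with
-- coordinates (a, b) centered at γ, the members of its orbit under g centered on the conic α = 0, β =
-- γ″ have coordinates proportional to (az², bzz′) with Tr z = 0, and they span the plane { (−a(h +
-- h″), bh) : h ∈ GF(q³) }. These planes therefore correspond to the q²(q²+q+1) degenerate forms that
-- are not repeated lines. Each intersection becomes a condition Ay + By″ = 0 or c₀y + c₁y′ + c₂y″ = 0
-- on one element y of GF(q³), whose solutions are proportional over GF(q) outside the excluded cases.
-- The exception is a plane of the last kind against a net: there the discriminant restricted to the
-- plane has a linear factor over GF(q), so a common line would contain a degenerate form, whereas the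
-- nets contain none.
module Submission where

open import Defs
open import Data.Nat as ℕ using (ℕ; zero; suc; _!)
import Data.Nat.Properties as ℕₚ
open import Data.Bool as Bool using (Bool; true; false; not; if_then_else_; _xor_)
open import Data.Fin as Fin using (Fin; zero; suc; toℕ; fromℕ; inject₁)
open import Data.List using (List; []; _∷_; length; map; replicate; filter; allFin; foldr; _++_; cartesianProduct; lookup)
open import Data.Product using (Σ; _×_; _,_; proj₁; proj₂)
open import Data.Sum using (_⊎_; inj₁; inj₂; [_,_]′)
open import Data.Empty using (⊥; ⊥-elim)
open import Data.Unit using (⊤; tt)
open import Relation.Nullary using (¬_; Dec; yes; no; ¬?; _×-dec_)
open import Relation.Binary.PropositionalEquality as ≡ using (_≡_; _≢_; refl; sym; trans; cong; cong₂; subst)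
open import Algebra.Bundles using (CommutativeRing; CommutativeSemiring)
import Algebra.Properties.Ring as RingProperties
import Algebra.Properties.CommutativeSemigroup as CommutativeSemigroupProperties
open import Level using (0ℓ; Level)
open import Function using (_∘_; case_of_; id)
open import Data.Nat.Primality using (Prime; euclidsLemma; prime⇒nonZero; prime⇒nonTrivial)
open import Data.Nat.Divisibility using (_∣_; divides; ∣⇒≤; ∣1⇒≡1; m∣m*n)
open import Data.Nat.Combinatorics using (nCn≡1; nCk≡nC[n∸k]; nCk≡n!/k![n-k]!; [n∸k]!k!∣n!) renaming (_C_ to _choose_)
open import Data.Nat.DivMod using (m/n*n≡m; m*n/n≡m)
import Data.Fin.Properties as Finₚ
import Data.List.Properties as Listₚ
open import Data.Vec as Vec using (Vec; []; _∷_)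
open import Data.Vec.Functional using (tail)
open import Data.List.Membership.Propositional using (_∈_; lose)
open import Data.List.Membership.Propositional.Properties using (∈-map⁺; ∈-map⁻; ∈-filter⁺; ∈-filter⁻; ∈-allFin; ∈-++⁺ˡ; ∈-++⁺ʳ; ∈-++⁻; ∈-cartesianProduct⁺; ∈-cartesianProduct⁻)
open import Data.List.Membership.Propositional.Properties.WithK using (unique∧set⇒bag)
open import Data.List.Relation.Binary.BagAndSetEquality using (∼bag⇒↭)
open import Data.List.Relation.Binary.Permutation.Propositional using (_↭_; ↭⇒↭ₛ)
open import Data.List.Relation.Binary.Permutation.Propositional.Properties using (↭-length)
import Data.List.Relation.Binary.Permutation.Setoid.Properties as PermutationSetoid
open import Data.List.Relation.Unary.Any as Any using (here; there; Any)
open import Data.List.Relation.Unary.All as All using (All; []; _∷_)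
open import Data.List.Relation.Unary.AllPairs using ([]; _∷_; AllPairs)
open import Data.List.Relation.Unary.Unique.Propositional using (Unique)
import Data.List.Relation.Unary.Unique.Propositional.Properties as Uniqueₚ
import Algebra.Properties.CommutativeSemiring.Binomial as Binomial
import Algebra.Properties.Semiring.Exp as Exp
import Algebra.Properties.CommutativeSemiring.Exp as CommExp
import Algebra.Properties.Semiring.Mult as Mult
import Algebra.Properties.Semiring.Sum as Sum
open import Function.Bundles using (mk⇔)
open import Algebra.Structures.Biased using (isCommutativeSemiringˡ; isCommutativeMonoidˡ)
open import Data.Nat.Solver using (module +-*-Solver)
open import Relation.Unary using (Decidable)
import Data.List.Relation.Unary.Any.Properties as Anyₚ
import Data.List.Relation.Unary.All.Properties as Allₚ
import Data.List.Relation.Unary.AllPairs.Properties as AllPairsₚ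

-- Polynomial identities with integer coefficients are decided by comparing
-- normal forms: lists of signed monomials, each a sorted list of variables.
-- A coefficient is represented by repetition, which is cheap for the small
-- coefficients occurring here.

-- The fields are arbitrary operations on `Fin q`, with no chosen generator or minimal polynomial.
-- One device recovers their structure: if X^m - X has m known roots, then A^m v = A v with v ≠ 0
-- gives an eigenvector of A with an eigenvalue among them. In dimension one this identifies the
-- solutions of x^q = x, in dimension two it puts roots of irreducible quadratics into the given
-- GF(q²), and in dimension three it produces T. Characteristic two shapes the definitions: forms
-- are handled through values and polar form instead of a symmetric matrix, and a singular point is
-- required to lie on the quadric. Bi-lines and imaginary bi-lines are treated together as
-- non-repeated forms with a singular point over GF(q), which keeps GF(q²) out of the arguments
-- about planes. Their orbit parts become linear for two reasons: Tr(cxx′) = 0 divided by the norm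
-- of x reads Tr(c′/x) = 0, and z² = -(zz′ + z″z) when Tr z = 0. Distinctness needs no separate
-- argument, because equal planes share more than a point. The second summand of the count is
-- q²(q²+q+1) orbit planes plus q²+q+1 planes π_A.

module RingExpressions where

  infixl 6 _:+_ _:-_
  infixl 7 _:*_
  infix 8 :-_
  infix 4 _:=_

  data Expr : Set where
    var       : ℕ → Expr
    :0 :1     : Expr
    _:+_ _:*_ : Expr → Expr → Expr
    :-_       : Expr → Expr

  _:-_ : Expr → Expr → Expr
  a :- b = a :+ (:- b)

  _:=_ : Expr → Expr → Expr × Expr
  a := b = a , b

  Monomial : Set
  Monomial = List ℕ

  Polynomial : Set
  Polynomial = List (Bool × Monomial)

  -- Only `eq` carries evidence. Soundness requires that merged monomials be equal; a wrong order
  -- could at worst prevent a cancellation.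
  data Comparison {A : Set} (a b : A) : Set where
    lt gt : Comparison a b
    eq    : a ≡ b → Comparison a b

  compareℕ : (a b : ℕ) → Comparison a b
  compareℕ a b with a ℕ.≡ᵇ b in e
  ... | true  = eq (ℕₚ.≡ᵇ⇒≡ a b (subst Bool.T (sym e) tt))
  ... | false = if a ℕ.<ᵇ b then lt else gt

  compareLex : (a b : Monomial) → Comparison a b
  compareLex []      []      = eq refl
  compareLex []      (_ ∷ _) = lt
  compareLex (_ ∷ _) []      = gt
  compareLex (x ∷ a) (y ∷ b) with compareℕ x y
  ... | lt = lt
  ... | gt = gt
  ... | eq x≡y with compareLex a b
  ...   | lt     = lt
  ...   | gt     = gt
  ...   | eq a≡b = eq (cong₂ _∷_ x≡y a≡b)

  -- Comparing degrees first makes multiplication by a monomial monotone.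
  compareMonomial : (a b : Monomial) → Comparison a b
  compareMonomial a b with compareℕ (length a) (length b)
  ... | lt   = lt
  ... | gt   = gt
  ... | eq _ = compareLex a b

  choose : ∀ {A : Set} {a b : A} → Comparison a b → {B : Set} → B → B → B → B
  choose lt     x y z = x
  choose gt     x y z = y
  choose (eq _) x y z = z

  choose-elim : ∀ {A : Set} {a b : A} (c : Comparison a b) {B : Set} {x y z : B} (P : B → Set) →
    P x → P y → (a ≡ b → P z) → P (choose c x y z)
  choose-elim lt       P px py pz = px
  choose-elim gt       P px py pz = py
  choose-elim (eq a≡b) P px py pz = pz a≡b

  if-elim : ∀ (c : Bool) {B : Set} {x y : B} (P : B → Set) → P x → P y → P (if c then x else y)
  if-elim true  P px py = px
  if-elim false P px py = py

  mulM : Monomial → Monomial → Monomial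
  mulM []      b       = b
  mulM (x ∷ a) []      = x ∷ a
  mulM (x ∷ a) (y ∷ b) = if x ℕ.<ᵇ y then x ∷ mulM a (y ∷ b) else y ∷ mulM (x ∷ a) b

  addP : Polynomial → Polynomial → Polynomial
  addP []             Q              = Q
  addP (x ∷ P)        []             = x ∷ P
  addP ((s , m) ∷ P) ((t , k) ∷ Q) = choose (compareMonomial m k)
    ((s , m) ∷ addP P ((t , k) ∷ Q))
    ((t , k) ∷ addP ((s , m) ∷ P) Q)
    -- Opposite signs cancel one copy of the monomial; equal signs keep both copies.
    (if s xor t then addP P Q else (s , m) ∷ (t , k) ∷ addP P Q)

  negP : Polynomial → Polynomial
  negP []            = []
  negP ((s , m) ∷ P) = (not s , m) ∷ negP P

  scaleP : Bool × Monomial → Polynomial → Polynomial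
  scaleP _       []            = []
  scaleP (s , m) ((t , k) ∷ P) = (s xor t , mulM m k) ∷ scaleP (s , m) P

  mulP : Polynomial → Polynomial → Polynomial
  mulP []      Q = []
  mulP (x ∷ P) Q = addP (scaleP x Q) (mulP P Q)

  normalise : Expr → Polynomial
  normalise (var i)  = (false , i ∷ []) ∷ []
  normalise :0       = []
  normalise :1       = (false , []) ∷ []
  normalise (a :+ b) = addP (normalise a) (normalise b)
  normalise (a :* b) = mulP (normalise a) (normalise b)
  normalise (:- a)   = negP (normalise a)

  isNil : Polynomial → Bool
  isNil []      = true
  isNil (_ ∷ _) = false

  Holds : Expr × Expr → Set
  Holds (a , b) = Bool.T (isNil (normalise (a :- b)))

  -- Identities may also quantify over vectors, quadratic forms and matrices,
  -- which are replaced by their coordinates.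
  data Sort : Set where
    scalar vector form matrix : Sort

  size : Sort → ℕ
  size scalar = 1
  size vector = 3
  size form   = 6
  size matrix = 9

  Value : Set → Sort → Set
  Value A scalar = A
  Value A vector = Fin 3 → A
  Value A form   = Pair → A
  Value A matrix = Fin 3 → Fin 3 → A

  pairIndex : Pair → ℕ
  pairIndex p11 = 0
  pairIndex p22 = 1
  pairIndex p33 = 2
  pairIndex p12 = 3
  pairIndex p13 = 4
  pairIndex p23 = 5

  variableOf : ℕ → ∀ s → Value Expr s
  variableOf k scalar     = var k
  variableOf k vector i   = var (Fin.toℕ i ℕ.+ k)
  variableOf k form p     = var (pairIndex p ℕ.+ k)
  variableOf k matrix i j = var (Fin.toℕ i ℕ.* 3 ℕ.+ Fin.toℕ j ℕ.+ k)

  coordinates : ∀ {A : Set} s → Value A s → List A → List A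
  coordinates scalar x ρ = x ∷ ρ
  coordinates vector v ρ = v zero ∷ v (suc zero) ∷ v (suc (suc zero)) ∷ ρ
  coordinates form a ρ   = a p11 ∷ a p22 ∷ a p33 ∷ a p12 ∷ a p13 ∷ a p23 ∷ ρ
  coordinates matrix M ρ = coordinates vector (M zero) (coordinates vector (M (suc zero))
                             (coordinates vector (M (suc (suc zero))) ρ))

  Identity : List Sort → Set
  Identity []       = Expr × Expr
  Identity (s ∷ ss) = Value Expr s → Identity ss

  totalSize : List Sort → ℕ
  totalSize []       = 0
  totalSize (s ∷ ss) = size s ℕ.+ totalSize ss

  close : ∀ ss → Identity ss → Expr × Expr
  close []       e = e
  -- Values are pushed in front of the environment one after the other, so the first variable ends
  -- up behind those of `ss`.
  close (s ∷ ss) f = close ss (f (variableOf (totalSize ss) s))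

  sumE : (Fin 3 → Expr) → Expr
  sumE f = f zero :+ (f (suc zero) :+ f (suc (suc zero)))

  infix 8 _:·_
  _:·_ : (ℓ x : Fin 3 → Expr) → Expr
  ℓ :· x = sumE λ i → ℓ i :* x i

  sumPE : (Pair → Expr) → Expr
  sumPE f = f p11 :+ (f p22 :+ (f p33 :+ (f p12 :+ (f p13 :+ f p23))))

  evalE : (Pair → Expr) → (Fin 3 → Expr) → Expr
  evalE a x = sumPE λ p → a p :* (x (fstP p) :* x (sndP p))

  polarE : (Pair → Expr) → (x y : Fin 3 → Expr) → Expr
  polarE a x y = sumPE λ p → a p :* (x (fstP p) :* y (sndP p) :+ x (sndP p) :* y (fstP p))

  prodLinE : (ℓ m : Fin 3 → Expr) → Pair → Expr
  prodLinE ℓ m p =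
    if diag p then ℓ (fstP p) :* m (fstP p)
    else ℓ (fstP p) :* m (sndP p) :+ ℓ (sndP p) :* m (fstP p)

  substFormE : (Pair → Expr) → (Fin 3 → Fin 3 → Expr) → Pair → Expr
  substFormE a M kl = sumPE λ ij →
    a ij :* (if diag kl
             then M (fstP ij) k :* M (sndP ij) k
             else M (fstP ij) k :* M (sndP ij) l :+ M (fstP ij) l :* M (sndP ij) k)
    where k = fstP kl
          l = sndP kl

  applyE : (Fin 3 → Fin 3 → Expr) → (Fin 3 → Expr) → Fin 3 → Expr
  applyE M x i = sumE λ j → M i j :* x j

  crossE : (u v : Fin 3 → Expr) → Fin 3 → Expr
  crossE u v zero             = u (suc zero) :* v (suc (suc zero)) :- u (suc (suc zero)) :* v (suc zero)
  crossE u v (suc zero)       = u (suc (suc zero)) :* v zero :- u zero :* v (suc (suc zero))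
  crossE u v (suc (suc zero)) = u zero :* v (suc zero) :- u (suc zero) :* v zero

  detE : (u v w : Fin 3 → Expr) → Expr
  detE u v w = u :· crossE v w

-- Soundness of the normal forms in a finite field

module FieldTheory {q : ℕ} (F : FiniteField q) where

  open LinAlg F public
  open RingExpressions

  commutativeRing : CommutativeRing 0ℓ 0ℓ
  commutativeRing = record { isCommutativeRing = isCommutativeRing }

  open CommutativeRing commutativeRing public using
    ( +-assoc; +-comm; +-identityˡ; +-identityʳ; -‿inverseˡ; -‿inverseʳ
    ; *-assoc; *-comm; *-identityˡ; *-identityʳ; distribˡ; distribʳ; zeroˡ; zeroʳ
    ; ring; *-commutativeMonoid; +-commutativeMonoid; commutativeSemiring)
  open RingProperties ring public using
    (-‿distribˡ-*; -‿distribʳ-*; -‿involutive; -0#≈0#; -‿+-comm)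

  infixl 6 _-_
  _-_ : C → C → C
  x - y = x + (- y)

  private
    module +S = CommutativeSemigroupProperties (CommutativeRing.+-commutativeSemigroup commutativeRing)
    module *S = CommutativeSemigroupProperties (CommutativeRing.*-commutativeSemigroup commutativeRing)

    Env : Set
    Env = List C

    _!_ : Env → ℕ → C
    []      ! _     = 0#
    (x ∷ _) ! zero  = x
    (_ ∷ ρ) ! suc i = ρ ! i

    ⟦_⟧ : Expr → Env → C
    ⟦ var i ⟧  ρ = ρ ! i
    ⟦ :0 ⟧     ρ = 0#
    ⟦ :1 ⟧     ρ = 1#
    ⟦ a :+ b ⟧ ρ = ⟦ a ⟧ ρ + ⟦ b ⟧ ρ
    ⟦ a :* b ⟧ ρ = ⟦ a ⟧ ρ * ⟦ b ⟧ ρ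
    ⟦ :- a ⟧   ρ = - ⟦ a ⟧ ρ

    module Soundness (ρ : Env) where

      signed : Bool → C → C
      signed false x = x
      signed true  x = - x

      ⟦_⟧M : Monomial → C
      ⟦ [] ⟧M    = 1#
      ⟦ i ∷ m ⟧M = (ρ ! i) * ⟦ m ⟧M

      ⟦_⟧P : Polynomial → C
      ⟦ [] ⟧P          = 0#
      ⟦ (s , m) ∷ P ⟧P = signed s ⟦ m ⟧M + ⟦ P ⟧P

      mulM-sound : ∀ a b → ⟦ mulM a b ⟧M ≡ ⟦ a ⟧M * ⟦ b ⟧M
      mulM-sound []      b  = sym (*-identityˡ _)
      mulM-sound (x ∷ a) [] = sym (*-identityʳ _)
      mulM-sound (x ∷ a) (y ∷ b) = if-elim (x ℕ.<ᵇ y)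
        (λ z → ⟦ z ⟧M ≡ ⟦ x ∷ a ⟧M * ⟦ y ∷ b ⟧M)
        (trans (cong (_ *_) (mulM-sound a (y ∷ b))) (sym (*-assoc _ _ _)))
        (trans (cong (_ *_) (mulM-sound (x ∷ a) b)) (*S.x∙yz≈y∙xz _ _ _))

      combine : ∀ s t m R → ⟦ (if s xor t then R else (s , m) ∷ (t , m) ∷ R) ⟧P
        ≡ signed s ⟦ m ⟧M + (signed t ⟦ m ⟧M + ⟦ R ⟧P)
      combine false false m R = refl
      combine true  true  m R = refl
      combine false true  m R = trans (sym (+-identityˡ _))
        (trans (cong (_+ ⟦ R ⟧P) (sym (-‿inverseʳ _))) (+-assoc _ _ _))
      combine true  false m R = trans (sym (+-identityˡ _))
        (trans (cong (_+ ⟦ R ⟧P) (sym (-‿inverseˡ _))) (+-assoc _ _ _))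

      addP-sound : ∀ P Q → ⟦ addP P Q ⟧P ≡ ⟦ P ⟧P + ⟦ Q ⟧P
      addP-sound []      Q  = sym (+-identityˡ _)
      addP-sound (x ∷ P) [] = sym (+-identityʳ _)
      addP-sound ((s , m) ∷ P) ((t , k) ∷ Q) = choose-elim (compareMonomial m k)
        (λ R → ⟦ R ⟧P ≡ ⟦ (s , m) ∷ P ⟧P + ⟦ (t , k) ∷ Q ⟧P)
        (trans (cong (_ +_) (addP-sound P ((t , k) ∷ Q))) (sym (+-assoc _ _ _)))
        (trans (cong (_ +_) (addP-sound ((s , m) ∷ P) Q)) (+S.x∙yz≈y∙xz _ _ _))
        (λ { refl → trans (combine s t m (addP P Q)) (trans (cong (λ z → _ + (_ + z)) (addP-sound P Q))
          (trans (sym (+-assoc _ _ _)) (+S.interchange _ _ _ _))) })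

      negP-sound : ∀ P → ⟦ negP P ⟧P ≡ - ⟦ P ⟧P
      negP-sound []               = sym -0#≈0#
      negP-sound ((false , m) ∷ P) = trans (cong (_ +_) (negP-sound P)) (-‿+-comm _ _)
      negP-sound ((true  , m) ∷ P) = trans
        (cong₂ _+_ (sym (-‿involutive _)) (negP-sound P)) (-‿+-comm _ _)

      signed-* : ∀ s t x y → signed (s xor t) (x * y) ≡ signed s x * signed t y
      signed-* false false x y = refl
      signed-* false true  x y = -‿distribʳ-* x y
      signed-* true  false x y = -‿distribˡ-* x y
      signed-* true  true  x y = trans (sym (-‿involutive _))
        (trans (cong -_ (-‿distribˡ-* x y)) (-‿distribʳ-* _ _))

      scaleP-sound : ∀ s m P → ⟦ scaleP (s , m) P ⟧P ≡ signed s ⟦ m ⟧M * ⟦ P ⟧P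
      scaleP-sound s m []            = sym (zeroʳ _)
      scaleP-sound s m ((t , k) ∷ P) = trans
        (cong₂ _+_ (trans (cong (signed (s xor t)) (mulM-sound m k)) (signed-* s t _ _))
                   (scaleP-sound s m P))
        (sym (distribˡ _ _ _))

      mulP-sound : ∀ P Q → ⟦ mulP P Q ⟧P ≡ ⟦ P ⟧P * ⟦ Q ⟧P
      mulP-sound []            Q = sym (zeroˡ _)
      mulP-sound ((s , m) ∷ P) Q = trans (addP-sound (scaleP (s , m) Q) (mulP P Q))
        (trans (cong₂ _+_ (scaleP-sound s m Q) (mulP-sound P Q)) (sym (distribʳ _ _ _)))

      sound : ∀ e → ⟦ normalise e ⟧P ≡ ⟦ e ⟧ ρ
      sound (var i)  = trans (+-identityʳ _) (*-identityʳ _)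
      sound :0       = refl
      sound :1       = +-identityʳ _
      sound (a :+ b) = trans (addP-sound (normalise a) (normalise b)) (cong₂ _+_ (sound a) (sound b))
      sound (a :* b) = trans (mulP-sound (normalise a) (normalise b)) (cong₂ _*_ (sound a) (sound b))
      sound (:- a)   = trans (negP-sound (normalise a)) (cong -_ (sound a))

      isNil-sound : ∀ P → Bool.T (isNil P) → ⟦ P ⟧P ≡ 0#
      isNil-sound [] _ = refl

  x-y≡0⇒x≡y : ∀ {x y} → x - y ≡ 0# → x ≡ y
  x-y≡0⇒x≡y {x} {y} e = trans (sym (+-identityʳ x)) (trans (cong (x +_) (sym (-‿inverseˡ y)))
    (trans (sym (+-assoc _ _ _)) (trans (cong (_+ y) e) (+-identityˡ y))))

  private
    Goal : (ss : List Sort) → Env → Expr × Expr → Set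
    Goal []       ρ (a , b) = ⟦ a ⟧ ρ ≡ ⟦ b ⟧ ρ
    Goal (s ∷ ss) ρ e       = ∀ x → Goal ss (coordinates s x ρ) e

    goal : (ss : List Sort) → ∀ ρ e → Holds e → Goal ss ρ e
    goal []       ρ (a , b) h = x-y≡0⇒x≡y (trans (sym (sound (a :- b))) (isNil-sound (normalise (a :- b)) h))
      where open Soundness ρ
    goal (s ∷ ss) ρ e       h x = goal ss (coordinates s x ρ) e h

  -- The type of the implicit `h` computes to `⊤` exactly when the difference normalises to the
  -- empty list, so it is filled in by eta and a false identity leaves it unsolvable.
  solveFor : ∀ (ss : List Sort) (f : Identity ss) {h : Holds (close ss f)} → Goal ss [] (close ss f)
  solveFor ss f {h} = goal ss [] (close ss f) h

  solve : ∀ n (f : Identity (replicate n scalar)) {h : Holds (close (replicate n scalar) f)} →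
    Goal (replicate n scalar) [] (close (replicate n scalar) f)
  solve n = solveFor (replicate n scalar)

sameMembers⇒↭ : ∀ {A : Set} {xs ys : List A} → Unique xs → Unique ys →
  (∀ {x} → x ∈ xs → x ∈ ys) → (∀ {x} → x ∈ ys → x ∈ xs) → xs ↭ ys
sameMembers⇒↭ u v f g = ∼bag⇒↭ (unique∧set⇒bag u v (mk⇔ f g))

-- Binomial coefficients and additivity of p-th powers

∣!⇒≤ : ∀ {p} → Prime p → ∀ m → p ∣ m ! → p ℕ.≤ m
∣!⇒≤ {p} pr zero    d = ⊥-elim (ℕ.nonTrivial⇒≢1 {{prime⇒nonTrivial pr}} (∣1⇒≡1 d))
∣!⇒≤ {p} pr (suc m) d with euclidsLemma (suc m) (m !) pr d
... | inj₁ d′ = ∣⇒≤ d′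
... | inj₂ d′ = ℕₚ.m≤n⇒m≤1+n (∣!⇒≤ pr m d′)

-- The prime p divides p! = C(p,k) k! (p - k)!, but neither k! nor (p - k)!, since k and p - k are
-- less than p.
prime∣binomial : ∀ {p} → Prime p → ∀ {k} → 0 ℕ.< k → k ℕ.< p → p ∣ p choose k
prime∣binomial {p} pr {k} 0<k k<p with euclidsLemma (p choose k) (k ! ℕ.* (p ℕ.∸ k) !) pr p∣product
  where
  instance
    _ = ℕₚ.m*n≢0 (k !) ((p ℕ.∸ k) !) {{ℕₚ._!≢0 k}} {{ℕₚ._!≢0 (p ℕ.∸ k)}}
  product≡ : (p choose k) ℕ.* (k ! ℕ.* (p ℕ.∸ k) !) ≡ p !
  product≡ = trans (cong (ℕ._* (k ! ℕ.* (p ℕ.∸ k) !)) (nCk≡n!/k![n-k]! (ℕₚ.<⇒≤ k<p)))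
    (m/n*n≡m (subst (_∣ p !) (ℕₚ.*-comm ((p ℕ.∸ k) !) (k !)) ([n∸k]!k!∣n! (ℕₚ.<⇒≤ k<p))))
  p∣p! : ∀ {p} → p ≢ 0 → p ∣ p !
  p∣p! {zero}  ne = ⊥-elim (ne refl)
  p∣p! {suc m} _  = m∣m*n (m !)
  p∣product = subst (p ∣_) (sym product≡) (p∣p! (ℕ.≢-nonZero⁻¹ p {{prime⇒nonZero pr}}))
... | inj₁ d = d
... | inj₂ d with euclidsLemma (k !) ((p ℕ.∸ k) !) pr d
...   | inj₁ d′ = ⊥-elim (ℕₚ.<⇒≱ k<p (∣!⇒≤ pr k d′))
...   | inj₂ d′ = ⊥-elim (ℕₚ.<⇒≱ (ℕₚ.∸-monoʳ-< 0<k (ℕₚ.<⇒≤ k<p)) (∣!⇒≤ pr (p ℕ.∸ k) d′))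

-- Commutative semirings suffice. This lets the same result serve the algebra `semiringE` of
-- `QuadraticRoot`, which is never shown to be a field.
module FreshmansDream (S : CommutativeSemiring 0ℓ 0ℓ) where
  open CommutativeSemiring S hiding (zero) renaming (refl to ≈-refl; sym to ≈-sym; trans to ≈-trans)
  open Mult semiring using (×-assoc-*; ×-assocˡ; ×-homo-1; ×-congʳ; ×-cong) renaming (_×_ to _×′_)
  open Exp semiring using (_^_; ^-congˡ; ^-assocʳ)
  open Sum semiring using (sum; sum-init-last; sum-cong-≋; sum-replicate-zero)
  open Binomial S using (theorem; binomialTerm)

  multiple≈0 : ∀ {p n} x → p ×′ 1# ≈ 0# → p ∣ n → n ×′ x ≈ 0#
  multiple≈0 {p} {n} x p≈0 (divides c refl) = ≈-trans (≈-sym (×-assocˡ x c p)) (≈-trans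
    (×-congʳ c (≈-trans (×-congʳ p (≈-sym (*-identityˡ x))) (≈-trans (≈-sym (×-assoc-* p 1# x))
      (≈-trans (*-congʳ p≈0) (zeroˡ x))))) (zero× c))
    where
    zero× : ∀ c → c ×′ 0# ≈ 0#
    zero× zero    = ≈-refl
    zero× (suc c) = ≈-trans (+-identityˡ _) (zero× c)

  dream : ∀ {p} → Prime p → p ×′ 1# ≈ 0# → ∀ x y → (x + y) ^ p ≈ x ^ p + y ^ p
  dream {zero}  pr p≈0 x y = ⊥-elim (ℕ.≢-nonZero⁻¹ 0 {{prime⇒nonZero pr}} refl)
  dream {suc m} pr p≈0 x y = ≈-trans (theorem (suc m) x y) (≈-trans (+-cong first≈ rest≈) (+-comm _ _))
    where
    t = binomialTerm x y (suc m)
    n0≡1 : suc m choose 0 ≡ 1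
    n0≡1 = trans (nCk≡nC[n∸k] {0} {suc m} ℕ.z≤n) (nCn≡1 (suc m))
    first≈ : t zero ≈ y ^ suc m
    first≈ = ≈-trans (reflexive (cong (_×′ (1# * y ^ suc m)) n0≡1)) (≈-trans (×-homo-1 _) (*-identityˡ _))
    middle≈0 : ∀ (i : Fin m) → tail t (inject₁ i) ≈ 0#
    middle≈0 i = multiple≈0 _ p≈0 (prime∣binomial pr (ℕ.s≤s ℕ.z≤n)
      (ℕ.s≤s (subst (ℕ._< m) (sym (Finₚ.toℕ-inject₁ i)) (Finₚ.toℕ<n i))))
    last≈ : tail t (fromℕ m) ≈ x ^ suc m
    last≈ = ≈-trans (reflexive (cong (λ k → (suc m choose suc k) ×′ (x ^ suc k * y ^ (m ℕ.∸ k))) (Finₚ.toℕ-fromℕ m)))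
      (≈-trans (reflexive (cong₂ (λ c e → c ×′ (x ^ suc m * y ^ e)) (nCn≡1 (suc m)) (ℕₚ.n∸n≡0 m)))
        (≈-trans (×-homo-1 _) (*-identityʳ _)))
    rest≈ : sum (tail t) ≈ x ^ suc m
    rest≈ = ≈-trans (sum-init-last (tail t))
      (≈-trans (+-cong (≈-trans (sum-cong-≋ middle≈0) (sum-replicate-zero m)) last≈) (+-identityˡ _))

  dream^ : ∀ {p} → Prime p → p ×′ 1# ≈ 0# → ∀ k x y → (x + y) ^ (p ℕ.^ k) ≈ x ^ (p ℕ.^ k) + y ^ (p ℕ.^ k)
  dream^ pr p≈0 zero x y = distribʳ 1# x y
  dream^ {p} pr p≈0 (suc k) x y = ≈-trans (≈-sym (^-assocʳ (x + y) p (p ℕ.^ k)))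
    (≈-trans (^-congˡ (p ℕ.^ k) (dream pr p≈0 x y)) (≈-trans (dream^ pr p≈0 k _ _)
      (+-cong (^-assocʳ x p (p ℕ.^ k)) (^-assocʳ y p (p ℕ.^ k)))))

-- Inverses, Fermat's little theorem and the characteristic

module FieldLemmas {q : ℕ} (F : FiniteField q) where

  open FieldTheory F public
  open RingExpressions public using (_:+_; _:*_; :-_; _:-_; _:=_; :0; :1)

  infix 4 _≟_
  _≟_ : (x y : C) → Dec (x ≡ y)
  _≟_ = Fin._≟_

  1≢0 : 1# ≢ 0#
  1≢0 = 0≢1 ∘ sym

  infix 10 _⁻¹
  -- total, with junk value 0⁻¹ = 0
  _⁻¹ : C → C
  x ⁻¹ with x ≟ 0#
  ... | yes _ = 0#
  ... | no x≢0 = proj₁ (inverse x x≢0)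

  *-inverseʳ : ∀ {x} → x ≢ 0# → x * x ⁻¹ ≡ 1#
  *-inverseʳ {x} x≢0 with x ≟ 0#
  ... | yes x≡0 = ⊥-elim (x≢0 x≡0)
  ... | no x≢0′ = proj₂ (inverse x x≢0′)

  *-inverseˡ : ∀ {x} → x ≢ 0# → x ⁻¹ * x ≡ 1#
  *-inverseˡ x≢0 = trans (*-comm _ _) (*-inverseʳ x≢0)

  x≡y⇒x-y≡0 : ∀ {x y} → x ≡ y → x - y ≡ 0#
  x≡y⇒x-y≡0 {x} refl = -‿inverseʳ x

  *-cancelˡ-0 : ∀ {x y} → x ≢ 0# → x * y ≡ 0# → y ≡ 0#
  *-cancelˡ-0 {x} {y} x≢0 e = trans (sym (*-identityˡ y)) (trans (cong (_* y) (sym (*-inverseˡ x≢0)))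
    (trans (*-assoc _ _ _) (trans (cong (x ⁻¹ *_) e) (zeroʳ _))))

  *-cancelʳ-0 : ∀ {x y} → y ≢ 0# → x * y ≡ 0# → x ≡ 0#
  *-cancelʳ-0 y≢0 e = *-cancelˡ-0 y≢0 (trans (*-comm _ _) e)

  *-cancelˡ : ∀ {x y z} → x ≢ 0# → x * y ≡ x * z → y ≡ z
  *-cancelˡ {x} {y} {z} x≢0 e = x-y≡0⇒x≡y (*-cancelˡ-0 x≢0
    (trans (solve 3 (λ x y z → x :* (y :- z) := x :* y :- x :* z) x y z) (x≡y⇒x-y≡0 e)))

  *-zero-product : ∀ {x y} → x * y ≡ 0# → x ≡ 0# ⊎ y ≡ 0#
  *-zero-product {x} e with x ≟ 0#
  ... | yes x≡0 = inj₁ x≡0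
  ... | no x≢0  = inj₂ (*-cancelˡ-0 x≢0 e)

  *-nonzero : ∀ {x y} → x ≢ 0# → y ≢ 0# → x * y ≢ 0#
  *-nonzero x≢0 y≢0 e = y≢0 (*-cancelˡ-0 x≢0 e)

  ⁻¹-nonzero : ∀ {x} → x ≢ 0# → x ⁻¹ ≢ 0#
  ⁻¹-nonzero x≢0 e = 1≢0 (trans (sym (*-inverseʳ x≢0)) (trans (cong (_ *_) e) (zeroʳ _)))

  -‿nonzero : ∀ {x} → x ≢ 0# → - x ≢ 0#
  -‿nonzero {x} x≢0 e = x≢0 (trans (sym (-‿involutive x)) (trans (cong -_ e) -0#≈0#))

  private
    term : ∀ {a b} c → a ≡ b → c * (a - b) ≡ 0#
    term c e = trans (cong (c *_) (x≡y⇒x-y≡0 e)) (zeroʳ c)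

  -- x ≡ y follows from hypotheses aᵢ ≡ bᵢ once x − y is a combination of the aᵢ − bᵢ
  linear₁ : ∀ {x y a b} c → a ≡ b → x - y ≡ c * (a - b) → x ≡ y
  linear₁ c e h = x-y≡0⇒x≡y (trans h (term c e))

  linear₂ : ∀ {x y a b a′ b′} c → a ≡ b → ∀ c′ → a′ ≡ b′ →
    x - y ≡ c * (a - b) + c′ * (a′ - b′) → x ≡ y
  linear₂ c e c′ e′ h = x-y≡0⇒x≡y (trans h (trans (cong₂ _+_ (term c e) (term c′ e′)) (+-identityʳ _)))

  linear₃ : ∀ {x y a b a′ b′ a″ b″} c → a ≡ b → ∀ c′ → a′ ≡ b′ → ∀ c″ → a″ ≡ b″ →
    x - y ≡ c * (a - b) + c′ * (a′ - b′) + c″ * (a″ - b″) → x ≡ y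
  linear₃ c e c′ e′ c″ e″ h = x-y≡0⇒x≡y (trans h (trans
    (cong₂ _+_ (trans (cong₂ _+_ (term c e) (term c′ e′)) (+-identityʳ _)) (term c″ e″)) (+-identityʳ _)))

  open Exp (CommutativeSemiring.semiring commutativeSemiring) public using (^-homo-*; ^-assocʳ)
    renaming (_^_ to _^′_)
  open CommExp commutativeSemiring using (^-distrib-*)
  open Mult (CommutativeSemiring.semiring commutativeSemiring) public using (×1-homo-*) renaming (_×_ to _×′_)

  ^≡^′ : ∀ x n → x ^ n ≡ x ^′ n
  ^≡^′ x zero    = refl
  ^≡^′ x (suc n) = cong (x *_) (^≡^′ x n)

  ^-* : ∀ n x y → (x * y) ^ n ≡ x ^ n * y ^ n
  ^-* n x y = trans (^≡^′ (x * y) n) (trans (^-distrib-* x y n) (sym (cong₂ _*_ (^≡^′ x n) (^≡^′ y n))))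

  ^-^ : ∀ x m n → (x ^ m) ^ n ≡ x ^ (m ℕ.* n)
  ^-^ x m n = trans (^≡^′ (x ^ m) n) (trans (cong (_^′ n) (^≡^′ x m)) (trans (^-assocʳ x m n) (sym (^≡^′ x (m ℕ.* n)))))

  1^ : ∀ n → 1# ^ n ≡ 1#
  1^ zero    = refl
  1^ (suc n) = trans (*-identityˡ _) (1^ n)

  0^ : ∀ {n} → 0 ℕ.< n → 0# ^ n ≡ 0#
  0^ {suc n} _ = zeroˡ _

  ^-nonzero : ∀ {x} n → x ≢ 0# → x ^ n ≢ 0#
  ^-nonzero zero    x≢0 = 1≢0
  ^-nonzero (suc n) x≢0 = *-nonzero x≢0 (^-nonzero n x≢0)

  private
    module PS = PermutationSetoid (≡.setoid C)
    product sum′ : List C → C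
    product = foldr _*_ 1#
    sum′ = foldr _+_ 0#

    nonzeros : List C
    nonzeros = filter (λ x → ¬? (x ≟ 0#)) (allFin q)

    nonzeros-unique : Unique nonzeros
    nonzeros-unique = Uniqueₚ.filter⁺ (λ x → ¬? (x ≟ 0#)) (Uniqueₚ.allFin⁺ q)

    ∈-nonzeros : ∀ {x} → x ≢ 0# → x ∈ nonzeros
    ∈-nonzeros x≢0 = ∈-filter⁺ (λ x → ¬? (x ≟ 0#)) (∈-allFin _) x≢0

    nonzeros⇒≢0 : ∀ {x} → x ∈ nonzeros → x ≢ 0#
    nonzeros⇒≢0 x∈ = proj₂ (∈-filter⁻ (λ x → ¬? (x ≟ 0#)) {xs = allFin q} x∈)

    order≡ : suc (length nonzeros) ≡ q
    order≡ = trans (↭-length (sameMembers⇒↭ {xs = 0# ∷ nonzeros} {ys = allFin q}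
      (All.tabulate (λ x∈ e → nonzeros⇒≢0 x∈ (sym e)) ∷ nonzeros-unique) (Uniqueₚ.allFin⁺ q)
      (λ {x} _ → ∈-allFin x)
      (λ {x} _ → case x ≟ 0# of λ { (yes e) → here e ; (no ne) → there (∈-nonzeros ne) })))
      (Listₚ.length-tabulate _)

    product-scale : ∀ x ys → product (map (x *_) ys) ≡ x ^ length ys * product ys
    product-scale x []       = sym (*-identityˡ _)
    product-scale x (y ∷ ys) = trans (cong (x * y *_) (product-scale x ys))
      (solve 4 (λ x y a b → x :* y :* (a :* b) := x :* a :* (y :* b)) x y _ _)

    product≢0 : ∀ ys → (∀ {y} → y ∈ ys → y ≢ 0#) → product ys ≢ 0#
    product≢0 []       h = 1≢0
    product≢0 (y ∷ ys) h = *-nonzero (h (here refl)) (product≢0 ys (h ∘ there))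

    sum-shift : ∀ ys → sum′ (map (1# +_) ys) ≡ length ys ×′ 1# + sum′ ys
    sum-shift []       = sym (+-identityˡ _)
    sum-shift (y ∷ ys) = trans (cong (1# + y +_) (sum-shift ys))
      (solve 4 (λ o y a b → o :+ y :+ (a :+ b) := o :+ a :+ (y :+ b)) 1# y _ _)

  -- Multiplication by x permutes the nonzero elements, so their product is unchanged when
  -- multiplied by x^(q-1), and this product is nonzero.
  fermat* : ∀ {x} → x ≢ 0# → x ^ (q ℕ.∸ 1) ≡ 1#
  fermat* {x} x≢0 = subst (λ n → x ^ n ≡ 1#) (cong (ℕ._∸ 1) order≡)
    (*-cancelˡ (product≢0 nonzeros nonzeros⇒≢0) (trans (*-comm _ _) (trans
      (sym (product-scale x nonzeros)) (trans (PS.foldr-commMonoid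
        (CommutativeRing.*-isCommutativeMonoid commutativeRing) (↭⇒↭ₛ permuted)) (sym (*-identityʳ _))))))
    where
    permuted : map (x *_) nonzeros ↭ nonzeros
    permuted = sameMembers⇒↭ (Uniqueₚ.map⁺ (*-cancelˡ x≢0) nonzeros-unique) nonzeros-unique
      (λ z∈ → let y , y∈ , e = ∈-map⁻ (x *_) z∈ in
         ∈-nonzeros (subst (_≢ 0#) (sym e) (*-nonzero x≢0 (nonzeros⇒≢0 y∈))))
      (λ {z} z∈ → subst (_∈ map (x *_) nonzeros)
         (trans (sym (*-assoc _ _ _)) (trans (cong (_* z) (*-inverseʳ x≢0)) (*-identityˡ z)))
         (∈-map⁺ (x *_) (∈-nonzeros (*-nonzero (⁻¹-nonzero x≢0) (nonzeros⇒≢0 z∈)))))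

  fermat : ∀ x → x ^ q ≡ x
  fermat x = subst (λ n → x ^ n ≡ x) order≡ (go (x ≟ 0#))
    where
    go : Dec (x ≡ 0#) → x ^ suc (length nonzeros) ≡ x
    go (yes refl) = zeroˡ _
    go (no x≢0)   = trans (cong (x *_) (subst (λ n → x ^ n ≡ 1#) (cong (ℕ._∸ 1) (sym order≡)) (fermat* x≢0))) (*-identityʳ x)

  -- Translation by 1 permutes the field, so the sum of all elements is unchanged when q copies of 1
  -- are added.
  order×1≡0 : q ×′ 1# ≡ 0#
  order×1≡0 = subst (λ n → n ×′ 1# ≡ 0#) (Listₚ.length-tabulate {n = q} (λ i → i))
    (x-y≡0⇒x≡y (trans (solve 2 (λ a b → a :- :0 := a :+ b :- b) (length (allFin q) ×′ 1#) (sum′ (allFin q)))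
      (x≡y⇒x-y≡0 (trans (sym (sum-shift (allFin q))) (PS.foldr-commMonoid
        (CommutativeRing.+-isCommutativeMonoid commutativeRing) (↭⇒↭ₛ permuted))))))
    where
    +-cancel : ∀ {x y} → 1# + x ≡ 1# + y → x ≡ y
    +-cancel {x} {y} e = linear₁ 1# e (solve 3 (λ o x y → x :- y := :1 :* (o :+ x :- (o :+ y))) 1# x y)
    permuted : map (1# +_) (allFin q) ↭ allFin q
    permuted = sameMembers⇒↭ (Uniqueₚ.map⁺ +-cancel (Uniqueₚ.allFin⁺ q)) (Uniqueₚ.allFin⁺ q)
      (λ {x} _ → ∈-allFin x)
      (λ {z} _ → subst (_∈ map (1# +_) (allFin q)) (solve 2 (λ o z → o :+ (z :- o) := z) 1# z)
         (∈-map⁺ (1# +_) (∈-allFin (z - 1#))))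

  -- The power (p·1)^k equals q·1 = 0, and a field has no zero divisors.
  characteristic : ∀ {p k} → q ≡ p ℕ.^ k → p ×′ 1# ≡ 0#
  characteristic {p} {k} q≡ = go k (trans (cong (_×′ 1#) (sym q≡)) order×1≡0)
    where
    go : ∀ k → (p ℕ.^ k) ×′ 1# ≡ 0# → p ×′ 1# ≡ 0#
    go zero    e = ⊥-elim (1≢0 (trans (sym (+-identityʳ 1#)) e))
    go (suc k) e with *-zero-product (trans (sym (×1-homo-* p (p ℕ.^ k))) e)
    ... | inj₁ z = z
    ... | inj₂ z = go k z

-- Eigenvectors from polynomials with known roots

module Eigenvector {q : ℕ} (F : FiniteField q) (d : ℕ) where
  open FieldLemmas F

  V : Set
  V = Fin d → C

  infix 4 _≈_
  _≈_ : V → V → Set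
  v ≈ w = ∀ i → v i ≡ w i

  record Linear (A : V → V) : Set where
    field
      A-cong : ∀ {v w} → v ≈ w → A v ≈ A w
      A-+    : ∀ v w → A (λ i → v i + w i) ≈ (λ i → A v i + A w i)
      A-*    : ∀ c v → A (λ i → c * v i) ≈ (λ i → c * A v i)

  iterate : (V → V) → ℕ → V → V
  iterate A zero    v = v
  iterate A (suc n) v = A (iterate A n v)

  -- (c₀ , … , cₘ₋₁) stands for the monic polynomial c₀ + c₁X + … + cₘ₋₁Xᵐ⁻¹ + Xᵐ
  value : ∀ {m} → Vec C m → C → C
  value []       x = 1#
  value (c ∷ cs) x = c + x * value cs x

  -- Synthetic division by X - r; the remainder is `value p r`.
  quotient : ∀ {m} → C → Vec C (suc m) → Vec C m
  quotient r (c ∷ [])     = []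
  quotient r (c ∷ d ∷ cs) = value (d ∷ cs) r ∷ quotient r (d ∷ cs)

  value-quotient : ∀ {m} r (p : Vec C (suc m)) x → value p x ≡ (x - r) * value (quotient r p) x + value p r
  value-quotient r (c ∷ []) x = solve 3 (λ r c x → c :+ x :* :1 := (x :- r) :* :1 :+ (c :+ r :* :1)) r c x
  value-quotient r (c ∷ d ∷ cs) x = trans (cong (λ z → c + x * z) (value-quotient r (d ∷ cs) x))
    (solve 5 (λ r c x Q P → c :+ x :* ((x :- r) :* Q :+ P) := (x :- r) :* (P :+ x :* Q) :+ (c :+ r :* P))
       r c x _ _)

  module _ {A : V → V} (linear : Linear A) where
    open Linear linear

    act : ∀ {m} → Vec C m → V → V
    act []       v   = v
    act (c ∷ cs) v i = c * v i + A (act cs v) i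

    act-quotient : ∀ {m} r (p : Vec C (suc m)) v i →
      act p v i ≡ A (act (quotient r p) v) i - r * act (quotient r p) v i + value p r * v i
    act-quotient r (c ∷ []) v i =
      solve 4 (λ r c a b → c :* a :+ b := b :- r :* a :+ (c :+ r :* :1) :* a) r c (v i) (A v i)
    act-quotient r (c ∷ p@(_ ∷ _)) v i = trans
      (cong (c * v i +_) (trans (A-cong (λ j → trans (act-quotient r p v j)
         (solve 5 (λ r P a b e → b :- r :* a :+ P :* e := b :+ ((:- r) :* a :+ P :* e)) r (value p r) _ _ (v j))) i)
       (trans (A-+ _ _ i) (cong (A (A Q) i +_) (trans (A-+ _ _ i) (cong₂ _+_ (A-* _ _ i) (A-* _ _ i)))))))
      (trans (solve 7 (λ c e X r Y P Z → c :* e :+ (X :+ ((:- r) :* Y :+ P :* Z)) :=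
                (P :* Z :+ X) :- r :* (P :* e :+ Y) :+ (c :+ r :* P) :* e)
                c (v i) (A (A Q) i) r (A Q i) (value p r) (A v i))
        (cong (λ z → z - r * (value p r * v i + A Q i) + (c + r * value p r) * v i)
          (sym (trans (A-+ _ _ i) (cong (_+ A (A Q) i) (A-* _ _ i))))))
      where Q = act (quotient r p) v

    Eigen : List C → Set
    Eigen rs = Σ V λ w → (Σ (Fin d) λ i → w i ≢ 0#) × Σ C λ r → r ∈ rs × (∀ i → A w i ≡ r * w i)

    -- If r is a root, then p(A)v = (A - r)w with w the value of the quotient at A, applied to v.
    -- Either w ≠ 0 is an eigenvector for r, or the quotient also annihilates v and the remaining
    -- roots are its roots. A constant polynomial cannot annihilate v ≠ 0.
    annihilated⇒eigen : ∀ {m} (p : Vec C m) rs → length rs ≡ m → Unique rs → All (λ r → value p r ≡ 0#) rs →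
      ∀ v → (Σ (Fin d) λ i → v i ≢ 0#) → (∀ i → act p v i ≡ 0#) → Eigen rs
    annihilated⇒eigen [] rs _ _ _ v (i , vi≢0) v≈0 = ⊥-elim (vi≢0 (v≈0 i))
    annihilated⇒eigen p@(_ ∷ _) (r ∷ rs) l (r∉ ∷ u) (pr≡0 ∷ prs) v v≢0 pv≈0
      with Finₚ.any? (λ i → ¬? (act (quotient r p) v i ≟ 0#))
    ... | yes w≢0 = act (quotient r p) v , w≢0 , r , here refl , λ i →
            linear₂ 1# (trans (sym (act-quotient r p v i)) (pv≈0 i)) (- v i) pr≡0
              (solve 5 (λ a r w P e → a :- r :* w := :1 :* (a :- r :* w :+ P :* e :- :0) :+ (:- e) :* (P :- :0))
                 (A (act (quotient r p) v) i) r (act (quotient r p) v i) (value p r) (v i))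
    ... | no w≡0 =
      let w , w≢0 , s , s∈ , e = annihilated⇒eigen (quotient r p) rs (ℕₚ.suc-injective l) u
            (All.zipWith quotientRoot (r∉ , prs)) v v≢0 (λ i → decide i)
      in w , w≢0 , s , there s∈ , e
      where
      decide : ∀ i → act (quotient r p) v i ≡ 0#
      decide i with act (quotient r p) v i ≟ 0#
      ... | yes e = e
      ... | no ne = ⊥-elim (w≡0 (i , ne))
      quotientRoot : ∀ {s} → r ≢ s × value p s ≡ 0# → value (quotient r p) s ≡ 0#
      quotientRoot {s} (r≢s , ps≡0) = *-cancelˡ-0 {s - r} (λ e → r≢s (sym (x-y≡0⇒x≡y e)))
        (linear₃ 1# (sym (value-quotient r p s)) 1# ps≡0 (- 1#) pr≡0
          (solve 3 (λ a b c → a :- :0 := :1 :* (a :+ c :- b) :+ :1 :* (b :- :0) :+ (:- :1) :* (c :- :0)) _ (value p s) (value p r)))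

    private
      zeros-value : ∀ k x → value (Vec.replicate k 0#) x ≡ x ^ k
      zeros-value zero    x = refl
      zeros-value (suc k) x = trans (+-identityˡ _) (cong (x *_) (zeros-value k x))

      zeros-act : ∀ k v i → act (Vec.replicate k 0#) v i ≡ iterate A k v i
      zeros-act zero    v i = refl
      zeros-act (suc k) v i = trans (cong₂ _+_ (zeroˡ _) (A-cong (zeros-act k v) i)) (+-identityˡ _)

    -- X^m − X splits over K with roots rs, so A^m v = A v forces an eigenvector.
    power⇒eigen : ∀ m → 1 ℕ.< m → ∀ rs → length rs ≡ m → Unique rs → (∀ {r} → r ∈ rs → r ^ m ≡ r) →
      ∀ v → (Σ (Fin d) λ i → v i ≢ 0#) → iterate A m v ≈ A v → Eigen rs
    power⇒eigen (suc zero) (ℕ.s≤s ())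
    power⇒eigen (suc (suc k)) _ rs l u roots v v≢0 Aᵐv≈Av =
      -- The coefficients 0, -1, 0, ..., 0 of the monic polynomial X^m - X with m = k + 2.
      annihilated⇒eigen (0# ∷ (- 1#) ∷ Vec.replicate k 0#) rs l u (All.tabulate root) v v≢0 annihilates
      where
      root : ∀ {r} → r ∈ rs → 0# + r * (- 1# + r * value (Vec.replicate k 0#) r) ≡ 0#
      root {r} r∈ = trans (cong (λ z → 0# + r * (- 1# + r * z)) (zeros-value k r))
        (linear₁ 1# (roots r∈) (solve 2 (λ r z → :0 :+ r :* ((:- :1) :+ r :* z) :- :0 := :1 :* (r :* (r :* z) :- r)) r (r ^ k)))
      annihilates : ∀ i → 0# * v i + A (λ j → - 1# * v j + A (act (Vec.replicate k 0#) v) j) i ≡ 0#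
      annihilates i = trans (cong (0# * v i +_) (trans (A-+ _ _ i) (cong₂ _+_ (A-* _ _ i)
          (A-cong (A-cong (zeros-act k v)) i))))
        (linear₁ 1# (Aᵐv≈Av i) (solve 3 (λ e a b → :0 :* e :+ ((:- :1) :* a :+ b) :- :0 := :1 :* (b :- a)) (v i) (A v i) _))

-- Vectors, determinants and quadratic forms in three variables

pattern i0 = zero
pattern i1 = suc zero
pattern i2 = suc (suc zero)

next : Fin 3 → Fin 3
next i0 = i1
next i1 = i2
next i2 = i0

∀Fin3 : ∀ {P : Fin 3 → Set} → P i0 → P i1 → P i2 → ∀ i → P i
∀Fin3 a b c i0 = a
∀Fin3 a b c i1 = b
∀Fin3 a b c i2 = c

∀Pair : ∀ {P : Pair → Set} → P p11 → P p22 → P p33 → P p12 → P p13 → P p23 → ∀ p → P p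
∀Pair a b c d e f p11 = a
∀Pair a b c d e f p22 = b
∀Pair a b c d e f p33 = c
∀Pair a b c d e f p12 = d
∀Pair a b c d e f p13 = e
∀Pair a b c d e f p23 = f

module LinearAlgebra {q : ℕ} (F : FiniteField q) where

  open FieldLemmas F public
  open RingExpressions public using (Sort; scalar; vector; form; matrix; _:·_; evalE; polarE; prodLinE;
    substFormE; applyE; crossE; detE; Expr)

  zero3 : Vec3
  zero3 _ = 0#

  vec3 : C → C → C → Vec3
  vec3 a b c i0 = a
  vec3 a b c i1 = b
  vec3 a b c i2 = c

  _+V_ : Vec3 → Vec3 → Vec3
  (u +V v) i = u i + v i

  _*V_ : C → Vec3 → Vec3
  (c *V v) i = c * v i

  cross : Vec3 → Vec3 → Vec3
  cross u v i0 = u i1 * v i2 - u i2 * v i1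
  cross u v i1 = u i2 * v i0 - u i0 * v i2
  cross u v i2 = u i0 * v i1 - u i1 * v i0

  det : Vec3 → Vec3 → Vec3 → C
  det u v w = u · cross v w

  basis : Fin 3 → Vec3
  basis i j = idM i j

  nonzero? : ∀ v → NonZero3 v ⊎ (∀ i → v i ≡ 0#)
  nonzero? v with v i0 ≟ 0# | v i1 ≟ 0# | v i2 ≟ 0#
  ... | no n  | _     | _     = inj₁ (i0 , n)
  ... | yes _ | no n  | _     = inj₁ (i1 , n)
  ... | yes _ | yes _ | no n  = inj₁ (i2 , n)
  ... | yes a | yes b | yes c = inj₂ (∀Fin3 a b c)

  nonzeroForm? : ∀ Q → NonZeroForm Q ⊎ (∀ p → Q p ≡ 0#)
  nonzeroForm? Q with nonzero? (λ { i0 → Q p11 ; i1 → Q p22 ; i2 → Q p33 })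
                    | nonzero? (λ { i0 → Q p12 ; i1 → Q p13 ; i2 → Q p23 })
  ... | inj₁ (i0 , n) | _ = inj₁ (p11 , n)
  ... | inj₁ (i1 , n) | _ = inj₁ (p22 , n)
  ... | inj₁ (i2 , n) | _ = inj₁ (p33 , n)
  ... | inj₂ z | inj₁ (i0 , n) = inj₁ (p12 , n)
  ... | inj₂ z | inj₁ (i1 , n) = inj₁ (p13 , n)
  ... | inj₂ z | inj₁ (i2 , n) = inj₁ (p23 , n)
  ... | inj₂ z | inj₂ z′ = inj₂ (∀Pair (z i0) (z i1) (z i2) (z′ i0) (z′ i1) (z′ i2))

  ·-cong : ∀ {u u′ v v′ : Vec3} → (∀ i → u i ≡ u′ i) → (∀ i → v i ≡ v′ i) → u · v ≡ u′ · v′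
  ·-cong e f = cong₂ _+_ (cong₂ _*_ (e i0) (f i0)) (cong₂ _+_ (cong₂ _*_ (e i1) (f i1)) (cong₂ _*_ (e i2) (f i2)))

  cross-cong : ∀ {u u′ v v′ : Vec3} → (∀ i → u i ≡ u′ i) → (∀ i → v i ≡ v′ i) → ∀ i → cross u v i ≡ cross u′ v′ i
  cross-cong e f i0 = cong₂ _-_ (cong₂ _*_ (e i1) (f i2)) (cong₂ _*_ (e i2) (f i1))
  cross-cong e f i1 = cong₂ _-_ (cong₂ _*_ (e i2) (f i0)) (cong₂ _*_ (e i0) (f i2))
  cross-cong e f i2 = cong₂ _-_ (cong₂ _*_ (e i0) (f i1)) (cong₂ _*_ (e i1) (f i0))

  det-cong : ∀ {u u′ v v′ w w′ : Vec3} → (∀ i → u i ≡ u′ i) → (∀ i → v i ≡ v′ i) → (∀ i → w i ≡ w′ i) →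
    det u v w ≡ det u′ v′ w′
  det-cong e f g = ·-cong e (cross-cong f g)

  ·-zero : ∀ {u v : Vec3} → (∀ i → u i ≡ 0#) → u · v ≡ 0#
  ·-zero {u} {v} e = trans (·-cong {v = v} e (λ _ → refl)) (solveFor (vector ∷ []) (λ v → (λ _ → :0) :· v := :0) v)

  det-cyclic : ∀ u v w → det u v w ≡ det v w u
  det-cyclic = solveFor (vector ∷ vector ∷ vector ∷ []) λ u v w → detE u v w := detE v w u

  cramer : ∀ u v w x i → det u v w * x i ≡ det x v w * u i + det x w u * v i + det x u v * w i
  cramer u v w x i0 = solveFor (vector ∷ vector ∷ vector ∷ vector ∷ []) (λ u v w x →
    detE u v w :* x i0 := detE x v w :* u i0 :+ detE x w u :* v i0 :+ detE x u v :* w i0) u v w x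
  cramer u v w x i1 = solveFor (vector ∷ vector ∷ vector ∷ vector ∷ []) (λ u v w x →
    detE u v w :* x i1 := detE x v w :* u i1 :+ detE x w u :* v i1 :+ detE x u v :* w i1) u v w x
  cramer u v w x i2 = solveFor (vector ∷ vector ∷ vector ∷ vector ∷ []) (λ u v w x →
    detE u v w :* x i2 := detE x v w :* u i2 :+ detE x w u :* v i2 :+ detE x u v :* w i2) u v w x

  -- The dual form of Cramer's rule: up to the factor `det u v w`, the three cross products are the
  -- basis dual to u, v, w.
  cramer* : ∀ u v w r i → det u v w * r i ≡ (r · u) * cross v w i + (r · v) * cross w u i + (r · w) * cross u v i
  cramer* u v w x i0 = solveFor (vector ∷ vector ∷ vector ∷ vector ∷ []) (λ u v w x →
    detE u v w :* x i0 := (x :· u) :* crossE v w i0 :+ (x :· v) :* crossE w u i0 :+ (x :· w) :* crossE u v i0) u v w x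
  cramer* u v w x i1 = solveFor (vector ∷ vector ∷ vector ∷ vector ∷ []) (λ u v w x →
    detE u v w :* x i1 := (x :· u) :* crossE v w i1 :+ (x :· v) :* crossE w u i1 :+ (x :· w) :* crossE u v i1) u v w x
  cramer* u v w x i2 = solveFor (vector ∷ vector ∷ vector ∷ vector ∷ []) (λ u v w x →
    detE u v w :* x i2 := (x :· u) :* crossE v w i2 :+ (x :· v) :* crossE w u i2 :+ (x :· w) :* crossE u v i2) u v w x

  cross-zero⇒minor-zero : ∀ {u v} → (∀ i → cross u v i ≡ 0#) → ∀ i j → u i * v j ≡ u j * v i
  cross-zero⇒minor-zero {u} {v} z i0 i0 = refl
  cross-zero⇒minor-zero {u} {v} z i1 i1 = refl
  cross-zero⇒minor-zero {u} {v} z i2 i2 = refl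
  cross-zero⇒minor-zero {u} {v} z i1 i2 = x-y≡0⇒x≡y (z i0)
  cross-zero⇒minor-zero {u} {v} z i2 i0 = x-y≡0⇒x≡y (z i1)
  cross-zero⇒minor-zero {u} {v} z i0 i1 = x-y≡0⇒x≡y (z i2)
  cross-zero⇒minor-zero {u} {v} z i2 i1 = sym (x-y≡0⇒x≡y (z i0))
  cross-zero⇒minor-zero {u} {v} z i0 i2 = sym (x-y≡0⇒x≡y (z i1))
  cross-zero⇒minor-zero {u} {v} z i1 i0 = sym (x-y≡0⇒x≡y (z i2))

  cross-zero⇒multiple : ∀ {u v} → NonZero3 u → (∀ i → cross u v i ≡ 0#) → Σ C λ c → ∀ i → v i ≡ c * u i
  cross-zero⇒multiple {u} {v} (k , uk≢0) z = u k ⁻¹ * v k , λ i → *-cancelˡ uk≢0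
    (linear₂ 1# (cross-zero⇒minor-zero {u} {v} z k i) (- (v k * u i)) (*-inverseʳ uk≢0)
      (solve 5 (λ uk vi ui vk d → uk :* vi :- uk :* (d :* vk :* ui) :=
         :1 :* (uk :* vi :- ui :* vk) :+ (:- (vk :* ui)) :* (uk :* d :- :1)) (u k) (v i) (u i) (v k) (u k ⁻¹)))

  multiple⇒Prop3 : ∀ {u v} → NonZero3 v → (Σ C λ c → ∀ i → v i ≡ c * u i) → Prop3 u v
  multiple⇒Prop3 {u} {v} (k , vk≢0) (c , e) =
    c , (λ c≡0 → vk≢0 (trans (e k) (trans (cong (_* u k) c≡0) (zeroˡ _)))) , e

  cross-zero⇒Prop3 : ∀ {u v} → NonZero3 u → NonZero3 v → (∀ i → cross u v i ≡ 0#) → Prop3 u v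
  cross-zero⇒Prop3 nu nv z = multiple⇒Prop3 nv (cross-zero⇒multiple nu z)

  Prop3-sym : ∀ {u v} → Prop3 u v → Prop3 v u
  Prop3-sym {u} {v} (c , c≢0 , e) = c ⁻¹ , ⁻¹-nonzero c≢0 , λ i → *-cancelˡ c≢0
    (linear₂ (- 1#) (e i) (- v i) (*-inverseʳ c≢0) (solve 4 (λ c d u v → c :* u :- c :* (d :* v) :=
      (:- :1) :* (v :- c :* u) :+ (:- v) :* (c :* d :- :1)) c (c ⁻¹) (u i) (v i)))

  Prop3-trans : ∀ {u v w} → Prop3 u v → Prop3 v w → Prop3 u w
  Prop3-trans {u} (c , c≢0 , e) (d , d≢0 , f) = d * c , *-nonzero d≢0 c≢0 , λ i →
    trans (f i) (trans (cong (d *_) (e i)) (sym (*-assoc d c (u i))))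

  basis-· : ∀ i x → basis i · x ≡ x i
  basis-· i0 x = solveFor (vector ∷ []) (λ v → (λ { i0 → :1 ; i1 → :0 ; i2 → :0 }) :· v := v i0) x
  basis-· i1 x = solveFor (vector ∷ []) (λ v → (λ { i0 → :0 ; i1 → :1 ; i2 → :0 }) :· v := v i1) x
  basis-· i2 x = solveFor (vector ∷ []) (λ v → (λ { i0 → :0 ; i1 → :0 ; i2 → :1 }) :· v := v i2) x

  det-zero⇒dependent : ∀ u v w → det u v w ≡ 0# →
    Σ Vec3 λ c → NonZero3 c × (∀ i → c i0 * u i + c i1 * v i + c i2 * w i ≡ 0#)
  det-zero⇒dependent u v w d≡0 with nonzero? (cross u v)
  -- Coordinate k of `cramer*`, applied to each basis vector in place of r, is a linear relation
  -- whose coefficients are the k-th coordinates of the cross products.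
  ... | inj₁ (k , ck≢0) = vec3 (cross v w k) (cross w u k) (cross u v k) , (i2 , ck≢0) , λ i →
      trans (cong₂ _+_ (cong₂ _+_ (swap u i (cross v w k)) (swap v i (cross w u k))) (swap w i (cross u v k)))
        (trans (sym (cramer* u v w (basis i) k)) (trans (cong (_* basis i k) d≡0) (zeroˡ _)))
    where
    swap : ∀ x i c → c * x i ≡ (basis i · x) * c
    swap x i c = trans (*-comm c (x i)) (cong (_* c) (sym (basis-· i x)))
  ... | inj₂ z with nonzero? u
  ...   | inj₂ u≡0 = basis i0 , (i0 , 1≢0) , λ i → linear₁ 1# (u≡0 i)
          (solve 3 (λ u v w → :1 :* u :+ :0 :* v :+ :0 :* w :- :0 := :1 :* (u :- :0)) (u i) (v i) (w i))
  ...   | inj₁ nu = let c , e = cross-zero⇒multiple {u} {v} nu z in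
          (λ { i0 → - c ; i1 → 1# ; i2 → 0# }) , (i1 , 1≢0) , λ i → linear₁ 1# (e i)
          (solve 4 (λ c u v w → (:- c) :* u :+ :1 :* v :+ :0 :* w :- :0 := :1 :* (v :- c :* u)) c (u i) (v i) (w i))

  module _ {u v w : Vec3} (D≢0 : det u v w ≢ 0#) where

    combination : ∀ x i → x i ≡ (det u v w ⁻¹ * det x v w) * u i + (det u v w ⁻¹ * det x w u) * v i
                              + (det u v w ⁻¹ * det x u v) * w i
    combination x i = *-cancelˡ D≢0 (trans (cramer u v w x i)
      (linear₁ (- (det x v w * u i + det x w u * v i + det x u v * w i)) (*-inverseʳ D≢0)
        (solve 8 (λ D D⁻ a b c u v w → (a :* u :+ b :* v :+ c :* w) :- D :* ((D⁻ :* a) :* u :+ (D⁻ :* b) :* v :+ (D⁻ :* c) :* w)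
          := (:- (a :* u :+ b :* v :+ c :* w)) :* (D :* D⁻ :- :1)) (det u v w) (det u v w ⁻¹) (det x v w) (det x w u) (det x u v) (u i) (v i) (w i))))

    orthogonal⇒zero : ∀ r → r · u ≡ 0# → r · v ≡ 0# → r · w ≡ 0# → ∀ i → r i ≡ 0#
    orthogonal⇒zero r e f g i = *-cancelˡ-0 D≢0 (trans (cramer* u v w r i)
      (linear₃ (cross v w i) e (cross w u i) f (cross u v i) g
        (solve 6 (λ a b c x y z → a :* x :+ b :* y :+ c :* z :- :0 := x :* (a :- :0) :+ y :* (b :- :0) :+ z :* (c :- :0))
          (r · u) (r · v) (r · w) (cross v w i) (cross w u i) (cross u v i))))

  sumP-cong : ∀ {f g : Pair → C} → (∀ p → f p ≡ g p) → sumP f ≡ sumP g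
  sumP-cong e = cong₂ _+_ (e p11) (cong₂ _+_ (e p22) (cong₂ _+_ (e p33) (cong₂ _+_ (e p12) (cong₂ _+_ (e p13) (e p23)))))

  eval-cong : ∀ {a b : Form} {x y : Vec3} → (∀ p → a p ≡ b p) → (∀ i → x i ≡ y i) → eval a x ≡ eval b y
  eval-cong e f = sumP-cong λ p → cong₂ _*_ (e p) (cong₂ _*_ (f (fstP p)) (f (sndP p)))

  polar : Form → Vec3 → Vec3 → C
  polar a x y = sumP λ p → a p * (x (fstP p) * y (sndP p) + x (sndP p) * y (fstP p))

  polar-cong : ∀ {a b : Form} {x y x′ y′ : Vec3} → (∀ p → a p ≡ b p) → (∀ i → x i ≡ x′ i) → (∀ i → y i ≡ y′ i) →
    polar a x y ≡ polar b x′ y′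
  polar-cong e f g = sumP-cong λ p → cong₂ _*_ (e p)
    (cong₂ _+_ (cong₂ _*_ (f (fstP p)) (g (sndP p))) (cong₂ _*_ (f (sndP p)) (g (fstP p))))

  polar-sym : ∀ a x y → polar a x y ≡ polar a y x
  polar-sym = solveFor (form ∷ vector ∷ vector ∷ []) λ a x y → polarE a x y := polarE a y x

  polar-self : ∀ a x → polar a x x ≡ eval a x + eval a x
  polar-self = solveFor (form ∷ vector ∷ []) λ a x → polarE a x x := evalE a x :+ evalE a x

  combine : C → C → C → Vec3 → Vec3 → Vec3 → Vec3
  combine r s t u v w i = r * u i + s * v i + t * w i

  eval-combine : ∀ a r s t u v w → eval a (combine r s t u v w) ≡
    eval a u * (r * r) + eval a v * (s * s) + eval a w * (t * t)
    + polar a u v * (r * s) + polar a v w * (s * t) + polar a w u * (t * r)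
  eval-combine = solveFor (form ∷ scalar ∷ scalar ∷ scalar ∷ vector ∷ vector ∷ vector ∷ []) λ a r s t u v w →
    evalE a (λ i → r :* u i :+ s :* v i :+ t :* w i) :=
    evalE a u :* (r :* r) :+ evalE a v :* (s :* s) :+ evalE a w :* (t :* t)
    :+ polarE a u v :* (r :* s) :+ polarE a v w :* (s :* t) :+ polarE a w u :* (t :* r)

  polar-combine : ∀ a r s t u v w x → polar a (combine r s t u v w) x ≡
    r * polar a u x + s * polar a v x + t * polar a w x
  polar-combine = solveFor (form ∷ scalar ∷ scalar ∷ scalar ∷ vector ∷ vector ∷ vector ∷ vector ∷ []) λ a r s t u v w x →
    polarE a (λ i → r :* u i :+ s :* v i :+ t :* w i) x := r :* polarE a u x :+ s :* polarE a v x :+ t :* polarE a w x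

  eval-scaleF : ∀ c a x → eval (scaleF c a) x ≡ c * eval a x
  eval-scaleF = solveFor (scalar ∷ form ∷ vector ∷ []) λ c a x → evalE (λ p → c :* a p) x := c :* evalE a x

  eval-+F : ∀ a b x → eval (a +F b) x ≡ eval a x + eval b x
  eval-+F = solveFor (form ∷ form ∷ vector ∷ []) λ a b x → evalE (λ p → a p :+ b p) x := evalE a x :+ evalE b x

  eval-zeroF : ∀ x → eval zeroF x ≡ 0#
  eval-zeroF = solveFor (vector ∷ []) λ x → evalE (λ _ → :0) x := :0

  polar-scaleF : ∀ c a x y → polar (scaleF c a) x y ≡ c * polar a x y
  polar-scaleF = solveFor (scalar ∷ form ∷ vector ∷ vector ∷ []) λ c a x y → polarE (λ p → c :* a p) x y := c :* polarE a x y

  polar-+F : ∀ a b x y → polar (a +F b) x y ≡ polar a x y + polar b x y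
  polar-+F = solveFor (form ∷ form ∷ vector ∷ vector ∷ []) λ a b x y →
    polarE (λ p → a p :+ b p) x y := polarE a x y :+ polarE b x y

  polar-zeroF : ∀ x y → polar zeroF x y ≡ 0#
  polar-zeroF = solveFor (vector ∷ vector ∷ []) λ x y → polarE (λ _ → :0) x y := :0

  eval-prodLin : ∀ ℓ m x → eval (prodLin ℓ m) x ≡ (ℓ · x) * (m · x)
  eval-prodLin = solveFor (vector ∷ vector ∷ vector ∷ []) λ ℓ m x → evalE (prodLinE ℓ m) x := (ℓ :· x) :* (m :· x)

  polar-prodLin : ∀ ℓ m x y → polar (prodLin ℓ m) x y ≡ (ℓ · x) * (m · y) + (ℓ · y) * (m · x)
  polar-prodLin = solveFor (vector ∷ vector ∷ vector ∷ vector ∷ []) λ ℓ m x y →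
    polarE (prodLinE ℓ m) x y := (ℓ :· x) :* (m :· y) :+ (ℓ :· y) :* (m :· x)

  eval-substForm : ∀ a M x → eval (substForm a M) x ≡ eval a (apply M x)
  eval-substForm = solveFor (form ∷ matrix ∷ vector ∷ []) λ a M x → evalE (substFormE a M) x := evalE a (applyE M x)

  polar-substForm : ∀ a M x y → polar (substForm a M) x y ≡ polar a (apply M x) (apply M y)
  polar-substForm = solveFor (form ∷ matrix ∷ vector ∷ vector ∷ []) λ a M x y →
    polarE (substFormE a M) x y := polarE a (applyE M x) (applyE M y)

  -- The diagonal coefficients are the values at basis vectors and the mixed ones are Q(x + y) -
  -- Q(x) - Q(y) at two of them. So values determine a form even over the field of two elements.
  form-ext : ∀ a b → (∀ x → eval a x ≡ eval b x) → a ≗F b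
  form-ext a b e = ∀Pair (square i0 (solveFor (form ∷ []) (λ a → a p11 := evalE a (unitE i0))))
                         (square i1 (solveFor (form ∷ []) (λ a → a p22 := evalE a (unitE i1))))
                         (square i2 (solveFor (form ∷ []) (λ a → a p33 := evalE a (unitE i2))))
                         (mixed i0 i1 (solveFor (form ∷ []) (λ a → a p12 := evalE a (λ k → unitE i0 k :+ unitE i1 k) :- evalE a (unitE i0) :- evalE a (unitE i1))))
                         (mixed i0 i2 (solveFor (form ∷ []) (λ a → a p13 := evalE a (λ k → unitE i0 k :+ unitE i2 k) :- evalE a (unitE i0) :- evalE a (unitE i2))))
                         (mixed i1 i2 (solveFor (form ∷ []) (λ a → a p23 := evalE a (λ k → unitE i1 k :+ unitE i2 k) :- evalE a (unitE i1) :- evalE a (unitE i2))))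
    where
    unitE : Fin 3 → Fin 3 → Expr
    unitE i j with i Finₚ.≟ j
    ... | yes _ = :1
    ... | no _  = :0
    square : ∀ i {p} → (∀ (a : Form) → a p ≡ eval a (basis i)) → a p ≡ b p
    square i h = trans (h a) (trans (e (basis i)) (sym (h b)))
    mixed : ∀ i j {p} → (∀ (a : Form) → a p ≡ eval a (basis i +V basis j) - eval a (basis i) - eval a (basis j)) → a p ≡ b p
    mixed i j h = trans (h a) (trans (cong₂ _-_ (cong₂ _-_ (e (basis i +V basis j)) (e (basis i))) (e (basis j))) (sym (h b)))

  gradient : Form → Vec3 → Vec3
  gradient a x i = polar a x (basis i)

  polar≡gradient : ∀ a x y → polar a x y ≡ gradient a x · y
  polar≡gradient = solveFor (form ∷ vector ∷ vector ∷ []) λ a x y →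
    polarE a x y := (λ { i0 → polarE a x (λ { i0 → :1 ; i1 → :0 ; i2 → :0 })
                       ; i1 → polarE a x (λ { i0 → :0 ; i1 → :1 ; i2 → :0 })
                       ; i2 → polarE a x (λ { i0 → :0 ; i1 → :0 ; i2 → :1 }) }) :· y

  -- Both conditions are imposed because in characteristic two a vanishing gradient does not put the
  -- point on the quadric: the nucleus of a conic has gradient zero.
  Singular : Form → Vec3 → Set
  Singular a x = eval a x ≡ 0# × (∀ i → gradient a x i ≡ 0#)

  Singular-polar : ∀ {a x} → Singular a x → ∀ y → polar a x y ≡ 0#
  Singular-polar {a} {x} (_ , e) y = trans (polar≡gradient a x y) (·-zero {gradient a x} {y} e)

  Singular-cong : ∀ {a b x y} → (∀ p → a p ≡ b p) → (∀ i → x i ≡ y i) → Singular a x → Singular b y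
  Singular-cong {a} {b} {x} {y} e f (s , g) = trans (sym (eval-cong {a} {b} {x} {y} e f)) s ,
    λ i → trans (sym (polar-cong {a} {b} {x} {basis i} {y} {basis i} e f (λ _ → refl))) (g i)

  Singular-scale : ∀ {a x} c → Singular a x → Singular a (c *V x)
  Singular-scale {a} {x} c (s , g) =
    trans (solveFor (form ∷ vector ∷ scalar ∷ []) (λ a x c → evalE a (λ i → c :* x i) := c :* c :* evalE a x) a x c) (trans (cong (c * c *_) s) (zeroʳ _)) ,
    λ i → trans (solveFor (form ∷ vector ∷ scalar ∷ vector ∷ []) (λ a x c y → polarE a (λ i → c :* x i) y := c :* polarE a x y) a x c (basis i))
      (trans (cong (c *_) (g i)) (zeroʳ _))

  Singular-Prop3 : ∀ {a x y} → Prop3 x y → Singular a x → Singular a y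
  Singular-Prop3 {a} {x} {y} (c , _ , e) s =
    Singular-cong {a} {a} {c *V x} {y} (λ _ → refl) (λ i → sym (e i)) (Singular-scale {a} {x} c s)

  Singular-substForm : ∀ {a M x} → Singular a (apply M x) → Singular (substForm a M) x
  Singular-substForm {a} {M} {x} s = trans (eval-substForm a M x) (proj₁ s) , λ i →
    trans (polar-substForm a M x (basis i)) (Singular-polar {a} {apply M x} s (apply M (basis i)))

  lincomb-closed : ∀ {W : Subset6} → (∀ {Q R} → Q ≗F R → W Q → W R) → W zeroF → (∀ {Q R} → W Q → W R → W (Q +F R)) →
    (∀ c {Q} → W Q → W (scaleF c Q)) → ∀ {P : Subset6} → (∀ Q → P Q → W Q) → ∀ {Q} → Span P Q → W Q
  lincomb-closed {W} resp z add scale {P} P⊆W (xs , all , e) = resp (λ p → sym (e p)) (go xs all)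
    where
    go : ∀ xs → All (λ cw → P (proj₂ cw)) xs → W (lincomb xs)
    go []             []         = z
    go ((c , w) ∷ xs) (px ∷ pxs) = add (scale c (P⊆W w px)) (go xs pxs)

  record IsSubspace (W : Subset6) : Set where
    field
      respects : ∀ {Q R} → Q ≗F R → W Q → W R
      has-zero : W zeroF
      has-+    : ∀ {Q R} → W Q → W R → W (Q +F R)
      has-*    : ∀ c {Q} → W Q → W (scaleF c Q)

    span⊆ : ∀ {P : Subset6} → (∀ Q → P Q → W Q) → ∀ {Q} → Span P Q → W Q
    span⊆ = lincomb-closed respects has-zero has-+ has-*

  span-three : ∀ {P : Subset6} {Q u v w} r s t → P u → P v → P w →
    Q ≗F (scaleF r u +F (scaleF s v +F scaleF t w)) → Span P Q
  span-three {P} {Q} {u} {v} {w} r s t pu pv pw e = (r , u) ∷ (s , v) ∷ (t , w) ∷ [] , pu ∷ pv ∷ pw ∷ [] , λ p →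
    trans (e p) (cong (λ z → r * u p + (s * v p + z)) (sym (+-identityʳ _)))

  isPlane : ∀ {W : Subset6} → IsSubspace W → ∀ u v w → Independent3 u v w → W u → W v → W w →
    (∀ Q → W Q → Σ C λ r → Σ C λ s → Σ C λ t → Q ≗F (scaleF r u +F (scaleF s v +F scaleF t w))) → IsPlane W
  isPlane {W} sub u v w ind wu wv ww spans = u , v , w , ind , λ Q →
    (λ wQ → let r , s , t , e = spans Q wQ in
       span-three r s t (inj₁ (λ _ → refl)) (inj₂ (inj₁ (λ _ → refl))) (inj₂ (inj₂ (λ _ → refl))) e) ,
    IsSubspace.span⊆ sub (λ { R (inj₁ e) → IsSubspace.respects sub (λ p → sym (e p)) wu
                            ; R (inj₂ (inj₁ e)) → IsSubspace.respects sub (λ p → sym (e p)) wv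
                            ; R (inj₂ (inj₂ e)) → IsSubspace.respects sub (λ p → sym (e p)) ww })

-- Transport along field homomorphisms, applied to inclusions and to Frobenius

module Hom {q r : ℕ} (F : FiniteField q) (K : FiniteField r) (hom : FieldHom F K) where
  private module F = LinearAlgebra F
  open LinearAlgebra K
  open FieldHom hom public renaming (⟦_⟧ to h)

  h-neg : ∀ x → h (F.- x) ≡ - h x
  h-neg x = x-y≡0⇒x≡y (trans (solve 2 (λ a b → a :- (:- b) := b :+ a) (h (F.- x)) (h x))
    (trans (sym (pres-+ x (F.- x))) (trans (cong h (F.-‿inverseʳ x)) pres-0)))

  h-sub : ∀ x y → h (x F.- y) ≡ h x - h y
  h-sub x y = trans (pres-+ x (F.- y)) (cong (h x +_) (h-neg y))

  h-nonzero : ∀ {x} → x ≢ F.0# → h x ≢ 0#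
  h-nonzero {x} x≢0 e = 1≢0 (trans (sym pres-1) (trans (cong h (sym (F.*-inverseʳ x≢0)))
    (trans (pres-* x (x F.⁻¹)) (trans (cong (_* h (x F.⁻¹)) e) (zeroˡ _)))))

  h-zero : ∀ {x} → h x ≡ 0# → x ≡ F.0#
  h-zero {x} e with x F.≟ F.0#
  ... | yes z = z
  ... | no n  = ⊥-elim (h-nonzero n e)

  h-injective : ∀ {x y} → h x ≡ h y → x ≡ y
  h-injective {x} {y} e = F.x-y≡0⇒x≡y (h-zero (trans (h-sub x y) (x≡y⇒x-y≡0 e)))

  h-^ : ∀ x n → h (x F.^ n) ≡ h x ^ n
  h-^ x zero    = pres-1
  h-^ x (suc n) = trans (pres-* x _) (cong (h x *_) (h-^ x n))

  h-×1 : ∀ n → h (n F.×′ F.1#) ≡ n ×′ 1#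
  h-×1 zero    = pres-0
  h-×1 (suc n) = trans (pres-+ _ _) (cong₂ _+_ pres-1 (h-×1 n))

  hV : F.Vec3 → Vec3
  hV v i = h (v i)

  hF : F.Form → Form
  hF a p = h (a p)

  hM : F.Mat → Mat
  hM M i j = h (M i j)

  hV-nonzero : ∀ {v} → F.NonZero3 v → NonZero3 (hV v)
  hV-nonzero (i , n) = i , h-nonzero n

  -- The convention 0⁻¹ = 0 makes this hold for every x.
  h-⁻¹ : ∀ x → h (x F.⁻¹) ≡ h x ⁻¹
  h-⁻¹ x with x F.≟ F.0# in e
  ... | yes z = trans pres-0 (sym (junk (trans (cong h z) pres-0)))
    where
    junk : ∀ {y} → y ≡ 0# → y ⁻¹ ≡ 0#
    junk {y} y≡0 with y ≟ 0#
    ... | yes _ = refl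
    ... | no n = ⊥-elim (n y≡0)
  ... | no n  = *-cancelˡ (h-nonzero n) (trans (sym (pres-* _ _)) (trans (cong h (proj₂ (F.inverse x n)))
          (trans pres-1 (sym (*-inverseʳ (h-nonzero n))))))

  h-sum3 : ∀ f → h (F.sum3 f) ≡ sum3 (λ i → h (f i))
  h-sum3 f = trans (pres-+ _ _) (cong (_ +_) (pres-+ _ _))

  h-sumP : ∀ f → h (F.sumP f) ≡ sumP (λ p → h (f p))
  h-sumP f = trans (pres-+ _ _) (cong (_ +_) (trans (pres-+ _ _) (cong (_ +_) (trans (pres-+ _ _)
    (cong (_ +_) (trans (pres-+ _ _) (cong (_ +_) (pres-+ _ _))))))))

  h-· : ∀ u v → h (u F.· v) ≡ hV u · hV v
  h-· u v = trans (h-sum3 (λ i → u i F.* v i)) (cong₂ _+_ (pres-* _ _) (cong₂ _+_ (pres-* _ _) (pres-* _ _)))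

  h-minor : ∀ a b c d → h (a F.* b F.- c F.* d) ≡ h a * h b - h c * h d
  h-minor a b c d = trans (h-sub _ _) (cong₂ _-_ (pres-* _ _) (pres-* _ _))

  h-cross : ∀ u v i → h (F.cross u v i) ≡ cross (hV u) (hV v) i
  h-cross u v i0 = h-minor _ _ _ _
  h-cross u v i1 = h-minor _ _ _ _
  h-cross u v i2 = h-minor _ _ _ _

  h-det : ∀ u v w → h (F.det u v w) ≡ det (hV u) (hV v) (hV w)
  h-det u v w = trans (h-· u (F.cross v w)) (·-cong {hV u} {hV u} (λ _ → refl) (h-cross v w))

  h-eval : ∀ a x → h (F.eval a x) ≡ eval (hF a) (hV x)
  h-eval a x = trans (h-sumP λ p → a p F.* (x (fstP p) F.* x (sndP p))) (sumP-cong λ p → trans (pres-* (a p) _) (cong (h (a p) *_) (pres-* (x (fstP p)) (x (sndP p)))))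

  h-polar : ∀ a x y → h (F.polar a x y) ≡ polar (hF a) (hV x) (hV y)
  h-polar a x y = trans (h-sumP λ p → a p F.* (x (fstP p) F.* y (sndP p) F.+ x (sndP p) F.* y (fstP p)))
    (sumP-cong λ p → trans (pres-* (a p) _) (cong (h (a p) *_) (trans (pres-+ _ _)
      (cong₂ _+_ (pres-* (x (fstP p)) (y (sndP p))) (pres-* (x (sndP p)) (y (fstP p)))))))

  h-prodLin : ∀ ℓ m p → h (F.prodLin ℓ m p) ≡ prodLin (hV ℓ) (hV m) p
  h-prodLin ℓ m = ∀Pair (pres-* _ _) (pres-* _ _) (pres-* _ _) mixed mixed mixed
    where
    mixed : ∀ {a b c d} → h (a F.* b F.+ c F.* d) ≡ h a * h b + h c * h d
    mixed = trans (pres-+ _ _) (cong₂ _+_ (pres-* _ _) (pres-* _ _))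

  h-substForm : ∀ Q M p → h (F.substForm Q M p) ≡ substForm (hF Q) (hM M) p
  h-substForm Q M = ∀Pair (square i0) (square i1) (square i2) (mixed i0 i1) (mixed i0 i2) (mixed i1 i2)
    where
    square : ∀ k → h (F.sumP λ ij → Q ij F.* (M (fstP ij) k F.* M (sndP ij) k)) ≡ sumP λ ij → h (Q ij) * (h (M (fstP ij) k) * h (M (sndP ij) k))
    square k = trans (h-sumP (λ ij → Q ij F.* (M (fstP ij) k F.* M (sndP ij) k)))
      (sumP-cong λ ij → trans (pres-* (Q ij) _) (cong (h (Q ij) *_) (pres-* (M (fstP ij) k) (M (sndP ij) k))))
    mixed : ∀ k l → h (F.sumP λ ij → Q ij F.* (M (fstP ij) k F.* M (sndP ij) l F.+ M (fstP ij) l F.* M (sndP ij) k)) ≡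
      sumP λ ij → h (Q ij) * (h (M (fstP ij) k) * h (M (sndP ij) l) + h (M (fstP ij) l) * h (M (sndP ij) k))
    mixed k l = trans (h-sumP (λ ij → Q ij F.* (M (fstP ij) k F.* M (sndP ij) l F.+ M (fstP ij) l F.* M (sndP ij) k)))
      (sumP-cong λ ij → trans (pres-* (Q ij) _) (cong (h (Q ij) *_) (trans (pres-+ _ _)
        (cong₂ _+_ (pres-* (M (fstP ij) k) (M (sndP ij) l)) (pres-* (M (fstP ij) l) (M (sndP ij) k))))))

  h-apply : ∀ M x i → h (F.apply M x i) ≡ apply (hM M) (hV x) i
  h-apply M x i = h-· (M i) x

  h-basis : ∀ i j → h (F.basis i j) ≡ basis i j
  h-basis i j with i Finₚ.≟ j
  ... | yes _ = pres-1
  ... | no _  = pres-0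

  h-gradient : ∀ a x i → h (F.gradient a x i) ≡ gradient (hF a) (hV x) i
  h-gradient a x i = trans (h-polar a x (F.basis i))
    (polar-cong {hF a} {hF a} {hV x} {hV (F.basis i)} {hV x} {basis i} (λ _ → refl) (λ _ → refl) (h-basis i))

  Singular⁺ : ∀ {a x} → F.Singular a x → Singular (hF a) (hV x)
  Singular⁺ {a} {x} (s , g) = trans (sym (h-eval a x)) (trans (cong h s) pres-0) ,
    λ i → trans (sym (h-gradient a x i)) (trans (cong h (g i)) pres-0)

  Singular⁻ : ∀ {a x} → Singular (hF a) (hV x) → F.Singular a x
  Singular⁻ {a} {x} (s , g) = h-zero (trans (h-eval a x) s) , λ i → h-zero (trans (h-gradient a x i) (g i))

-- Frobenius over the base field and its fixed elements

module Extension {q r : ℕ} {p k : ℕ} (p-prime : Prime p) (q≡ : q ≡ p ℕ.^ suc k) (F : FiniteField q) (K : FiniteField r) (ι-hom : FieldHom F K) where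
  private module F = LinearAlgebra F
  open LinearAlgebra K
  open Hom F K ι-hom public using () renaming
    ( h to ι; pres-+ to ι-+; pres-* to ι-*; pres-0 to ι-0; pres-1 to ι-1; h-neg to ι-neg; h-sub to ι-sub
    ; h-nonzero to ι-nonzero; h-zero to ι-zero; h-injective to ι-injective; h-^ to ι-^; hV to ιV; hF to ιF; hM to ιM
    ; hV-nonzero to ιV-nonzero
    ; h-⁻¹ to ι-⁻¹; h-· to ι-·; h-det to ι-det; h-eval to ι-eval; h-prodLin to ι-prodLin; h-apply to ι-apply; h-substForm to ιF-substForm; Singular⁺ to ι-Singular⁺; Singular⁻ to ι-Singular⁻; h-×1 to ι-×1; h-basis to ι-basis)

  1<q : 1 ℕ.< q
  1<q = ℕₚ.<-≤-trans (ℕ.nonTrivial⇒n>1 p {{prime⇒nonTrivial p-prime}})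
    (subst (ℕ._≤ q) (ℕₚ.*-identityʳ p) (subst (p ℕ.* 1 ℕ.≤_) (sym q≡)
      (ℕₚ.*-monoʳ-≤ p (ℕₚ.m^n>0 p {{prime⇒nonZero p-prime}} k))))

  characteristic-K : p ×′ 1# ≡ 0#
  characteristic-K = trans (sym (ι-×1 p)) (trans (cong ι (F.characteristic {p} {suc k} q≡)) ι-0)

  fr : C → C
  fr x = x ^ q

  fr-+ : ∀ x y → fr (x + y) ≡ fr x + fr y
  fr-+ x y = trans (^≡^′ (x + y) q) (trans (subst (λ n → (x + y) ^′ n ≡ x ^′ n + y ^′ n) (sym q≡)
    (FreshmansDream.dream^ commutativeSemiring p-prime characteristic-K (suc k) x y))
    (sym (cong₂ _+_ (^≡^′ x q) (^≡^′ y q))))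

  frobenius : FieldHom K K
  frobenius = record
    { ⟦_⟧    = fr
    ; pres-+ = fr-+
    ; pres-* = ^-* q
    ; pres-0 = 0^ (ℕₚ.<-trans (ℕ.s≤s ℕ.z≤n) 1<q)
    ; pres-1 = 1^ q
    }

  open Hom K K frobenius public using () renaming
    ( pres-* to fr-*; pres-0 to fr-0; pres-1 to fr-1; h-neg to fr-neg; h-sub to fr-sub
    ; h-nonzero to fr-nonzero; h-zero to fr-zero; h-injective to fr-injective; hV to frV; hF to frF
    ; hV-nonzero to frV-nonzero
    ; h-⁻¹ to fr-⁻¹; h-· to fr-·; h-cross to fr-cross; h-det to fr-det; h-eval to fr-eval
    ; h-polar to fr-polar; h-prodLin to fr-prodLin; h-minor to fr-minor)

  fr-ι : ∀ x → fr (ι x) ≡ ι x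
  fr-ι x = trans (sym (ι-^ x q)) (cong ι (F.fermat x))

  -- Let A be multiplication by x on the one-dimensional space K. Then A^q and A agree at 1, and the
  -- images of the q elements of F are distinct roots of X^q - X. The eigenvalue supplied by
  -- `power⇒eigen`, which can only be x, is therefore one of these images.
  fr-fixed⇒ι : ∀ {x} → fr x ≡ x → Σ F.C λ y → ι y ≡ x
  fr-fixed⇒ι {x} fixed =
    let w , (j , w≢0) , s , s∈ , e = power⇒eigen linear q 1<q (map ι (allFin q))
          (trans (Listₚ.length-map ι (allFin q)) (Listₚ.length-tabulate {n = q} (λ i → i)))
          (Uniqueₚ.map⁺ ι-injective (Uniqueₚ.allFin⁺ q))
          (λ r∈ → let y , _ , e = ∈-map⁻ ι r∈ in trans (cong fr e) (trans (fr-ι y) (sym e)))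
          (λ _ → 1#) (i0 , 1≢0) (λ { i0 → trans (iterated q) (trans fixed (sym (*-identityʳ x))) })
        y , _ , s≡ = ∈-map⁻ ι s∈
    in y , sym (trans (*-cancelˡ w≢0 (trans (*-comm _ _) (trans (e j) (*-comm _ _)))) s≡)
    where
    open Eigenvector K 1
    A : V → V
    A v i = x * v i
    linear : Linear A
    linear = record
      { A-cong = λ e i → cong (x *_) (e i)
      ; A-+ = λ v w i → distribˡ x (v i) (w i)
      ; A-* = λ c v i → solve 3 (λ x c v → x :* (c :* v) := c :* (x :* v)) x c (v i) }
    iterated : ∀ n → iterate A n (λ _ → 1#) i0 ≡ x ^ n
    iterated zero    = refl
    iterated (suc n) = cong (x *_) (iterated n)

-- Roots of irreducible quadratics in GF(q²)

module QuadraticRoot {q : ℕ} {p k : ℕ} (p-prime : Prime p) (q≡ : q ≡ p ℕ.^ suc k)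
  (F : FiniteField q) (L : FiniteField (q ℕ.^ 2)) (ι-hom : FieldHom F L)
  (t n : Fin q) where

  private module L = LinearAlgebra L
  open LinearAlgebra F
  open Extension {p = p} {k = k} p-prime q≡ F L ι-hom using (ι; ι-+; ι-*; ι-0; ι-1; ι-neg; 1<q)

  -- E = F[θ] with θ² = tθ − n; (a , b) stands for a + bθ.
  E : Set
  E = C × C

  _+E_ _*E_ : E → E → E
  (a , b) +E (c , d) = a + c , b + d
  (a , b) *E (c , d) = a * c - n * (b * d) , a * d + b * c + t * (b * d)

  0E 1E θ : E
  0E = 0# , 0#
  1E = 1# , 0#
  θ  = 0# , 1#

  semiringE : CommutativeSemiring 0ℓ 0ℓ
  semiringE = record
    { Carrier = E ; _≈_ = _≡_ ; _+_ = _+E_ ; _*_ = _*E_ ; 0# = 0E ; 1# = 1E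
    ; isCommutativeSemiring = isCommutativeSemiringˡ record
      { +-isCommutativeMonoid = isCommutativeMonoidˡ record
        { isSemigroup = record
          { isMagma = record { isEquivalence = ≡.isEquivalence ; ∙-cong = cong₂ _+E_ }
          ; assoc = λ (a , b) (c , d) (e , f) → cong₂ _,_ (+-assoc a c e) (+-assoc b d f) }
        ; identityˡ = λ (a , b) → cong₂ _,_ (+-identityˡ a) (+-identityˡ b)
        ; comm = λ (a , b) (c , d) → cong₂ _,_ (+-comm a c) (+-comm b d) }
      ; *-isCommutativeMonoid = isCommutativeMonoidˡ record
        { isSemigroup = record
          { isMagma = record { isEquivalence = ≡.isEquivalence ; ∙-cong = cong₂ _*E_ }
          ; assoc = λ (a , b) (c , d) (e , f) → cong₂ _,_
              (solve 8 (λ t n a b c d e f →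
                (a :* c :- n :* (b :* d)) :* e :- n :* ((a :* d :+ b :* c :+ t :* (b :* d)) :* f) :=
                a :* (c :* e :- n :* (d :* f)) :- n :* (b :* (c :* f :+ d :* e :+ t :* (d :* f)))) t n a b c d e f)
              (solve 8 (λ t n a b c d e f →
                (a :* c :- n :* (b :* d)) :* f :+ (a :* d :+ b :* c :+ t :* (b :* d)) :* e :+ t :* ((a :* d :+ b :* c :+ t :* (b :* d)) :* f) :=
                a :* (c :* f :+ d :* e :+ t :* (d :* f)) :+ b :* (c :* e :- n :* (d :* f)) :+ t :* (b :* (c :* f :+ d :* e :+ t :* (d :* f)))) t n a b c d e f) }
        ; identityˡ = λ (a , b) → cong₂ _,_
            (solve 3 (λ n a b → :1 :* a :- n :* (:0 :* b) := a) n a b)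
            (solve 3 (λ t a b → :1 :* b :+ :0 :* a :+ t :* (:0 :* b) := b) t a b)
        ; comm = λ (a , b) (c , d) → cong₂ _,_
            (solve 5 (λ n a b c d → a :* c :- n :* (b :* d) := c :* a :- n :* (d :* b)) n a b c d)
            (solve 5 (λ t a b c d → a :* d :+ b :* c :+ t :* (b :* d) := c :* b :+ d :* a :+ t :* (d :* b)) t a b c d) }
      ; distribʳ = λ (a , b) (c , d) (e , f) → cong₂ _,_
          (solve 7 (λ n a b c d e f → (c :+ e) :* a :- n :* ((d :+ f) :* b) :=
             (c :* a :- n :* (d :* b)) :+ (e :* a :- n :* (f :* b))) n a b c d e f)
          (solve 7 (λ t a b c d e f → (c :+ e) :* b :+ (d :+ f) :* a :+ t :* ((d :+ f) :* b) :=
             (c :* b :+ d :* a :+ t :* (d :* b)) :+ (e :* b :+ f :* a :+ t :* (f :* b))) t a b c d e f)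
      ; zeroˡ = λ (a , b) → cong₂ _,_
          (solve 3 (λ n a b → :0 :* a :- n :* (:0 :* b) := :0) n a b)
          (solve 3 (λ t a b → :0 :* b :+ :0 :* a :+ t :* (:0 :* b) := :0) t a b) } }

  open Exp (CommutativeSemiring.semiring semiringE) using () renaming (_^_ to _^E_; ^-assocʳ to ^E-^E)
  open CommExp semiringE using () renaming (^-distrib-* to ^E-*E)
  open Mult (CommutativeSemiring.semiring semiringE) using () renaming (_×_ to _×E_)

  scalarE : C → E
  scalarE c = c , 0#

  scalarE-^ : ∀ c m → scalarE c ^E m ≡ scalarE (c ^ m)
  scalarE-^ c zero    = refl
  scalarE-^ c (suc m) = trans (cong (scalarE c *E_) (scalarE-^ c m)) (cong₂ _,_
    (solve 3 (λ n c x → c :* x :- n :* (:0 :* :0) := c :* x) n c (c ^ m))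
    (solve 3 (λ t c x → c :* :0 :+ :0 :* x :+ t :* (:0 :* :0) := :0) t c (c ^ m)))

  characteristicE : p ×E 1E ≡ 0E
  characteristicE = trans (multiple p) (cong scalarE (characteristic {p} {suc k} q≡))
    where
    multiple : ∀ m → m ×E 1E ≡ scalarE (m ×′ 1#)
    multiple zero    = refl
    multiple (suc m) = trans (cong (1E +E_) (multiple m)) (cong₂ _,_ refl (+-identityˡ 0#))

  frE-+ : ∀ x y → (x +E y) ^E q ≡ (x ^E q) +E (y ^E q)
  frE-+ x y = subst (λ m → (x +E y) ^E m ≡ (x ^E m) +E (y ^E m)) (sym q≡)
    (FreshmansDream.dream^ semiringE p-prime characteristicE (suc k) x y)

  frE-scalar : ∀ c → scalarE c ^E q ≡ scalarE c
  frE-scalar c = trans (scalarE-^ c q) (cong scalarE (fermat c))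

  module _ (irreducible : ∀ x → x * x - t * x + n ≢ 0#) where

    -- The norm of x + yθ, that is (x + yθ)(x + yθ̄) with θ̄ = t - θ.
    norm : C → C → C
    norm x y = x * x + t * x * y + n * (y * y)

    norm-zero : ∀ x y → norm x y ≡ 0# → x ≡ 0# × y ≡ 0#
    norm-zero x y e with y ≟ 0#
    ... | no y≢0 = ⊥-elim (irreducible (- (x * y ⁻¹)) (linear₂ (y ⁻¹ * y ⁻¹) e
            (- (t * x * y ⁻¹ + n * (y * y ⁻¹ + 1#))) (*-inverseʳ y≢0)
            (solve 5 (λ t n x y d → ((:- (x :* d)) :* (:- (x :* d)) :- t :* (:- (x :* d)) :+ n) :- :0 :=
               (d :* d) :* (x :* x :+ t :* x :* y :+ n :* (y :* y) :- :0) :+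
               (:- (t :* x :* d :+ n :* (y :* d :+ :1))) :* (y :* d :- :1)) t n x y (y ⁻¹))))
    ... | yes refl = x≡0 , refl
      where
      x≡0 : x ≡ 0#
      x≡0 with *-zero-product {x} {x} (trans (solve 3 (λ t n x → x :* x := x :* x :+ t :* x :* :0 :+ n :* (:0 :* :0)) t n x) e)
      ... | inj₁ z = z
      ... | inj₂ z = z

    -- Multiplicativity of the norm for (z - θ)(z - θ̄) = z² - tz + n with z = u + vθ. As only 0 has
    -- norm 0, this leaves θ and θ̄ as the roots, without showing first that E is a field.
    norm-product : ∀ u v → norm u (v - 1#) * norm (u - t) (v + 1#) ≡
      norm (u * u - n * (v * v) + n - t * u) (u * v + v * u + t * (v * v) - t * v)
    norm-product = solve 4 (λ t n u v →
      (u :* u :+ t :* u :* (v :- :1) :+ n :* ((v :- :1) :* (v :- :1))) :*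
      ((u :- t) :* (u :- t) :+ t :* (u :- t) :* (v :+ :1) :+ n :* ((v :+ :1) :* (v :+ :1))) :=
      (u :* u :- n :* (v :* v) :+ n :- t :* u) :* (u :* u :- n :* (v :* v) :+ n :- t :* u)
      :+ t :* (u :* u :- n :* (v :* v) :+ n :- t :* u) :* (u :* v :+ v :* u :+ t :* (v :* v) :- t :* v)
      :+ n :* ((u :* v :+ v :* u :+ t :* (v :* v) :- t :* v) :* (u :* v :+ v :* u :+ t :* (v :* v) :- t :* v))) t n

    conjugate-root : ∀ u v → u * u - n * (v * v) + n ≡ t * u → u * v + v * u + t * (v * v) ≡ t * v →
      (u , v) ≡ θ ⊎ (u , v) ≡ (t , - 1#)
    conjugate-root u v e₁ e₂ = [ first , second ]′ (*-zero-product {norm u (v - 1#)} {norm (u - t) (v + 1#)}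
      (trans (norm-product u v) (trans (cong₂ norm (x≡y⇒x-y≡0 e₁) (x≡y⇒x-y≡0 e₂))
        (solve 2 (λ t n → :0 :* :0 :+ t :* :0 :* :0 :+ n :* (:0 :* :0) := :0) t n))))
      where
      first : norm u (v - 1#) ≡ 0# → (u , v) ≡ θ ⊎ (u , v) ≡ (t , - 1#)
      first z = let a , b = norm-zero u (v - 1#) z in inj₁ (cong₂ _,_ a (x-y≡0⇒x≡y b))
      second : norm (u - t) (v + 1#) ≡ 0# → (u , v) ≡ θ ⊎ (u , v) ≡ (t , - 1#)
      second z = let a , b = norm-zero (u - t) (v + 1#) z in inj₂ (cong₂ _,_ (x-y≡0⇒x≡y a)
            (linear₁ 1# b (solve 1 (λ v → v :- (:- :1) := :1 :* (v :+ :1 :- :0)) v)))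

    -- The q-th power map is additive and multiplicative on E and fixes the scalars, so it sends θ
    -- to a root of the same quadratic.
    frE-θ : θ ^E q ≡ θ ⊎ θ ^E q ≡ (t , - 1#)
    frE-θ = conjugate-root u v
        (trans (cong proj₁ conjugate) (solve 4 (λ t n u v → t :* u :- n :* (:0 :* v) := t :* u) t n u v))
        (trans (sym (+-identityʳ (u * v + v * u + t * (v * v)))) (trans (cong proj₂ conjugate)
          (solve 3 (λ t u v → t :* v :+ :0 :* u :+ t :* (:0 :* v) := t :* v) t u v)))
      where
      u v : C
      u = proj₁ (θ ^E q)
      v = proj₂ (θ ^E q)
      minimal : (θ *E θ) +E scalarE n ≡ scalarE t *E θ
      minimal = cong₂ _,_
        (solve 2 (λ t n → :0 :* :0 :- n :* (:1 :* :1) :+ n := t :* :0 :- n :* (:0 :* :1)) t n)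
        (solve 2 (λ t n → :0 :* :1 :+ :1 :* :0 :+ t :* (:1 :* :1) :+ :0 := t :* :1 :+ :0 :* :0 :+ t :* (:0 :* :1)) t n)
      conjugate : ((θ ^E q) *E (θ ^E q)) +E scalarE n ≡ scalarE t *E (θ ^E q)
      conjugate = trans (cong₂ _+E_ (sym (^E-*E θ θ q)) (sym (frE-scalar n)))
        (trans (sym (frE-+ (θ *E θ) (scalarE n))) (trans (cong (_^E q) minimal)
          (trans (^E-*E (scalarE t) θ q) (cong (_*E (θ ^E q)) (frE-scalar t)))))

    -- In the case θ^q = t - θ, the q-th power of θ^q + θ = t shows that θ^(q²) = t - θ^q = θ.
    θ^q² : θ ^E (q ℕ.^ 2) ≡ θ
    θ^q² = trans (sym (^E-^E θ q (q ℕ.* 1))) (trans (cong ((θ ^E q) ^E_) (ℕₚ.*-identityʳ q)) (twice frE-θ))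
      where
      twice : θ ^E q ≡ θ ⊎ θ ^E q ≡ (t , - 1#) → (θ ^E q) ^E q ≡ θ
      twice (inj₁ e) = trans (cong (_^E q) e) e
      twice (inj₂ e) = trans (cong (_^E q) e) (cong₂ _,_
          (linear₁ 1# (cong proj₁ total) (solve 2 (λ a t → a :- :0 := :1 :* (a :+ t :- t)) _ t))
          (linear₁ 1# (cong proj₂ total) (solve 1 (λ b → b :- :1 := :1 :* (b :+ (:- :1) :- :0)) _)))
        where
        total : ((t , - 1#) ^E q) +E (t , - 1#) ≡ scalarE t
        total = trans (cong (((t , - 1#) ^E q) +E_) (sym e)) (trans (sym (frE-+ (t , - 1#) θ))
          (trans (cong (_^E q) (cong₂ _,_ (+-identityʳ t) (-‿inverseˡ 1#))) (frE-scalar t)))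

    -- Here A is the companion matrix, multiplication by θ in the basis 1, θ, acting over L. From
    -- θ^(q²) = θ it follows that A^(q²) and A agree at the vector of 1. All elements of L are roots
    -- of X^(q²) - X, so A has an eigenvalue in L, and an eigenvalue of A is a root of X² - tX + n.
    root : Σ L.C λ ρ → ρ L.* ρ L.- ι t L.* ρ L.+ ι n ≡ L.0#
    root =
      let w , w≢0 , ρ , _ , e = power⇒eigen linear (q ℕ.^ 2) 1<q² (allFin (q ℕ.^ 2))
            (Listₚ.length-tabulate {n = q ℕ.^ 2} (λ i → i)) (Uniqueₚ.allFin⁺ (q ℕ.^ 2)) (λ {r} _ → L.fermat r)
            one (zero , L.1≢0) annihilated
      in ρ , eigenvalue w w≢0 ρ e
      where
      open Eigenvector L 2
      one : V
      one zero    = L.1#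
      one (suc _) = L.0#
      A : V → V
      A v zero    = L.- (ι n L.* v (suc zero))
      A v (suc _) = v zero L.+ ι t L.* v (suc zero)
      linear : Linear A
      linear = record
        { A-cong = λ { e zero → cong (λ z → L.- (ι n L.* z)) (e (suc zero))
                     ; e (suc zero) → cong₂ (λ y z → y L.+ ι t L.* z) (e zero) (e (suc zero)) }
        ; A-+ = λ { v w zero → L.solve 3 (λ n a b → :- (n :* (a :+ b)) := :- (n :* a) :+ :- (n :* b)) (ι n) (v (suc zero)) (w (suc zero))
                  ; v w (suc zero) → L.solve 5 (λ t a b c d → (a :+ b) :+ t :* (c :+ d) := (a :+ t :* c) :+ (b :+ t :* d))
                      (ι t) (v zero) (w zero) (v (suc zero)) (w (suc zero)) }
        ; A-* = λ { c v zero → L.solve 3 (λ n c a → :- (n :* (c :* a)) := c :* :- (n :* a)) (ι n) c (v (suc zero))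
                  ; c v (suc zero) → L.solve 4 (λ t c a b → c :* a :+ t :* (c :* b) := c :* (a :+ t :* b)) (ι t) c (v zero) (v (suc zero)) } }
      1<q² : 1 ℕ.< q ℕ.^ 2
      1<q² = ℕₚ.<-≤-trans 1<q (subst (q ℕ.≤_) (cong (q ℕ.*_) (sym (ℕₚ.*-identityʳ q)))
        (ℕₚ.m≤m*n q q {{ℕ.>-nonZero (ℕₚ.<-trans (ℕ.s≤s ℕ.z≤n) 1<q)}}))
      embed : E → V
      embed (a , b) zero    = ι a
      embed (a , b) (suc _) = ι b
      iterated : ∀ m → iterate A m one ≈ embed (θ ^E m)
      iterated zero zero          = sym ι-1
      iterated zero (suc zero)    = sym ι-0
      iterated (suc m) zero       = trans (cong (λ z → L.- (ι n L.* z)) (iterated m (suc zero)))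
        (trans (cong L.-_ (sym (ι-* n _))) (trans (sym (ι-neg _))
          (cong ι (solve 3 (λ n a b → :- (n :* b) := :0 :* a :- n :* (:1 :* b)) n (proj₁ (θ ^E m)) (proj₂ (θ ^E m))))))
      iterated (suc m) (suc zero) = trans (cong₂ (λ y z → y L.+ ι t L.* z) (iterated m zero) (iterated m (suc zero)))
        (trans (cong (ι (proj₁ (θ ^E m)) L.+_) (sym (ι-* t _))) (trans (sym (ι-+ _ _))
          (cong ι (solve 3 (λ t a b → a :+ t :* b := :0 :* b :+ :1 :* a :+ t :* (:1 :* b)) t (proj₁ (θ ^E m)) (proj₂ (θ ^E m))))))
      annihilated : iterate A (q ℕ.^ 2) one ≈ A one
      annihilated i = trans (iterated (q ℕ.^ 2) i) (trans (cong (λ z → embed z i) (trans θ^q² (sym θ^1))) (sym (iterated 1 i)))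
        where
        θ^1 : θ ^E 1 ≡ θ
        θ^1 = CommutativeSemiring.*-identityʳ semiringE θ
      eigenvalue : ∀ w → (Σ (Fin 2) λ i → w i ≢ L.0#) → ∀ ρ → (∀ i → A w i ≡ ρ L.* w i) →
        ρ L.* ρ L.- ι t L.* ρ L.+ ι n ≡ L.0#
      eigenvalue w w≢0 ρ e = L.*-cancelˡ-0 (w₁≢0 w≢0)
        (L.linear₂ (L.- L.1#) (e zero) (L.- ρ) (e (suc zero))
          (L.solve 5 (λ t n a b r → b :* (r :* r :- t :* r :+ n) :- :0 :=
             (:- :1) :* (:- (n :* b) :- r :* a) :+ (:- r) :* (a :+ t :* b :- r :* b)) (ι t) (ι n) (w zero) (w (suc zero)) ρ))
        where
        w₁≢0 : (Σ (Fin 2) λ i → w i ≢ L.0#) → w (suc zero) ≢ L.0#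
        w₁≢0 (suc zero , ne) z = ne z
        w₁≢0 (zero , ne) z = ne (L.linear₂ L.1# (e (suc zero)) (ρ L.- ι t) z
          (L.solve 4 (λ t a b r → a :- :0 := :1 :* (a :+ t :* b :- r :* b) :+ (r :- t) :* (b :- :0)) (ι t) (w zero) (w (suc zero)) ρ))

injective⇒surjective : ∀ {n} {f : Fin n → Fin n} → (∀ {x y} → f x ≡ f y → x ≡ y) → ∀ y → Σ (Fin n) λ x → f x ≡ y
injective⇒surjective {suc m} {f} inj y with Finₚ.any? (λ x → f x Finₚ.≟ y)
... | yes found = found
... | no missed = ⊥-elim (ℕₚ.1+n≰n (Finₚ.injective⇒≤ {f = λ x → Fin.punchOut (avoids x)}
        (λ {x} {y} e → inj (Finₚ.punchOut-injective (avoids x) (avoids y) e))))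
  where
  avoids : ∀ x → y ≢ f x
  avoids x e = missed (x , sym e)

-- Degenerate forms and their singular points

module DegenerateForms {q : ℕ} (F : FiniteField q) where
  open LinearAlgebra F public

  ·-basis : ∀ v i → v · basis i ≡ v i
  ·-basis v i = trans (solveFor (vector ∷ vector ∷ []) (λ u v → u :· v := v :· u) v (basis i)) (basis-· i v)

  cross-basis : ∀ u v i → u · cross v (basis i) ≡ cross u v i
  cross-basis u v i = trans (solveFor (vector ∷ vector ∷ vector ∷ []) (λ u v w → u :· crossE v w := crossE u v :· w) u v (basis i))
    (·-basis (cross u v) i)

  cross-self : ∀ u i → cross u u i ≡ 0#
  cross-self u i0 = solveFor (vector ∷ []) (λ u → crossE u u i0 := :0) u
  cross-self u i1 = solveFor (vector ∷ []) (λ u → crossE u u i1 := :0) u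
  cross-self u i2 = solveFor (vector ∷ []) (λ u → crossE u u i2 := :0) u

  det-basis : ∀ u v i → det u v (basis i) ≡ cross u v i
  det-basis u v i = cross-basis u v i

  not-zero : ∀ {v} → NonZero3 v → ¬ (∀ i → v i ≡ 0#)
  not-zero (i , n) z = n (z i)

  eval-multiple : ∀ {Q c ℓ m} → Q ≗F scaleF c (prodLin ℓ m) → ∀ x → eval Q x ≡ c * ((ℓ · x) * (m · x))
  eval-multiple {Q} {c} {ℓ} {m} e x = trans (eval-cong {Q} {scaleF c (prodLin ℓ m)} {x} {x} e (λ _ → refl))
    (trans (eval-scaleF c (prodLin ℓ m) x) (cong (c *_) (eval-prodLin ℓ m x)))

  polar-multiple : ∀ {Q c ℓ m} → Q ≗F scaleF c (prodLin ℓ m) → ∀ x y →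
    polar Q x y ≡ c * ((ℓ · x) * (m · y) + (ℓ · y) * (m · x))
  polar-multiple {Q} {c} {ℓ} {m} e x y =
    trans (polar-cong {Q} {scaleF c (prodLin ℓ m)} {x} {y} {x} {y} e (λ _ → refl) (λ _ → refl))
      (trans (polar-scaleF c (prodLin ℓ m) x y) (cong (c *_) (polar-prodLin ℓ m x y)))

  centered⇒singular : ∀ {Q c ℓ m A} → Q ≗F scaleF c (prodLin ℓ m) → ℓ · A ≡ 0# → m · A ≡ 0# → Singular Q A
  centered⇒singular {Q} {c} {ℓ} {m} {A} e f g =
    trans (eval-multiple {Q} {c} {ℓ} {m} e A) (linear₁ (c * (m · A)) f
      (solve 3 (λ c a b → c :* (a :* b) :- :0 := (c :* b) :* (a :- :0)) c (ℓ · A) (m · A))) ,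
    λ i → trans (polar-multiple {Q} {c} {ℓ} {m} e A (basis i)) (linear₂ (c * (m · basis i)) f (c * (ℓ · basis i)) g
      (solve 5 (λ c a b a′ b′ → c :* (a :* b′ :+ a′ :* b) :- :0 := (c :* b′) :* (a :- :0) :+ (c :* a′) :* (b :- :0))
        c (ℓ · A) (m · A) (ℓ · basis i) (m · basis i)))

  -- The gradient at A is c times (ℓ·A)m + (m·A)ℓ. As ℓ and m are not proportional, both
  -- coefficients vanish.
  singular⇒centered : ∀ {Q c ℓ m A} → c ≢ 0# → NonZero3 ℓ → NonZero3 m → ¬ Prop3 ℓ m →
    Q ≗F scaleF c (prodLin ℓ m) → Singular Q A → ℓ · A ≡ 0# × m · A ≡ 0#
  singular⇒centered {Q} {c} {ℓ} {m} {A} c≢0 (j , ℓj≢0) m≢0 independent e s = ℓA≡0 , mA≡0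
    where
    relation : ∀ i → (ℓ · A) * m i + (m · A) * ℓ i ≡ 0#
    relation i = *-cancelˡ-0 c≢0 (trans (trans
      (cong (c *_) (trans (cong₂ (λ x y → (ℓ · A) * x + (m · A) * y) (sym (·-basis m i)) (sym (·-basis ℓ i)))
        (cong ((ℓ · A) * (m · basis i) +_) (*-comm (m · A) (ℓ · basis i)))))
      (sym (polar-multiple {Q} {c} {ℓ} {m} e A (basis i)))) (proj₂ s i))
    ℓA≡0 : ℓ · A ≡ 0#
    ℓA≡0 with (ℓ · A) ≟ 0#
    ... | yes z = z
    ... | no n  = ⊥-elim (independent (multiple⇒Prop3 {ℓ} {m} m≢0 ((- ((ℓ · A) ⁻¹ * (m · A))) , λ i → *-cancelˡ n
          (linear₂ 1# (relation i) (m · A * ℓ i) (*-inverseʳ n)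
            (solve 5 (λ a b d l m → a :* m :- a :* ((:- (d :* b)) :* l) := :1 :* (a :* m :+ b :* l :- :0) :+ (b :* l) :* (a :* d :- :1))
              (ℓ · A) (m · A) ((ℓ · A) ⁻¹) (ℓ i) (m i))))))
    mA≡0 : m · A ≡ 0#
    mA≡0 = *-cancelʳ-0 ℓj≢0 (linear₂ 1# (relation j) (- m j) ℓA≡0
      (solve 4 (λ a b l m → b :* l :- :0 := :1 :* (a :* m :+ b :* l :- :0) :+ (:- m) :* (a :- :0)) (ℓ · A) (m · A) (ℓ j) (m j)))

  biLine-center : ∀ {ℓ m} → NonZero3 ℓ → NonZero3 m → ¬ Prop3 ℓ m → NonZero3 (cross ℓ m) × ℓ · cross ℓ m ≡ 0# × m · cross ℓ m ≡ 0#
  biLine-center {ℓ} {m} ℓ≢0 m≢0 independent = center≢0 (nonzero? (cross ℓ m)) ,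
    solveFor (vector ∷ vector ∷ []) (λ ℓ m → ℓ :· crossE ℓ m := :0) ℓ m ,
    solveFor (vector ∷ vector ∷ []) (λ ℓ m → m :· crossE ℓ m := :0) ℓ m
    where
    center≢0 : NonZero3 (cross ℓ m) ⊎ (∀ i → cross ℓ m i ≡ 0#) → NonZero3 (cross ℓ m)
    center≢0 (inj₁ n) = n
    center≢0 (inj₂ z) = ⊥-elim (independent (cross-zero⇒Prop3 {ℓ} {m} ℓ≢0 m≢0 z))

  -- Every point of the repeated line is singular, but a bi-line has only its center.
  biLine⇒¬repeated : ∀ {Q c ℓ m c′ n} → c ≢ 0# → NonZero3 ℓ → NonZero3 m → ¬ Prop3 ℓ m →
    Q ≗F scaleF c (prodLin ℓ m) → NonZero3 n → ¬ (Q ≗F scaleF c′ (prodLin n n))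
  biLine⇒¬repeated {Q} {c} {ℓ} {m} {c′} {n} c≢0 ℓ≢0 m≢0 independent e n≢0 f =
    independent (Prop3-trans {ℓ} {n} {m} (Prop3-sym {n} {ℓ} (cross-zero⇒Prop3 {n} {ℓ} n≢0 ℓ≢0 (λ i → flipped ℓ i (λ i → proj₁ (both i)))))
      (cross-zero⇒Prop3 {n} {m} n≢0 m≢0 (λ i → flipped m i (λ i → proj₂ (both i)))))
    where
    both : ∀ i → ℓ · cross n (basis i) ≡ 0# × m · cross n (basis i) ≡ 0#
    both i = singular⇒centered {Q} {c} {ℓ} {m} {cross n (basis i)} c≢0 ℓ≢0 m≢0 independent e
      (centered⇒singular {Q} {c′} {n} {n} {cross n (basis i)} f on on)
      where
      on : n · cross n (basis i) ≡ 0#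
      on = trans (cross-basis n n i) (cross-self n i)
    flipped : ∀ ℓ i → (∀ i → ℓ · cross n (basis i) ≡ 0#) → cross n ℓ i ≡ 0#
    flipped ℓ i0 h = linear₁ (- 1#) (trans (sym (cross-basis ℓ n i0)) (h i0))
      (solveFor (vector ∷ vector ∷ []) (λ ℓ n → crossE n ℓ i0 :- :0 := (:- :1) :* (crossE ℓ n i0 :- :0)) ℓ n)
    flipped ℓ i1 h = linear₁ (- 1#) (trans (sym (cross-basis ℓ n i1)) (h i1))
      (solveFor (vector ∷ vector ∷ []) (λ ℓ n → crossE n ℓ i1 :- :0 := (:- :1) :* (crossE ℓ n i1 :- :0)) ℓ n)
    flipped ℓ i2 h = linear₁ (- 1#) (trans (sym (cross-basis ℓ n i2)) (h i2))
      (solveFor (vector ∷ vector ∷ []) (λ ℓ n → crossE n ℓ i2 :- :0 := (:- :1) :* (crossE ℓ n i2 :- :0)) ℓ n)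

  biLine⇒nonzero : ∀ {Q c ℓ m} → c ≢ 0# → NonZero3 ℓ → NonZero3 m → ¬ Prop3 ℓ m →
    Q ≗F scaleF c (prodLin ℓ m) → NonZeroForm Q
  biLine⇒nonzero {Q} {c} {ℓ} {m} c≢0 ℓ≢0 m≢0 independent e = [ (λ n → n) , (λ z → ⊥-elim (absurd z)) ]′ (nonzeroForm? Q)
    where
    absurd : ¬ (∀ p → Q p ≡ 0#)
    absurd z = biLine⇒¬repeated {Q} {c} {ℓ} {m} {0#} {ℓ} c≢0 ℓ≢0 m≢0 independent e ℓ≢0 (λ p → trans (z p) (sym (zeroˡ _)))

  -- The linear form x ↦ ℓ(Mx), a row vector times a matrix.
  infixl 7 _◃_
  _◃_ : Vec3 → Mat → Vec3
  (ℓ ◃ M) i = sum3 λ j → ℓ j * M j i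

  ◃-· : ∀ ℓ M x → (ℓ ◃ M) · x ≡ ℓ · apply M x
  ◃-· = solveFor (vector ∷ matrix ∷ vector ∷ []) λ ℓ M x →
    (λ i → ℓ i0 :* M i0 i :+ (ℓ i1 :* M i1 i :+ ℓ i2 :* M i2 i)) :· x := ℓ :· applyE M x

  apply-∙M : ∀ M N x i → apply M (apply N x) i ≡ apply (M ∙M N) x i
  apply-∙M M N x i = solveFor (vector ∷ matrix ∷ vector ∷ []) (λ m N x →
    m :· applyE N x := (λ j → m i0 :* N i0 j :+ (m i1 :* N i1 j :+ m i2 :* N i2 j)) :· x) (M i) N x

  apply-idM : ∀ x i → apply idM x i ≡ x i
  apply-idM x i = basis-· i x

  apply-cong : ∀ {M N x y} → (∀ i j → M i j ≡ N i j) → (∀ i → x i ≡ y i) → ∀ i → apply M x i ≡ apply N y i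
  apply-cong {M} {N} {x} {y} e f i = ·-cong {M i} {N i} {x} {y} (e i) f

  apply-inverse : ∀ {M N} → (∀ i j → (M ∙M N) i j ≡ idM i j) → ∀ x i → apply M (apply N x) i ≡ x i
  apply-inverse {M} {N} e x i = trans (apply-∙M M N x i) (trans (apply-cong {M ∙M N} {idM} {x} {x} e (λ _ → refl) i) (apply-idM x i))

  apply-scale : ∀ M c x i → apply M (c *V x) i ≡ c * apply M x i
  apply-scale M c x i = solveFor (vector ∷ scalar ∷ vector ∷ []) (λ m c x → m :· (λ j → c :* x j) := c :* (m :· x)) (M i) c x

  ◃-inverse : ∀ {M N} → (∀ i j → (M ∙M N) i j ≡ idM i j) → ∀ ℓ i → ((ℓ ◃ M) ◃ N) i ≡ ℓ i
  ◃-inverse {M} {N} e ℓ i = trans (sym (·-basis ((ℓ ◃ M) ◃ N) i)) (trans (◃-· (ℓ ◃ M) N (basis i)) (trans (◃-· ℓ M (apply N (basis i)))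
    (trans (·-cong {ℓ} {ℓ} {apply M (apply N (basis i))} {basis i} (λ _ → refl) (apply-inverse {M} {N} e (basis i))) (·-basis ℓ i))))

  ◃-nonzero : ∀ {M} → Invertible M → ∀ {ℓ} → NonZero3 ℓ → NonZero3 (ℓ ◃ M)
  ◃-nonzero {M} (N , e) {ℓ} ℓ≢0 = [ (λ n → n) , (λ z → ⊥-elim (not-zero {ℓ} ℓ≢0 (λ i → trans (sym (◃-inverse {M} {N} e ℓ i))
    (·-zero {ℓ ◃ M} {λ j → N j i} z)))) ]′ (nonzero? (ℓ ◃ M))

  ◃-scale : ∀ c ℓ M i → ((c *V ℓ) ◃ M) i ≡ c * (ℓ ◃ M) i
  ◃-scale c ℓ M i = solveFor (scalar ∷ vector ∷ vector ∷ []) (λ c ℓ m → (λ j → c :* ℓ j) :· m := c :* (ℓ :· m)) c ℓ (λ j → M j i)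

  ◃-cong : ∀ {ℓ m} M → (∀ i → ℓ i ≡ m i) → ∀ i → (ℓ ◃ M) i ≡ (m ◃ M) i
  ◃-cong {ℓ} {m} M e i = ·-cong {ℓ} {m} {λ j → M j i} {λ j → M j i} e (λ _ → refl)

  ◃-Prop3⁻ : ∀ {M} → Invertible M → ∀ {ℓ m} → Prop3 (ℓ ◃ M) (m ◃ M) → Prop3 ℓ m
  ◃-Prop3⁻ {M} (N , e) {ℓ} {m} (c , c≢0 , f) = c , c≢0 , λ i → trans (sym (◃-inverse {M} {N} e m i))
    (trans (◃-cong {m ◃ M} {c *V (ℓ ◃ M)} N f i) (trans (◃-scale c (ℓ ◃ M) N i) (cong (c *_) (◃-inverse {M} {N} e ℓ i))))

  substForm-multiple : ∀ {Q c ℓ m} M → Q ≗F scaleF c (prodLin ℓ m) → substForm Q M ≗F scaleF c (prodLin (ℓ ◃ M) (m ◃ M))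
  substForm-multiple {Q} {c} {ℓ} {m} M e = form-ext (substForm Q M) (scaleF c (prodLin (ℓ ◃ M) (m ◃ M))) λ x →
    trans (eval-substForm Q M x) (trans (eval-multiple {Q} {c} {ℓ} {m} e (apply M x)) (trans
      (cong (c *_) (cong₂ _*_ (sym (◃-· ℓ M x)) (sym (◃-· m M x))))
      (sym (trans (eval-scaleF c (prodLin (ℓ ◃ M) (m ◃ M)) x) (cong (c *_) (eval-prodLin (ℓ ◃ M) (m ◃ M) x))))))

  open IsSubspace

  singular-subspace : ∀ A → IsSubspace (λ Q → Singular Q A)
  singular-subspace A = record
    { respects = λ {Q} {R} e s → Singular-cong {Q} {R} {A} {A} e (λ _ → refl) s
    ; has-zero = eval-zeroF A , λ i → polar-zeroF A (basis i)
    ; has-+ = λ {Q} {R} (e , f) (e′ , f′) →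
        trans (eval-+F Q R A) (trans (cong₂ _+_ e e′) (+-identityʳ 0#)) ,
        λ i → trans (polar-+F Q R A (basis i)) (trans (cong₂ _+_ (f i) (f′ i)) (+-identityʳ 0#))
    ; has-* = λ c {Q} (e , f) →
        trans (eval-scaleF c Q A) (trans (cong (c *_) e) (zeroʳ c)) ,
        λ i → trans (polar-scaleF c Q A (basis i)) (trans (cong (c *_) (f i)) (zeroʳ c)) }

  complete₁ : ∀ {A B} → NonZero3 (cross A B) → Σ Vec3 λ D → det A B D ≢ 0#
  complete₁ {A} {B} (k , n) = basis k , λ z → n (trans (sym (det-basis A B k)) z)

  complete₂ : ∀ {A} → NonZero3 A → Σ Vec3 λ E₁ → Σ Vec3 λ E₂ → det A E₁ E₂ ≢ 0#
  complete₂ {A} (i0 , n) = basis i1 , basis i2 , λ z → n (trans (solveFor (vector ∷ []) (λ a →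
    a i0 := detE a (λ { i0 → :0 ; i1 → :1 ; i2 → :0 }) (λ { i0 → :0 ; i1 → :0 ; i2 → :1 })) A) z)
  complete₂ {A} (i1 , n) = basis i2 , basis i0 , λ z → n (trans (solveFor (vector ∷ []) (λ a →
    a i1 := detE a (λ { i0 → :0 ; i1 → :0 ; i2 → :1 }) (λ { i0 → :1 ; i1 → :0 ; i2 → :0 })) A) z)
  complete₂ {A} (i2 , n) = basis i0 , basis i1 , λ z → n (trans (solveFor (vector ∷ []) (λ a →
    a i2 := detE a (λ { i0 → :1 ; i1 → :0 ; i2 → :0 }) (λ { i0 → :0 ; i1 → :1 ; i2 → :0 })) A) z)

  dual : Vec3 → Vec3 → Vec3 → Vec3
  dual u v w i = det u v w ⁻¹ * cross v w i

  dual-· : ∀ u v w x → dual u v w · x ≡ det u v w ⁻¹ * det x v w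
  dual-· u v w x = solveFor (scalar ∷ vector ∷ vector ∷ []) (λ d c x → (λ i → d :* c i) :· x := d :* (x :· c)) (det u v w ⁻¹) (cross v w) x

  -- The form r m₁² + s m₁m₂ + t m₂², where m₁ and m₂ are the coordinates of E₁ and E₂
  -- in the basis A, E₁, E₂.
  module Pencil (A E₁ E₂ : Vec3) (D≢0 : det A E₁ E₂ ≢ 0#) where
    m₁ m₂ : Vec3
    m₁ = dual E₁ E₂ A
    m₂ = dual E₂ A E₁

    private
      D₁ : det E₁ E₂ A ≢ 0#
      D₁ z = D≢0 (trans (det-cyclic A E₁ E₂) z)
      D₂ : det E₂ A E₁ ≢ 0#
      D₂ z = D₁ (trans (det-cyclic E₁ E₂ A) z)
      repeat₁ : ∀ u v → det u u v ≡ 0#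
      repeat₁ = solveFor (vector ∷ vector ∷ []) λ u v → detE u u v := :0
      repeat₂ : ∀ u v → det u v u ≡ 0#
      repeat₂ = solveFor (vector ∷ vector ∷ []) λ u v → detE u v u := :0
      vanish : ∀ {u v w x} → det x v w ≡ 0# → dual u v w · x ≡ 0#
      vanish {u} {v} {w} {x} e = trans (dual-· u v w x) (trans (cong (det u v w ⁻¹ *_) e) (zeroʳ _))

    m₁A : m₁ · A ≡ 0#
    m₁A = vanish {E₁} {E₂} {A} {A} (repeat₂ A E₂)
    m₁E₁ : m₁ · E₁ ≡ 1#
    m₁E₁ = trans (dual-· E₁ E₂ A E₁) (*-inverseˡ D₁)
    m₁E₂ : m₁ · E₂ ≡ 0#
    m₁E₂ = vanish {E₁} {E₂} {A} {E₂} (repeat₁ E₂ A)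
    m₂A : m₂ · A ≡ 0#
    m₂A = vanish {E₂} {A} {E₁} {A} (repeat₁ A E₁)
    m₂E₁ : m₂ · E₁ ≡ 0#
    m₂E₁ = vanish {E₂} {A} {E₁} {E₁} (repeat₂ E₁ A)
    m₂E₂ : m₂ · E₂ ≡ 1#
    m₂E₂ = trans (dual-· E₂ A E₁ E₂) (*-inverseˡ D₂)

    pencil : C → C → C → Form
    pencil r s t = scaleF r (prodLin m₁ m₁) +F (scaleF s (prodLin m₁ m₂) +F scaleF t (prodLin m₂ m₂))

    eval-pencil : ∀ r s t x → eval (pencil r s t) x ≡
      r * ((m₁ · x) * (m₁ · x)) + (s * ((m₁ · x) * (m₂ · x)) + t * ((m₂ · x) * (m₂ · x)))
    eval-pencil r s t x = trans (eval-+F (scaleF r (prodLin m₁ m₁)) (scaleF s (prodLin m₁ m₂) +F scaleF t (prodLin m₂ m₂)) x) (cong₂ _+_ (part r m₁ m₁) (trans (eval-+F (scaleF s (prodLin m₁ m₂)) (scaleF t (prodLin m₂ m₂)) x)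
      (cong₂ _+_ (part s m₁ m₂) (part t m₂ m₂))))
      where
      part : ∀ c ℓ m → eval (scaleF c (prodLin ℓ m)) x ≡ c * ((ℓ · x) * (m · x))
      part c ℓ m = eval-multiple {scaleF c (prodLin ℓ m)} {c} {ℓ} {m} (λ _ → refl) x

    polar-pencil : ∀ r s t → polar (pencil r s t) E₁ E₂ ≡ s
    polar-pencil r s t = trans (polar-+F (scaleF r (prodLin m₁ m₁)) (scaleF s (prodLin m₁ m₂) +F scaleF t (prodLin m₂ m₂)) E₁ E₂) (trans (cong₂ _+_ (part r m₁ m₁) (trans (polar-+F (scaleF s (prodLin m₁ m₂)) (scaleF t (prodLin m₂ m₂)) E₁ E₂)
      (cong₂ _+_ (part s m₁ m₂) (part t m₂ m₂)))) (trans
       (cong₂ (λ p q → r * p + (s * q + t * (((m₂ · E₁) * (m₂ · E₂)) + ((m₂ · E₂) * (m₂ · E₁)))))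
          (cong₂ (λ a b → a * b + b * a) m₁E₁ m₁E₂) (cong₂ _+_ (cong₂ _*_ m₁E₁ m₂E₂) (cong₂ _*_ m₁E₂ m₂E₁)))
       (trans (cong₂ (λ a b → r * (1# * 0# + 0# * 1#) + (s * (1# * 1# + 0# * 0#) + t * (a * b + b * a))) m₂E₁ m₂E₂)
         (solve 3 (λ r s t → r :* (:1 :* :0 :+ :0 :* :1) :+ (s :* (:1 :* :1 :+ :0 :* :0) :+ t :* (:0 :* :1 :+ :1 :* :0)) := s) r s t))))
      where
      part : ∀ c ℓ m → polar (scaleF c (prodLin ℓ m)) E₁ E₂ ≡ c * ((ℓ · E₁) * (m · E₂) + (ℓ · E₂) * (m · E₁))
      part c ℓ m = polar-multiple {scaleF c (prodLin ℓ m)} {c} {ℓ} {m} (λ _ → refl) E₁ E₂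

    pencil-E₁ : ∀ r s t → eval (pencil r s t) E₁ ≡ r
    pencil-E₁ r s t = trans (eval-pencil r s t E₁) (trans
      (cong₂ (λ a b → r * (a * a) + (s * (a * b) + t * (b * b))) m₁E₁ m₂E₁)
      (solve 3 (λ r s t → r :* (:1 :* :1) :+ (s :* (:1 :* :0) :+ t :* (:0 :* :0)) := r) r s t))

    pencil-E₂ : ∀ r s t → eval (pencil r s t) E₂ ≡ t
    pencil-E₂ r s t = trans (eval-pencil r s t E₂) (trans
      (cong₂ (λ a b → r * (a * a) + (s * (a * b) + t * (b * b))) m₁E₂ m₂E₂)
      (solve 3 (λ r s t → r :* (:0 :* :0) :+ (s :* (:0 :* :1) :+ t :* (:1 :* :1)) := t) r s t))

    pencil-singular : ∀ r s t → Singular (pencil r s t) A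
    pencil-singular r s t = has-+ sub {scaleF r (prodLin m₁ m₁)} {scaleF s (prodLin m₁ m₂) +F scaleF t (prodLin m₂ m₂)} (part r m₁ m₁ m₁A m₁A)
      (has-+ sub {scaleF s (prodLin m₁ m₂)} {scaleF t (prodLin m₂ m₂)} (part s m₁ m₂ m₁A m₂A) (part t m₂ m₂ m₂A m₂A))
      where
      sub = singular-subspace A
      part : ∀ c ℓ m → ℓ · A ≡ 0# → m · A ≡ 0# → Singular (scaleF c (prodLin ℓ m)) A
      part c ℓ m = centered⇒singular {scaleF c (prodLin ℓ m)} {c} {ℓ} {m} {A} (λ _ → refl)

    -- A contributes neither a square nor a mixed term, so Q depends only on the coordinates along
    -- E₁ and E₂.
    singular≗pencil : ∀ {Q} → Singular Q A → Q ≗F pencil (eval Q E₁) (polar Q E₁ E₂) (eval Q E₂)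
    singular≗pencil {Q} s = form-ext Q (pencil (eval Q E₁) (polar Q E₁ E₂) (eval Q E₂)) λ x → trans (expand x) (sym (eval-pencil _ _ _ x))
      where
      expand : ∀ x → eval Q x ≡ eval Q E₁ * ((m₁ · x) * (m₁ · x)) + (polar Q E₁ E₂ * ((m₁ · x) * (m₂ · x)) + eval Q E₂ * ((m₂ · x) * (m₂ · x)))
      expand x = trans (eval-cong {Q} {Q} {x} {combine a b c A E₁ E₂} (λ _ → refl) (combination D≢0 x))
        (trans (eval-combine Q a b c A E₁ E₂)
          (trans (cong₂ (λ e f → eval Q A * (a * a) + eval Q E₁ * (e * e) + eval Q E₂ * (f * f)
              + polar Q A E₁ * (a * e) + polar Q E₁ E₂ * (e * f) + polar Q E₂ A * (f * a)) b≡ c≡)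
           (linear₃ (a * a) (proj₁ s) (a * (m₁ · x)) (Singular-polar {Q} {A} s E₁) ((m₂ · x) * a) (trans (polar-sym Q E₂ A) (Singular-polar {Q} {A} s E₂))
             (solve 9 (λ a e f QA Q1 Q2 PA1 P12 P2A →
               (QA :* (a :* a) :+ Q1 :* (e :* e) :+ Q2 :* (f :* f) :+ PA1 :* (a :* e) :+ P12 :* (e :* f) :+ P2A :* (f :* a))
               :- (Q1 :* (e :* e) :+ (P12 :* (e :* f) :+ Q2 :* (f :* f))) :=
               (a :* a) :* (QA :- :0) :+ (a :* e) :* (PA1 :- :0) :+ (f :* a) :* (P2A :- :0))
               a (m₁ · x) (m₂ · x) (eval Q A) (eval Q E₁) (eval Q E₂) (polar Q A E₁) (polar Q E₁ E₂) (polar Q E₂ A)))))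
        where
        a b c : C
        a = det A E₁ E₂ ⁻¹ * det x E₁ E₂
        b = det A E₁ E₂ ⁻¹ * det x E₂ A
        c = det A E₁ E₂ ⁻¹ * det x A E₁
        b≡ : b ≡ m₁ · x
        b≡ = trans (cong (λ d → d ⁻¹ * det x E₂ A) (det-cyclic A E₁ E₂)) (sym (dual-· E₁ E₂ A x))
        c≡ : c ≡ m₂ · x
        c≡ = trans (cong (λ d → d ⁻¹ * det x A E₁) (trans (det-cyclic A E₁ E₂) (det-cyclic E₁ E₂ A))) (sym (dual-· E₂ A E₁ x))

    singular-plane : IsPlane (λ Q → Singular Q A)
    singular-plane = isPlane (singular-subspace A) (prodLin m₁ m₁) (prodLin m₁ m₂) (prodLin m₂ m₂)
      (λ r s t z → trans (sym (pencil-E₁ r s t)) (trans (eval-cong {pencil r s t} {zeroF} {E₁} {E₁} z (λ _ → refl)) (eval-zeroF E₁)) ,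
                   trans (sym (polar-pencil r s t)) (trans (polar-cong {pencil r s t} {zeroF} {E₁} {E₂} {E₁} {E₂} z (λ _ → refl) (λ _ → refl)) (polar-zeroF E₁ E₂)) ,
                   trans (sym (pencil-E₂ r s t)) (trans (eval-cong {pencil r s t} {zeroF} {E₂} {E₂} z (λ _ → refl)) (eval-zeroF E₂)))
      (single {m₁} {m₁} m₁A m₁A) (single {m₁} {m₂} m₁A m₂A) (single {m₂} {m₂} m₂A m₂A)
      (λ Q s → eval Q E₁ , polar Q E₁ E₂ , eval Q E₂ , singular≗pencil {Q} s)
      where
      single : ∀ {ℓ m} → ℓ · A ≡ 0# → m · A ≡ 0# → Singular (prodLin ℓ m) A
      single {ℓ} {m} = centered⇒singular {prodLin ℓ m} {1#} {ℓ} {m} {A} (λ _ → sym (*-identityˡ _))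

  -- In a basis A, B, D a form singular at A is r m₁² + s m₁m₂ + t m₂². Singularity at B removes r
  -- and s and leaves a multiple of the square of the line AB.
  two-singular-points : ∀ {A B} → NonZero3 (cross A B) → Σ Vec3 λ D → Σ Vec3 λ n → NonZero3 n ×
    (∀ Q → Singular Q A → Singular Q B → Q ≗F scaleF (eval Q D) (prodLin n n))
  two-singular-points {A} {B} AB≢0 = go (complete₁ {A} {B} AB≢0)
    where
    go : (Σ Vec3 λ D → det A B D ≢ 0#) → Σ Vec3 λ D → Σ Vec3 λ n → NonZero3 n ×
      (∀ Q → Singular Q A → Singular Q B → Q ≗F scaleF (eval Q D) (prodLin n n))
    go (D , D≢0) = D , m₂ , n≢0 , λ Q sA sB p →
      trans (singular≗pencil {Q} sA p) (linear₂ (prodLin m₁ m₁ p) (proj₁ sB) (prodLin m₁ m₂ p) (Singular-polar {Q} {B} sB D)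
        (solve 6 (λ e f g x y z → e :* x :+ (f :* y :+ g :* z) :- g :* z := x :* (e :- :0) :+ y :* (f :- :0))
          (eval Q B) (polar Q B D) (eval Q D) (prodLin m₁ m₁ p) (prodLin m₁ m₂ p) (prodLin m₂ m₂ p)))
      where
      open Pencil A B D D≢0
      n≢0 : NonZero3 m₂
      n≢0 = [ (λ n → n) , (λ z → ⊥-elim (1≢0 (trans (sym m₂E₂) (·-zero {m₂} {D} z)))) ]′ (nonzero? m₂)

  -- Forms of this kind with a singular point over the field are exactly the bi-lines and imaginary
  -- bi-lines (the converse is `classify`), described without a quadratic extension.
  NonRepeated : Form → Set
  NonRepeated Q = NonZeroForm Q × ¬ RepeatedLine Q

  center-unique : ∀ {Q A B} → NonRepeated Q → NonZero3 A → NonZero3 B → Singular Q A → Singular Q B → Prop3 A B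
  center-unique {Q} {A} {B} (Q≢0 , ¬rep) A≢0 B≢0 sA sB = [ (λ n → ⊥-elim (absurd n)) , cross-zero⇒Prop3 {A} {B} A≢0 B≢0 ]′ (nonzero? (cross A B))
    where
    decide : ∀ c ℓ → NonZero3 ℓ → Q ≗F scaleF c (prodLin ℓ ℓ) → Dec (c ≡ 0#) → ⊥
    decide c ℓ ℓ≢0 h (no c≢0)  = ¬rep (c , ℓ , c≢0 , ℓ≢0 , h)
    decide c ℓ ℓ≢0 h (yes c≡0) = let p , Qp≢0 = Q≢0 in Qp≢0 (trans (h p) (trans (cong (_* prodLin ℓ ℓ p) c≡0) (zeroˡ _)))
    absurd : ¬ NonZero3 (cross A B)
    absurd n = let D , ℓ , ℓ≢0 , h = two-singular-points {A} {B} n in decide (eval Q D) ℓ ℓ≢0 (h Q sA sB) (eval Q D ≟ 0#)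

  PropForm-scale : ∀ {Q R} → (c d : C) → d ≢ 0# → NonZeroForm R → (∀ p → d * R p ≡ c * Q p) → PropForm Q R
  PropForm-scale {Q} {R} c d d≢0 (p , Rp≢0) e = d ⁻¹ * c , *-nonzero (⁻¹-nonzero d≢0) c≢0 , λ p →
    *-cancelˡ d≢0 (trans (e p) (linear₁ (- (c * Q p)) (*-inverseʳ d≢0)
      (solve 4 (λ d e c Q → c :* Q :- d :* (e :* c :* Q) := (:- (c :* Q)) :* (d :* e :- :1)) d (d ⁻¹) c (Q p))))
    where
    c≢0 : c ≢ 0#
    c≢0 z = *-nonzero d≢0 Rp≢0 (trans (e p) (trans (cong (_* Q p) z) (zeroˡ _)))

  -- A form singular at both points is a multiple of the square of the line joining them.
  singular-planes-meet : ∀ {A B} → NonZero3 A → NonZero3 B → ¬ Prop3 A B →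
    MeetInAtMostOnePoint (λ Q → Singular Q A) (λ Q → Singular Q B)
  singular-planes-meet {A} {B} A≢0 B≢0 A≁B Q R (p , Qp≢0) R≢0 QA QB RA RB =
    [ meet , (λ z → ⊥-elim (A≁B (cross-zero⇒Prop3 {A} {B} A≢0 B≢0 z))) ]′ (nonzero? (cross A B))
    where
    meet : NonZero3 (cross A B) → PropForm Q R
    meet n = let D , ℓ , _ , h = two-singular-points {A} {B} n in
      PropForm-scale {Q} {R} (eval R D) (eval Q D)
        (λ z → Qp≢0 (trans (h Q QA QB p) (trans (cong (_* prodLin ℓ ℓ p) z) (zeroˡ _)))) R≢0
        (λ p → linear₂ (eval Q D) (h R RA RB p) (- eval R D) (h Q QA QB p)
          (solve 5 (λ d c R Q l → d :* R :- c :* Q := d :* (R :- c :* l) :+ (:- c) :* (Q :- d :* l))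
            (eval Q D) (eval R D) (R p) (Q p) (prodLin ℓ ℓ p)))

  -- In characteristic two every element is a square (squaring is injective on a finite field).
  char2-repeated : 1# + 1# ≡ 0# → ∀ {Q} → NonZeroForm Q → Q p12 ≡ 0# → Q p13 ≡ 0# → Q p23 ≡ 0# → RepeatedLine Q
  char2-repeated 2≡0 {Q} Q≢0 e12 e13 e23 = 1# , ℓ , 1≢0 , ℓ≢0 , equal
    where
    doubled : ∀ x → x + x ≡ 0#
    doubled x = linear₁ x 2≡0 (solve 1 (λ x → x :+ x :- :0 := x :* (:1 :+ :1 :- :0)) x)
    squaring-injective : ∀ {x y} → x * x ≡ y * y → x ≡ y
    squaring-injective {x} {y} e = [ (λ z → x-y≡0⇒x≡y z) , (λ z → x-y≡0⇒x≡y z) ]′ (*-zero-product {x - y} {x - y}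
      (linear₂ 1# e (y * y - x * y) 2≡0
        (solve 2 (λ x y → (x :- y) :* (x :- y) :- :0 := :1 :* (x :* x :- y :* y) :+ (y :* y :- x :* y) :* (:1 :+ :1 :- :0)) x y)))
    sqrt : ∀ x → Σ C λ y → y * y ≡ x
    sqrt = injective⇒surjective squaring-injective
    ℓ : Vec3
    ℓ i0 = proj₁ (sqrt (Q p11))
    ℓ i1 = proj₁ (sqrt (Q p22))
    ℓ i2 = proj₁ (sqrt (Q p33))
    mixed : ∀ a b → 1# * (a * b + b * a) ≡ 0#
    mixed a b = trans (solve 2 (λ a b → :1 :* (a :* b :+ b :* a) := a :* b :+ a :* b) a b) (doubled (a * b))
    equal : Q ≗F scaleF 1# (prodLin ℓ ℓ)
    equal = ∀Pair (sym (trans (*-identityˡ _) (proj₂ (sqrt (Q p11))))) (sym (trans (*-identityˡ _) (proj₂ (sqrt (Q p22)))))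
      (sym (trans (*-identityˡ _) (proj₂ (sqrt (Q p33)))))
      (trans e12 (sym (mixed (ℓ i0) (ℓ i1)))) (trans e13 (sym (mixed (ℓ i0) (ℓ i2)))) (trans e23 (sym (mixed (ℓ i1) (ℓ i2))))
    ℓ≢0 : NonZero3 ℓ
    ℓ≢0 = [ (λ n → n) , (λ z → let p , Qp≢0 = Q≢0 in ⊥-elim (Qp≢0 (trans (equal p) (vanish z p)))) ]′ (nonzero? ℓ)
      where
      vanish : (∀ i → ℓ i ≡ 0#) → ∀ p → scaleF 1# (prodLin ℓ ℓ) p ≡ 0#
      vanish z = ∀Pair (sq i0) (sq i1) (sq i2) (mixed _ _) (mixed _ _) (mixed _ _)
        where
        sq : ∀ i → 1# * (ℓ i * ℓ i) ≡ 0#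
        sq i = trans (*-identityˡ _) (trans (cong (_* ℓ i) (z i)) (zeroˡ _))

-- GF(q³) and coordinates with respect to conjugate points S, S′, S″

module Cubic {q : ℕ} {p k : ℕ} (p-prime : Prime p) (q≡ : q ≡ p ℕ.^ suc k)
  (F : FiniteField q) (K : FiniteField (q ℕ.^ 3)) (ι-hom : FieldHom F K) where

  module F = DegenerateForms F
  open DegenerateForms K public
  open Extension {p = p} {k = k} p-prime q≡ F K ι-hom public

  infix 9 _′ _″
  _′ _″ : C → C
  x ′ = fr x
  x ″ = fr (fr x)

  fr³ : ∀ x → fr (fr (fr x)) ≡ x
  fr³ x = trans (cong fr (^-^ x q q)) (trans (^-^ x (q ℕ.* q) q)
    (trans (cong (x ^_) (trans (ℕₚ.*-assoc q q q) (cong (λ m → q ℕ.* (q ℕ.* m)) (sym (ℕₚ.*-identityʳ q))))) (fermat x)))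

  Tr : C → C
  Tr x = x + x ′ + x ″

  fr-Tr : ∀ x → fr (Tr x) ≡ Tr x
  fr-Tr x = trans (fr-+ (x + x ′) (x ″)) (trans (cong₂ _+_ (fr-+ x (x ′)) (fr³ x))
    (solve 3 (λ a b c → b :+ c :+ a := a :+ b :+ c) x (x ′) (x ″)))

  fr³-det : ∀ u → fr (det u (frV u) (frV (frV u))) ≡ det u (frV u) (frV (frV u))
  fr³-det u = trans (fr-det u (frV u) (frV (frV u)))
    (trans (det-cong {frV u} {frV u} {frV (frV u)} {frV (frV u)} {frV (frV (frV u))} {u} (λ _ → refl) (λ _ → refl) (λ i → fr³ (u i)))
      (sym (det-cyclic u (frV u) (frV (frV u)))))

  -- If B ≠ 0, elimination gives z″y = zy″, so z/y is fixed by the square of Frobenius and hence, as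
  -- the cube is the identity, by Frobenius. If B = 0, then A ≠ 0 and y would vanish.
  proportional : ∀ {A B y z} → ¬ (A ≡ 0# × B ≡ 0#) → y ≢ 0# → A * y + B * y ″ ≡ 0# → A * z + B * z ″ ≡ 0# →
    Σ F.C λ c → z ≡ ι c * y
  proportional {A} {B} {y} {z} AB≢0 y≢0 e f = go (B ≟ 0#)
    where
    ratio : C
    ratio = z * y ⁻¹
    z≡ : z ≡ ratio * y
    z≡ = linear₁ (- z) (*-inverseˡ y≢0) (solve 3 (λ z d y → z :- z :* d :* y := (:- z) :* (d :* y :- :1)) z (y ⁻¹) y)
    go : Dec (B ≡ 0#) → Σ F.C λ c → z ≡ ι c * y
    go (no B≢0) = let c , ιc≡ = fr-fixed⇒ι fixed in c , trans z≡ (cong (_* y) (sym ιc≡))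
      where
      cross-equal : z ″ * y ≡ z * y ″
      cross-equal = *-cancelˡ B≢0 (linear₂ (- z) e y f
        (solve 6 (λ A B y z y″ z″ → B :* (z″ :* y) :- B :* (z :* y″) := (:- z) :* (A :* y :+ B :* y″ :- :0) :+ y :* (A :* z :+ B :* z″ :- :0))
          A B y z (y ″) (z ″)))
      fixed″ : ratio ″ ≡ ratio
      fixed″ = *-cancelˡ (*-nonzero y≢0 (fr-nonzero (fr-nonzero y≢0))) (trans
        (trans (solve 3 (λ y y″ r → y :* y″ :* r := r :* y″ :* y) y (y ″) (ratio ″))
          (trans (cong (_* y) (sym (trans (cong (λ w → fr (fr w)) z≡) (trans (cong fr (fr-* ratio y)) (fr-* (ratio ′) (y ′)))))) cross-equal))
        (trans (cong (_* y ″) z≡) (solve 3 (λ y y″ r → r :* y :* y″ := y :* y″ :* r) y (y ″) ratio)))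
      fixed : fr ratio ≡ ratio
      fixed = trans (cong fr (sym fixed″)) (fr³ ratio)
    go (yes B≡0) = ⊥-elim (y≢0 (*-cancelˡ-0 (λ A≡0 → AB≢0 (A≡0 , B≡0))
      (linear₂ 1# e (- (y ″)) B≡0 (solve 4 (λ A B y y″ → A :* y :- :0 := :1 :* (A :* y :+ B :* y″ :- :0) :+ (:- y″) :* (B :- :0)) A B y (y ″)))))

  module Frame (S : Vec3) (D≢0 : det S (frV S) (frV (frV S)) ≢ 0#) where

    S₁ S₂ : Vec3
    S₁ = frV S
    S₂ = frV S₁

    D : C
    D = det S S₁ S₂

    ℓ₀ ℓ₁ ℓ₂ : Vec3
    ℓ₀ i = D ⁻¹ * cross S₁ S₂ i
    ℓ₁ i = D ⁻¹ * cross S₂ S i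
    ℓ₂ i = D ⁻¹ * cross S S₁ i

    X Y Z : Vec3 → C
    X x = D ⁻¹ * det x S₁ S₂
    Y x = D ⁻¹ * det x S₂ S
    Z x = D ⁻¹ * det x S S₁

    private
      dual-value : ∀ d c x → (λ i → d * c i) · x ≡ d * (x · c)
      dual-value = solveFor (scalar ∷ vector ∷ vector ∷ []) λ d c x → (λ i → d :* c i) :· x := d :* (x :· c)

      fr-D⁻¹ : fr (D ⁻¹) ≡ D ⁻¹
      fr-D⁻¹ = trans (fr-⁻¹ D) (cong _⁻¹ (fr³-det S))

      S₃ : ∀ i → frV S₂ i ≡ S i
      S₃ i = fr³ (S i)

    ℓ₀-X : ∀ x → ℓ₀ · x ≡ X x
    ℓ₀-X = dual-value (D ⁻¹) (cross S₁ S₂)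
    ℓ₁-Y : ∀ x → ℓ₁ · x ≡ Y x
    ℓ₁-Y = dual-value (D ⁻¹) (cross S₂ S)
    ℓ₂-Z : ∀ x → ℓ₂ · x ≡ Z x
    ℓ₂-Z = dual-value (D ⁻¹) (cross S S₁)

    expand : ∀ x i → x i ≡ X x * S i + Y x * S₁ i + Z x * S₂ i
    expand = combination D≢0

    X-cong : ∀ {x y} → (∀ i → x i ≡ y i) → X x ≡ X y
    X-cong {x} {y} e = cong (D ⁻¹ *_) (·-cong {x} {y} {cross S₁ S₂} {cross S₁ S₂} e (λ _ → refl))

    fr-X : ∀ x → fr (X x) ≡ Y (frV x)
    fr-X x = trans (fr-* (D ⁻¹) _) (cong₂ _*_ fr-D⁻¹ (trans (fr-det x S₁ S₂)
      (det-cong {frV x} {frV x} {S₂} {S₂} {frV S₂} {S} (λ _ → refl) (λ _ → refl) S₃)))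

    fr-Y : ∀ x → fr (Y x) ≡ Z (frV x)
    fr-Y x = trans (fr-* (D ⁻¹) _) (cong₂ _*_ fr-D⁻¹ (trans (fr-det x S₂ S)
      (det-cong {frV x} {frV x} {frV S₂} {S} {S₁} {S₁} (λ _ → refl) S₃ (λ _ → refl))))

    fr-Z : ∀ x → fr (Z x) ≡ X (frV x)
    fr-Z x = trans (fr-* (D ⁻¹) _) (cong₂ _*_ fr-D⁻¹ (fr-det x S S₁))

    X-combine : ∀ r s t → X (combine r s t S S₁ S₂) ≡ r
    X-combine r s t = *-cancelˡ D≢0 (linear₁ (r * D) (*-inverseʳ D≢0)
      (solveFor (vector ∷ vector ∷ vector ∷ scalar ∷ scalar ∷ scalar ∷ scalar ∷ [])
        (λ u v w d r s t → detE u v w :* (d :* detE (λ i → r :* u i :+ s :* v i :+ t :* w i) v w) :- detE u v w :* r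
          := (r :* detE u v w) :* (detE u v w :* d :- :1)) S S₁ S₂ (D ⁻¹) r s t))

    Y-combine : ∀ r s t → Y (combine r s t S S₁ S₂) ≡ s
    Y-combine r s t = *-cancelˡ D≢0 (linear₁ (s * D) (*-inverseʳ D≢0)
      (solveFor (vector ∷ vector ∷ vector ∷ scalar ∷ scalar ∷ scalar ∷ scalar ∷ [])
        (λ u v w d r s t → detE u v w :* (d :* detE (λ i → r :* u i :+ s :* v i :+ t :* w i) w u) :- detE u v w :* s
          := (s :* detE u v w) :* (detE u v w :* d :- :1)) S S₁ S₂ (D ⁻¹) r s t))

    Z-combine : ∀ r s t → Z (combine r s t S S₁ S₂) ≡ t
    Z-combine r s t = *-cancelˡ D≢0 (linear₁ (t * D) (*-inverseʳ D≢0)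
      (solveFor (vector ∷ vector ∷ vector ∷ scalar ∷ scalar ∷ scalar ∷ scalar ∷ [])
        (λ u v w d r s t → detE u v w :* (d :* detE (λ i → r :* u i :+ s :* v i :+ t :* w i) u v) :- detE u v w :* t
          := (t :* detE u v w) :* (detE u v w :* d :- :1)) S S₁ S₂ (D ⁻¹) r s t))

    -- At a rational point Y and Z are the conjugates of X, so X = 0 would make all three
    -- coordinates vanish.
    X-point : ∀ {A : F.Vec3} → F.NonZero3 A → X (ιV A) ≢ 0#
    X-point {A} (i , Ai≢0) z = ι-nonzero Ai≢0 (trans (expand (ιV A) i)
      (trans (cong₂ _+_ (cong₂ _+_ (cong (_* S i) z) (cong (_* S₁ i) Y≡0)) (cong (_* S₂ i) Z≡0))
        (solve 3 (λ a b c → :0 :* a :+ :0 :* b :+ :0 :* c := :0) (S i) (S₁ i) (S₂ i))))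
      where
      Y≡0 : Y (ιV A) ≡ 0#
      Y≡0 = trans (cong (D ⁻¹ *_) (·-cong {ιV A} {frV (ιV A)} {cross S₂ S} {cross S₂ S} (λ j → sym (fr-ι (A j))) (λ _ → refl)))
        (trans (sym (fr-X (ιV A))) (trans (cong fr z) fr-0))
      Z≡0 : Z (ιV A) ≡ 0#
      Z≡0 = trans (cong (D ⁻¹ *_) (·-cong {ιV A} {frV (ιV A)} {cross S S₁} {cross S S₁} (λ j → sym (fr-ι (A j))) (λ _ → refl)))
        (trans (sym (fr-Y (ιV A))) (trans (cong fr Y≡0) fr-0))

    Y-point : ∀ (A : F.Vec3) → Y (ιV A) ≡ X (ιV A) ′
    Y-point A = trans (cong (D ⁻¹ *_) (·-cong {ιV A} {frV (ιV A)} {cross S₂ S} {cross S₂ S} (λ j → sym (fr-ι (A j))) (λ _ → refl)))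
        (sym (fr-X (ιV A)))

    Z-point : ∀ (A : F.Vec3) → Z (ιV A) ≡ X (ιV A) ″
    Z-point A = trans (cong (D ⁻¹ *_) (·-cong {ιV A} {frV (ιV A)} {cross S S₁} {cross S S₁} (λ j → sym (fr-ι (A j))) (λ _ → refl)))
        (trans (sym (fr-Y (ιV A))) (cong fr (Y-point A)))

    private
      rational-sum : ∀ (u : Vec3) w i → fr (w * u i + w ′ * frV u i + w ″ * frV (frV u) i) ≡ w * u i + w ′ * frV u i + w ″ * frV (frV u) i
      rational-sum u w i = trans (cong fr (cong₂ _+_ (cong₂ _+_ refl (sym (fr-* w (u i)))) (sym (trans (cong fr (fr-* w (u i))) (fr-* (w ′) _)))))
        (trans (fr-Tr (w * u i)) (cong₂ _+_ (cong₂ _+_ refl (fr-* w (u i))) (trans (cong fr (fr-* w (u i))) (fr-* (w ′) _))))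

    -- The F-rational points wS + w′S′ + w″S″ (w ∈ K) identify F³ with K.
    pointOf : C → F.Vec3
    pointOf w i = proj₁ (fr-fixed⇒ι (rational-sum S w i))

    ι-pointOf : ∀ w i → ι (pointOf w i) ≡ combine w (w ′) (w ″) S S₁ S₂ i
    ι-pointOf w i = proj₂ (fr-fixed⇒ι (rational-sum S w i))

    X-pointOf : ∀ w → X (ιV (pointOf w)) ≡ w
    X-pointOf w = trans (X-cong {ιV (pointOf w)} {combine w (w ′) (w ″) S S₁ S₂} (ι-pointOf w)) (X-combine w (w ′) (w ″))

    pointOf-nonzero : ∀ {w} → w ≢ 0# → F.NonZero3 (pointOf w)
    pointOf-nonzero {w} w≢0 = [ id , (λ z → ⊥-elim (w≢0 (trans (sym (X-pointOf w)) (trans (X-cong {ιV (pointOf w)} {zero3} (λ i → trans (cong ι (z i)) ι-0))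
      (trans (cong (D ⁻¹ *_) (·-zero {zero3} {cross S₁ S₂} (λ _ → refl))) (zeroʳ _)))))) ]′ (F.nonzero? (pointOf w))

    private
      fr-ℓ₀ : ∀ i → fr (ℓ₀ i) ≡ ℓ₁ i
      fr-ℓ₀ i = trans (fr-* (D ⁻¹) _) (cong₂ _*_ fr-D⁻¹ (trans (fr-cross S₁ S₂ i) (cross-cong {S₂} {S₂} {frV S₂} {S} (λ _ → refl) S₃ i)))
      fr-ℓ₁ : ∀ i → fr (ℓ₁ i) ≡ ℓ₂ i
      fr-ℓ₁ i = trans (fr-* (D ⁻¹) _) (cong₂ _*_ fr-D⁻¹ (trans (fr-cross S₂ S i) (cross-cong {frV S₂} {S} {S₁} {S₁} S₃ (λ _ → refl) i)))
      fr-ℓ₂ : ∀ i → fr (ℓ₂ i) ≡ ℓ₀ i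
      fr-ℓ₂ i = trans (fr-* (D ⁻¹) _) (cong₂ _*_ fr-D⁻¹ (fr-cross S S₁ i))
      rational-sum′ : ∀ w i → fr (w * ℓ₀ i + w ′ * ℓ₁ i + w ″ * ℓ₂ i) ≡ w * ℓ₀ i + w ′ * ℓ₁ i + w ″ * ℓ₂ i
      rational-sum′ w i = trans (cong fr e) (trans (rational-sum ℓ₀ w i) (sym e))
        where
        e : w * ℓ₀ i + w ′ * ℓ₁ i + w ″ * ℓ₂ i ≡ w * ℓ₀ i + w ′ * frV ℓ₀ i + w ″ * frV (frV ℓ₀) i
        e = cong₂ _+_ (cong₂ _+_ refl (cong (w ′ *_) (sym (fr-ℓ₀ i)))) (cong (w ″ *_) (sym (trans (cong fr (fr-ℓ₀ i)) (fr-ℓ₁ i))))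

    -- The coordinates of S form a basis of K over F.
    coefficients : C → F.Vec3
    coefficients h i = proj₁ (fr-fixed⇒ι (rational-sum′ h i))

    coefficients-sum : ∀ h → ιV (coefficients h) · S ≡ h
    coefficients-sum h = trans (·-cong {ιV (coefficients h)} {combine h (h ′) (h ″) ℓ₀ ℓ₁ ℓ₂} {S} {S} (λ i → proj₂ (fr-fixed⇒ι (rational-sum′ h i))) (λ _ → refl))
      (trans (solveFor (scalar ∷ scalar ∷ scalar ∷ vector ∷ vector ∷ vector ∷ vector ∷ [])
          (λ a b c u v w x → (λ i → a :* u i :+ b :* v i :+ c :* w i) :· x := a :* (u :· x) :+ b :* (v :· x) :+ c :* (w :· x)) h (h ′) (h ″) ℓ₀ ℓ₁ ℓ₂ S)
        (trans (cong₂ _+_ (cong₂ _+_ (cong (h *_) (trans (ℓ₀-X S) (*-inverseˡ D≢0)))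
            (cong (h ′ *_) (trans (ℓ₁-Y S) (trans (cong (D ⁻¹ *_) (solveFor (vector ∷ vector ∷ []) (λ u v → detE u v u := :0) S S₂)) (zeroʳ _)))))
            (cong (h ″ *_) (trans (ℓ₂-Z S) (trans (cong (D ⁻¹ *_) (solveFor (vector ∷ vector ∷ []) (λ u v → detE u u v := :0) S S₁)) (zeroʳ _)))))
          (solve 3 (λ a b c → a :* :1 :+ b :* :0 :+ c :* :0 := a) h (h ′) (h ″))))

    -- Conjugation of r·S = 0 with r rational makes r orthogonal to S, S′ and S″, which are
    -- independent.
    basis-independent : ∀ (r : F.Vec3) → ιV r · S ≡ 0# → ∀ i → r i ≡ F.0#
    basis-independent r e i = ι-zero (orthogonal⇒zero {S} {S₁} {S₂} D≢0 (ιV r) e e₁ (trans (sym (conj S₁)) (trans (cong fr e₁) fr-0)) i)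
      where
      conj : ∀ u → fr (ιV r · u) ≡ ιV r · frV u
      conj u = trans (fr-· (ιV r) u) (·-cong {frV (ιV r)} {ιV r} {frV u} {frV u} (λ j → fr-ι (r j)) (λ _ → refl))
      e₁ : ιV r · S₁ ≡ 0#
      e₁ = trans (sym (conj S)) (trans (cong fr e) fr-0)

    -- The coordinates of a form: Q = Tr(α X²) + Tr(β XX′), see eval-frame.
    α β : F.Form → C
    α Q = eval (ιF Q) S
    β Q = polar (ιF Q) S S₁

    fr-eval-ι : ∀ Q x → fr (eval (ιF Q) x) ≡ eval (ιF Q) (frV x)
    fr-eval-ι Q x = trans (fr-eval (ιF Q) x) (eval-cong {frF (ιF Q)} {ιF Q} {frV x} {frV x} (λ p → fr-ι (Q p)) (λ _ → refl))

    fr-polar-ι : ∀ Q x y → fr (polar (ιF Q) x y) ≡ polar (ιF Q) (frV x) (frV y)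
    fr-polar-ι Q x y = trans (fr-polar (ιF Q) x y)
      (polar-cong {frF (ιF Q)} {ιF Q} {frV x} {frV y} {frV x} {frV y} (λ p → fr-ι (Q p)) (λ _ → refl) (λ _ → refl))

    polar-S₁S₂ : ∀ Q → polar (ιF Q) S₁ S₂ ≡ β Q ′
    polar-S₁S₂ Q = sym (fr-polar-ι Q S S₁)

    polar-S₂S : ∀ Q → polar (ιF Q) S₂ S ≡ β Q ″
    polar-S₂S Q = sym (trans (cong fr (fr-polar-ι Q S S₁)) (trans (fr-polar-ι Q S₁ S₂)
      (polar-cong {ιF Q} {ιF Q} {S₂} {frV S₂} {S₂} {S} (λ _ → refl) (λ _ → refl) S₃)))

    eval-S₁ : ∀ Q → eval (ιF Q) S₁ ≡ α Q ′
    eval-S₁ Q = sym (fr-eval-ι Q S)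

    eval-S₂ : ∀ Q → eval (ιF Q) S₂ ≡ α Q ″
    eval-S₂ Q = sym (trans (cong fr (fr-eval-ι Q S)) (fr-eval-ι Q S₁))

    value : (a b x y z : C) → C
    value a b x y z = a * (x * x) + a ′ * (y * y) + a ″ * (z * z) + b * (x * y) + b ′ * (y * z) + b ″ * (z * x)

    eval-frame : ∀ Q x → eval (ιF Q) x ≡ value (α Q) (β Q) (X x) (Y x) (Z x)
    eval-frame Q x = trans (eval-cong {ιF Q} {ιF Q} {x} {combine (X x) (Y x) (Z x) S S₁ S₂} (λ _ → refl) (expand x))
      (trans (eval-combine (ιF Q) (X x) (Y x) (Z x) S S₁ S₂)
        (cong₂ _+_ (cong₂ _+_ (cong₂ _+_ (cong₂ _+_ (cong₂ _+_ refl
          (cong (_* (Y x * Y x)) (eval-S₁ Q))) (cong (_* (Z x * Z x)) (eval-S₂ Q))) refl)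
          (cong (_* (Y x * Z x)) (polar-S₁S₂ Q))) (cong (_* (Z x * X x)) (polar-S₂S Q))))

    coordinates-injective : ∀ {Q R} → α Q ≡ α R → β Q ≡ β R → Q F.≗F R
    coordinates-injective {Q} {R} e f p = ι-injective (form-ext (ιF Q) (ιF R) (λ x →
      trans (eval-frame Q x) (trans (cong₂ (λ a b → value a b (X x) (Y x) (Z x)) e f) (sym (eval-frame R x)))) p)

    α-cong : ∀ {Q R} → Q F.≗F R → α Q ≡ α R
    α-cong {Q} {R} e = eval-cong {ιF Q} {ιF R} {S} {S} (λ p → cong ι (e p)) (λ _ → refl)

    β-cong : ∀ {Q R} → Q F.≗F R → β Q ≡ β R
    β-cong {Q} {R} e = polar-cong {ιF Q} {ιF R} {S} {S₁} {S} {S₁} (λ p → cong ι (e p)) (λ _ → refl) (λ _ → refl)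

    α-zero : α F.zeroF ≡ 0#
    α-zero = trans (eval-cong {ιF F.zeroF} {zeroF} {S} {S} (λ _ → ι-0) (λ _ → refl)) (eval-zeroF S)

    β-zero : β F.zeroF ≡ 0#
    β-zero = trans (polar-cong {ιF F.zeroF} {zeroF} {S} {S₁} {S} {S₁} (λ _ → ι-0) (λ _ → refl) (λ _ → refl)) (polar-zeroF S S₁)

    α-+ : ∀ Q R → α (Q F.+F R) ≡ α Q + α R
    α-+ Q R = trans (eval-cong {ιF (Q F.+F R)} {ιF Q +F ιF R} {S} {S} (λ p → ι-+ (Q p) (R p)) (λ _ → refl)) (eval-+F (ιF Q) (ιF R) S)

    β-+ : ∀ Q R → β (Q F.+F R) ≡ β Q + β R
    β-+ Q R = trans (polar-cong {ιF (Q F.+F R)} {ιF Q +F ιF R} {S} {S₁} {S} {S₁} (λ p → ι-+ (Q p) (R p)) (λ _ → refl) (λ _ → refl)) (polar-+F (ιF Q) (ιF R) S S₁)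

    α-* : ∀ c Q → α (F.scaleF c Q) ≡ ι c * α Q
    α-* c Q = trans (eval-cong {ιF (F.scaleF c Q)} {scaleF (ι c) (ιF Q)} {S} {S} (λ p → ι-* c (Q p)) (λ _ → refl)) (eval-scaleF (ι c) (ιF Q) S)

    β-* : ∀ c Q → β (F.scaleF c Q) ≡ ι c * β Q
    β-* c Q = trans (polar-cong {ιF (F.scaleF c Q)} {scaleF (ι c) (ιF Q)} {S} {S₁} {S} {S₁} (λ p → ι-* c (Q p)) (λ _ → refl) (λ _ → refl)) (polar-scaleF (ι c) (ιF Q) S S₁)

    coordinates-zero : ∀ {Q} → α Q ≡ 0# → β Q ≡ 0# → ∀ p → Q p ≡ F.0#
    coordinates-zero {Q} e f = coordinates-injective {Q} {F.zeroF} (trans e (sym α-zero)) (trans f (sym β-zero))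

    private
      module Construct (a b : C) where
        form′ : Form
        form′ p = a * prodLin ℓ₀ ℓ₀ p + a ′ * prodLin ℓ₁ ℓ₁ p + a ″ * prodLin ℓ₂ ℓ₂ p
                + b * prodLin ℓ₀ ℓ₁ p + b ′ * prodLin ℓ₁ ℓ₂ p + b ″ * prodLin ℓ₂ ℓ₀ p

        eval-form′ : ∀ x → eval form′ x ≡ value a b (X x) (Y x) (Z x)
        eval-form′ x = trans (solveFor (vector ∷ vector ∷ vector ∷ scalar ∷ scalar ∷ scalar ∷ scalar ∷ scalar ∷ scalar ∷ vector ∷ [])
            (λ u v w a a′ a″ b b′ b″ x → evalE (λ p → a :* prodLinE u u p :+ a′ :* prodLinE v v p :+ a″ :* prodLinE w w p
                :+ b :* prodLinE u v p :+ b′ :* prodLinE v w p :+ b″ :* prodLinE w u p) x :=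
              a :* ((u :· x) :* (u :· x)) :+ a′ :* ((v :· x) :* (v :· x)) :+ a″ :* ((w :· x) :* (w :· x))
                :+ b :* ((u :· x) :* (v :· x)) :+ b′ :* ((v :· x) :* (w :· x)) :+ b″ :* ((w :· x) :* (u :· x)))
            ℓ₀ ℓ₁ ℓ₂ a (a ′) (a ″) b (b ′) (b ″) x)
          (cong₃ (value a b) (ℓ₀-X x) (ℓ₁-Y x) (ℓ₂-Z x))
          where
          cong₃ : ∀ (f : C → C → C → C) {x x′ y y′ z z′} → x ≡ x′ → y ≡ y′ → z ≡ z′ → f x y z ≡ f x′ y′ z′
          cong₃ f refl refl refl = refl

        fr-term : ∀ c {ℓ m ℓ′ m′} → (∀ i → fr (ℓ i) ≡ ℓ′ i) → (∀ i → fr (m i) ≡ m′ i) → ∀ p →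
          fr (c * prodLin ℓ m p) ≡ c ′ * prodLin ℓ′ m′ p
        fr-term c {ℓ} {m} {ℓ′} {m′} e f p = trans (fr-* c _) (cong (c ′ *_) (trans (fr-prodLin ℓ m p) (equal p)))
          where
          equal : ∀ p → prodLin (frV ℓ) (frV m) p ≡ prodLin ℓ′ m′ p
          equal = ∀Pair (cong₂ _*_ (e i0) (f i0)) (cong₂ _*_ (e i1) (f i1)) (cong₂ _*_ (e i2) (f i2))
            (cong₂ _+_ (cong₂ _*_ (e i0) (f i1)) (cong₂ _*_ (e i1) (f i0)))
            (cong₂ _+_ (cong₂ _*_ (e i0) (f i2)) (cong₂ _*_ (e i2) (f i0)))
            (cong₂ _+_ (cong₂ _*_ (e i1) (f i2)) (cong₂ _*_ (e i2) (f i1)))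

        -- Frobenius permutes cyclically the three terms in a and the three terms in b. This brings
        -- the coefficients down to F.
        fr-form′ : ∀ p → fr (form′ p) ≡ form′ p
        fr-form′ p = trans (fr-+ _ _) (trans (cong₂ _+_ (trans (fr-+ _ _) (cong₂ _+_ (trans (fr-+ _ _) (cong₂ _+_
            (trans (fr-+ _ _) (cong₂ _+_ (trans (fr-+ _ _) (cong₂ _+_
              (fr-term a {ℓ₀} {ℓ₀} {ℓ₁} {ℓ₁} fr-ℓ₀ fr-ℓ₀ p) (fr-term (a ′) {ℓ₁} {ℓ₁} {ℓ₂} {ℓ₂} fr-ℓ₁ fr-ℓ₁ p)))
              (trans (fr-term (a ″) {ℓ₂} {ℓ₂} {ℓ₀} {ℓ₀} fr-ℓ₂ fr-ℓ₂ p) (cong (_* prodLin ℓ₀ ℓ₀ p) (fr³ a)))))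
              (fr-term b {ℓ₀} {ℓ₁} {ℓ₁} {ℓ₂} fr-ℓ₀ fr-ℓ₁ p)))
              (fr-term (b ′) {ℓ₁} {ℓ₂} {ℓ₂} {ℓ₀} fr-ℓ₁ fr-ℓ₂ p)))
              (trans (fr-term (b ″) {ℓ₂} {ℓ₀} {ℓ₀} {ℓ₁} fr-ℓ₂ fr-ℓ₀ p) (cong (_* prodLin ℓ₀ ℓ₁ p) (fr³ b))))
          (solve 6 (λ u v w x y z → v :+ w :+ u :+ y :+ z :+ x := u :+ v :+ w :+ x :+ y :+ z)
            (a * prodLin ℓ₀ ℓ₀ p) (a ′ * prodLin ℓ₁ ℓ₁ p) (a ″ * prodLin ℓ₂ ℓ₂ p) (b * prodLin ℓ₀ ℓ₁ p) (b ′ * prodLin ℓ₁ ℓ₂ p) (b ″ * prodLin ℓ₂ ℓ₀ p)))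

        result : F.Form
        result p = proj₁ (fr-fixed⇒ι (fr-form′ p))

        eval-result : ∀ x → eval (ιF result) x ≡ value a b (X x) (Y x) (Z x)
        eval-result x = trans (eval-cong {ιF result} {form′} {x} {x} (λ p → proj₂ (fr-fixed⇒ι (fr-form′ p))) (λ _ → refl)) (eval-form′ x)

        eval-at : ∀ r s t → eval (ιF result) (combine r s t S S₁ S₂) ≡ value a b r s t
        eval-at r s t = trans (eval-result (combine r s t S S₁ S₂)) (cong₃ (value a b) (X-combine r s t) (Y-combine r s t) (Z-combine r s t))
          where
          cong₃ : ∀ (f : C → C → C → C) {x x′ y y′ z z′} → x ≡ x′ → y ≡ y′ → z ≡ z′ → f x y z ≡ f x′ y′ z′
          cong₃ f refl refl refl = refl

        α-result : α result ≡ a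
        α-result = trans (eval-cong {ιF result} {ιF result} {S} {combine 1# 0# 0# S S₁ S₂} (λ _ → refl)
            (λ i → solve 3 (λ u v w → u := :1 :* u :+ :0 :* v :+ :0 :* w) (S i) (S₁ i) (S₂ i)))
          (trans (eval-at 1# 0# 0#) (solve 6 (λ a a′ a″ b b′ b″ →
            a :* (:1 :* :1) :+ a′ :* (:0 :* :0) :+ a″ :* (:0 :* :0) :+ b :* (:1 :* :0) :+ b′ :* (:0 :* :0) :+ b″ :* (:0 :* :1) := a)
              a (a ′) (a ″) b (b ′) (b ″)))

        β-result : β result ≡ b
        β-result = trans (solveFor (form ∷ vector ∷ vector ∷ []) (λ Q u v →
            polarE Q u v := evalE Q (λ i → u i :+ v i) :- evalE Q u :- evalE Q v) (ιF result) S S₁)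
          (trans (cong₂ _-_ (cong₂ _-_
            (trans (eval-cong {ιF result} {ιF result} {S +V S₁} {combine 1# 1# 0# S S₁ S₂} (λ _ → refl)
              (λ i → solve 3 (λ u v w → u :+ v := :1 :* u :+ :1 :* v :+ :0 :* w) (S i) (S₁ i) (S₂ i))) (eval-at 1# 1# 0#))
            α-result) (trans (eval-S₁ result) (cong fr α-result)))
            (solve 6 (λ a a′ a″ b b′ b″ →
              (a :* (:1 :* :1) :+ a′ :* (:1 :* :1) :+ a″ :* (:0 :* :0) :+ b :* (:1 :* :1) :+ b′ :* (:1 :* :0) :+ b″ :* (:0 :* :1)) :- a :- a′ := b)
              a (a ′) (a ″) b (b ′) (b ″)))

    opaque
      formWith : C → C → F.Form
      formWith a b = Construct.result a b

      α-formWith : ∀ a b → α (formWith a b) ≡ a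
      α-formWith a b = Construct.α-result a b

      β-formWith : ∀ a b → β (formWith a b) ≡ b
      β-formWith a b = Construct.β-result a b

    -- One shape for two kinds of planes: a net has f = 0 and g the identity, an orbit plane has f =
    -- `twist a` and g multiplication by b.
    Graph : (f g : C → C) → F.Subset6
    Graph f g Q = Σ C λ h → α Q ≡ f h × β Q ≡ g h

    record Linear (f : C → C) : Set where
      field
        additive    : ∀ x y → f (x + y) ≡ f x + f y
        homogeneous : ∀ c x → f (ι c * x) ≡ ι c * f x

    open Linear

    linear-zero : ∀ {f} → Linear f → f 0# ≡ 0#
    linear-zero {f} lin = trans (cong f (trans (sym (zeroˡ 0#)) (cong (_* 0#) (sym ι-0))))
      (trans (homogeneous lin F.0# 0#) (trans (cong (_* f 0#) ι-0) (zeroˡ _)))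

    graph-subspace : ∀ {f g} → Linear f → Linear g → F.IsSubspace (Graph f g)
    graph-subspace {f} {g} lf lg = record
      { respects = λ {Q} {R} e (h , a , b) → h , trans (sym (α-cong {Q} {R} e)) a , trans (sym (β-cong {Q} {R} e)) b
      ; has-zero = 0# , trans α-zero (sym (linear-zero lf)) , trans β-zero (sym (linear-zero lg))
      ; has-+ = λ {Q} {R} (h , a , b) (h′ , a′ , b′) → h + h′ ,
          trans (α-+ Q R) (trans (cong₂ _+_ a a′) (sym (additive lf h h′))) ,
          trans (β-+ Q R) (trans (cong₂ _+_ b b′) (sym (additive lg h h′)))
      ; has-* = λ c {Q} (h , a , b) → ι c * h ,
          trans (α-* c Q) (trans (cong (ι c *_) a) (sym (homogeneous lf c h))) ,
          trans (β-* c Q) (trans (cong (ι c *_) b) (sym (homogeneous lg c h))) }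

    graph-plane : ∀ {f g} → Linear f → Linear g → (∀ h → f h ≡ 0# → g h ≡ 0# → h ≡ 0#) → F.IsPlane (Graph f g)
    graph-plane {f} {g} lf lg injective = F.isPlane (graph-subspace lf lg) (u i0) (u i1) (u i2)
      (λ r s t z → let h≡0 = independent r s t z in h≡0 i0 , h≡0 i1 , h≡0 i2)
      (member i0) (member i1) (member i2)
      (λ Q (h , a , b) → let r = coefficients h in r i0 , r i1 , r i2 ,
        coordinates-injective {Q} {sumOf r} (trans a (trans (cong f (sym (coefficients-sum h))) (sym (α-sum r))))
                              (trans b (trans (cong g (sym (coefficients-sum h))) (sym (β-sum r)))))
      where
      u : Fin 3 → F.Form
      -- The coordinates of S are a basis of K over F, so their images under h ↦ (f h, g h) generate
      -- the graph.
      u i = formWith (f (S i)) (g (S i))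
      member : ∀ i → Graph f g (u i)
      member i = S i , α-formWith _ _ , β-formWith _ _
      sumOf : F.Vec3 → F.Form
      sumOf r = F.scaleF (r i0) (u i0) F.+F (F.scaleF (r i1) (u i1) F.+F F.scaleF (r i2) (u i2))
      lin-sum : ∀ {f} → Linear f → ∀ r → f (ιV r · S) ≡ ι (r i0) * f (S i0) + (ι (r i1) * f (S i1) + ι (r i2) * f (S i2))
      lin-sum lf r = trans (additive lf _ _) (cong₂ _+_ (homogeneous lf (r i0) (S i0))
        (trans (additive lf _ _) (cong₂ _+_ (homogeneous lf (r i1) (S i1)) (homogeneous lf (r i2) (S i2)))))
      α-sum : ∀ r → α (sumOf r) ≡ f (ιV r · S)
      α-sum r = trans (trans (α-+ (F.scaleF (r i0) (u i0)) (F.scaleF (r i1) (u i1) F.+F F.scaleF (r i2) (u i2))) (cong₂ _+_ (part i0) (trans (α-+ (F.scaleF (r i1) (u i1)) (F.scaleF (r i2) (u i2))) (cong₂ _+_ (part i1) (part i2))))) (sym (lin-sum lf r))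
        where
        part : ∀ i → α (F.scaleF (r i) (u i)) ≡ ι (r i) * f (S i)
        part i = trans (α-* (r i) (u i)) (cong (ι (r i) *_) (α-formWith _ _))
      β-sum : ∀ r → β (sumOf r) ≡ g (ιV r · S)
      β-sum r = trans (trans (β-+ (F.scaleF (r i0) (u i0)) (F.scaleF (r i1) (u i1) F.+F F.scaleF (r i2) (u i2))) (cong₂ _+_ (part i0) (trans (β-+ (F.scaleF (r i1) (u i1)) (F.scaleF (r i2) (u i2))) (cong₂ _+_ (part i1) (part i2))))) (sym (lin-sum lg r))
        where
        part : ∀ i → β (F.scaleF (r i) (u i)) ≡ ι (r i) * g (S i)
        part i = trans (β-* (r i) (u i)) (cong (ι (r i) *_) (β-formWith _ _))
      independent : ∀ r s t → (F.scaleF r (u i0) F.+F (F.scaleF s (u i1) F.+F F.scaleF t (u i2))) F.≗F F.zeroF →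
        ∀ i → F.vec3 r s t i ≡ F.0#
      independent r s t z = basis-independent v (injective _
        (trans (sym (α-sum v)) (trans (α-cong {sumOf v} {F.zeroF} z) α-zero))
        (trans (sym (β-sum v)) (trans (β-cong {sumOf v} {F.zeroF} z) β-zero)))
        where
        v : F.Vec3
        v = F.vec3 r s t

-- Nets of conics through three conjugate points

module Planes {q : ℕ} {p k : ℕ} (p-prime : Prime p) (q≡ : q ≡ p ℕ.^ suc k)
  (F : FiniteField q) (K : FiniteField (q ℕ.^ 3)) (ι-hom : FieldHom F K) where

  open Cubic {p = p} {k = k} p-prime q≡ F K ι-hom public

  Independent : Vec3 → Set
  Independent S = det S (frV S) (frV (frV S)) ≢ 0#

  -- the conics through the points S, S′, S″ of PG(2,q³)
  Through : Vec3 → F.Subset6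
  Through S Q = eval (ιF Q) S ≡ 0#

  Independent⇒nonzero : ∀ {S} → Independent S → NonZero3 S
  Independent⇒nonzero {S} D≢0 = [ id , (λ z → ⊥-elim (D≢0 (·-zero {S} {cross (frV S) (frV (frV S))} z))) ]′ (nonzero? S)

  module FramePlanes (S : Vec3) (D≢0 : Independent S) where
    open Frame S D≢0 public

    polar-S : ∀ Q x → polar (ιF Q) x S ≡ X x * (α Q + α Q) + Y x * β Q + Z x * β Q ″
    polar-S Q x = trans (polar-cong {ιF Q} {ιF Q} {x} {S} {combine (X x) (Y x) (Z x) S S₁ S₂} {S} (λ _ → refl) (expand x) (λ _ → refl))
      (trans (polar-combine (ιF Q) (X x) (Y x) (Z x) S S₁ S₂ S)
        (cong₂ _+_ (cong₂ _+_ (cong (X x *_) (polar-self (ιF Q) S)) (cong (Y x *_) (polar-sym (ιF Q) S₁ S))) (cong (Z x *_) (polar-S₂S Q))))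

    polar-S₁ : ∀ Q x → polar (ιF Q) x S₁ ≡ X x * β Q + Y x * (α Q ′ + α Q ′) + Z x * β Q ′
    polar-S₁ Q x = trans (polar-cong {ιF Q} {ιF Q} {x} {S₁} {combine (X x) (Y x) (Z x) S S₁ S₂} {S₁} (λ _ → refl) (expand x) (λ _ → refl))
      (trans (polar-combine (ιF Q) (X x) (Y x) (Z x) S S₁ S₂ S₁)
        (cong₂ _+_ (cong₂ _+_ refl (cong (Y x *_) (trans (polar-self (ιF Q) S₁) (cong₂ _+_ (eval-S₁ Q) (eval-S₁ Q)))))
          (cong (Z x *_) (trans (polar-sym (ιF Q) S₂ S₁) (polar-S₁S₂ Q)))))

    polar-S₂ : ∀ Q x → polar (ιF Q) x S₂ ≡ X x * β Q ″ + Y x * β Q ′ + Z x * (α Q ″ + α Q ″)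
    polar-S₂ Q x = trans (polar-cong {ιF Q} {ιF Q} {x} {S₂} {combine (X x) (Y x) (Z x) S S₁ S₂} {S₂} (λ _ → refl) (expand x) (λ _ → refl))
      (trans (polar-combine (ιF Q) (X x) (Y x) (Z x) S S₁ S₂ S₂)
        (cong₂ _+_ (cong₂ _+_ (cong (X x *_) (trans (polar-sym (ιF Q) S S₂) (polar-S₂S Q))) (cong (Y x *_) (polar-S₁S₂ Q)))
          (cong (Z x *_) (trans (polar-self (ιF Q) S₂) (cong₂ _+_ (eval-S₂ Q) (eval-S₂ Q))))))

    polar-zero : ∀ Q x → polar (ιF Q) x S ≡ 0# → polar (ιF Q) x S₁ ≡ 0# → polar (ιF Q) x S₂ ≡ 0# → ∀ y → polar (ιF Q) x y ≡ 0#
    polar-zero Q x e f g y = trans (polar-sym (ιF Q) x y)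
      (trans (polar-cong {ιF Q} {ιF Q} {y} {x} {combine (X y) (Y y) (Z y) S S₁ S₂} {x} (λ _ → refl) (expand y) (λ _ → refl))
        (trans (polar-combine (ιF Q) (X y) (Y y) (Z y) S S₁ S₂ x)
          (linear₃ (X y) (trans (polar-sym (ιF Q) S x) e) (Y y) (trans (polar-sym (ιF Q) S₁ x) f) (Z y) (trans (polar-sym (ιF Q) S₂ x) g)
            (solve 6 (λ a b c u v w → a :* u :+ b :* v :+ c :* w :- :0 := a :* (u :- :0) :+ b :* (v :- :0) :+ c :* (w :- :0))
              (X y) (Y y) (Z y) (polar (ιF Q) S x) (polar (ιF Q) S₁ x) (polar (ιF Q) S₂ x)))))

    coordinates-vanish : ∀ {x} → X x ≡ 0# → Y x ≡ 0# → Z x ≡ 0# → ∀ i → x i ≡ 0#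
    coordinates-vanish {x} e f g i = trans (expand x i) (linear₃ (S i) e (S₁ i) f (S₂ i) g
      (solve 6 (λ a b c u v w → a :* u :+ b :* v :+ c :* w :- :0 := u :* (a :- :0) :+ v :* (b :- :0) :+ w :* (c :- :0))
        (X x) (Y x) (Z x) (S i) (S₁ i) (S₂ i)))

    -- With α = 0 the polar matrix has determinant 2bb′b″, which says nothing in characteristic two.
    -- If b ≠ 0, the gradient equations combined with Q(R) = 0 give xy = yz = zx = 0 in every
    -- characteristic; feeding this back into the gradient equations makes x, y and z vanish.
    through-nonsingular : ∀ {Q R} → Through S Q → NonZero3 R → Singular (ιF Q) R → ∀ p → Q p ≡ F.0#
    through-nonsingular {Q} {R} αQ≡0 R≢0 singular = coordinates-zero {Q} αQ≡0 (decide (b ≟ 0#))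
      where
      b x y z : C
      b = β Q
      x = X R
      y = Y R
      z = Z R
      α≡0 : α Q ≡ 0#
      α≡0 = αQ≡0
      α′≡0 : α Q ′ ≡ 0#
      α′≡0 = trans (cong fr α≡0) fr-0
      α″≡0 : α Q ″ ≡ 0#
      α″≡0 = trans (cong fr α′≡0) fr-0
      drop : ∀ {c} → c ≡ 0# → ∀ {u v w} → u * (c + c) + v + w ≡ 0# → v + w ≡ 0#
      drop {c} c≡0 {u} {v} {w} e = linear₂ 1# e (- (u + u)) c≡0
        (solve 4 (λ c u v w → v :+ w :- :0 := :1 :* (u :* (c :+ c) :+ v :+ w :- :0) :+ (:- (u :+ u)) :* (c :- :0)) c u v w)
      e₀ : y * b + z * b ″ ≡ 0#
      e₀ = drop α≡0 (trans (sym (polar-S Q R)) (Singular-polar {ιF Q} {R} singular S))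
      e₁ : x * b + z * b ′ ≡ 0#
      e₁ = drop {α Q ′} α′≡0 {y} (trans (solve 3 (λ u v w → u :+ v :+ w := v :+ u :+ w) (y * (α Q ′ + α Q ′)) (x * b) (z * b ′))
        (trans (sym (polar-S₁ Q R)) (Singular-polar {ιF Q} {R} singular S₁)))
      e₂ : x * b ″ + y * b ′ ≡ 0#
      e₂ = drop {α Q ″} α″≡0 {z} (trans (solve 3 (λ u v w → u :+ v :+ w := v :+ w :+ u) (z * (α Q ″ + α Q ″)) (x * b ″) (y * b ′))
        (trans (sym (polar-S₂ Q R)) (Singular-polar {ιF Q} {R} singular S₂)))
      E : b * (x * y) + b ′ * (y * z) + b ″ * (z * x) ≡ 0#
      E = linear₂ 1# (trans (sym (eval-frame Q R)) (proj₁ singular)) (- 1#)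
        (trans (cong₂ _+_ (cong₂ _+_ (cong (_* (x * x)) α≡0) (cong (_* (y * y)) α′≡0)) (cong (_* (z * z)) α″≡0))
          (solve 3 (λ x y z → :0 :* (x :* x) :+ :0 :* (y :* y) :+ :0 :* (z :* z) := :0) x y z))
        (solve 9 (λ a a′ a″ b b′ b″ x y z → b :* (x :* y) :+ b′ :* (y :* z) :+ b″ :* (z :* x) :- :0 :=
          :1 :* (a :* (x :* x) :+ a′ :* (y :* y) :+ a″ :* (z :* z) :+ b :* (x :* y) :+ b′ :* (y :* z) :+ b″ :* (z :* x) :- :0)
          :+ (:- :1) :* (a :* (x :* x) :+ a′ :* (y :* y) :+ a″ :* (z :* z) :- :0)) (α Q) (α Q ′) (α Q ″) b (b ′) (b ″) x y z)
      decide : Dec (b ≡ 0#) → b ≡ 0#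
      decide (yes b≡0) = b≡0
      decide (no b≢0)  = ⊥-elim (not-zero {R} R≢0 (coordinates-vanish {R} x≡0 y≡0 z≡0))
        where
        b′≢0 : b ′ ≢ 0#
        b′≢0 = fr-nonzero b≢0
        b″≢0 : b ″ ≢ 0#
        b″≢0 = fr-nonzero b′≢0
        square : ∀ {u v} → u ≢ 0# → u * (v * v) ≡ 0# → v ≡ 0#
        square {u} {v} u≢0 e = [ id , id ]′ (*-zero-product (*-cancelˡ-0 u≢0 e))
        zx≡0 : z * x ≡ 0#
        zx≡0 = *-cancelˡ-0 b″≢0 (linear₃ (- 1#) E x e₀ z e₂
          (solve 6 (λ b b′ b″ x y z → b″ :* (z :* x) :- :0 := (:- :1) :* (b :* (x :* y) :+ b′ :* (y :* z) :+ b″ :* (z :* x) :- :0)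
            :+ x :* (y :* b :+ z :* b″ :- :0) :+ z :* (x :* b″ :+ y :* b′ :- :0)) b (b ′) (b ″) x y z))
        xy≡0 : x * y ≡ 0#
        xy≡0 = *-cancelˡ-0 b≢0 (linear₃ (- 1#) E y e₁ x e₀
          (solve 6 (λ b b′ b″ x y z → b :* (x :* y) :- :0 := (:- :1) :* (b :* (x :* y) :+ b′ :* (y :* z) :+ b″ :* (z :* x) :- :0)
            :+ y :* (x :* b :+ z :* b′ :- :0) :+ x :* (y :* b :+ z :* b″ :- :0)) b (b ′) (b ″) x y z))
        yz≡0 : y * z ≡ 0#
        yz≡0 = *-cancelˡ-0 b′≢0 (linear₃ (- 1#) E z e₂ y e₁
          (solve 6 (λ b b′ b″ x y z → b′ :* (y :* z) :- :0 := (:- :1) :* (b :* (x :* y) :+ b′ :* (y :* z) :+ b″ :* (z :* x) :- :0)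
            :+ z :* (x :* b″ :+ y :* b′ :- :0) :+ y :* (x :* b :+ z :* b′ :- :0)) b (b ′) (b ″) x y z))
        x≡0 : x ≡ 0#
        x≡0 = square b≢0 (linear₂ x e₁ (- (b ′)) zx≡0
          (solve 4 (λ b b′ x z → b :* (x :* x) :- :0 := x :* (x :* b :+ z :* b′ :- :0) :+ (:- b′) :* (z :* x :- :0)) b (b ′) x z))
        y≡0 : y ≡ 0#
        y≡0 = square b≢0 (linear₂ y e₀ (- (b ″)) yz≡0
          (solve 4 (λ b b″ y z → b :* (y :* y) :- :0 := y :* (y :* b :+ z :* b″ :- :0) :+ (:- b″) :* (y :* z :- :0)) b (b ″) y z))
        z≡0 : z ≡ 0#
        z≡0 = square b″≢0 (linear₂ z e₀ (- b) yz≡0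
          (solve 4 (λ b b″ y z → b″ :* (z :* z) :- :0 := z :* (y :* b :+ z :* b″ :- :0) :+ (:- b) :* (y :* z :- :0)) b (b ″) y z))

    through≐graph : F._≐_ (Through S) (Graph (λ _ → 0#) id)
    through≐graph Q = (λ e → β Q , e , refl) , (λ (_ , e , _) → e)

    isPlane-≐ : ∀ {W W′} → F._≐_ W W′ → F.IsPlane W′ → F.IsPlane W
    isPlane-≐ W≐W′ (u , v , w , ind , e) = u , v , w , ind , λ Q →
      (λ x → proj₁ (e Q) (proj₁ (W≐W′ Q) x)) , (λ x → proj₂ (W≐W′ Q) (proj₂ (e Q) x))

    linear-0 : Linear (λ _ → 0#)
    linear-0 = record { additive = λ _ _ → sym (+-identityʳ 0#) ; homogeneous = λ _ _ → sym (zeroʳ _) }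

    linear-id : Linear id
    linear-id = record { additive = λ _ _ → refl ; homogeneous = λ _ _ → refl }

    through-plane : F.IsPlane (Through S)
    through-plane = isPlane-≐ through≐graph (graph-plane linear-0 linear-id (λ h _ e → e))

    β≡0⇒zero : ∀ {Q} → Through S Q → β Q ≡ 0# → ∀ p → Q p ≡ F.0#
    β≡0⇒zero {Q} = coordinates-zero {Q}

    multiple-from-coordinates : ∀ {Q R} c → F.NonZeroForm R → α R ≡ ι c * α Q → β R ≡ ι c * β Q → F.PropForm Q R
    multiple-from-coordinates {Q} {R} c R≢0 e f = F.PropForm-scale {Q} {R} c F.1# F.1≢0 R≢0 λ p →
      trans (F.*-identityˡ (R p)) (coordinates-injective {R} {F.scaleF c Q} (trans e (sym (α-* c Q))) (trans f (sym (β-* c Q))) p)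

    -- Six points: the condition on b = β Q is c₀b + c₁b′ + c₂b″ = 0. If it has two solutions
    -- independent over F, then it is proportional to its conjugate.
    through-meet : ∀ {R} → Independent R → ¬ Prop3 S R → ¬ Prop3 S₁ R → ¬ Prop3 S₂ R →
      F.MeetInAtMostOnePoint (Through S) (Through R)
    through-meet {R} R-independent S≁R S₁≁R S₂≁R Q P Q≢0 P≢0 SQ RQ SP RP =
      decide (x ≟ 0#) (y ≟ 0#) (z ≟ 0#)
      where
      R≢0 : NonZero3 R
      R≢0 = Independent⇒nonzero {R} R-independent
      x y z : C
      x = X R
      y = Y R
      z = Z R
      c d : Vec3
      c = vec3 (x * y) (y * z) (z * x)
      -- Frobenius turns c₀b + c₁b′ + c₂b″ into c₀′b′ + c₁′b″ + c₂′b, hence the rotated order.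
      d = vec3 ((z * x) ′) ((x * y) ′) ((y * z) ′)
      conj : C → Vec3
      conj b = vec3 b (b ′) (b ″)
      β≢0 : ∀ {Q} → F.NonZeroForm Q → Through S Q → β Q ≢ 0#
      β≢0 {Q} (p , Qp≢0) SQ e = Qp≢0 (β≡0⇒zero {Q} SQ e p)
      relation : ∀ {Q} → Through S Q → Through R Q → c · conj (β Q) ≡ 0#
      relation {Q} SQ RQ = trans
        (linear₃ (- (x * x)) SQ (- (y * y)) (trans (cong fr SQ) fr-0) (- (z * z)) (trans (cong fr (trans (cong fr SQ) fr-0)) fr-0)
          (solve 9 (λ a a′ a″ b b′ b″ x y z →
            ((x :* y) :* b :+ ((y :* z) :* b′ :+ (z :* x) :* b″)) :- (a :* (x :* x) :+ a′ :* (y :* y) :+ a″ :* (z :* z) :+ b :* (x :* y) :+ b′ :* (y :* z) :+ b″ :* (z :* x))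
            := (:- (x :* x)) :* (a :- :0) :+ (:- (y :* y)) :* (a′ :- :0) :+ (:- (z :* z)) :* (a″ :- :0)) (α Q) (α Q ′) (α Q ″) (β Q) (β Q ′) (β Q ″) x y z))
        (trans (sym (eval-frame Q R)) RQ)
      relation′ : ∀ {Q} → Through S Q → Through R Q → d · conj (β Q) ≡ 0#
      relation′ {Q} SQ RQ = trans (trans
          (solve 6 (λ a b c u v w → c :* u :+ (a :* v :+ b :* w) := a :* v :+ (b :* w :+ c :* u)) ((x * y) ′) ((y * z) ′) ((z * x) ′) (β Q) (β Q ′) (β Q ″))
          (cong ((x * y) ′ * β Q ′ +_) (cong ((y * z) ′ * β Q ″ +_) (cong ((z * x) ′ *_) (sym (fr³ (β Q)))))))
        (trans (sym (fr-· c (conj (β Q)))) (trans (cong fr (relation {Q} SQ RQ)) fr-0))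
      parallel : ∀ {Q} → Through S Q → Through R Q → ∀ i → cross (cross c d) (conj (β Q)) i ≡ 0#
      parallel {Q} SQ RQ i = trans (triple c d (conj (β Q)) i) (linear₂ (d i) (relation {Q} SQ RQ) (- c i) (relation′ {Q} SQ RQ)
        (solve 4 (λ di ci u v → u :* di :- v :* ci :- :0 := di :* (u :- :0) :+ (:- ci) :* (v :- :0)) (d i) (c i) (c · conj (β Q)) (d · conj (β Q))))
        where
        triple : ∀ c d b i → cross (cross c d) b i ≡ (c · b) * d i - (d · b) * c i
        triple c d b i0 = solveFor (vector ∷ vector ∷ vector ∷ []) (λ c d b → crossE (crossE c d) b i0 := (c :· b) :* d i0 :- (d :· b) :* c i0) c d b
        triple c d b i1 = solveFor (vector ∷ vector ∷ vector ∷ []) (λ c d b → crossE (crossE c d) b i1 := (c :· b) :* d i1 :- (d :· b) :* c i1) c d b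
        triple c d b i2 = solveFor (vector ∷ vector ∷ vector ∷ []) (λ c d b → crossE (crossE c d) b i2 := (c :· b) :* d i2 :- (d :· b) :* c i2) c d b
      generic : NonZero3 (cross c d) → F.PropForm Q P
      -- For both forms (b, b′, b″) is orthogonal to c and d, hence a multiple of c × d. The ratio
      -- of the two vectors is the same in the first and the second coordinate, so Frobenius fixes
      -- it.
      generic w≢0 =
        let s , e = cross-zero⇒multiple {cross c d} {conj (β Q)} w≢0 (parallel {Q} SQ RQ)
            t , f = cross-zero⇒multiple {cross c d} {conj (β P)} w≢0 (parallel {P} SP RP)
        in finish s e t f
        where
        w = cross c d
        finish : ∀ s → (∀ i → conj (β Q) i ≡ s * w i) → ∀ t → (∀ i → conj (β P) i ≡ t * w i) → F.PropForm Q P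
        finish s e t f = multiple-from-coordinates {Q} {P} (proj₁ rational) P≢0
            (trans SP (sym (trans (cong (ι (proj₁ rational) *_) SQ) (zeroʳ _)))) (trans (ratio i0) (cong (_* β Q) (sym (proj₂ rational))))
          where
          s≢0 : s ≢ 0#
          s≢0 s≡0 = β≢0 {Q} Q≢0 SQ (trans (e i0) (trans (cong (_* w i0) s≡0) (zeroˡ _)))
          ratio : ∀ i → conj (β P) i ≡ (t * s ⁻¹) * conj (β Q) i
          ratio i = trans (f i) (linear₂ (- (t * s ⁻¹)) (e i) (- (t * w i)) (*-inverseʳ s≢0)
            (solve 5 (λ t s u w b → t :* w :- t :* u :* b := (:- (t :* u)) :* (b :- s :* w) :+ (:- (t :* w)) :* (s :* u :- :1)) t s (s ⁻¹) (w i) (conj (β Q) i)))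
          fixed : fr (t * s ⁻¹) ≡ t * s ⁻¹
          fixed = *-cancelˡ (fr-nonzero (β≢0 {Q} Q≢0 SQ)) (trans (*-comm _ _) (trans (sym (fr-* (t * s ⁻¹) (β Q)))
            (trans (cong fr (sym (ratio i0))) (trans (ratio i1) (*-comm _ _)))))
          rational : Σ F.C λ r → ι r ≡ t * s ⁻¹
          rational = fr-fixed⇒ι fixed
      -- all minors of c, c′ vanish and x, y, z ≠ 0: then R′ is proportional to R
      special : x ≢ 0# → y ≢ 0# → z ≢ 0# → (∀ i → cross c d i ≡ 0#) → ⊥
      special x≢0 y≢0 z≢0 w≡0 = R-independent dependent
        where
        u : C
        u = z ′ * x ⁻¹
        minor₂ : x * y ′ ≡ z * z ′
        minor₂ = *-cancelˡ (*-nonzero y≢0 (fr-nonzero x≢0)) (linear₃ 1# (w≡0 i2) (- (x * y)) (fr-* x y) (y * z) (fr-* z x)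
          (solve 8 (λ x y z x′ y′ z′ xy′ zx′ → y :* x′ :* (x :* y′) :- y :* x′ :* (z :* z′) :=
            :1 :* ((x :* y) :* xy′ :- (y :* z) :* zx′ :- :0) :+ (:- (x :* y)) :* (xy′ :- x′ :* y′) :+ (y :* z) :* (zx′ :- z′ :* x′))
            x y z (x ′) (y ′) (z ′) ((x * y) ′) ((z * x) ′)))
        minor₀ : y * z ′ ≡ x * x ′
        minor₀ = *-cancelˡ (*-nonzero z≢0 (fr-nonzero y≢0)) (linear₃ 1# (w≡0 i0) (- (y * z)) (fr-* y z) (z * x) (fr-* x y)
          (solve 8 (λ x y z x′ y′ z′ yz′ xy′ → z :* y′ :* (y :* z′) :- z :* y′ :* (x :* x′) :=
            :1 :* ((y :* z) :* yz′ :- (z :* x) :* xy′ :- :0) :+ (:- (y :* z)) :* (yz′ :- y′ :* z′) :+ (z :* x) :* (xy′ :- x′ :* y′))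
            x y z (x ′) (y ′) (z ′) ((y * z) ′) ((x * y) ′)))
        inverse-x : x * x ⁻¹ ≡ 1#
        inverse-x = *-inverseʳ x≢0
        X′ : X (frV R) ≡ u * x
        X′ = trans (sym (fr-Z R)) (linear₁ (- (z ′)) inverse-x (solve 3 (λ z′ x d → z′ :- z′ :* d :* x := (:- z′) :* (x :* d :- :1)) (z ′) x (x ⁻¹)))
        Y′ : Y (frV R) ≡ u * y
        Y′ = trans (sym (fr-X R)) (linear₂ (- (x ′)) inverse-x (- (x ⁻¹)) minor₀
          (solve 5 (λ x′ x d y z′ → x′ :- z′ :* d :* y := (:- x′) :* (x :* d :- :1) :+ (:- d) :* (y :* z′ :- x :* x′)) (x ′) x (x ⁻¹) y (z ′)))
        Z′ : Z (frV R) ≡ u * z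
        Z′ = trans (sym (fr-Y R)) (linear₂ (- (y ′)) inverse-x (x ⁻¹) minor₂
          (solve 5 (λ y′ x d z z′ → y′ :- z′ :* d :* z := (:- y′) :* (x :* d :- :1) :+ d :* (x :* y′ :- z :* z′)) (y ′) x (x ⁻¹) z (z ′)))
        R′≡ : ∀ i → frV R i ≡ u * R i
        R′≡ i = trans (expand (frV R) i) (trans (cong₂ _+_ (cong₂ _+_ (cong (_* S i) X′) (cong (_* S₁ i) Y′)) (cong (_* S₂ i) Z′))
          (trans (solve 7 (λ u x y z a b c → u :* x :* a :+ u :* y :* b :+ u :* z :* c := u :* (x :* a :+ y :* b :+ z :* c)) u x y z (S i) (S₁ i) (S₂ i))
            (cong (u *_) (sym (expand R i)))))
        dependent : det R (frV R) (frV (frV R)) ≡ 0#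
        dependent = trans (det-cong {R} {R} {frV R} {u *V R} {frV (frV R)} {frV (frV R)} (λ _ → refl) R′≡ (λ _ → refl))
          (solveFor (vector ∷ vector ∷ scalar ∷ []) (λ R w u → detE R (λ i → u :* R i) w := :0) R (frV (frV R)) u)
      single : ∀ {u} i → u ≢ 0# → (∀ {Q} → Through S Q → Through R Q → u * conj (β Q) i ≡ 0#) → ⊥
      single i0 u≢0 h = β≢0 {Q} Q≢0 SQ (*-cancelˡ-0 u≢0 (h {Q} SQ RQ))
      single i1 u≢0 h = fr-nonzero (β≢0 {Q} Q≢0 SQ) (*-cancelˡ-0 u≢0 (h {Q} SQ RQ))
      single i2 u≢0 h = fr-nonzero (fr-nonzero (β≢0 {Q} Q≢0 SQ)) (*-cancelˡ-0 u≢0 (h {Q} SQ RQ))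
      on-vertex : ∀ {V} → ¬ Prop3 V R → ∀ {t} → (∀ i → R i ≡ t * V i) → ⊥
      on-vertex {V} V≁R {t} e = V≁R (multiple⇒Prop3 {V} {R} R≢0 (t , e))
      decide : Dec (x ≡ 0#) → Dec (y ≡ 0#) → Dec (z ≡ 0#) → F.PropForm Q P
      decide (no x≢0) (no y≢0) (no z≢0) = [ generic , (λ w≡0 → ⊥-elim (special x≢0 y≢0 z≢0 w≡0)) ]′ (nonzero? (cross c d))
      -- If exactly one coordinate of R vanishes, a single term of the relation survives and forces
      -- β Q = 0. If two vanish, R is one of the points S, S′, S″.
      decide (yes x≡0) (no y≢0) (no z≢0) = ⊥-elim (single i1 (*-nonzero y≢0 z≢0) (λ {Q} SQ RQ →
        linear₂ 1# (relation {Q} SQ RQ) (- (y * β Q + z * β Q ″)) x≡0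
          (solve 6 (λ x y z b b′ b″ → (y :* z) :* b′ :- :0 := :1 :* ((x :* y) :* b :+ ((y :* z) :* b′ :+ (z :* x) :* b″) :- :0) :+ (:- (y :* b :+ z :* b″)) :* (x :- :0)) x y z (β Q) (β Q ′) (β Q ″))))
      decide (no x≢0) (yes y≡0) (no z≢0) = ⊥-elim (single i2 (*-nonzero z≢0 x≢0) (λ {Q} SQ RQ →
        linear₂ 1# (relation {Q} SQ RQ) (- (x * β Q + z * β Q ′)) y≡0
          (solve 6 (λ x y z b b′ b″ → (z :* x) :* b″ :- :0 := :1 :* ((x :* y) :* b :+ ((y :* z) :* b′ :+ (z :* x) :* b″) :- :0) :+ (:- (x :* b :+ z :* b′)) :* (y :- :0)) x y z (β Q) (β Q ′) (β Q ″))))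
      decide (no x≢0) (no y≢0) (yes z≡0) = ⊥-elim (single i0 (*-nonzero x≢0 y≢0) (λ {Q} SQ RQ →
        linear₂ 1# (relation {Q} SQ RQ) (- (y * β Q ′ + x * β Q ″)) z≡0
          (solve 6 (λ x y z b b′ b″ → (x :* y) :* b :- :0 := :1 :* ((x :* y) :* b :+ ((y :* z) :* b′ :+ (z :* x) :* b″) :- :0) :+ (:- (y :* b′ :+ x :* b″)) :* (z :- :0)) x y z (β Q) (β Q ′) (β Q ″))))
      decide _ (yes y≡0) (yes z≡0) = ⊥-elim (on-vertex {S} S≁R {x} λ i → trans (expand R i) (linear₂ (S₁ i) y≡0 (S₂ i) z≡0
        (solve 6 (λ x y z a b c → x :* a :+ y :* b :+ z :* c :- x :* a := b :* (y :- :0) :+ c :* (z :- :0)) x y z (S i) (S₁ i) (S₂ i))))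
      decide (yes x≡0) _ (yes z≡0) = ⊥-elim (on-vertex {S₁} S₁≁R {y} λ i → trans (expand R i) (linear₂ (S i) x≡0 (S₂ i) z≡0
        (solve 6 (λ x y z a b c → x :* a :+ y :* b :+ z :* c :- y :* b := a :* (x :- :0) :+ c :* (z :- :0)) x y z (S i) (S₁ i) (S₂ i))))
      decide (yes x≡0) (yes y≡0) _ = ⊥-elim (on-vertex {S₂} S₂≁R {z} λ i → trans (expand R i) (linear₂ (S i) x≡0 (S₁ i) y≡0
        (solve 6 (λ x y z a b c → x :* a :+ y :* b :+ z :* c :- z :* c := a :* (x :- :0) :+ b :* (y :- :0)) x y z (S i) (S₁ i) (S₂ i))))

-- Orbit planes in coordinates and their intersections

module DegeneratePlanes {q : ℕ} {p k : ℕ} (p-prime : Prime p) (q≡ : q ≡ p ℕ.^ suc k)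
  (F : FiniteField q) (K : FiniteField (q ℕ.^ 3)) (ι-hom : FieldHom F K)
  (S : Fin 3 → Fin (q ℕ.^ 3)) (D≢0 : Planes.Independent {p = p} {k = k} p-prime q≡ F K ι-hom S) where

  open Planes {p = p} {k = k} p-prime q≡ F K ι-hom public
  open FramePlanes S D≢0 public

  -- If Tr z = 0 and h = zz′, then h″ = z″z and h + h″ = z(z′ + z″) = -z². So this is az², written
  -- as an F-linear function of zz′.
  twist : C → C → C
  twist a h = - (a * (h + h ″))

  fr²-+ : ∀ x y → (x + y) ″ ≡ x ″ + y ″
  fr²-+ x y = trans (cong fr (fr-+ x y)) (fr-+ (x ′) (y ′))

  fr²-* : ∀ x y → (x * y) ″ ≡ x ″ * y ″
  fr²-* x y = trans (cong fr (fr-* x y)) (fr-* (x ′) (y ′))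

  fr²-ι : ∀ c → ι c ″ ≡ ι c
  fr²-ι c = trans (cong fr (fr-ι c)) (fr-ι c)

  twist-linear : ∀ a → Linear (twist a)
  twist-linear a = record
    { additive = λ x y → trans (cong (λ z → - (a * (x + y + z))) (fr²-+ x y))
        (solve 5 (λ a x y u v → :- (a :* (x :+ y :+ (u :+ v))) := :- (a :* (x :+ u)) :+ :- (a :* (y :+ v))) a x y (x ″) (y ″))
    ; homogeneous = λ c x → trans (cong (λ z → - (a * (ι c * x + z))) (trans (fr²-* (ι c) x) (cong (_* x ″) (fr²-ι c))))
        (solve 4 (λ a c x u → :- (a :* (c :* x :+ c :* u)) := c :* :- (a :* (x :+ u))) a (ι c) x (x ″)) }

  scale-linear : ∀ b → Linear (b *_)
  scale-linear b = record
    { additive = distribˡ b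
    ; homogeneous = λ c x → solve 3 (λ b c x → b :* (c :* x) := c :* (b :* x)) b (ι c) x }

  Plane : C → C → F.Subset6
  Plane a b = Graph (twist a) (b *_)

  plane-subspace : ∀ a b → F.IsSubspace (Plane a b)
  plane-subspace a b = graph-subspace (twist-linear a) (scale-linear b)

  plane-isPlane : ∀ {a b} → b ≢ 0# → F.IsPlane (Plane a b)
  plane-isPlane {a} {b} b≢0 = graph-plane (twist-linear a) (scale-linear b) (λ h _ e → *-cancelˡ-0 b≢0 e)

  plane-scale : ∀ {a b a′ b′} c → c ≢ F.0# → a′ ≡ ι c * a → b′ ≡ ι c * b → ∀ {Q} → Plane a b Q → Plane a′ b′ Q
  plane-scale {a} {b} {a′} {b′} c c≢0 e f {Q} (h , u , v) = ι (c F.⁻¹) * h ,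
      trans u (sym (trans (Linear.homogeneous (twist-linear a′) (c F.⁻¹) h) (trans (cong (λ z → ι (c F.⁻¹) * twist z h) e)
        (linear₁ (twist a h) cc⁻¹ (solve 5 (λ c d a h k → d :* (:- (c :* a :* (h :+ k))) :- (:- (a :* (h :+ k))) := (:- (a :* (h :+ k))) :* (c :* d :- :1))
          (ι c) (ι (c F.⁻¹)) a h (h ″)))))) ,
      trans v (sym (trans (cong (_* (ι (c F.⁻¹) * h)) f)
        (linear₁ (b * h) cc⁻¹ (solve 4 (λ c d b h → c :* b :* (d :* h) :- b :* h := (b :* h) :* (c :* d :- :1)) (ι c) (ι (c F.⁻¹)) b h))))
    where
    cc⁻¹ : ι c * ι (c F.⁻¹) ≡ 1#
    cc⁻¹ = trans (sym (ι-* c _)) (trans (cong ι (F.*-inverseʳ c≢0)) ι-1)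

  plane-zero : ∀ {a b Q h} → α Q ≡ twist a h → β Q ≡ b * h → h ≡ 0# → ∀ p → Q p ≡ F.0#
  plane-zero {a} {b} {Q} {h} e f h≡0 = coordinates-zero {Q}
    (trans e (trans (cong (twist a) h≡0) (linear-zero (twist-linear a)))) (trans f (trans (cong (b *_) h≡0) (zeroʳ b)))

  plane-multiple : ∀ {a b Q R h k} → F.NonZeroForm R → α Q ≡ twist a h → β Q ≡ b * h → α R ≡ twist a k → β R ≡ b * k →
    (Σ F.C λ c → k ≡ ι c * h) → F.PropForm Q R
  plane-multiple {a} {b} {Q} {R} {h} {k} R≢0 e f e′ f′ (c , k≡) = multiple-from-coordinates {Q} {R} c R≢0
    (trans e′ (trans (cong (twist a) k≡) (trans (Linear.homogeneous (twist-linear a) c h) (cong (ι c *_) (sym e)))))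
    (trans f′ (trans (cong (b *_) k≡) (trans (Linear.homogeneous (scale-linear b) c h) (cong (ι c *_) (sym f)))))

  module _ {Q R : F.Form} (Q≢0 : F.NonZeroForm Q) (R≢0 : F.NonZeroForm R) where

    plane-meet : ∀ {a b A B} → Plane a b Q → Plane a b R → ¬ (A ≡ 0# × B ≡ 0#) →
      (∀ {P h} → P ≡ Q ⊎ P ≡ R → α P ≡ twist a h → β P ≡ b * h → A * h + B * h ″ ≡ 0#) → F.PropForm Q R
    plane-meet {a} {b} (h , e , f) (k , e′ , f′) AB≢0 condition = plane-multiple {a} {b} {Q} {R} R≢0 e f e′ f′
      (proportional AB≢0 h≢0 (condition (inj₁ refl) e f) (condition (inj₂ refl) e′ f′))
      where
      h≢0 : h ≢ 0#
      h≢0 h≡0 = proj₂ Q≢0 (plane-zero {a} {b} {Q} e f h≡0 (proj₁ Q≢0))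

  module Degenerate {B : F.Form} {A : F.Vec3} (B-nr : F.NonRepeated B) (A≢0 : F.NonZero3 A) (B-A : F.Singular B A) where

    a b w : C
    a = α B
    b = β B
    w = X (ιV A)

    singularK : Singular (ιF B) (ιV A)
    singularK = ι-Singular⁺ {B} {A} B-A

    w≢0 : w ≢ 0#
    w≢0 = X-point {A} A≢0

    a≢0 : a ≢ 0#
    a≢0 a≡0 = let p , n = proj₁ B-nr in n (through-nonsingular {B} {ιV A} a≡0 (ιV-nonzero {A} A≢0) singularK p)

    polar₀ : w * (a + a) + w ′ * b + w ″ * b ″ ≡ 0#
    polar₀ = trans (cong₂ (λ u v → w * (a + a) + u * b + v * b ″) (sym (Y-point A)) (sym (Z-point A)))
      (trans (sym (polar-S B (ιV A))) (Singular-polar {ιF B} {ιV A} singularK S))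

    -- If b = 0, the polar equation at the center reads 2aw = 0, so the characteristic is two. Then
    -- the whole polar form vanishes, B has no mixed terms, and B is a repeated line.
    b≢0 : b ≢ 0#
    b≢0 b≡0 = proj₂ B-nr (F.char2-repeated 2≡0 {B} (proj₁ B-nr) (off p12 i0 i1 (λ a → solveFor (form ∷ []) (λ a → a p12 := polarE a e₀ e₁) a))
        (off p13 i0 i2 (λ a → solveFor (form ∷ []) (λ a → a p13 := polarE a e₀ e₂) a)) (off p23 i1 i2 (λ a → solveFor (form ∷ []) (λ a → a p23 := polarE a e₁ e₂) a)))
      where
      e₀ e₁ e₂ : Fin 3 → Expr
      e₀ = λ { i0 → :1 ; i1 → :0 ; i2 → :0 }
      e₁ = λ { i0 → :0 ; i1 → :1 ; i2 → :0 }
      e₂ = λ { i0 → :0 ; i1 → :0 ; i2 → :1 }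
      b′≡0 : b ′ ≡ 0#
      b′≡0 = trans (cong fr b≡0) fr-0
      b″≡0 : b ″ ≡ 0#
      b″≡0 = trans (cong fr b′≡0) fr-0
      a+a≡0 : a + a ≡ 0#
      a+a≡0 = *-cancelˡ-0 w≢0 (linear₃ 1# polar₀ (- (w ′)) b≡0 (- (w ″)) b″≡0
        (solve 6 (λ w a w′ b w″ b″ → w :* (a :+ a) :- :0 := :1 :* (w :* (a :+ a) :+ w′ :* b :+ w″ :* b″ :- :0) :+ (:- w′) :* (b :- :0) :+ (:- w″) :* (b″ :- :0))
          w a (w ′) b (w ″) (b ″)))
      2≡0 : F.1# F.+ F.1# ≡ F.0#
      2≡0 = ι-zero (trans (ι-+ F.1# F.1#) (trans (cong₂ _+_ ι-1 ι-1) (*-cancelˡ-0 a≢0 (trans (solve 1 (λ a → a :* (:1 :+ :1) := a :+ a) a) a+a≡0))))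
      a′+a′≡0 : a ′ + a ′ ≡ 0#
      a′+a′≡0 = trans (sym (fr-+ a a)) (trans (cong fr a+a≡0) fr-0)
      a″+a″≡0 : a ″ + a ″ ≡ 0#
      a″+a″≡0 = trans (sym (fr-+ (a ′) (a ′))) (trans (cong fr a′+a′≡0) fr-0)
      vanish : ∀ {c d e} x y z → c ≡ 0# → d ≡ 0# → e ≡ 0# → x * c + y * d + z * e ≡ 0#
      vanish {c} {d} {e} x y z f g h = linear₃ x f y g z h
        (solve 6 (λ x y z c d e → x :* c :+ y :* d :+ z :* e :- :0 := x :* (c :- :0) :+ y :* (d :- :0) :+ z :* (e :- :0)) x y z c d e)
      no-polar : ∀ x y → polar (ιF B) x y ≡ 0#
      no-polar x = polar-zero B x
        (trans (polar-S B x) (vanish (X x) (Y x) (Z x) a+a≡0 b≡0 b″≡0))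
        (trans (polar-S₁ B x) (vanish (X x) (Y x) (Z x) b≡0 a′+a′≡0 b′≡0))
        (trans (polar-S₂ B x) (vanish (X x) (Y x) (Z x) b″≡0 b′≡0 a″+a″≡0))
      off : ∀ p i j → (∀ (a : Form) → a p ≡ polar a (basis i) (basis j)) → B p ≡ F.0#
      off p i j h = ι-zero (trans (h (ιF B)) (no-polar (basis i) (basis j)))

    isPlaneB : F.IsPlane (Plane a b)
    isPlaneB = plane-isPlane b≢0

  -- A common form has parameters h and rh with r = b₁/b₂. Comparison of the α coordinates gives (a₁
  -- - a₂r)h + (a₁ - a₂r″)h″ = 0. If both coefficients vanish, then r = r″ lies in F and B₁ = rB₂.
  planes-meet : ∀ {B₁ A₁ B₂ A₂} → F.NonRepeated B₁ → F.NonZero3 A₁ → F.Singular B₁ A₁ →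
    F.NonRepeated B₂ → F.NonZero3 A₂ → F.Singular B₂ A₂ → ¬ F.PropForm B₂ B₁ →
    F.MeetInAtMostOnePoint (Plane (α B₁) (β B₁)) (Plane (α B₂) (β B₂))
  planes-meet {B₁} {A₁} {B₂} {A₂} nr₁ A₁≢0 s₁ nr₂ A₂≢0 s₂ B₁≁B₂ Q R Q≢0 R≢0 Q₁ Q₂ R₁ R₂ =
    plane-meet {Q} {R} Q≢0 R≢0 {A = coeff} {B = coeff″} Q₁ R₁ nonzero condition
    where
    module D₁ = Degenerate {B₁} {A₁} nr₁ A₁≢0 s₁
    module D₂ = Degenerate {B₂} {A₂} nr₂ A₂≢0 s₂
    a₁ b₁ a₂ b₂ r coeff coeff″ : C
    a₁ = D₁.a
    b₁ = D₁.b
    a₂ = D₂.a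
    b₂ = D₂.b
    r = b₁ * b₂ ⁻¹
    coeff = a₁ - a₂ * r
    coeff″ = a₁ - a₂ * r ″
    b₁≡ : b₁ ≡ r * b₂
    b₁≡ = linear₁ (- b₁) (*-inverseʳ D₂.b≢0) (solve 3 (λ b c d → b :- b :* d :* c := (:- b) :* (c :* d :- :1)) b₁ b₂ (b₂ ⁻¹))
    nonzero : ¬ (coeff ≡ 0# × coeff″ ≡ 0#)
    nonzero (e , f) = B₁≁B₂ (multiple-from-coordinates {B₂} {B₁} (proj₁ rational) (proj₁ nr₁)
        (trans (x-y≡0⇒x≡y e) (trans (*-comm a₂ r) (cong (_* a₂) (sym (proj₂ rational)))))
        (trans b₁≡ (cong (_* b₂) (sym (proj₂ rational)))))
      where
      r≡r″ : r ≡ r ″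
      r≡r″ = *-cancelˡ D₂.a≢0 (linear₂ (- 1#) e 1# f (solve 4 (λ a c r s → c :* r :- c :* s := (:- :1) :* (a :- c :* r :- :0) :+ :1 :* (a :- c :* s :- :0)) a₁ a₂ r (r ″)))
      rational : Σ F.C λ c → ι c ≡ r
      rational = fr-fixed⇒ι (trans (cong fr r≡r″) (fr³ r))
    second : ∀ {P} → P ≡ Q ⊎ P ≡ R → Plane a₂ b₂ P
    second (inj₁ refl) = Q₂
    second (inj₂ refl) = R₂
    condition : ∀ {P h} → P ≡ Q ⊎ P ≡ R → α P ≡ twist a₁ h → β P ≡ b₁ * h → coeff * h + coeff″ * h ″ ≡ 0#
    condition {P} {h} which e f = let h₂ , e₂ , f₂ = second which in go h₂ e₂ f₂
      where
      go : ∀ h₂ → α P ≡ twist a₂ h₂ → β P ≡ b₂ * h₂ → coeff * h + coeff″ * h ″ ≡ 0#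
      go h₂ e₂ f₂ = linear₁ (- 1#) (trans (sym e) (trans e₂ (trans (cong (twist a₂) h₂≡)
          (cong (λ z → - (a₂ * (r * h + z))) (fr²-* r h)))))
          (solve 6 (λ a c r s h k → (a :- c :* r) :* h :+ (a :- c :* s) :* k :- :0 :=
            (:- :1) :* ((:- (a :* (h :+ k))) :- (:- (c :* (r :* h :+ s :* k))))) a₁ a₂ r (r ″) h (h ″))
        where
        h₂≡ : h₂ ≡ r * h
        h₂≡ = *-cancelˡ D₂.b≢0 (linear₂ 1# (trans (sym f₂) f) h b₁≡
          (solve 5 (λ b c r h k → c :* k :- c :* (r :* h) := :1 :* (c :* k :- b :* h) :+ h :* (b :- r :* c)) b₁ b₂ r h h₂))

  -- If both coefficients vanish then 2a = f/v² and b = f/(vv′) with f ∈ F, so B = (f/2)·Tr(X/v)².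
  plane-singular-meet : ∀ {B A P} → F.NonRepeated B → F.NonZero3 A → F.Singular B A → F.NonZero3 P →
    F.MeetInAtMostOnePoint (Plane (α B) (β B)) (λ Q → F.Singular Q P)
  plane-singular-meet {B} {A} {P} nr A≢0 s P≢0 Q R Q≢0 R≢0 Q₁ Q₂ R₁ R₂ =
    plane-meet {Q} {R} Q≢0 R≢0 {A = coeff} {B = coeff″} Q₁ R₁ nonzero condition
    where
    open Degenerate {B} {A} nr A≢0 s using (a; b; a≢0; b≢0)
    v coeff coeff″ : C
    v = X (ιV P)
    v≢0 : v ≢ 0#
    v≢0 = X-point {P} P≢0
    -- The equation 2αv + βv′ + β″v″ = 0, which expresses polarity of P and S, for α = -a(h + h″)
    -- and β = bh.
    coeff = b * v ′ - (a + a) * v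
    coeff″ = b ″ * v ″ - (a + a) * v
    second : ∀ {T} → T ≡ Q ⊎ T ≡ R → F.Singular T P
    second (inj₁ refl) = Q₂
    second (inj₂ refl) = R₂
    condition : ∀ {T h} → T ≡ Q ⊎ T ≡ R → α T ≡ twist a h → β T ≡ b * h → coeff * h + coeff″ * h ″ ≡ 0#
    condition {T} {h} which e f = trans
      (solve 8 (λ a b b″ v v′ v″ h k → (b :* v′ :- (a :+ a) :* v) :* h :+ (b″ :* v″ :- (a :+ a) :* v) :* k :=
          v :* (:- (a :* (h :+ k)) :+ :- (a :* (h :+ k))) :+ v′ :* (b :* h) :+ v″ :* (b″ :* k)) a b (b ″) v (v ′) (v ″) h (h ″))
      (trans (cong₂ _+_ (cong₂ _+_ (cong (λ z → v * (z + z)) (sym e)) (cong₂ _*_ (sym (Y-point P)) (sym f)))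
          (cong₂ _*_ (sym (Z-point P)) (trans (sym (fr²-* b h)) (cong (λ z → fr (fr z)) (sym f)))))
        (trans (sym (polar-S T (ιV P))) (Singular-polar {ιF T} {ιV P} (ι-Singular⁺ {T} {P} (second which)) S)))
    nonzero : ¬ (coeff ≡ 0# × coeff″ ≡ 0#)
    nonzero (e , f) = proj₂ nr (g , n , g≢0 , n≢0 , coordinates-injective {B} {F.scaleF g (F.prodLin n n)}
        (sym (trans (α-* g (F.prodLin n n)) (trans (cong (ι g *_) α-n) a≡)))
        (sym (trans (β-* g (F.prodLin n n)) (trans (cong (ι g *_) β-n) b≡))))
      where
      2≢0 : 1# + 1# ≢ 0#
      2≢0 2≡0 = *-nonzero b≢0 (fr-nonzero v≢0) (linear₂ 1# e (a * v) 2≡0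
        (solve 4 (λ a b v v′ → b :* v′ :- :0 := :1 :* (b :* v′ :- (a :+ a) :* v :- :0) :+ (a :* v) :* (:1 :+ :1 :- :0)) a b v (v ′)))
      φ : C
      φ = b * (v * v ′)
      φ≡ : φ ≡ (a + a) * (v * v)
      φ≡ = linear₁ v e (solve 4 (λ a b v v′ → b :* (v :* v′) :- (a :+ a) :* (v :* v) := v :* (b :* v′ :- (a :+ a) :* v :- :0)) a b v (v ′))
      φ″ : φ ″ ≡ φ
      φ″ = trans (trans (fr²-* b (v * v ′)) (cong (b ″ *_) (trans (fr²-* v (v ′)) (cong (v ″ *_) (fr³ v)))))
        (linear₂ v f (- v) e (solve 6 (λ a b v v′ b″ v″ → b″ :* (v″ :* v) :- b :* (v :* v′) :=
          v :* (b″ :* v″ :- (a :+ a) :* v :- :0) :+ (:- v) :* (b :* v′ :- (a :+ a) :* v :- :0)) a b v (v ′) (b ″) (v ″)))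
      half : C
      half = (1# + 1#) ⁻¹
      two : F.C
      two = F.1# F.+ F.1#
      ι-two : ι two ≡ 1# + 1#
      ι-two = trans (ι-+ F.1# F.1#) (cong₂ _+_ ι-1 ι-1)
      fr-φ : fr φ ≡ φ
      fr-φ = trans (cong fr (sym φ″)) (fr³ φ)
      φF : F.C
      φF = proj₁ (fr-fixed⇒ι fr-φ)
      g : F.C
      g = two F.⁻¹ F.* φF
      ι-g : ι g ≡ half * φ
      ι-g = trans (ι-* _ _) (cong₂ _*_ (trans (ι-⁻¹ two) (cong _⁻¹ ι-two)) (proj₂ (fr-fixed⇒ι fr-φ)))
      2half : (1# + 1#) * half ≡ 1#
      2half = *-inverseʳ 2≢0
      n : F.Vec3
      -- The line whose value at `S` is 1/v, that is Tr(X/v).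
      n = coefficients (v ⁻¹)
      nS : ιV n · S ≡ v ⁻¹
      nS = coefficients-sum (v ⁻¹)
      nS₁ : ιV n · S₁ ≡ v ⁻¹ ′
      nS₁ = trans (·-cong {ιV n} {frV (ιV n)} {S₁} {S₁} (λ j → sym (fr-ι (n j))) (λ _ → refl)) (trans (sym (fr-· (ιV n) S)) (cong fr nS))
      α-n : α (F.prodLin n n) ≡ v ⁻¹ * v ⁻¹
      α-n = trans (eval-cong {ιF (F.prodLin n n)} {prodLin (ιV n) (ιV n)} {S} {S} (ι-prodLin n n) (λ _ → refl))
        (trans (eval-prodLin (ιV n) (ιV n) S) (cong₂ _*_ nS nS))
      β-n : β (F.prodLin n n) ≡ v ⁻¹ * v ⁻¹ ′ + v ⁻¹ ′ * v ⁻¹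
      β-n = trans (polar-cong {ιF (F.prodLin n n)} {prodLin (ιV n) (ιV n)} {S} {S₁} {S} {S₁} (ι-prodLin n n) (λ _ → refl) (λ _ → refl))
        (trans (polar-prodLin (ιV n) (ιV n) S S₁) (cong₂ _+_ (cong₂ _*_ nS nS₁) (cong₂ _*_ nS₁ nS)))
      vv : v * v ⁻¹ ≡ 1#
      vv = *-inverseʳ v≢0
      vv′ : v ′ * v ⁻¹ ′ ≡ 1#
      vv′ = trans (sym (fr-* v (v ⁻¹))) (trans (cong fr vv) fr-1)
      a≡ : ι g * (v ⁻¹ * v ⁻¹) ≡ a
      a≡ = trans (cong (_* (v ⁻¹ * v ⁻¹)) (trans ι-g (cong (half *_) φ≡)))
        (linear₂ a 2half ((1# + 1#) * half * a * (v * v ⁻¹ + 1#)) vv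
          (solve 4 (λ d a v u → d :* ((a :+ a) :* (v :* v)) :* (u :* u) :- a :=
            a :* ((:1 :+ :1) :* d :- :1) :+ ((:1 :+ :1) :* d :* a :* (v :* u :+ :1)) :* (v :* u :- :1)) half a v (v ⁻¹)))
      b≡ : ι g * (v ⁻¹ * v ⁻¹ ′ + v ⁻¹ ′ * v ⁻¹) ≡ b
      b≡ = trans (cong (_* (v ⁻¹ * v ⁻¹ ′ + v ⁻¹ ′ * v ⁻¹)) ι-g)
        (linear₃ b 2half ((1# + 1#) * half * b) vv ((1# + 1#) * half * b * (v * v ⁻¹)) vv′
          (solve 6 (λ d b v u v′ u′ → d :* (b :* (v :* v′)) :* (u :* u′ :+ u′ :* u) :- b :=
            b :* ((:1 :+ :1) :* d :- :1) :+ ((:1 :+ :1) :* d :* b) :* (v :* u :- :1) :+ ((:1 :+ :1) :* d :* b :* (v :* u)) :* (v′ :* u′ :- :1))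
            half b v (v ⁻¹) (v ′) (v ⁻¹ ′)))
      g≢0 : g ≢ F.0#
      g≢0 g≡0 = a≢0 (trans (sym a≡) (trans (cong (_* (v ⁻¹ * v ⁻¹)) (trans (cong ι g≡0) ι-0)) (zeroˡ _)))
      n≢0 : F.NonZero3 n
      n≢0 = [ id , (λ z → ⊥-elim (⁻¹-nonzero v≢0 (trans (sym nS) (·-zero {ιV n} {S} (λ i → trans (cong ι (z i)) ι-0))))) ]′ (F.nonzero? n)

  -- half the determinant of the polar form (the determinant itself would lose characteristic two)
  disc : (x x′ x″ y y′ y″ : C) → C
  disc x x′ x″ y y′ y″ = (1# + 1# + 1# + 1#) * (x * x′ * x″) + y * y′ * y″ - (x * (y′ * y′) + x′ * (y″ * y″) + x″ * (y * y))

  discOf : F.Form → C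
  discOf Q = disc (α Q) (α Q ′) (α Q ″) (β Q) (β Q ′) (β Q ″)

  -- A combination of B(A) = 0 and two of the polar equations at A equals w² times the discriminant,
  -- and w ≠ 0 because A is rational. Division by w² instead of 2 covers characteristic two.
  singular⇒disc : ∀ {B A} → F.NonZero3 A → F.Singular B A → discOf B ≡ 0#
  singular⇒disc {B} {A} A≢0 s = *-cancelʳ-0 (*-nonzero w≢0 w≢0)
    (linear₃ ((1# + 1# + 1# + 1#) * (a ′ * a ″) - b ′ * b ′) E
             (- (a ″ * (w * b + w ′ * (a ′ + a ′) + w ″ * b ′) - b ′ * (w * b ″ + w ′ * b ′ + w ″ * (a ″ + a ″)))) e₁
             (- (a ′ * (w * b ″ + w ′ * b ′ + w ″ * (a ″ + a ″)))) e₂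
      (solve 9 (λ a a′ a″ b b′ b″ w w′ w″ →
        ((:1 :+ :1 :+ :1 :+ :1) :* (a :* a′ :* a″) :+ b :* b′ :* b″ :- (a :* (b′ :* b′) :+ a′ :* (b″ :* b″) :+ a″ :* (b :* b))) :* (w :* w) :- :0 :=
        ((:1 :+ :1 :+ :1 :+ :1) :* (a′ :* a″) :- b′ :* b′) :* (a :* (w :* w) :+ a′ :* (w′ :* w′) :+ a″ :* (w″ :* w″) :+ b :* (w :* w′) :+ b′ :* (w′ :* w″) :+ b″ :* (w″ :* w) :- :0)
        :+ (:- (a″ :* (w :* b :+ w′ :* (a′ :+ a′) :+ w″ :* b′) :- b′ :* (w :* b″ :+ w′ :* b′ :+ w″ :* (a″ :+ a″)))) :* (w :* b :+ w′ :* (a′ :+ a′) :+ w″ :* b′ :- :0)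
        :+ (:- (a′ :* (w :* b″ :+ w′ :* b′ :+ w″ :* (a″ :+ a″)))) :* (w :* b″ :+ w′ :* b′ :+ w″ :* (a″ :+ a″) :- :0))
        a (a ′) (a ″) b (b ′) (b ″) w (w ′) (w ″)))
    where
    a b w : C
    a = α B
    b = β B
    w = X (ιV A)
    w≢0 : w ≢ 0#
    w≢0 = X-point {A} A≢0
    sK : Singular (ιF B) (ιV A)
    sK = ι-Singular⁺ {B} {A} s
    E : value a b w (w ′) (w ″) ≡ 0#
    E = trans (cong₂ (value a b w) (sym (Y-point A)) (sym (Z-point A))) (trans (sym (eval-frame B (ιV A))) (proj₁ sK))
    e₁ : w * b + w ′ * (a ′ + a ′) + w ″ * b ′ ≡ 0#
    e₁ = trans (cong₂ (λ u v → w * b + u * (a ′ + a ′) + v * b ′) (sym (Y-point A)) (sym (Z-point A)))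
      (trans (sym (polar-S₁ B (ιV A))) (Singular-polar {ιF B} {ιV A} sK S₁))
    e₂ : w * b ″ + w ′ * b ′ + w ″ * (a ″ + a ″) ≡ 0#
    e₂ = trans (cong₂ (λ u v → w * b ″ + u * b ′ + v * (a ″ + a ″)) (sym (Y-point A)) (sym (Z-point A)))
      (trans (sym (polar-S₂ B (ιV A))) (Singular-polar {ιF B} {ιV A} sK S₂))

  singular-combine : ∀ Q r s t → value (α Q) (β Q) r s t ≡ 0# →
    r * (α Q + α Q) + s * β Q + t * β Q ″ ≡ 0# → r * β Q + s * (α Q ′ + α Q ′) + t * β Q ′ ≡ 0# →
    r * β Q ″ + s * β Q ′ + t * (α Q ″ + α Q ″) ≡ 0# → Singular (ιF Q) (combine r s t S S₁ S₂)
  singular-combine Q r s t E e₀ e₁ e₂ =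
    trans (eval-frame Q R) (trans (cong₃ (value (α Q) (β Q))) E) ,
    λ i → polar-zero Q R (trans (polar-S Q R) (trans (cong₃ (λ x y z → x * (α Q + α Q) + y * β Q + z * β Q ″)) e₀))
                         (trans (polar-S₁ Q R) (trans (cong₃ (λ x y z → x * β Q + y * (α Q ′ + α Q ′) + z * β Q ′)) e₁))
                         (trans (polar-S₂ Q R) (trans (cong₃ (λ x y z → x * β Q ″ + y * β Q ′ + z * (α Q ″ + α Q ″))) e₂)) (basis i)
    where
    R : Vec3
    R = combine r s t S S₁ S₂
    cong₃ : ∀ (f : C → C → C → C) → f (X R) (Y R) (Z R) ≡ f r s t
    cong₃ f = trans (cong (λ x → f x (Y R) (Z R)) (X-combine r s t)) (cong₂ (f r) (Y-combine r s t) (Z-combine r s t))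

  combine-nonzero : ∀ {r s t} → NonZero3 (vec3 r s t) → NonZero3 (combine r s t S S₁ S₂)
  combine-nonzero {r} {s} {t} (i , n) = [ id , (λ z → ⊥-elim (n (vanish z i))) ]′ (nonzero? R)
    where
    R : Vec3
    R = combine r s t S S₁ S₂
    zero-det : (∀ i → R i ≡ 0#) → ∀ u v → D ⁻¹ * det R u v ≡ 0#
    zero-det z u v = trans (cong (D ⁻¹ *_) (·-zero {R} {cross u v} z)) (zeroʳ _)
    vanish : (∀ i → R i ≡ 0#) → ∀ i → vec3 r s t i ≡ 0#
    vanish z i0 = trans (sym (X-combine r s t)) (zero-det z S₁ S₂)
    vanish z i1 = trans (sym (Y-combine r s t)) (zero-det z S₂ S)
    vanish z i2 = trans (sym (Z-combine r s t)) (zero-det z S S₁)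

  -- The last column of the adjugate of the polar matrix is singular; if it vanishes, (y, −2x, 0) is.
  disc⇒singular : ∀ {Q} → discOf Q ≡ 0# → β Q ≢ 0# → Σ Vec3 λ R → NonZero3 R × Singular (ιF Q) R
  disc⇒singular {Q} Δ≡0 y≢0 = [ generic , special ]′ (nonzero? col)
    where
    x y : C
    x = α Q
    y = β Q
    col : Vec3
    col = vec3 (y * y ′ - (x ′ + x ′) * y ″) (y * y ″ - (x + x) * y ′) ((x + x) * (x ′ + x ′) - y * y)
    generic : NonZero3 col → Σ Vec3 λ R → NonZero3 R × Singular (ιF Q) R
    generic n = combine (col i0) (col i1) (col i2) S S₁ S₂ , combine-nonzero n , singular-combine Q (col i0) (col i1) (col i2)
      (linear₁ (col i2) Δ≡0 (solve 6 (λ x x′ x″ y y′ y″ →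
        let c₀ = y :* y′ :- (x′ :+ x′) :* y″ ; c₁ = y :* y″ :- (x :+ x) :* y′ ; c₂ = (x :+ x) :* (x′ :+ x′) :- y :* y in
        x :* (c₀ :* c₀) :+ x′ :* (c₁ :* c₁) :+ x″ :* (c₂ :* c₂) :+ y :* (c₀ :* c₁) :+ y′ :* (c₁ :* c₂) :+ y″ :* (c₂ :* c₀) :- :0 :=
        c₂ :* ((:1 :+ :1 :+ :1 :+ :1) :* (x :* x′ :* x″) :+ y :* y′ :* y″ :- (x :* (y′ :* y′) :+ x′ :* (y″ :* y″) :+ x″ :* (y :* y)) :- :0))
        x (x ′) (x ″) y (y ′) (y ″)))
      (solve 6 (λ x x′ x″ y y′ y″ →
        let c₀ = y :* y′ :- (x′ :+ x′) :* y″ ; c₁ = y :* y″ :- (x :+ x) :* y′ ; c₂ = (x :+ x) :* (x′ :+ x′) :- y :* y in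
        c₀ :* (x :+ x) :+ c₁ :* y :+ c₂ :* y″ := :0) x (x ′) (x ″) y (y ′) (y ″))
      (solve 6 (λ x x′ x″ y y′ y″ →
        let c₀ = y :* y′ :- (x′ :+ x′) :* y″ ; c₁ = y :* y″ :- (x :+ x) :* y′ ; c₂ = (x :+ x) :* (x′ :+ x′) :- y :* y in
        c₀ :* y :+ c₁ :* (x′ :+ x′) :+ c₂ :* y′ := :0) x (x ′) (x ″) y (y ′) (y ″))
      (linear₁ (1# + 1#) Δ≡0 (solve 6 (λ x x′ x″ y y′ y″ →
        let c₀ = y :* y′ :- (x′ :+ x′) :* y″ ; c₁ = y :* y″ :- (x :+ x) :* y′ ; c₂ = (x :+ x) :* (x′ :+ x′) :- y :* y in
        c₀ :* y″ :+ c₁ :* y′ :+ c₂ :* (x″ :+ x″) :- :0 :=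
        (:1 :+ :1) :* ((:1 :+ :1 :+ :1 :+ :1) :* (x :* x′ :* x″) :+ y :* y′ :* y″ :- (x :* (y′ :* y′) :+ x′ :* (y″ :* y″) :+ x″ :* (y :* y)) :- :0))
        x (x ′) (x ″) y (y ′) (y ″)))
    special : (∀ i → col i ≡ 0#) → Σ Vec3 λ R → NonZero3 R × Singular (ιF Q) R
    special z = combine y (- (x + x)) 0# S S₁ S₂ , combine-nonzero (i0 , y≢0) , singular-combine Q y (- (x + x)) 0#
      (linear₁ x (z i2) (solve 6 (λ x x′ x″ y y′ y″ →
        x :* (y :* y) :+ x′ :* (:- (x :+ x) :* :- (x :+ x)) :+ x″ :* (:0 :* :0) :+ y :* (y :* :- (x :+ x)) :+ y′ :* (:- (x :+ x) :* :0) :+ y″ :* (:0 :* y) :- :0 :=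
        x :* ((x :+ x) :* (x′ :+ x′) :- y :* y :- :0)) x (x ′) (x ″) y (y ′) (y ″)))
      (solve 3 (λ x y y″ → y :* (x :+ x) :+ :- (x :+ x) :* y :+ :0 :* y″ := :0) x y (y ″))
      (linear₁ (- 1#) (z i2) (solve 4 (λ x x′ y y′ → y :* y :+ :- (x :+ x) :* (x′ :+ x′) :+ :0 :* y′ :- :0 :=
        (:- :1) :* ((x :+ x) :* (x′ :+ x′) :- y :* y :- :0)) x (x ′) y (y ′)))
      (linear₁ 1# (z i1) (solve 5 (λ x x″ y y′ y″ → y :* y″ :+ :- (x :+ x) :* y′ :+ :0 :* (x″ :+ x″) :- :0 :=
        :1 :* (y :* y″ :- (x :+ x) :* y′ :- :0)) x (x ″) y (y ′) (y ″)))

  -- On Plane a b the discriminant has a linear factor, so every line of the plane contains a degenerate form.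
  plane-through-meet : ∀ {B A R} → F.NonRepeated B → F.NonZero3 A → F.Singular B A → Independent R →
    F.MeetInAtMostOnePoint (Plane (α B) (β B)) (Through R)
  plane-through-meet {B} {A} {R} nr A≢0 s R-independent Q P Q≢0 P≢0 (h , e , f) RQ (h′ , e′ , f′) RP =
    -- The form τ(h′)Q - τ(h)P lies in the kernel of the linear factor, so it is degenerate or zero;
    -- it also lies in the net, so it is zero. The same argument applied to Q alone shows τ(h) ≠ 0.
    F.PropForm-scale {Q} {P} (sF h′) (sF h) sh≢0 P≢0 λ p → F.x-y≡0⇒x≡y
      (trans (F.solve 4 (λ s t Q P → s :* P :- t :* Q := :- (t :* Q :+ :- s :* P)) (sF h) (sF h′) (Q p) (P p))
        (trans (cong F.-_ (combined-zero p)) F.-0#≈0#))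
    where
    open Degenerate {B} {A} nr A≢0 s using (a; b; a≢0; b≢0)
    module R = FramePlanes R R-independent
    n κ κ′ κ″ : C
    n = (1# + 1# + 1# + 1#) * (a * a ′ * a ″)
    κ = a * (b ′ * b ′) - n
    κ′ = a ′ * (b ″ * b ″) - n
    κ″ = a ″ * (b * b) - n
    -- The linear factor of the discriminant: by `disc-plane` the discriminant at h is (hh′ + h′h″ +
    -- h″h)τ(h) plus a multiple of the discriminant of B, which is zero. Frobenius fixes τ(h), so τ
    -- is a linear form with values in F.
    τ : C → C
    τ h = κ″ * h + κ * h ′ + κ′ * h ″
    fr-n : fr n ≡ n
    fr-n = trans (fr-* _ _) (cong₂ _*_ four (trans (fr-* _ _) (trans (cong₂ _*_ (fr-* a (a ′)) (fr³ a))
        (solve 3 (λ a b c → b :* c :* a := a :* b :* c) a (a ′) (a ″)))))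
      where
      four : fr (1# + 1# + 1# + 1#) ≡ 1# + 1# + 1# + 1#
      four = trans (fr-+ _ _) (cong₂ _+_ (trans (fr-+ _ _) (cong₂ _+_ (trans (fr-+ _ _) (cong₂ _+_ fr-1 fr-1)) fr-1)) fr-1)
    fr-κ-part : ∀ u v {u′ v′} → fr u ≡ u′ → fr v ≡ v′ → fr (u * (v * v) - n) ≡ u′ * (v′ * v′) - n
    fr-κ-part u v eu ev = trans (fr-sub _ _) (cong₂ _-_ (trans (fr-* u (v * v)) (cong₂ _*_ eu (trans (fr-* v v) (cong₂ _*_ ev ev)))) fr-n)
    fr-τ : ∀ h → fr (τ h) ≡ τ h
    fr-τ h = trans (fr-+ _ _) (trans (cong₂ _+_ (trans (fr-+ _ _) (cong₂ _+_
        (trans (fr-* κ″ h) (cong (_* h ′) (fr-κ-part (a ″) b (fr³ a) refl)))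
        (trans (fr-* κ (h ′)) (cong (_* h ″) (fr-κ-part a (b ′) refl refl)))))
        (trans (fr-* κ′ (h ″)) (cong₂ _*_ (fr-κ-part (a ′) (b ″) refl (fr³ b)) (fr³ h))))
      (solve 3 (λ a b c → b :+ c :+ a := a :+ b :+ c) (κ″ * h) (κ * h ′) (κ′ * h ″)))
    sF : C → F.C
    sF h = proj₁ (fr-fixed⇒ι (fr-τ h))
    ι-sF : ∀ h → ι (sF h) ≡ τ h
    ι-sF h = proj₂ (fr-fixed⇒ι (fr-τ h))
    disc-plane : ∀ {Q h} → α Q ≡ twist a h → β Q ≡ b * h → discOf Q ≡ (h * h ′ + h ′ * h ″ + h ″ * h) * τ h + h * h ′ * h ″ * discOf B
    disc-plane {Q} {h} e f = trans
        (cong₆ disc e (trans (cong fr e) x′≡) (trans (cong (λ z → fr (fr z)) e) (trans (cong fr x′≡) x″≡)) f (trans (cong fr f) (fr-* b h)) (trans (cong (λ z → fr (fr z)) f) (fr²-* b h)))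
        (solve 9 (λ a a′ a″ b b′ b″ h h′ h″ →
          let four = :1 :+ :1 :+ :1 :+ :1 ; n = four :* (a :* a′ :* a″)
              x = :- (a :* (h :+ h″)) ; x′ = :- (a′ :* (h′ :+ h)) ; x″ = :- (a″ :* (h″ :+ h′)) in
          four :* (x :* x′ :* x″) :+ (b :* h) :* (b′ :* h′) :* (b″ :* h″)
            :- (x :* ((b′ :* h′) :* (b′ :* h′)) :+ x′ :* ((b″ :* h″) :* (b″ :* h″)) :+ x″ :* ((b :* h) :* (b :* h))) :=
          (h :* h′ :+ h′ :* h″ :+ h″ :* h) :* ((a″ :* (b :* b) :- n) :* h :+ (a :* (b′ :* b′) :- n) :* h′ :+ (a′ :* (b″ :* b″) :- n) :* h″)
          :+ h :* h′ :* h″ :* (four :* (a :* a′ :* a″) :+ b :* b′ :* b″ :- (a :* (b′ :* b′) :+ a′ :* (b″ :* b″) :+ a″ :* (b :* b))))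
          a (a ′) (a ″) b (b ′) (b ″) h (h ′) (h ″))
      where
      x′≡ : fr (twist a h) ≡ - (a ′ * (h ′ + h))
      x′≡ = trans (fr-neg _) (cong -_ (trans (fr-* a _) (cong (a ′ *_) (trans (fr-+ h (h ″)) (cong (h ′ +_) (fr³ h))))))
      x″≡ : fr (- (a ′ * (h ′ + h))) ≡ - (a ″ * (h ″ + h ′))
      x″≡ = trans (fr-neg _) (cong -_ (trans (fr-* (a ′) _) (cong (a ″ *_) (fr-+ (h ′) h))))
      cong₆ : ∀ (f : C → C → C → C → C → C → C) {u u′ v v′ w w′ x x′ y y′ z z′} → u ≡ u′ → v ≡ v′ → w ≡ w′ → x ≡ x′ → y ≡ y′ → z ≡ z′ →
        f u v w x y z ≡ f u′ v′ w′ x′ y′ z′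
      cong₆ f refl refl refl refl refl refl = refl
    degenerate-zero : ∀ {Q h} → α Q ≡ twist a h → β Q ≡ b * h → τ h ≡ 0# → Through R Q → ∀ p → Q p ≡ F.0#
    degenerate-zero {Q} {h} e f τ≡0 RQ = decide (h ≟ 0#)
      where
      Δ≡0 : discOf Q ≡ 0#
      Δ≡0 = trans (disc-plane {Q} e f) (linear₂ (h * h ′ + h ′ * h ″ + h ″ * h) τ≡0 (h * h ′ * h ″) (singular⇒disc {B} {A} A≢0 s)
        (solve 4 (λ u t v d → u :* t :+ v :* d :- :0 := u :* (t :- :0) :+ v :* (d :- :0)) (h * h ′ + h ′ * h ″ + h ″ * h) (τ h) (h * h ′ * h ″) (discOf B)))
      decide : Dec (h ≡ 0#) → ∀ p → Q p ≡ F.0#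
      decide (yes h≡0) = plane-zero {a} {b} {Q} e f h≡0
      decide (no h≢0) = let T , T≢0 , sing = disc⇒singular {Q} Δ≡0 (λ z → *-nonzero b≢0 h≢0 (trans (sym f) z)) in
        R.through-nonsingular {Q} {T} RQ T≢0 sing
    sh≢0 : sF h ≢ F.0#
    sh≢0 z = proj₂ Q≢0 (degenerate-zero {Q} {h} e f (trans (sym (ι-sF h)) (trans (cong ι z) ι-0)) RQ (proj₁ Q≢0))
    combined : F.Form
    combined = F.scaleF (sF h′) Q F.+F F.scaleF (F.- sF h) P
    through-combined : Through R combined
    through-combined = F.IsSubspace.has-+ sub {F.scaleF (sF h′) Q} {F.scaleF (F.- sF h) P} (F.IsSubspace.has-* sub (sF h′) {Q} RQ) (F.IsSubspace.has-* sub (F.- sF h) {P} RP)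
      where
      sub : F.IsSubspace (Through R)
      sub = record
        { respects = λ {Q} {T} e z → trans (sym (R.α-cong {Q} {T} e)) z
        ; has-zero = R.α-zero
        ; has-+ = λ {Q} {T} u v → trans (R.α-+ Q T) (trans (cong₂ _+_ u v) (+-identityʳ 0#))
        ; has-* = λ c {Q} u → trans (R.α-* c Q) (trans (cong (ι c *_) u) (zeroʳ _)) }
    hc : C
    hc = ι (sF h′) * h + ι (F.- sF h) * h′
    α-combined : α combined ≡ twist a hc
    α-combined = trans (α-+ (F.scaleF (sF h′) Q) (F.scaleF (F.- sF h) P)) (trans (cong₂ _+_
        (trans (α-* (sF h′) Q) (trans (cong (ι (sF h′) *_) e) (sym (Linear.homogeneous (twist-linear a) (sF h′) h))))
        (trans (α-* (F.- sF h) P) (trans (cong (ι (F.- sF h) *_) e′) (sym (Linear.homogeneous (twist-linear a) (F.- sF h) h′)))))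
      (sym (Linear.additive (twist-linear a) (ι (sF h′) * h) (ι (F.- sF h) * h′))))
    β-combined : β combined ≡ b * hc
    β-combined = trans (β-+ (F.scaleF (sF h′) Q) (F.scaleF (F.- sF h) P)) (trans (cong₂ _+_
        (trans (β-* (sF h′) Q) (trans (cong (ι (sF h′) *_) f) (sym (Linear.homogeneous (scale-linear b) (sF h′) h))))
        (trans (β-* (F.- sF h) P) (trans (cong (ι (F.- sF h) *_) f′) (sym (Linear.homogeneous (scale-linear b) (F.- sF h) h′)))))
      (sym (Linear.additive (scale-linear b) (ι (sF h′) * h) (ι (F.- sF h) * h′))))
    τ-linear : Linear τ
    τ-linear = record
      { additive = λ x y → trans (cong₂ (λ u v → κ″ * (x + y) + κ * u + κ′ * v) (fr-+ x y) (fr²-+ x y))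
          (solve 9 (λ c d e x y x′ y′ x″ y″ → c :* (x :+ y) :+ d :* (x′ :+ y′) :+ e :* (x″ :+ y″) := (c :* x :+ d :* x′ :+ e :* x″) :+ (c :* y :+ d :* y′ :+ e :* y″))
            κ″ κ κ′ x y (x ′) (y ′) (x ″) (y ″))
      ; homogeneous = λ c x → trans (cong₂ (λ u v → κ″ * (ι c * x) + κ * u + κ′ * v) (trans (fr-* (ι c) x) (cong (_* x ′) (fr-ι c))) (trans (fr²-* (ι c) x) (cong (_* x ″) (fr²-ι c))))
          (solve 7 (λ c d e k x x′ x″ → c :* (k :* x) :+ d :* (k :* x′) :+ e :* (k :* x″) := k :* (c :* x :+ d :* x′ :+ e :* x″)) κ″ κ κ′ (ι c) x (x ′) (x ″)) }
    τ-combined : τ hc ≡ 0#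
    τ-combined = trans (Linear.additive τ-linear (ι (sF h′) * h) (ι (F.- sF h) * h′)) (trans (cong₂ _+_
        (trans (Linear.homogeneous τ-linear (sF h′) h) (cong (_* τ h) (ι-sF h′)))
        (trans (Linear.homogeneous τ-linear (F.- sF h) h′) (cong (_* τ h′) (trans (ι-neg (sF h)) (cong -_ (ι-sF h))))))
      (solve 2 (λ u v → v :* u :+ (:- u) :* v := :0) (τ h) (τ h′)))
    combined-zero : ∀ p → sF h′ F.* Q p F.+ (F.- sF h) F.* P p ≡ F.0#
    combined-zero = degenerate-zero {combined} {hc} α-combined β-combined τ-combined through-combined

-- Invertible matrices, their powers and their action on forms

module MatrixLemmas {q : ℕ} (F : FiniteField q) where
  open DegenerateForms F

  invertible⇒injective : ∀ {M} → Invertible M → ∀ {x} → (∀ i → apply M x i ≡ 0#) → ∀ i → x i ≡ 0#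
  invertible⇒injective {M} inv {x} Mx≡0 = orthogonal⇒zero {M i0} {M i1} {M i2} rows x (flip i0) (flip i1) (flip i2)
    where
    flip : ∀ i → x · M i ≡ 0#
    flip i = trans (solveFor (vector ∷ vector ∷ []) (λ x m → x :· m := m :· x) x (M i)) (Mx≡0 i)
    rows : det (M i0) (M i1) (M i2) ≢ 0#
    rows d≡0 = let c , c≢0 , e = det-zero⇒dependent (M i0) (M i1) (M i2) d≡0 in
      not-zero {c ◃ M} (◃-nonzero {M} inv {c} c≢0) (λ i → trans (sym (+-assoc _ _ _)) (e i))

  apply-sub : ∀ M x y i → apply M (λ j → x j - y j) i ≡ apply M x i - apply M y i
  apply-sub M x y i = solveFor (vector ∷ vector ∷ vector ∷ []) (λ m x y → m :· (λ j → x j :- y j) := m :· x :- m :· y) (M i) x y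

  -- `Invertible` provides a right inverse only. The injective M sends N(Mx) - x to zero.
  left-inverse : ∀ {M N} → (∀ i j → (M ∙M N) i j ≡ idM i j) → ∀ x i → apply N (apply M x) i ≡ x i
  left-inverse {M} {N} e x i = x-y≡0⇒x≡y (invertible⇒injective {M} (N , e) {λ j → apply N (apply M x) j - x j}
    (λ j → trans (apply-sub M (apply N (apply M x)) x j) (x≡y⇒x-y≡0 (apply-inverse {M} {N} e (apply M x) j))) i)

  apply-combine : ∀ M r s t u v w i → apply M (combine r s t u v w) i ≡ combine r s t (apply M u) (apply M v) (apply M w) i
  apply-combine M r s t u v w i = solveFor (vector ∷ scalar ∷ scalar ∷ scalar ∷ vector ∷ vector ∷ vector ∷ [])
    (λ m r s t u v w → m :· (λ j → r :* u j :+ s :* v j :+ t :* w j) := r :* (m :· u) :+ s :* (m :· v) :+ t :* (m :· w)) (M i) r s t u v w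

  apply-^M-+ : ∀ M a b x i → apply (M ^M (a ℕ.+ b)) x i ≡ apply (M ^M a) (apply (M ^M b) x) i
  apply-^M-+ M zero    b x i = sym (apply-idM (apply (M ^M b) x) i)
  apply-^M-+ M (suc a) b x i = trans (sym (apply-∙M M (M ^M (a ℕ.+ b)) x i))
    (trans (apply-cong {M} {M} (λ _ _ → refl) (apply-^M-+ M a b x) i) (apply-∙M M (M ^M a) (apply (M ^M b) x) i))

  ^M-surjective : ∀ {M} → Invertible M → ∀ k x → Σ Vec3 λ y → ∀ i → apply (M ^M k) y i ≡ x i
  ^M-surjective inv zero    x = x , apply-idM x
  ^M-surjective {M} (N , e) (suc k) x = let y , f = ^M-surjective {M} (N , e) k (apply N x) in y , λ i →
    trans (sym (apply-∙M M (M ^M k) y i)) (trans (apply-cong {M} {M} (λ _ _ → refl) f i) (apply-inverse {M} {N} e x i))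

  ^M-invertible : ∀ {M} → Invertible M → ∀ k → Invertible (M ^M k)
  ^M-invertible {M} inv k = (λ i j → proj₁ (preimage j) i) , λ i j → trans (proj₂ (preimage j) i) (symmetric j i)
    where
    preimage : ∀ j → Σ Vec3 λ y → ∀ i → apply (M ^M k) y i ≡ basis j i
    preimage j = ^M-surjective {M} inv k (basis j)
    symmetric : ∀ i j → idM i j ≡ idM j i
    symmetric i0 i0 = refl
    symmetric i0 i1 = refl
    symmetric i0 i2 = refl
    symmetric i1 i0 = refl
    symmetric i1 i1 = refl
    symmetric i1 i2 = refl
    symmetric i2 i0 = refl
    symmetric i2 i1 = refl
    symmetric i2 i2 = refl

  eigen-^M : ∀ M c x → (∀ i → apply M x i ≡ c * x i) → ∀ k i → apply (M ^M k) x i ≡ c ^ k * x i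
  eigen-^M M c x e zero    i = trans (apply-idM x i) (sym (*-identityˡ _))
  eigen-^M M c x e (suc k) i = trans (sym (apply-∙M M (M ^M k) x i)) (trans (apply-cong {M} {M} (λ _ _ → refl) (eigen-^M M c x e k) i)
    (trans (apply-scale M (c ^ k) x i) (trans (cong (c ^ k *_) (e i)) (solve 3 (λ a c x → a :* (c :* x) := c :* a :* x) (c ^ k) c (x i)))))

  Singular-substForm⁻ : ∀ {Q M x} → (∀ z → Σ Vec3 λ y → ∀ i → apply M y i ≡ z i) → Singular (substForm Q M) x → Singular Q (apply M x)
  Singular-substForm⁻ {Q} {M} {x} surjective s = trans (sym (eval-substForm Q M x)) (proj₁ s) , λ i →
    let y , e = surjective (basis i) in
    trans (sym (polar-cong {Q} {Q} {apply M x} {apply M y} {apply M x} {basis i} (λ _ → refl) (λ _ → refl) e))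
      (trans (sym (polar-substForm Q M x y)) (Singular-polar {substForm Q M} {x} s y))

-- The Singer cycle: its eigenvector, its bundle and its orbits on degenerate forms

module Singer {q : ℕ} {p k : ℕ} (p-prime : Prime p) (q≡ : q ≡ p ℕ.^ suc k)
  (F : FiniteField q) (K : FiniteField (q ℕ.^ 3)) (ι-hom : FieldHom F K)
  (g : LinAlg.Mat F) (g-invertible : LinAlg.Invertible F g)
  (g-scalar : LinAlg.IsScalarMat F (LinAlg._^M_ F g (q ℕ.* q ℕ.+ q ℕ.+ 1)))
  (g-transitive : ∀ P Q → LinAlg.NonZero3 F P → LinAlg.NonZero3 F Q →
    Σ ℕ λ k → LinAlg.Prop3 F (LinAlg.apply F (LinAlg._^M_ F g k) P) Q) where

  open Planes {p = p} {k = k} p-prime q≡ F K ι-hom public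
  module FM = MatrixLemmas F
  module KM = MatrixLemmas K

  gK : Mat
  gK = ιM g

  private
    order : ℕ
    order = q ℕ.* q ℕ.+ q ℕ.+ 1

    c₀ : F.C
    c₀ = proj₁ g-scalar

    gⁿ : ∀ x i → F.apply (g F.^M order) x i ≡ c₀ F.* x i
    gⁿ x i = trans (F.apply-cong {g F.^M order} {λ i j → c₀ F.* F.idM i j} {x} {x} (proj₂ g-scalar) (λ _ → refl) i)
      (trans (F.solveFor (scalar ∷ vector ∷ vector ∷ []) (λ c₀ e x → (λ j → c₀ :* e j) :· x := c₀ :* (e :· x)) c₀ (F.idM i) x)
        (cong (c₀ F.*_) (F.apply-idM x i)))

    c₀≢0 : c₀ ≢ F.0#
    c₀≢0 c₀≡0 = let y , e = FM.^M-surjective {g} g-invertible order (F.basis i0) in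
      F.1≢0 (trans (sym (e i0)) (trans (gⁿ y i0) (trans (cong (F._* y i0) c₀≡0) (F.zeroˡ _))))

    gⁿᵐ : ∀ m x i → F.apply (g F.^M (m ℕ.* order)) x i ≡ c₀ F.^ m F.* x i
    gⁿᵐ zero    x i = trans (F.apply-idM x i) (sym (F.*-identityˡ _))
    gⁿᵐ (suc m) x i = trans (FM.apply-^M-+ g order (m ℕ.* order) x i) (trans (gⁿ (F.apply (g F.^M (m ℕ.* order)) x) i)
      (trans (cong (c₀ F.*_) (gⁿᵐ m x i)) (sym (F.*-assoc c₀ _ _))))

    q³≡ : q ℕ.^ 3 ≡ suc ((q ℕ.∸ 1) ℕ.* order)
    q³≡ = go q (ℕₚ.<-trans (ℕ.s≤s ℕ.z≤n) 1<q)
      where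
      open +-*-Solver renaming (solve to solveℕ; _:+_ to _+ℕ_; _:*_ to _*ℕ_; _:=_ to _=ℕ_; con to conℕ)
      go : ∀ q → 0 ℕ.< q → q ℕ.^ 3 ≡ suc ((q ℕ.∸ 1) ℕ.* (q ℕ.* q ℕ.+ q ℕ.+ 1))
      go (suc r) _ = solveℕ 1 (λ r → (conℕ 1 +ℕ r) *ℕ ((conℕ 1 +ℕ r) *ℕ ((conℕ 1 +ℕ r) *ℕ conℕ 1)) =ℕ
        conℕ 1 +ℕ r *ℕ ((conℕ 1 +ℕ r) *ℕ (conℕ 1 +ℕ r) +ℕ (conℕ 1 +ℕ r) +ℕ conℕ 1)) refl r

    -- As q³ = 1 + (q - 1)(q² + q + 1) and g^(q²+q+1) is a nonzero scalar c₀ of F, the power g^(q³)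
    -- is c₀^(q-1)g = g. This is the hypothesis of `power⇒eigen` over K, where every element is a
    -- root of X^(q³) - X.
    periodic : ∀ x i → F.apply (g F.^M (q ℕ.^ 3)) x i ≡ F.apply g x i
    periodic x i = trans (cong (λ m → F.apply (g F.^M m) x i) q³≡)
      (trans (sym (F.apply-∙M g (g F.^M ((q ℕ.∸ 1) ℕ.* order)) x i))
        (F.apply-cong {g} {g} (λ _ _ → refl) (λ j → trans (gⁿᵐ (q ℕ.∸ 1) x j)
          (trans (cong (F._* x j) (F.fermat* c₀≢0)) (F.*-identityˡ _))) i))

    open Eigenvector K 3 using (iterate; power⇒eigen; Eigen) renaming (Linear to LinearK)

    gK-linear : LinearK (apply gK)
    gK-linear = record
      { A-cong = λ {v} {w} e → apply-cong {gK} {gK} {v} {w} (λ _ _ → refl) e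
      ; A-+ = λ v w i → solveFor (vector ∷ vector ∷ vector ∷ []) (λ m v w → m :· (λ j → v j :+ w j) := m :· v :+ m :· w) (gK i) v w
      ; A-* = λ c v i → apply-scale gK c v i }

    iterated : ∀ m x i → iterate (apply gK) m (ιV x) i ≡ ι (F.apply (g F.^M m) x i)
    iterated zero    x i = cong ι (sym (F.apply-idM x i))
    iterated (suc m) x i = trans (apply-cong {gK} {gK} (λ _ _ → refl) (iterated m x) i)
      (trans (sym (ι-apply g (F.apply (g F.^M m) x) i)) (cong ι (F.apply-∙M g (g F.^M m) x i)))

    1<q³ : 1 ℕ.< q ℕ.^ 3
    1<q³ = ℕₚ.<-≤-trans 1<q (subst (ℕ._≤ q ℕ.^ 3) (ℕₚ.*-identityʳ q) (ℕₚ.*-monoʳ-≤ q (ℕₚ.m^n>0 q {{ℕ.>-nonZero (ℕₚ.<-trans (ℕ.s≤s ℕ.z≤n) 1<q)}} 2)))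

    eigen : Eigen gK-linear (allFin (q ℕ.^ 3))
    eigen = power⇒eigen gK-linear (q ℕ.^ 3) 1<q³ (allFin (q ℕ.^ 3)) (Listₚ.length-tabulate {n = q ℕ.^ 3} (λ i → i))
      (Uniqueₚ.allFin⁺ (q ℕ.^ 3)) (λ {r} _ → fermat r) (ιV (F.basis i0)) (i0 , ι-nonzero F.1≢0)
      (λ i → trans (iterated (q ℕ.^ 3) (F.basis i0) i) (trans (cong ι (periodic (F.basis i0) i)) (ι-apply g (F.basis i0) i)))

  opaque
    T : Vec3
    T = proj₁ eigen

    T≢0 : NonZero3 T
    T≢0 = proj₁ (proj₂ eigen)

    λ₀ : C
    λ₀ = proj₁ (proj₂ (proj₂ eigen))

    gT : ∀ i → apply gK T i ≡ λ₀ * T i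
    gT = proj₂ (proj₂ (proj₂ (proj₂ eigen)))

  -- an eigenvalue in F would give a point of PG(2,q) fixed by g
  λ₀-irrational : fr λ₀ ≢ λ₀
  λ₀-irrational fixed = no-fixed-point
    where
    f : F.C
    f = proj₁ (fr-fixed⇒ι fixed)
    ι-f : ι f ≡ λ₀
    ι-f = proj₂ (fr-fixed⇒ι fixed)
    row : Fin 3 → F.Vec3
    row i j = g i j F.- f F.* F.idM i j
    rowK-T : ∀ i → T · ιV (row i) ≡ 0#
    rowK-T i = trans (·-cong {T} {T} {ιV (row i)} {λ j → gK i j - λ₀ * idM i j} (λ _ → refl)
        (λ j → trans (ι-sub (g i j) (f F.* F.idM i j)) (cong (λ z → gK i j - z) (trans (ι-* f (F.idM i j)) (cong₂ _*_ ι-f (ι-basis i j))))))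
      (trans (solveFor (vector ∷ vector ∷ vector ∷ scalar ∷ []) (λ T m e l → T :· (λ j → m j :- l :* e j) := m :· T :- l :* (e :· T)) T (gK i) (idM i) λ₀)
        (x≡y⇒x-y≡0 (trans (gT i) (cong (λ₀ *_) (sym (apply-idM T i))))))
    rows-dependent : F.det (row i0) (row i1) (row i2) ≡ F.0#
    rows-dependent = decide (F.det (row i0) (row i1) (row i2) F.≟ F.0#)
      where
      decide : Dec (F.det (row i0) (row i1) (row i2) ≡ F.0#) → F.det (row i0) (row i1) (row i2) ≡ F.0#
      decide (yes z) = z
      decide (no ne) = ⊥-elim (not-zero {T} T≢0 (orthogonal⇒zero {ιV (row i0)} {ιV (row i1)} {ιV (row i2)}
            (λ z → ι-nonzero ne (trans (ι-det (row i0) (row i1) (row i2)) z)) T (rowK-T i0) (rowK-T i1) (rowK-T i2)))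
    -- A linear relation among the columns, rather than the rows, is a kernel vector of g - f.
    column : Fin 3 → F.Vec3
    column j i = row i j
    columns-dependent : F.det (column i0) (column i1) (column i2) ≡ F.0#
    columns-dependent = trans (F.solveFor (vector ∷ vector ∷ vector ∷ []) (λ u v w →
      detE (λ { i0 → u i0 ; i1 → v i0 ; i2 → w i0 }) (λ { i0 → u i1 ; i1 → v i1 ; i2 → w i1 }) (λ { i0 → u i2 ; i1 → v i2 ; i2 → w i2 }) := detE u v w)
      (row i0) (row i1) (row i2)) rows-dependent
    kernel : Σ F.Vec3 λ v → F.NonZero3 v × (∀ i → v i0 F.* column i0 i F.+ v i1 F.* column i1 i F.+ v i2 F.* column i2 i ≡ F.0#)
    kernel = F.det-zero⇒dependent (column i0) (column i1) (column i2) columns-dependent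
    v : F.Vec3
    v = proj₁ kernel
    gv : ∀ i → F.apply g v i ≡ f F.* v i
    gv i = F.linear₂ F.1# (proj₂ (proj₂ kernel) i) f (F.apply-idM v i)
      (F.solveFor (vector ∷ vector ∷ vector ∷ scalar ∷ scalar ∷ []) (λ m e v f vi → m :· v :- f :* vi :=
        :1 :* (v i0 :* (m i0 :- f :* e i0) :+ v i1 :* (m i1 :- f :* e i1) :+ v i2 :* (m i2 :- f :* e i2) :- :0) :+ f :* (e :· v :- vi))
        (g i) (F.idM i) v f (v i))
    multiple : ∀ x → F.NonZero3 x → Σ F.C λ s → ∀ i → x i ≡ s F.* v i
    multiple x x≢0 = let m , s , _ , e = g-transitive v x (proj₁ (proj₂ kernel)) x≢0 in s F.* (f F.^ m) , λ i →
      trans (e i) (trans (cong (s F.*_) (FM.eigen-^M g f v gv m i)) (sym (F.*-assoc s _ _)))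
    no-fixed-point : ⊥
    no-fixed-point =
      let s , e = multiple (F.basis i0) (i0 , F.1≢0)
          t , h = multiple (F.basis i1) (i1 , F.1≢0)
      in F.1≢0 (F.linear₃ F.1# (e i0) (F.- (s F.* v i1)) (h i0) (s F.* v i0) (h i1)
           (F.solve 4 (λ s t a b → :1 :- :0 := :1 :* (:1 :- s :* a) :+ (:- (s :* b)) :* (:0 :- t :* a) :+ (s :* a) :* (:1 :- t :* b)) s t (v i0) (v i1)))

  private
    λ₀≢λ₀″ : λ₀ ≢ λ₀ ″
    λ₀≢λ₀″ e = λ₀-irrational (trans (cong fr e) (fr³ λ₀))

    λ₀′≢λ₀″ : λ₀ ′ ≢ λ₀ ″
    λ₀′≢λ₀″ e = λ₀-irrational (sym (fr-injective e))

    T₁′ T₂′ : Vec3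
    T₁′ = frV T
    T₂′ = frV (frV T)

    fr-gK : ∀ x {l} → (∀ i → apply gK x i ≡ l * x i) → ∀ i → apply gK (frV x) i ≡ l ′ * frV x i
    fr-gK x {l} e i = trans (·-cong {gK i} {frV (gK i)} {frV x} {frV x} (λ j → sym (fr-ι (g i j))) (λ _ → refl))
      (trans (sym (fr-· (gK i) x)) (trans (cong fr (e i)) (fr-* l (x i))))

    gT₁ : ∀ i → apply gK T₁′ i ≡ λ₀ ′ * T₁′ i
    gT₁ = fr-gK T gT

    gT₂ : ∀ i → apply gK T₂′ i ≡ λ₀ ″ * T₂′ i
    gT₂ = fr-gK T₁′ gT₁

    gK-combine : ∀ r s t i → apply gK (combine r s t T T₁′ T₂′) i ≡ combine (r * λ₀) (s * λ₀ ′) (t * λ₀ ″) T T₁′ T₂′ i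
    gK-combine r s t i = trans (KM.apply-combine gK r s t T T₁′ T₂′ i)
      (trans (cong₂ _+_ (cong₂ _+_ (cong (r *_) (gT i)) (cong (s *_) (gT₁ i))) (cong (t *_) (gT₂ i)))
        (cong₂ _+_ (cong₂ _+_ (sym (*-assoc r _ _)) (sym (*-assoc s _ _))) (sym (*-assoc t _ _))))

    apply-zero : ∀ {x} → (∀ i → x i ≡ 0#) → ∀ i → apply gK x i ≡ 0#
    apply-zero {x} z i = trans (solveFor (vector ∷ vector ∷ []) (λ m x → m :· x := x :· m) (gK i) x) (·-zero {x} {gK i} z)

    -- The coefficients mn, -(m + n), 1 of (X - m)(X - n) combine the three equations into one
    -- without b and c.
    vandermonde : ∀ {l m n a b c} → l ≢ m → l ≢ n → a + b + c ≡ 0# → a * l + b * m + c * n ≡ 0# →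
      a * l * l + b * m * m + c * n * n ≡ 0# → a ≡ 0#
    vandermonde {l} {m} {n} {a} {b} {c} l≢m l≢n e₀ e₁ e₂ = *-cancelˡ-0 (*-nonzero (λ z → l≢m (x-y≡0⇒x≡y z)) (λ z → l≢n (x-y≡0⇒x≡y z)))
      (linear₃ (m * n) e₀ (- (m + n)) e₁ 1# e₂
        (solve 6 (λ l m n a b c → (l :- m) :* (l :- n) :* a :- :0 := (m :* n) :* (a :+ b :+ c :- :0) :+ (:- (m :+ n)) :* (a :* l :+ b :* m :+ c :* n :- :0)
          :+ :1 :* (a :* l :* l :+ b :* m :* m :+ c :* n :* n :- :0)) l m n a b c))

  -- T, T′, T″ are eigenvectors for the distinct eigenvalues λ₀, λ₀′, λ₀″. A relation among them and
  -- its images under g and g² form a Vandermonde system.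
  T-independent : Independent T
  T-independent d≡0 = let c , c≢0 , e = det-zero⇒dependent T T₁′ T₂′ d≡0 in absurd c c≢0 e
    where
    absurd : ∀ c → NonZero3 c → (∀ i → combine (c i0) (c i1) (c i2) T T₁′ T₂′ i ≡ 0#) → ⊥
    absurd c c≢0 e₀ = not-zero {c} c≢0 (∀Fin3
        (cancel T≢0 λ i → vandermonde (λ z → λ₀-irrational (sym z)) λ₀≢λ₀″ (e₀ i) (e₁′ i) (e₂′ i))
        (cancel (frV-nonzero {T} T≢0) λ i → vandermonde λ₀-irrational λ₀′≢λ₀″ (rotate (e₀ i)) (rotate (e₁′ i)) (rotate (e₂′ i)))
        (cancel (frV-nonzero {T₁′} (frV-nonzero {T} T≢0)) λ i → vandermonde (λ z → λ₀≢λ₀″ (sym z)) (λ z → λ₀′≢λ₀″ (sym z))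
          (rotate′ (e₀ i)) (rotate′ (e₁′ i)) (rotate′ (e₂′ i))))
      where
      cancel : ∀ {x v} → NonZero3 v → (∀ i → x * v i ≡ 0#) → x ≡ 0#
      cancel (i , n) h = *-cancelʳ-0 n (h i)
      e₁ : ∀ i → combine (c i0 * λ₀) (c i1 * λ₀ ′) (c i2 * λ₀ ″) T T₁′ T₂′ i ≡ 0#
      e₁ i = trans (sym (gK-combine (c i0) (c i1) (c i2) i)) (apply-zero {combine (c i0) (c i1) (c i2) T T₁′ T₂′} e₀ i)
      e₂ : ∀ i → combine (c i0 * λ₀ * λ₀) (c i1 * λ₀ ′ * λ₀ ′) (c i2 * λ₀ ″ * λ₀ ″) T T₁′ T₂′ i ≡ 0#
      e₂ i = trans (sym (gK-combine (c i0 * λ₀) (c i1 * λ₀ ′) (c i2 * λ₀ ″) i)) (apply-zero {combine (c i0 * λ₀) (c i1 * λ₀ ′) (c i2 * λ₀ ″) T T₁′ T₂′} e₁ i)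
      e₁′ : ∀ i → c i0 * T i * λ₀ + c i1 * T₁′ i * λ₀ ′ + c i2 * T₂′ i * λ₀ ″ ≡ 0#
      e₁′ i = trans (solve 9 (λ a b c x y z l m n → a :* x :* l :+ b :* y :* m :+ c :* z :* n := a :* l :* x :+ b :* m :* y :+ c :* n :* z)
        (c i0) (c i1) (c i2) (T i) (T₁′ i) (T₂′ i) λ₀ (λ₀ ′) (λ₀ ″)) (e₁ i)
      e₂′ : ∀ i → c i0 * T i * λ₀ * λ₀ + c i1 * T₁′ i * λ₀ ′ * λ₀ ′ + c i2 * T₂′ i * λ₀ ″ * λ₀ ″ ≡ 0#
      e₂′ i = trans (solve 9 (λ a b c x y z l m n → a :* x :* l :* l :+ b :* y :* m :* m :+ c :* z :* n :* n := a :* l :* l :* x :+ b :* m :* m :* y :+ c :* n :* n :* z)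
        (c i0) (c i1) (c i2) (T i) (T₁′ i) (T₂′ i) λ₀ (λ₀ ′) (λ₀ ″)) (e₂ i)
      rotate : ∀ {x y z} → x + y + z ≡ 0# → y + x + z ≡ 0#
      rotate {x} {y} {z} e = trans (solve 3 (λ x y z → y :+ x :+ z := x :+ y :+ z) x y z) e
      rotate′ : ∀ {x y z} → x + y + z ≡ 0# → z + x + y ≡ 0#
      rotate′ {x} {y} {z} e = trans (solve 3 (λ x y z → z :+ x :+ y := x :+ y :+ z) x y z) e

  open DegeneratePlanes {p = p} {k = k} p-prime q≡ F K ι-hom T T-independent public using
    ( X; Y; Z; α; β; expand; X-cong; X-combine; Y-combine; Z-combine; X-point; Y-point; Z-point; pointOf; X-pointOf; pointOf-nonzero
    ; coefficients; coefficients-sum; basis-independent; eval-frame; value; coordinates-injective; coordinates-zero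
    ; α-cong; β-cong; β-zero; α-+; β-+; α-*; β-*; formWith; α-formWith; β-formWith; Linear
    ; twist; twist-linear; scale-linear; fr²-+; fr²-*; Plane; plane-subspace; plane-scale
    ; planes-meet; plane-singular-meet; plane-through-meet; combine-nonzero; module Degenerate; through-nonsingular; through-plane; through-meet)

  X-gK : ∀ x → X (apply gK x) ≡ λ₀ * X x
  X-gK x = trans (X-cong {apply gK x} {combine (X x * λ₀) (Y x * λ₀ ′) (Z x * λ₀ ″) T T₁′ T₂′} (moved x))
      (trans (X-combine (X x * λ₀) (Y x * λ₀ ′) (Z x * λ₀ ″)) (*-comm _ _))
    where
    moved : ∀ x i → apply gK x i ≡ combine (X x * λ₀) (Y x * λ₀ ′) (Z x * λ₀ ″) T T₁′ T₂′ i
    moved x i = trans (apply-cong {gK} {gK} {x} {combine (X x) (Y x) (Z x) T T₁′ T₂′} (λ _ _ → refl) (expand x) i) (gK-combine (X x) (Y x) (Z x) i)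

  λ₀≢0 : λ₀ ≢ 0#
  λ₀≢0 λ≡0 = X-point {F.basis i0} (i0 , F.1≢0)
    (trans (X-cong {ιV (F.basis i0)} {apply gK (ιV y)} (λ i → trans (cong ι (sym (gy i))) (ι-apply g y i)))
      (trans (X-gK (ιV y)) (trans (cong (_* X (ιV y)) λ≡0) (zeroˡ _))))
    where
    y : F.Vec3
    y = F.apply (proj₁ g-invertible) (F.basis i0)
    gy : ∀ i → F.apply g y i ≡ F.basis i0 i
    gy = F.apply-inverse {g} {proj₁ g-invertible} (proj₂ g-invertible) (F.basis i0)

  X-g^ : ∀ m x → X (ιV (F.apply (g F.^M m) x)) ≡ λ₀ ^ m * X (ιV x)
  X-g^ zero    x = trans (X-cong {ιV (F.apply F.idM x)} {ιV x} (λ i → cong ι (F.apply-idM x i))) (sym (*-identityˡ _))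
  X-g^ (suc m) x = trans (X-cong {ιV (F.apply (g F.^M suc m) x)} {apply gK (ιV (F.apply (g F.^M m) x))}
      (λ i → trans (cong ι (sym (F.apply-∙M g (g F.^M m) x i))) (ι-apply g (F.apply (g F.^M m) x) i)))
    (trans (X-gK (ιV (F.apply (g F.^M m) x))) (trans (cong (λ₀ *_) (X-g^ m x)) (sym (*-assoc λ₀ _ _))))

  apply-g^-nonzero : ∀ m {x} → F.NonZero3 x → F.NonZero3 (F.apply (g F.^M m) x)
  apply-g^-nonzero m {x} x≢0 = [ id , (λ z → ⊥-elim (*-nonzero (^-nonzero m λ₀≢0) (X-point {x} x≢0)
      (trans (sym (X-g^ m x)) (trans (X-cong {ιV (F.apply (g F.^M m) x)} {zero3} (λ i → trans (cong ι (z i)) ι-0))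
        (trans (cong (det T T₁′ T₂′ ⁻¹ *_) (·-zero {zero3} {cross (frV T) (frV (frV T))} (λ _ → refl))) (zeroʳ _)))))) ]′ (F.nonzero? (F.apply (g F.^M m) x))

  eval-ι-substForm : ∀ Q M x → eval (ιF (F.substForm Q M)) x ≡ eval (ιF Q) (apply (ιM M) x)
  eval-ι-substForm Q M x = trans (eval-cong {ιF (F.substForm Q M)} {substForm (ιF Q) (ιM M)} {x} {x} (ιF-substForm Q M) (λ _ → refl)) (eval-substForm (ιF Q) (ιM M) x)

  polar-ι-substForm : ∀ Q M x y → polar (ιF (F.substForm Q M)) x y ≡ polar (ιF Q) (apply (ιM M) x) (apply (ιM M) y)
  polar-ι-substForm Q M x y = trans (polar-cong {ιF (F.substForm Q M)} {substForm (ιF Q) (ιM M)} {x} {y} {x} {y} (ιF-substForm Q M) (λ _ → refl) (λ _ → refl))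
    (polar-substForm (ιF Q) (ιM M) x y)

  private
    g^T : ∀ m i → apply (ιM (g F.^M m)) T i ≡ λ₀ ^ m * T i
    g^T zero i = trans (·-cong {ιV (F.idM i)} {idM i} {T} {T} (ι-basis i) (λ _ → refl)) (trans (apply-idM T i) (sym (*-identityˡ _)))
    g^T (suc m) i = trans (·-cong {ιV ((g F.∙M (g F.^M m)) i)} {(gK ∙M ιM (g F.^M m)) i} {T} {T} (λ j → ι-· (g i) (λ k → (g F.^M m) k j)) (λ _ → refl))
      (trans (sym (apply-∙M gK (ιM (g F.^M m)) T i)) (trans (apply-cong {gK} {gK} (λ _ _ → refl) (g^T m) i)
        (trans (apply-scale gK (λ₀ ^ m) T i) (trans (cong (λ₀ ^ m *_) (gT i)) (solve 3 (λ a b c → a :* (b :* c) := b :* a :* c) (λ₀ ^ m) λ₀ (T i))))))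

    g^T₁ : ∀ m i → apply (ιM (g F.^M m)) T₁′ i ≡ (λ₀ ^ m) ′ * T₁′ i
    g^T₁ m i = trans (·-cong {ιV ((g F.^M m) i)} {frV (ιV ((g F.^M m) i))} {T₁′} {T₁′} (λ j → sym (fr-ι ((g F.^M m) i j))) (λ _ → refl))
      (trans (sym (fr-· (ιV ((g F.^M m) i)) T)) (trans (cong fr (g^T m i)) (fr-* (λ₀ ^ m) (T i))))

  α-g^ : ∀ Q m → α (F.substForm Q (g F.^M m)) ≡ λ₀ ^ m * λ₀ ^ m * α Q
  α-g^ Q m = trans (eval-ι-substForm Q (g F.^M m) T) (trans (eval-cong {ιF Q} {ιF Q} {apply (ιM (g F.^M m)) T} {(λ₀ ^ m) *V T} (λ _ → refl) (g^T m))
    (solveFor (form ∷ vector ∷ scalar ∷ []) (λ a x c → evalE a (λ i → c :* x i) := c :* c :* evalE a x) (ιF Q) T (λ₀ ^ m)))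

  β-g^ : ∀ Q m → β (F.substForm Q (g F.^M m)) ≡ λ₀ ^ m * (λ₀ ^ m) ′ * β Q
  β-g^ Q m = trans (polar-ι-substForm Q (g F.^M m) T T₁′)
    (trans (polar-cong {ιF Q} {ιF Q} {apply (ιM (g F.^M m)) T} {apply (ιM (g F.^M m)) T₁′} {(λ₀ ^ m) *V T} {((λ₀ ^ m) ′) *V T₁′} (λ _ → refl) (g^T m) (g^T₁ m))
      (solveFor (form ∷ vector ∷ vector ∷ scalar ∷ scalar ∷ []) (λ a x y c d → polarE a (λ i → c :* x i) (λ i → d :* y i) := c :* d :* polarE a x y)
        (ιF Q) T T₁′ (λ₀ ^ m) ((λ₀ ^ m) ′)))

  -- The eigenvalues are distinct, so at a fixed point of g at most one of X, Y, Z is nonzero and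
  -- all mixed products vanish. Hence the condition that defines the bundle, which speaks of all
  -- fixed points, follows from the one at T.
  through-fixed-points : ∀ {Q} → Through T Q → ∀ R → NonZero3 R → Prop3 R (apply gK R) → eval (ιF Q) R ≡ 0#
  through-fixed-points {Q} TQ R R≢0 (μ , _ , gR) = trans (eval-frame Q R) (trans
      (cong₂ _+_ (cong₂ _+_ (cong₂ _+_ (cong₂ _+_ (cong₂ _+_ (cong (_* (x * x)) TQ) (cong (_* (y * y)) (trans (cong fr TQ) fr-0)))
        (cong (_* (z * z)) (trans (cong fr (trans (cong fr TQ) fr-0)) fr-0))) (cong (β Q *_) xy≡0)) (cong (β Q ′ *_) yz≡0)) (cong (β Q ″ *_) zx≡0))
      (solve 6 (λ x y z b c d → :0 :* x :+ :0 :* y :+ :0 :* z :+ b :* :0 :+ c :* :0 :+ d :* :0 := :0) (x * x) (y * y) (z * z) (β Q) (β Q ′) (β Q ″)))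
    where
    x y z : C
    x = X R
    y = Y R
    z = Z R
    product-zero : ∀ {a b l m} → l ≢ m → l * a ≡ μ * a → m * b ≡ μ * b → a * b ≡ 0#
    product-zero {a} {b} {l} {m} l≢m e f = *-cancelˡ-0 {l - m} (λ w → l≢m (x-y≡0⇒x≡y w))
      (linear₂ b e (- a) f (solve 5 (λ a b l m u → (l :- m) :* (a :* b) :- :0 := b :* (l :* a :- u :* a) :+ (:- a) :* (m :* b :- u :* b)) a b l m μ))
    moved : ∀ i → combine (x * λ₀) (y * λ₀ ′) (z * λ₀ ″) T T₁′ T₂′ i ≡ combine (μ * x) (μ * y) (μ * z) T T₁′ T₂′ i
    moved i = trans (sym (trans (apply-cong {gK} {gK} {R} {combine x y z T T₁′ T₂′} (λ _ _ → refl) (expand R) i) (gK-combine x y z i)))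
      (trans (gR i) (trans (cong (μ *_) (expand R i)) (solve 7 (λ u x y z a b c → u :* (x :* a :+ y :* b :+ z :* c) := u :* x :* a :+ u :* y :* b :+ u :* z :* c)
        μ x y z (T i) (T₁′ i) (T₂′ i))))
    det-moved : ∀ u v → det (combine (x * λ₀) (y * λ₀ ′) (z * λ₀ ″) T T₁′ T₂′) u v ≡ det (combine (μ * x) (μ * y) (μ * z) T T₁′ T₂′) u v
    det-moved u v = det-cong {combine (x * λ₀) (y * λ₀ ′) (z * λ₀ ″) T T₁′ T₂′} {combine (μ * x) (μ * y) (μ * z) T T₁′ T₂′} {u} {u} {v} {v} moved (λ _ → refl) (λ _ → refl)
    ex : λ₀ * x ≡ μ * x
    ex = trans (*-comm λ₀ x) (trans (sym (X-combine (x * λ₀) (y * λ₀ ′) (z * λ₀ ″))) (trans (cong (det T T₁′ T₂′ ⁻¹ *_) (det-moved T₁′ T₂′)) (X-combine (μ * x) (μ * y) (μ * z))))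
    ey : λ₀ ′ * y ≡ μ * y
    ey = trans (*-comm (λ₀ ′) y) (trans (sym (Y-combine (x * λ₀) (y * λ₀ ′) (z * λ₀ ″))) (trans (cong (det T T₁′ T₂′ ⁻¹ *_) (det-moved T₂′ T)) (Y-combine (μ * x) (μ * y) (μ * z))))
    ez : λ₀ ″ * z ≡ μ * z
    ez = trans (*-comm (λ₀ ″) z) (trans (sym (Z-combine (x * λ₀) (y * λ₀ ′) (z * λ₀ ″))) (trans (cong (det T T₁′ T₂′ ⁻¹ *_) (det-moved T T₁′)) (Z-combine (μ * x) (μ * y) (μ * z))))
    xy≡0 : x * y ≡ 0#
    xy≡0 = product-zero (λ e → λ₀-irrational (sym e)) ex ey
    yz≡0 : y * z ≡ 0#
    yz≡0 = product-zero λ₀′≢λ₀″ ey ez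
    zx≡0 : z * x ≡ 0#
    zx≡0 = product-zero (λ e → λ₀≢λ₀″ (sym e)) ez ex

  T-fixed : Prop3 T (apply gK T)
  T-fixed = λ₀ , λ₀≢0 , gT

  -- Substitution of M moves the condition at T to the condition at NT, where N inverts M. A nonzero
  -- form with this condition is itself a generator, so the span adds only the zero form.
  conic-span : ∀ {InB : F.Form → Set} → (∀ {Q} → Through T Q → F.NonZeroForm Q → InB Q) → (∀ {Q} → InB Q → Through T Q) →
    ∀ {M N} → (∀ i j → (M F.∙M N) i j ≡ F.idM i j) →
    F._≐_ (F.Span (λ v → Σ F.Form λ Q → InB Q × v F.≗F F.substForm Q M)) (Through (apply (ιM N) T))
  conic-span {InB} inB⁺ inB⁻ {M} {N} MN R = to , from
    where
    S : Vec3
    S = apply (ιM N) T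
    MS : ∀ i → apply (ιM M) S i ≡ T i
    MS = apply-inverse {ιM M} {ιM N} (λ i j → trans (sym (ι-· (M i) (λ k → N k j))) (trans (cong ι (MN i j)) (ι-basis i j))) T
    linear-through : F.IsSubspace (Through S)
    linear-through = record
      { respects = λ {Q} {R} e z → trans (sym (eval-cong {ιF Q} {ιF R} {S} {S} (λ p → cong ι (e p)) (λ _ → refl))) z
      ; has-zero = trans (eval-cong {ιF F.zeroF} {zeroF} {S} {S} (λ _ → ι-0) (λ _ → refl)) (eval-zeroF S)
      ; has-+ = λ {Q} {R} u v → trans (eval-cong {ιF (Q F.+F R)} {ιF Q +F ιF R} {S} {S} (λ p → ι-+ (Q p) (R p)) (λ _ → refl))
          (trans (eval-+F (ιF Q) (ιF R) S) (trans (cong₂ _+_ u v) (+-identityʳ 0#)))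
      ; has-* = λ c {Q} u → trans (eval-cong {ιF (F.scaleF c Q)} {scaleF (ι c) (ιF Q)} {S} {S} (λ p → ι-* c (Q p)) (λ _ → refl))
          (trans (eval-scaleF (ι c) (ιF Q) S) (trans (cong (ι c *_) u) (zeroʳ _))) }
    to : F.Span (λ v → Σ F.Form λ Q → InB Q × v F.≗F F.substForm Q M) R → Through S R
    to = F.IsSubspace.span⊆ linear-through λ v (Q , Q∈ , e) →
      F.IsSubspace.respects linear-through {F.substForm Q M} {v} (λ p → sym (e p))
        (trans (eval-ι-substForm Q M S) (trans (eval-cong {ιF Q} {ιF Q} {apply (ιM M) S} {T} (λ _ → refl) MS) (inB⁻ Q∈)))
    Q′ : F.Form
    Q′ = F.substForm R N
    R≗ : R F.≗F F.substForm Q′ M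
    R≗ = F.form-ext R (F.substForm Q′ M) λ x → sym (trans (F.eval-substForm Q′ M x) (trans (F.eval-substForm R N (F.apply M x))
      (F.eval-cong {R} {R} {F.apply N (F.apply M x)} {x} (λ _ → refl) (FM.left-inverse {M} {N} MN x))))
    from : Through S R → F.Span (λ v → Σ F.Form λ Q → InB Q × v F.≗F F.substForm Q M) R
    from SR = [ (λ Q′≢0 → (F.1# , R) ∷ [] , (Q′ , inB⁺ {Q′} (trans (eval-ι-substForm R N T) SR) Q′≢0 , R≗) All.∷ All.[] ,
                  λ p → sym (trans (F.+-identityʳ _) (F.*-identityˡ _)))
              , (λ z → [] , All.[] , λ p → trans (R≗ p) (F.form-ext (F.substForm Q′ M) F.zeroF (λ x → trans (F.eval-substForm Q′ M x)
                  (trans (F.eval-cong {Q′} {F.zeroF} {F.apply M x} {F.apply M x} z (λ _ → refl)) (trans (F.eval-zeroF (F.apply M x)) (sym (F.eval-zeroF x))))) p)) ]′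
              (F.nonzeroForm? Q′)

  inverse-image-independent : ∀ {M N} → (∀ i j → (M F.∙M N) i j ≡ F.idM i j) → Independent (apply (ιM N) T)
  inverse-image-independent {M} {N} MN d≡0 = let c , c≢0 , e = det-zero⇒dependent S (frV S) (frV (frV S)) d≡0 in
      not-zero {combine (c i0) (c i1) (c i2) T T₁′ T₂′} (combine-nonzero {c i0} {c i1} {c i2} (nonzero-vec c c≢0)) (λ i →
        trans (cong₂ _+_ (cong₂ _+_ (cong (c i0 *_) (sym (MS i))) (cong (c i1 *_) (sym (MS₁ i)))) (cong (c i2 *_) (sym (MS₂ i))))
          (trans (sym (KM.apply-combine (ιM M) (c i0) (c i1) (c i2) S (frV S) (frV (frV S)) i))
            (trans (solveFor (vector ∷ vector ∷ []) (λ m x → m :· x := x :· m) (ιM M i) (combine (c i0) (c i1) (c i2) S (frV S) (frV (frV S))))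
              (·-zero {combine (c i0) (c i1) (c i2) S (frV S) (frV (frV S))} {ιM M i} e))))
    where
    S : Vec3
    S = apply (ιM N) T
    nonzero-vec : ∀ c → NonZero3 c → NonZero3 (vec3 (c i0) (c i1) (c i2))
    nonzero-vec c (i0 , n) = i0 , n
    nonzero-vec c (i1 , n) = i1 , n
    nonzero-vec c (i2 , n) = i2 , n
    MS : ∀ i → apply (ιM M) S i ≡ T i
    MS = apply-inverse {ιM M} {ιM N} (λ i j → trans (sym (ι-· (M i) (λ k → N k j))) (trans (cong ι (MN i j)) (ι-basis i j))) T
    conj : ∀ x i → apply (ιM M) (frV x) i ≡ fr (apply (ιM M) x i)
    conj x i = trans (·-cong {ιV (M i)} {frV (ιV (M i))} {frV x} {frV x} (λ j → sym (fr-ι (M i j))) (λ _ → refl)) (sym (fr-· (ιV (M i)) x))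
    MS₁ : ∀ i → apply (ιM M) (frV S) i ≡ T₁′ i
    MS₁ i = trans (conj S i) (cong fr (MS i))
    MS₂ : ∀ i → apply (ιM M) (frV (frV S)) i ≡ T₂′ i
    MS₂ i = trans (conj (frV S) i) (cong fr (MS₁ i))

  -- T and S are both F-bases of K, so a matrix over F takes one to the other.
  moving-matrix : ∀ {S} → Independent S → Σ F.Mat λ M → Σ F.Mat λ N → (∀ i j → (M F.∙M N) i j ≡ F.idM i j) × (∀ i → apply (ιM N) T i ≡ S i)
  moving-matrix {S} S-independent = M , N , MN , NT
    where
    module S = Frame S S-independent
    M N : F.Mat
    M i = S.coefficients (T i)
    N i = coefficients (S i)
    MS : ∀ i → apply (ιM M) S i ≡ T i
    MS i = S.coefficients-sum (T i)
    NT : ∀ i → apply (ιM N) T i ≡ S i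
    NT i = coefficients-sum (S i)
    MN : ∀ i j → (M F.∙M N) i j ≡ F.idM i j
    MN i j = F.x-y≡0⇒x≡y (basis-independent (λ k → (M F.∙M N) i k F.- F.idM i k) (trans
      (·-cong {ιV (λ k → (M F.∙M N) i k F.- F.idM i k)} {λ k → (ιM M ∙M ιM N) i k - idM i k} {T} {T}
        (λ k → trans (ι-sub _ _) (cong₂ _-_ (ι-· (M i) (λ l → N l k)) (ι-basis i k))) (λ _ → refl))
      (trans (solveFor (vector ∷ vector ∷ vector ∷ []) (λ a b T → (λ k → a k :- b k) :· T := a :· T :- b :· T) ((ιM M ∙M ιM N) i) (idM i) T)
        (x≡y⇒x-y≡0 (trans (sym (apply-∙M (ιM M) (ιM N) T i)) (trans (apply-cong {ιM M} {ιM M} (λ _ _ → refl) NT i)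
          (trans (MS i) (sym (apply-idM T i)))))))) j)

  -- All that the orbit planes require of bi-lines or of imaginary bi-lines, so that Π_e and Π_i are
  -- handled at once.
  record DegenerateClass (Member : F.Form → Set) (CenteredAt : F.Vec3 → F.Form → Set) : Set where
    field
      nonrepeated : ∀ {Q} → Member Q → F.NonRepeated Q
      center      : ∀ {Q} → Member Q → Σ F.Vec3 λ A → F.NonZero3 A × F.Singular Q A
      translate   : ∀ {Q} → Member Q → ∀ m → Member (F.substForm Q (g F.^M m))
      centered⁺   : ∀ {Q A} → Member Q → F.Singular Q A → CenteredAt A Q
      centered⁻   : ∀ {Q A} → CenteredAt A Q → F.Singular Q A

  -- The generating set in `InΠe` and `InΠi`, with the kind of bi-line left open.
  OrbitPart : (F.Vec3 → F.Form → Set) → F.Form → F.Form → F.Subset6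
  OrbitPart CenteredAt B Cn v = Σ ℕ λ m → v F.≗F F.substForm B (g F.^M m) ×
    Σ F.Vec3 λ A → (F.NonZero3 A × F.eval Cn A ≡ F.0#) × CenteredAt A (F.substForm B (g F.^M m))

  private
    wedge-det : ∀ (u v w : Vec3) i → let t = λ j → u j + v j + w j ; n = next i ; m = next n in
      (u n * t i - u i * t n) * (v m * t i - v i * t m) - (u m * t i - u i * t m) * (v n * t i - v i * t n) ≡ t i * det u v w
    wedge-det u v w i0 = solveFor (vector ∷ vector ∷ vector ∷ []) (λ u v w → let t = λ j → u j :+ v j :+ w j in
      (u i1 :* t i0 :- u i0 :* t i1) :* (v i2 :* t i0 :- v i0 :* t i2) :- (u i2 :* t i0 :- u i0 :* t i2) :* (v i1 :* t i0 :- v i0 :* t i1) := t i0 :* detE u v w) u v w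
    wedge-det u v w i1 = solveFor (vector ∷ vector ∷ vector ∷ []) (λ u v w → let t = λ j → u j :+ v j :+ w j in
      (u i2 :* t i1 :- u i1 :* t i2) :* (v i0 :* t i1 :- v i1 :* t i0) :- (u i0 :* t i1 :- u i1 :* t i0) :* (v i2 :* t i1 :- v i1 :* t i2) := t i1 :* detE u v w) u v w
    wedge-det u v w i2 = solveFor (vector ∷ vector ∷ vector ∷ []) (λ u v w → let t = λ j → u j :+ v j :+ w j in
      (u i0 :* t i2 :- u i2 :* t i0) :* (v i1 :* t i2 :- v i2 :* t i1) :- (u i1 :* t i2 :- u i2 :* t i1) :* (v i0 :* t i2 :- v i2 :* t i0) := t i2 :* detE u v w) u v w

  -- Some Tr(T_i) is nonzero since T, T′, T″ are independent. The elements T_j Tr(T_i) - T_i Tr(T_j)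
  -- for the two other indices j have trace zero, and by `wedge-det` the required determinant is
  -- Tr(T_i) det(T, T′, T″).
  trace-zero-pair : Σ C λ z₁ → Σ C λ z₂ → Tr z₁ ≡ 0# × Tr z₂ ≡ 0# × z₁ * z₂ ′ - z₂ * z₁ ′ ≢ 0#
  trace-zero-pair = [ build , (λ z → ⊥-elim (not-zero {combine 1# 1# 1# T T₁′ T₂′} (combine-nonzero {1#} {1#} {1#} (i0 , 1≢0))
      (λ i → trans (solve 3 (λ x y z → :1 :* x :+ :1 :* y :+ :1 :* z := x :+ y :+ z) (T i) (T₁′ i) (T₂′ i)) (z i)))) ]′ (nonzero? (λ i → Tr (T i)))
    where
    build : NonZero3 (λ i → Tr (T i)) → Σ C λ z₁ → Σ C λ z₂ → Tr z₁ ≡ 0# × Tr z₂ ≡ 0# × z₁ * z₂ ′ - z₂ * z₁ ′ ≢ 0#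
    build (i , tᵢ≢0) = ζ (next i) , ζ (next (next i)) , Tr-ζ (next i) , Tr-ζ (next (next i)) , λ e →
        *-nonzero tᵢ≢0 T-independent (trans (sym (wedge-det T T₁′ T₂′ i))
          (trans (cong₂ (λ a b → ζ (next i) * a - ζ (next (next i)) * b) (sym (fr-ζ (next (next i)))) (sym (fr-ζ (next i)))) e))
      where
      t : Fin 3 → C
      t j = Tr (T j)
      ζ : Fin 3 → C
      ζ j = T j * t i - T i * t j
      fr-ζ : ∀ j → fr (ζ j) ≡ T₁′ j * t i - T₁′ i * t j
      fr-ζ j = trans (fr-minor (T j) (t i) (T i) (t j)) (cong₂ _-_ (cong (T₁′ j *_) (fr-Tr (T i))) (cong (T₁′ i *_) (fr-Tr (T j))))
      Tr-ζ : ∀ j → Tr (ζ j) ≡ 0#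
      Tr-ζ j = trans (cong₂ (λ a b → ζ j + a + b) (fr-ζ j) (trans (cong fr (fr-ζ j)) (trans (fr-minor (T₁′ j) (t i) (T₁′ i) (t j))
          (cong₂ _-_ (cong (T₂′ j *_) (fr-Tr (T i))) (cong (T₂′ i *_) (fr-Tr (T j)))))))
        (solve 6 (λ x x′ x″ y y′ y″ → (x :* (y :+ y′ :+ y″) :- y :* (x :+ x′ :+ x″)) :+ (x′ :* (y :+ y′ :+ y″) :- y′ :* (x :+ x′ :+ x″))
          :+ (x″ :* (y :+ y′ :+ y″) :- y″ :* (x :+ x′ :+ x″)) := :0) (T j) (T₁′ j) (T₂′ j) (T i) (T₁′ i) (T₂′ i))

  -- For z₁ = u and z₂ = v, the determinant of (uu′, uv′ + vu′, vv′) and its two conjugates is the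
  -- norm of uv′ - vu′. So the three products form a basis of K over F.
  products-span : ∀ {z₁ z₂} → z₁ * z₂ ′ - z₂ * z₁ ′ ≢ 0# → ∀ h → Σ F.Vec3 λ r →
    h ≡ ι (r i0) * (z₁ * z₁ ′) + (ι (r i1) * (z₁ * z₂ ′ + z₂ * z₁ ′) + ι (r i2) * (z₂ * z₂ ′))
  products-span {u} {v} d≢0 h = E.coefficients h , sym (E.coefficients-sum h)
    where
    e e′ e″ : Vec3
    e  = vec3 (u * u ′) (u * v ′ + v * u ′) (v * v ′)
    e′ = vec3 (u ′ * u ″) (u ′ * v ″ + v ′ * u ″) (v ′ * v ″)
    e″ = vec3 (u ″ * u) (u ″ * v + v ″ * u) (v ″ * v)
    fr-e : ∀ i → fr (e i) ≡ e′ i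
    fr-e i0 = fr-* u (u ′)
    fr-e i1 = trans (fr-+ _ _) (cong₂ _+_ (fr-* u (v ′)) (fr-* v (u ′)))
    fr-e i2 = fr-* v (v ′)
    fr-e′ : ∀ i → fr (fr (e i)) ≡ e″ i
    fr-e′ i0 = trans (cong fr (fr-e i0)) (trans (fr-* (u ′) (u ″)) (cong (u ″ *_) (fr³ u)))
    fr-e′ i1 = trans (cong fr (fr-e i1)) (trans (fr-+ _ _) (cong₂ _+_ (trans (fr-* (u ′) (v ″)) (cong (u ″ *_) (fr³ v))) (trans (fr-* (v ′) (u ″)) (cong (v ″ *_) (fr³ u)))))
    fr-e′ i2 = trans (cong fr (fr-e i2)) (trans (fr-* (v ′) (v ″)) (cong (v ″ *_) (fr³ v)))
    d : C
    d = u * v ′ - v * u ′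
    d′ : d ′ ≡ u ′ * v ″ - v ′ * u ″
    d′ = fr-minor u (v ′) v (u ′)
    d″ : d ″ ≡ u ″ * v - v ″ * u
    d″ = trans (cong fr d′) (trans (fr-minor (u ′) (v ″) (v ′) (u ″)) (cong₂ _-_ (cong (u ″ *_) (fr³ v)) (cong (v ″ *_) (fr³ u))))
    independent : Independent e
    independent z = *-nonzero d≢0 (*-nonzero (fr-nonzero d≢0) (fr-nonzero (fr-nonzero d≢0))) (trans (cong₂ (λ a b → d * (a * b)) d′ d″)
      (trans (solve 6 (λ u u′ u″ v v′ v″ → (u :* v′ :- v :* u′) :* ((u′ :* v″ :- v′ :* u″) :* (u″ :* v :- v″ :* u)) :=
          detE (λ { i0 → u :* u′ ; i1 → u :* v′ :+ v :* u′ ; i2 → v :* v′ }) (λ { i0 → u′ :* u″ ; i1 → u′ :* v″ :+ v′ :* u″ ; i2 → v′ :* v″ })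
            (λ { i0 → u″ :* u ; i1 → u″ :* v :+ v″ :* u ; i2 → v″ :* v })) u (u ′) (u ″) v (v ′) (v ″))
        (trans (det-cong {e} {e} {e′} {frV e} {e″} {frV (frV e)} (λ _ → refl) (λ i → sym (fr-e i)) (λ i → sym (fr-e′ i))) z)))
    module E = Frame e independent

  module OrbitSpan {Member : F.Form → Set} {CenteredAt : F.Vec3 → F.Form → Set} (class : DegenerateClass Member CenteredAt)
    {B : F.Form} (B∈ : Member B) {A₀ : F.Vec3} (A₀≢0 : F.NonZero3 A₀) (B-A₀ : F.Singular B A₀)
    {Cn : F.Form} (TCn : Through T Cn) (c≢0 : β Cn ≢ 0#) where
    open DegenerateClass class

    w₀ γ κ a* b* : C
    w₀ = X (ιV A₀)
    γ = β Cn ′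
    -- A point of the conic with coordinate u gives z = γ/u of trace zero. A power g^m takes it to
    -- the center A₀ when λ₀^m u = f w₀ with f in F, that is λ₀^m = fκz. The translate of B then has
    -- coordinates f²(a*z², b*zz′).
    κ = w₀ * γ ⁻¹
    a* = κ * κ * α B
    b* = κ * κ ′ * β B

    γ≢0 : γ ≢ 0#
    γ≢0 = fr-nonzero c≢0

    -- With c = β Cn, division of Tr(cuu′) by the norm uu′u″ leaves c/u″ + c′/u + c″/u′ = Tr(c′/u).
    -- So the inverse coordinates of the points on the conic obey a linear equation, which is why γ
    -- is c′.
    trace-on-conic : ∀ {A} → X (ιV A) ≢ 0# → let u = X (ιV A) in Tr (γ * u ⁻¹) * (u * u ′ * u ″) ≡ ι (F.eval Cn A)
    trace-on-conic {A} u≢0 = trans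
        (linear₃ (c ′ * (u ′ * u ″)) uu (c ″ * (u * u ″)) uu′ (c * (u * u ′)) uu″
          (trans (cong₂ (λ p q → (c ′ * u ⁻¹ + p + q) * (u * u ′ * u ″) - (c * (u * u ′) + c ′ * (u ′ * u ″) + c ″ * (u ″ * u)))
              (fr-* γ (u ⁻¹)) (trans (fr²-* γ (u ⁻¹)) (cong (_* u ⁻¹ ″) (fr³ c))))
            (solve 9 (λ c c′ c″ u u′ u″ d d′ d″ → (c′ :* d :+ c″ :* d′ :+ c :* d″) :* (u :* u′ :* u″) :- (c :* (u :* u′) :+ c′ :* (u′ :* u″) :+ c″ :* (u″ :* u)) :=
              (c′ :* (u′ :* u″)) :* (u :* d :- :1) :+ (c″ :* (u :* u″)) :* (u′ :* d′ :- :1) :+ (c :* (u :* u′)) :* (u″ :* d″ :- :1))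
              c (c ′) (c ″) u (u ′) (u ″) (u ⁻¹) (u ⁻¹ ′) (u ⁻¹ ″))))
        (sym (trans (ι-eval Cn A) (trans (eval-frame Cn (ιV A)) (trans
          (cong₂ (λ y z → value (α Cn) c u y z) (Y-point A) (Z-point A))
          (trans (cong₂ _+_ (cong₂ _+_ (cong₂ _+_ (cong₂ _+_ (cong₂ _+_ (cong (_* (u * u)) TCn) (cong (_* (u ′ * u ′)) (trans (cong fr TCn) fr-0)))
            (cong (_* (u ″ * u ″)) (trans (cong fr (trans (cong fr TCn) fr-0)) fr-0))) refl) refl) refl)
            (solve 6 (λ x y z p q r → :0 :* x :+ :0 :* y :+ :0 :* z :+ p :+ q :+ r := p :+ q :+ r) (u * u) (u ′ * u ′) (u ″ * u ″)
              (c * (u * u ′)) (c ′ * (u ′ * u ″)) (c ″ * (u ″ * u))))))))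
      where
      c u : C
      c = β Cn
      u = X (ιV A)
      uu : u * u ⁻¹ ≡ 1#
      uu = *-inverseʳ u≢0
      uu′ : u ′ * u ⁻¹ ′ ≡ 1#
      uu′ = trans (sym (fr-* u (u ⁻¹))) (trans (cong fr uu) fr-1)
      uu″ : u ″ * u ⁻¹ ″ ≡ 1#
      uu″ = trans (sym (fr-* (u ′) (u ⁻¹ ′))) (trans (cong fr uu′) fr-1)

    α-coordinate : ∀ {ρ z} → Tr z ≡ 0# → ρ ≡ κ * z → ρ * ρ * α B ≡ twist a* (z * z ′)
    α-coordinate {ρ} {z} Tr≡0 ρ≡ = trans (cong (λ r → r * r * α B) ρ≡) (linear₁ (κ * κ * α B * z) Tr≡0
      (trans (cong (λ y → κ * z * (κ * z) * α B - - (κ * κ * α B * (z * z ′ + y))) (trans (fr²-* z (z ′)) (cong (z ″ *_) (fr³ z))))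
        (solve 5 (λ k a z z′ z″ → k :* z :* (k :* z) :* a :- (:- (k :* k :* a :* (z :* z′ :+ z″ :* z))) := (k :* k :* a :* z) :* (z :+ z′ :+ z″ :- :0)) κ (α B) z (z ′) (z ″))))

    β-coordinate : ∀ {ρ z} → ρ ≡ κ * z → ρ * ρ ′ * β B ≡ b* * (z * z ′)
    β-coordinate {ρ} {z} ρ≡ = trans (cong (λ r → r * fr r * β B) ρ≡) (trans (cong (λ r → κ * z * r * β B) (fr-* κ z))
      (solve 5 (λ k z k′ z′ b → k :* z :* (k′ :* z′) :* b := k :* k′ :* b :* (z :* z′)) κ z (κ ′) (z ′) (β B)))

    X-scaled : ∀ {A A′ : F.Vec3} f → (∀ i → A′ i ≡ f F.* A i) → X (ιV A′) ≡ ι f * X (ιV A)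
    X-scaled {A} {A′} f e = trans (X-cong {ιV A′} {ι f *V ιV A} (λ i → trans (cong ι (e i)) (ι-* f (A i))))
      (solveFor (scalar ∷ scalar ∷ vector ∷ vector ∷ []) (λ d f a c → d :* ((λ i → f :* a i) :· c) := f :* (d :* (a :· c)))
        (det T T₁′ T₂′ ⁻¹) (ι f) (ιV A) (cross T₁′ T₂′))

    orbit⊆plane : ∀ v → OrbitPart CenteredAt B Cn v → Plane a* b* v
    orbit⊆plane v (m , v≗ , A , (A≢0 , onConic) , centered) =
        ι f * ι f * (z * z ′) ,
        trans (α-cong {v} {F.substForm B (g F.^M m)} v≗) (trans (α-g^ B m) (trans (cong (λ l → l * l * α B) l≡)
          (trans (solve 3 (λ f r a → f :* r :* (f :* r) :* a := f :* f :* (r :* r :* a)) (ι f) (κ * z) (α B))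
            (trans (cong (ι f * ι f *_) (α-coordinate {κ * z} {z} Tr≡0 refl)) (scaled (twist-linear a*)))))) ,
        trans (β-cong {v} {F.substForm B (g F.^M m)} v≗) (trans (β-g^ B m) (trans (cong (λ l → l * fr l * β B) l≡)
          (trans (cong (λ l → ι f * (κ * z) * l * β B) (trans (fr-* (ι f) (κ * z)) (cong (_* (κ * z) ′) (fr-ι f))))
            (trans (solve 4 (λ f r r′ b → f :* r :* (f :* r′) :* b := f :* f :* (r :* r′ :* b)) (ι f) (κ * z) ((κ * z) ′) (β B))
              (trans (cong (ι f * ι f *_) (β-coordinate {κ * z} {z} refl)) (scaled (scale-linear b*)))))))
      where
      proportion : F.Prop3 A₀ (F.apply (g F.^M m) A)
      -- Both A₀ and g^m A are singular points of B, and a non-repeated form has only one up to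
      -- scalars.
      proportion = F.center-unique {B} {A₀} {F.apply (g F.^M m) A} (nonrepeated B∈) A₀≢0 (apply-g^-nonzero m {A} A≢0) B-A₀
        (FM.Singular-substForm⁻ {B} {g F.^M m} {A} (FM.^M-surjective {g} g-invertible m) (centered⁻ centered))
      f : F.C
      f = proj₁ proportion
      u z : C
      u = X (ιV A)
      z = γ * u ⁻¹
      u≢0 : u ≢ 0#
      u≢0 = X-point {A} A≢0
      Tr≡0 : Tr z ≡ 0#
      Tr≡0 = *-cancelʳ-0 (*-nonzero (*-nonzero u≢0 (fr-nonzero u≢0)) (fr-nonzero (fr-nonzero u≢0)))
        (trans (trace-on-conic {A} u≢0) (trans (cong ι onConic) ι-0))
      lu≡ : λ₀ ^ m * u ≡ ι f * w₀
      lu≡ = trans (sym (X-g^ m A)) (X-scaled {A₀} {F.apply (g F.^M m) A} f (proj₂ (proj₂ proportion)))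
      l≡ : λ₀ ^ m ≡ ι f * (κ * z)
      l≡ = *-cancelˡ u≢0 (linear₃ 1# lu≡ (- (ι f * w₀)) (*-inverseʳ γ≢0) (- (ι f * w₀ * γ * γ ⁻¹)) (*-inverseʳ u≢0)
        (solve 7 (λ u l f w c d e → u :* l :- u :* (f :* (w :* d :* (c :* e))) := :1 :* (l :* u :- f :* w) :+ (:- (f :* w)) :* (c :* d :- :1)
          :+ (:- (f :* w :* c :* d)) :* (u :* e :- :1)) u (λ₀ ^ m) (ι f) w₀ γ (γ ⁻¹) (u ⁻¹)))
      scaled : ∀ {φ} → Linear φ → ∀ {x} → ι f * ι f * φ x ≡ φ (ι f * ι f * x)
      scaled {φ} lin {x} = trans (cong (_* φ x) (sym (ι-* f f))) (trans (sym (Linear.homogeneous lin (f F.* f) x)) (cong (λ y → φ (y * x)) (ι-* f f)))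

    -- The point with coordinate γ/z lies on the conic, and by transitivity some power of g takes it
    -- to the center A₀. That power puts a translate of B into the orbit part; its coordinates match
    -- z up to the square of the leftover scalar.
    generator : ∀ {z} → z ≢ 0# → Tr z ≡ 0# → Σ F.C λ f → Σ F.Form λ v → OrbitPart CenteredAt B Cn v ×
      ι f * α v ≡ twist a* (z * z ′) × ι f * β v ≡ b* * (z * z ′)
    generator {z} z≢0 Tr≡0 = f F.* f , F.substForm B (g F.^M m) ,
        (m , (λ _ → refl) , A , (A≢0 , onConic) , centered⁺ (translate B∈ m) (F.Singular-substForm {B} {g F.^M m} {A}
          (F.Singular-Prop3 {B} {A₀} {F.apply (g F.^M m) A} (F.Prop3-sym {F.apply (g F.^M m) A} {A₀} proportion) B-A₀))) ,
        trans (cong₂ _*_ (ι-* f f) (α-g^ B m)) (trans (solve 3 (λ f l a → f :* f :* (l :* l :* a) := f :* l :* (f :* l) :* a) (ι f) (λ₀ ^ m) (α B))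
          (α-coordinate {ι f * λ₀ ^ m} {z} Tr≡0 fl≡)) ,
        trans (cong₂ _*_ (ι-* f f) (β-g^ B m)) (trans (solve 4 (λ f l l′ b → f :* f :* (l :* l′ :* b) := f :* l :* (f :* l′) :* b) (ι f) (λ₀ ^ m) ((λ₀ ^ m) ′) (β B))
          (trans (cong (λ y → ι f * λ₀ ^ m * y * β B) (sym (trans (fr-* (ι f) (λ₀ ^ m)) (cong (_* (λ₀ ^ m) ′) (fr-ι f)))))
            (β-coordinate {ι f * λ₀ ^ m} {z} fl≡)))
      where
      u₀ : C
      u₀ = γ * z ⁻¹
      u₀≢0 : u₀ ≢ 0#
      u₀≢0 = *-nonzero γ≢0 (⁻¹-nonzero z≢0)
      A : F.Vec3
      A = pointOf u₀
      A≢0 : F.NonZero3 A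
      A≢0 = pointOf-nonzero u₀≢0
      u : C
      u = X (ιV A)
      u≡ : u ≡ u₀
      u≡ = X-pointOf u₀
      u≢0 : u ≢ 0#
      u≢0 = X-point {A} A≢0
      zu≡ : z * u ≡ γ
      zu≡ = trans (cong (z *_) u≡) (linear₁ γ (*-inverseʳ z≢0) (solve 3 (λ z g d → z :* (g :* d) :- g := g :* (z :* d :- :1)) z γ (z ⁻¹)))
      z≡ : γ * u ⁻¹ ≡ z
      z≡ = linear₂ (- (u ⁻¹)) zu≡ z (*-inverseʳ u≢0) (solve 4 (λ g u d z → g :* d :- z := (:- d) :* (z :* u :- g) :+ z :* (u :* d :- :1)) γ u (u ⁻¹) z)
      onConic : F.eval Cn A ≡ F.0#
      onConic = ι-zero (trans (sym (trace-on-conic {A} u≢0)) (trans (cong (_* (u * u ′ * u ″)) (trans (cong Tr z≡) Tr≡0)) (zeroˡ _)))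
      moved : Σ ℕ λ m → F.Prop3 (F.apply (g F.^M m) A) A₀
      moved = g-transitive A A₀ A≢0 A₀≢0
      m : ℕ
      m = proj₁ moved
      proportion : F.Prop3 (F.apply (g F.^M m) A) A₀
      proportion = proj₂ moved
      f : F.C
      f = proj₁ proportion
      w₀≡ : w₀ ≡ ι f * (λ₀ ^ m * u)
      w₀≡ = trans (X-scaled {F.apply (g F.^M m) A} {A₀} f (proj₂ (proj₂ proportion))) (cong (ι f *_) (X-g^ m A))
      fl≡ : ι f * λ₀ ^ m ≡ κ * z
      fl≡ = *-cancelˡ u≢0 (linear₃ (- 1#) w₀≡ (- (w₀ * γ ⁻¹)) zu≡ (- w₀) (*-inverseʳ γ≢0)
        (solve 7 (λ u f l w d z g → u :* (f :* l) :- u :* (w :* d :* z) := (:- :1) :* (w :- f :* (l :* u)) :+ (:- (w :* d)) :* (z :* u :- g) :+ (:- w) :* (g :* d :- :1))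
          u (ι f) (λ₀ ^ m) w₀ (γ ⁻¹) z γ))

    spanned : ∀ z₁ z₂ → Tr z₁ ≡ 0# → Tr z₂ ≡ 0# → z₁ * z₂ ′ - z₂ * z₁ ′ ≢ 0# → ∀ Q h → α Q ≡ twist a* h → β Q ≡ b* * h →
      F.Span (OrbitPart CenteredAt B Cn) Q
    spanned z₁ z₂ Tr₁ Tr₂ d≢0 Q h αQ βQ = combineAll (generator z₁≢0 Tr₁) (generator z₁₂≢0 Tr₁₂) (generator z₂≢0 Tr₂) (products-span {z₁} {z₂} d≢0 h)
      where
      z₁≢0 : z₁ ≢ 0#
      z₁≢0 e = d≢0 (trans (cong (λ z → z * z₂ ′ - z₂ * fr z) e) (trans (cong (λ y → 0# * z₂ ′ - z₂ * y) fr-0) (solve 2 (λ a b → :0 :* a :- b :* :0 := :0) (z₂ ′) z₂)))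
      z₂≢0 : z₂ ≢ 0#
      z₂≢0 e = d≢0 (trans (cong (λ z → z₁ * fr z - z * z₁ ′) e) (trans (cong (λ y → z₁ * y - 0# * z₁ ′) fr-0) (solve 2 (λ a b → a :* :0 :- :0 :* b := :0) z₁ (z₁ ′))))
      z₁₂≢0 : z₁ + z₂ ≢ 0#
      z₁₂≢0 e = d≢0 (linear₂ (- (z₁ ′)) e z₁ (trans (sym (fr-+ z₁ z₂)) (trans (cong fr e) fr-0))
        (solve 4 (λ a b a′ b′ → a :* b′ :- b :* a′ :- :0 := (:- a′) :* (a :+ b :- :0) :+ a :* (a′ :+ b′ :- :0)) z₁ z₂ (z₁ ′) (z₂ ′)))
      Tr₁₂ : Tr (z₁ + z₂) ≡ 0#
      Tr₁₂ = trans (cong₂ (λ a b → z₁ + z₂ + a + b) (fr-+ z₁ z₂) (fr²-+ z₁ z₂)) (linear₂ 1# Tr₁ 1# Tr₂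
        (solve 6 (λ a a′ a″ b b′ b″ → a :+ b :+ (a′ :+ b′) :+ (a″ :+ b″) :- :0 := :1 :* (a :+ a′ :+ a″ :- :0) :+ :1 :* (b :+ b′ :+ b″ :- :0)) z₁ (z₁ ′) (z₁ ″) z₂ (z₂ ′) (z₂ ″)))
      Generator : C → Set
      Generator z = Σ F.C λ f → Σ F.Form λ v → OrbitPart CenteredAt B Cn v × ι f * α v ≡ twist a* (z * z ′) × ι f * β v ≡ b* * (z * z ′)
      combineAll : Generator z₁ → Generator (z₁ + z₂) → Generator z₂ →
        (Σ F.Vec3 λ r → h ≡ ι (r i0) * (z₁ * z₁ ′) + (ι (r i1) * (z₁ * z₂ ′ + z₂ * z₁ ′) + ι (r i2) * (z₂ * z₂ ′))) → F.Span (OrbitPart CenteredAt B Cn) Q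
      combineAll (f₁ , v₁ , o₁ , α₁ , β₁) (f₁₂ , v₁₂ , o₁₂ , α₁₂ , β₁₂) (f₂ , v₂ , o₂ , α₂ , β₂) (r , h≡) =
        F.span-three {OrbitPart CenteredAt B Cn} {Q} {v₁} {v₁₂} {v₂} c₁ c₁₂ c₂ o₁ o₁₂ o₂
          (coordinates-injective {Q} {total} (trans αQ (sym (sum-equal α-total (twist-linear a*) α₁ α₁₂ α₂))) (trans βQ (sym (sum-equal β-total (scale-linear b*) β₁ β₁₂ β₂))))
        where
        s₁ s₂ : F.C
        -- A generator yields zz′ for a single z, so the mixed product z₁z₂′ + z₂z₁′ is taken from
        -- z₁ + z₂ and its two squares are subtracted: the weights become r₀ - r₁, r₁, r₂ - r₁.
        s₁ = r i0 F.- r i1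
        s₂ = r i2 F.- r i1
        c₁ c₁₂ c₂ : F.C
        c₁ = s₁ F.* f₁
        c₁₂ = r i1 F.* f₁₂
        c₂ = s₂ F.* f₂
        total : F.Form
        total = F.scaleF c₁ v₁ F.+F (F.scaleF c₁₂ v₁₂ F.+F F.scaleF c₂ v₂)
        h-split : h ≡ ι s₁ * (z₁ * z₁ ′) + (ι (r i1) * ((z₁ + z₂) * (z₁ + z₂) ′) + ι s₂ * (z₂ * z₂ ′))
        h-split = trans h≡ (sym (trans (cong₂ (λ a b → a * (z₁ * z₁ ′) + (ι (r i1) * ((z₁ + z₂) * (z₁ + z₂) ′) + b * (z₂ * z₂ ′))) (ι-sub (r i0) (r i1)) (ι-sub (r i2) (r i1)))
          (trans (cong (λ y → (ι (r i0) - ι (r i1)) * (z₁ * z₁ ′) + (ι (r i1) * ((z₁ + z₂) * y) + (ι (r i2) - ι (r i1)) * (z₂ * z₂ ′))) (fr-+ z₁ z₂))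
            (solve 7 (λ r s t a a′ b b′ → (r :- s) :* (a :* a′) :+ (s :* ((a :+ b) :* (a′ :+ b′)) :+ (t :- s) :* (b :* b′)) :=
              r :* (a :* a′) :+ (s :* (a :* b′ :+ b :* a′) :+ t :* (b :* b′))) (ι (r i0)) (ι (r i1)) (ι (r i2)) z₁ (z₁ ′) z₂ (z₂ ′)))))
        α-total : α total ≡ ι c₁ * α v₁ + (ι c₁₂ * α v₁₂ + ι c₂ * α v₂)
        α-total = trans (α-+ (F.scaleF c₁ v₁) (F.scaleF c₁₂ v₁₂ F.+F F.scaleF c₂ v₂)) (cong₂ _+_ (α-* c₁ v₁)
          (trans (α-+ (F.scaleF c₁₂ v₁₂) (F.scaleF c₂ v₂)) (cong₂ _+_ (α-* c₁₂ v₁₂) (α-* c₂ v₂))))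
        β-total : β total ≡ ι c₁ * β v₁ + (ι c₁₂ * β v₁₂ + ι c₂ * β v₂)
        β-total = trans (β-+ (F.scaleF c₁ v₁) (F.scaleF c₁₂ v₁₂ F.+F F.scaleF c₂ v₂)) (cong₂ _+_ (β-* c₁ v₁)
          (trans (β-+ (F.scaleF c₁₂ v₁₂) (F.scaleF c₂ v₂)) (cong₂ _+_ (β-* c₁₂ v₁₂) (β-* c₂ v₂))))
        sum-equal : ∀ {φ : C → C} {y y₁ y₁₂ y₂} → y ≡ ι c₁ * y₁ + (ι c₁₂ * y₁₂ + ι c₂ * y₂) → Linear φ →
          ι f₁ * y₁ ≡ φ (z₁ * z₁ ′) → ι f₁₂ * y₁₂ ≡ φ ((z₁ + z₂) * (z₁ + z₂) ′) → ι f₂ * y₂ ≡ φ (z₂ * z₂ ′) → y ≡ φ h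
        sum-equal {φ} e lin e₁ e₁₂ e₂ = trans e (trans (cong₂ _+_ (part s₁ f₁ e₁) (cong₂ _+_ (part (r i1) f₁₂ e₁₂) (part s₂ f₂ e₂)))
          (sym (trans (cong φ h-split) (trans (Linear.additive lin _ _) (cong₂ _+_ refl (Linear.additive lin _ _))))))
          where
          part : ∀ s f {y x} → ι f * y ≡ φ x → ι (s F.* f) * y ≡ φ (ι s * x)
          part s f {y} {x} e = trans (cong (_* y) (ι-* s f)) (trans (*-assoc _ _ _) (trans (cong (ι s *_) e) (sym (Linear.homogeneous lin s x))))

    plane⊆span : ∀ Q → Plane a* b* Q → F.Span (OrbitPart CenteredAt B Cn) Q
    plane⊆span Q (h , αQ , βQ) = let z₁ , z₂ , Tr₁ , Tr₂ , d≢0 = trace-zero-pair in spanned z₁ z₂ Tr₁ Tr₂ d≢0 Q h αQ βQ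

    orbit-span : F._≐_ (F.Span (OrbitPart CenteredAt B Cn)) (Plane a* b*)
    orbit-span Q = F.IsSubspace.span⊆ (plane-subspace a* b*) orbit⊆plane , plane⊆span Q

    -- the member of the orbit centered at the point γ
    orbit-plane : Σ ℕ λ m → F.Singular (F.substForm B (g F.^M m)) (pointOf γ) ×
      F._≐_ (Plane a* b*) (Plane (α (F.substForm B (g F.^M m))) (β (F.substForm B (g F.^M m))))
    orbit-plane = m , F.Singular-substForm {B} {g F.^M m} {A} (F.Singular-Prop3 {B} {A₀} {F.apply (g F.^M m) A}
        (F.Prop3-sym {F.apply (g F.^M m) A} {A₀} proportion) B-A₀) , λ Q →
        -- This factor is f⁻²: the pair (a*, b*) is f² times the coordinates of the translate.
        plane-scale {a*} {b*} {αₘ} {βₘ} (f F.* f F.⁻¹ F.* (f F.⁻¹ F.* f F.⁻¹)) (F.*-nonzero (F.*-nonzero f≢0 f⁻¹≢0) (F.*-nonzero f⁻¹≢0 f⁻¹≢0)) (inverse-scale {a*} {αₘ} a*≡) (inverse-scale {b*} {βₘ} b*≡) {Q} ,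
        plane-scale {αₘ} {βₘ} {a*} {b*} (f F.* f) (F.*-nonzero f≢0 f≢0) a*≡ b*≡ {Q}
      where
      A : F.Vec3
      A = pointOf γ
      moved : Σ ℕ λ m → F.Prop3 (F.apply (g F.^M m) A) A₀
      moved = g-transitive A A₀ (pointOf-nonzero γ≢0) A₀≢0
      m : ℕ
      m = proj₁ moved
      proportion : F.Prop3 (F.apply (g F.^M m) A) A₀
      proportion = proj₂ moved
      f : F.C
      f = proj₁ proportion
      f≢0 : f ≢ F.0#
      f≢0 = proj₁ (proj₂ proportion)
      f⁻¹≢0 : f F.⁻¹ ≢ F.0#
      f⁻¹≢0 = F.⁻¹-nonzero f≢0
      κ≡ : κ ≡ ι f * λ₀ ^ m
      κ≡ = linear₂ (γ ⁻¹) (trans (X-scaled {F.apply (g F.^M m) A} {A₀} f (proj₂ (proj₂ proportion))) (cong (ι f *_) (trans (X-g^ m A) (cong (λ₀ ^ m *_) (X-pointOf γ)))))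
        (ι f * λ₀ ^ m) (*-inverseʳ γ≢0) (solve 5 (λ w d f l g → w :* d :- f :* l := d :* (w :- f :* (l :* g)) :+ (f :* l) :* (g :* d :- :1)) w₀ (γ ⁻¹) (ι f) (λ₀ ^ m) γ)
      αₘ βₘ : C
      αₘ = α (F.substForm B (g F.^M m))
      βₘ = β (F.substForm B (g F.^M m))
      a*≡ : a* ≡ ι (f F.* f) * α (F.substForm B (g F.^M m))
      a*≡ = trans (cong (λ y → y * y * α B) κ≡) (sym (trans (cong₂ _*_ (ι-* f f) (α-g^ B m))
        (solve 3 (λ f l a → f :* f :* (l :* l :* a) := f :* l :* (f :* l) :* a) (ι f) (λ₀ ^ m) (α B))))
      b*≡ : b* ≡ ι (f F.* f) * β (F.substForm B (g F.^M m))
      b*≡ = trans (cong (λ y → y * fr y * β B) κ≡) (trans (cong (λ y → ι f * λ₀ ^ m * y * β B) (trans (fr-* (ι f) (λ₀ ^ m)) (cong (_* (λ₀ ^ m) ′) (fr-ι f))))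
        (sym (trans (cong₂ _*_ (ι-* f f) (β-g^ B m))
          (solve 4 (λ f l l′ b → f :* f :* (l :* l′ :* b) := f :* l :* (f :* l′) :* b) (ι f) (λ₀ ^ m) ((λ₀ ^ m) ′) (β B)))))
      inverse-scale : ∀ {x y} → x ≡ ι (f F.* f) * y → y ≡ ι (f F.* f F.⁻¹ F.* (f F.⁻¹ F.* f F.⁻¹)) * x
      inverse-scale {x} {y} e = sym (trans (cong (ι (f F.* f F.⁻¹ F.* (f F.⁻¹ F.* f F.⁻¹)) *_) e) (trans (sym (*-assoc _ _ _))
        (trans (cong (_* y) (trans (sym (ι-* _ _)) (trans (cong ι one) ι-1))) (*-identityˡ y))))
        where
        one : f F.* f F.⁻¹ F.* (f F.⁻¹ F.* f F.⁻¹) F.* (f F.* f) ≡ F.1#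
        one = F.linear₁ (f F.* f F.⁻¹ F.* (f F.* f F.⁻¹) F.+ f F.* f F.⁻¹ F.+ F.1#) (F.*-inverseʳ f≢0)
          (F.solve 2 (λ f d → f :* d :* (d :* d) :* (f :* f) :- :1 := (f :* d :* (f :* d) :+ f :* d :+ :1) :* (f :* d :- :1)) f (f F.⁻¹))

  -- For this conic the part of the orbit of a form B centered at A spans Plane (α B) (β B).
  matching-conic : ∀ {A} → F.NonZero3 A → Σ F.Form λ Cn → Through T Cn × β Cn ≢ 0# × β Cn ′ ≡ X (ιV A)
  matching-conic {A} A≢0 = formWith 0# (X (ιV A) ″) , α-formWith 0# (X (ιV A) ″) ,
    (λ z → fr-nonzero (fr-nonzero (X-point {A} A≢0)) (trans (sym (β-formWith 0# (X (ιV A) ″))) z)) ,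
    trans (cong fr (β-formWith 0# (X (ιV A) ″))) (fr³ (X (ιV A)))

-- Bi-lines, imaginary bi-lines and the classification of degenerate forms

module Imaginary {q : ℕ} {p k : ℕ} (p-prime : Prime p) (q≡ : q ≡ p ℕ.^ suc k)
  (F : FiniteField q) (L : FiniteField (q ℕ.^ 2)) (ιL : FieldHom F L) (K : FiniteField (q ℕ.^ 3)) (ιK : FieldHom F K) where

  private
    module G = Geometry F L ιL K ιK
    module F = DegenerateForms F
    module FM = MatrixLemmas F
  open DegenerateForms L
  open Extension {p = p} {k = k} p-prime q≡ F L ιL

  private
    fr² : ∀ x → fr (fr x) ≡ x
    fr² x = trans (^-^ x q q) (trans (cong (x ^_) (cong (q ℕ.*_) (sym (ℕₚ.*-identityʳ q)))) (fermat x))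

    σ≢0 : ∀ {ℓ} → NonZero3 ℓ → NonZero3 (frV ℓ)
    σ≢0 {ℓ} = frV-nonzero {ℓ}

  -- Frobenius swaps the two lines and so changes the sign of their cross product. Division by a
  -- nonzero coordinate cancels the sign and leaves a rational vector.
  ImBiLine⇒rational-center : ∀ {ℓ} → NonZero3 ℓ → ¬ Prop3 ℓ (frV ℓ) →
    Σ F.Vec3 λ A → F.NonZero3 A × ℓ · ιV A ≡ 0# × frV ℓ · ιV A ≡ 0#
  ImBiLine⇒rational-center {ℓ} ℓ≢0 independent = A , A≢0 , on ℓ (proj₁ (proj₂ center)) , on (frV ℓ) (proj₂ (proj₂ center))
    where
    w : Vec3
    w = cross ℓ (frV ℓ)
    center : NonZero3 w × ℓ · w ≡ 0# × frV ℓ · w ≡ 0#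
    center = biLine-center {ℓ} {frV ℓ} ℓ≢0 (σ≢0 {ℓ} ℓ≢0) independent
    j : Fin 3
    j = proj₁ (proj₁ center)
    wⱼ≢0 : w j ≢ 0#
    wⱼ≢0 = proj₂ (proj₁ center)
    fr-w : ∀ i → fr (w i) ≡ - w i
    fr-w i = trans (fr-cross ℓ (frV ℓ) i) (trans (cross-cong {frV ℓ} {frV ℓ} {frV (frV ℓ)} {ℓ} (λ _ → refl) (λ i → fr² (ℓ i)) i) (anti i))
      where
      anti : ∀ i → cross (frV ℓ) ℓ i ≡ - cross ℓ (frV ℓ) i
      anti i0 = solveFor (vector ∷ vector ∷ []) (λ u v → crossE v u i0 := :- crossE u v i0) ℓ (frV ℓ)
      anti i1 = solveFor (vector ∷ vector ∷ []) (λ u v → crossE v u i1 := :- crossE u v i1) ℓ (frV ℓ)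
      anti i2 = solveFor (vector ∷ vector ∷ []) (λ u v → crossE v u i2 := :- crossE u v i2) ℓ (frV ℓ)
    fixed : ∀ i → fr (w j ⁻¹ * w i) ≡ w j ⁻¹ * w i
    fixed i = *-cancelˡ (fr-nonzero wⱼ≢0) (trans (sym (fr-* (w j) _)) (trans (cong fr (trans (sym (*-assoc _ _ _)) (trans (cong (_* w i) (*-inverseʳ wⱼ≢0)) (*-identityˡ _))))
      (trans (fr-w i) (sym (trans (cong (_* (w j ⁻¹ * w i)) (fr-w j)) (linear₁ (- w i) (*-inverseʳ wⱼ≢0)
        (solve 3 (λ u d v → (:- u) :* (d :* v) :- (:- v) := (:- v) :* (u :* d :- :1)) (w j) (w j ⁻¹) (w i))))))))
    A : F.Vec3
    A i = proj₁ (fr-fixed⇒ι (fixed i))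
    ι-A : ∀ i → ι (A i) ≡ w j ⁻¹ * w i
    ι-A i = proj₂ (fr-fixed⇒ι (fixed i))
    A≢0 : F.NonZero3 A
    A≢0 = j , λ z → 1≢0 (trans (sym (*-inverseˡ wⱼ≢0)) (trans (sym (ι-A j)) (trans (cong ι z) ι-0)))
    on : ∀ m → m · w ≡ 0# → m · ιV A ≡ 0#
    on m e = trans (·-cong {m} {m} {ιV A} {(w j ⁻¹) *V w} (λ _ → refl) ι-A)
      (trans (solveFor (vector ∷ vector ∷ scalar ∷ []) (λ m w d → m :· (λ i → d :* w i) := d :* (m :· w)) m w (w j ⁻¹)) (trans (cong (w j ⁻¹ *_) e) (zeroʳ _)))

  ImBiLine⇒center : ∀ {Q} → G.ImBiLine Q → Σ F.Vec3 λ A → F.NonZero3 A × F.Singular Q A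
  ImBiLine⇒center {Q} (c , ℓ , c≢0 , ℓ≢0 , independent , e) =
    let A , A≢0 , ℓA , σℓA = ImBiLine⇒rational-center {ℓ} ℓ≢0 independent in
    A , A≢0 , ι-Singular⁻ {Q} {A} (centered⇒singular {ιF Q} {c} {ℓ} {frV ℓ} {ιV A} e ℓA σℓA)

  ImBiLine⇒nonrepeated : ∀ {Q} → G.ImBiLine Q → F.NonRepeated Q
  ImBiLine⇒nonrepeated {Q} (c , ℓ , c≢0 , ℓ≢0 , independent , e) =
    (let p , n = biLine⇒nonzero {ιF Q} {c} {ℓ} {frV ℓ} c≢0 ℓ≢0 (σ≢0 {ℓ} ℓ≢0) independent e in p , λ z → n (trans (cong ι z) ι-0)) ,
    λ (d , n , _ , n≢0 , f) → biLine⇒¬repeated {ιF Q} {c} {ℓ} {frV ℓ} {ι d} {ιV n} c≢0 ℓ≢0 (σ≢0 {ℓ} ℓ≢0) independent e (ιV-nonzero {n} n≢0)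
      (λ p → trans (cong ι (f p)) (trans (ι-* d _) (cong (ι d *_) (ι-prodLin n n p))))

  ImBiLine-substForm : ∀ {Q M} → F.Invertible M → G.ImBiLine Q → G.ImBiLine (F.substForm Q M)
  ImBiLine-substForm {Q} {M} (N , MN) (c , ℓ , c≢0 , ℓ≢0 , independent , e) =
    c , ℓ ◃ ιM M , c≢0 , ◃-nonzero {ιM M} ιM-invertible {ℓ} ℓ≢0 ,
    (λ pr → independent (◃-Prop3⁻ {ιM M} ιM-invertible {ℓ} {frV ℓ} (proj₁ pr , proj₁ (proj₂ pr) , λ i → trans (sym (conj i)) (proj₂ (proj₂ pr) i)))) ,
    λ p → trans (ιF-substForm Q M p) (trans (substForm-multiple {ιF Q} {c} {ℓ} {frV ℓ} (ιM M) e p)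
      (cong (c *_) (prodLin-cong p)))
    where
    ιM-invertible : Invertible (ιM M)
    ιM-invertible = ιM N , λ i j → trans (sym (ι-· (M i) (λ k → N k j))) (trans (cong ι (MN i j)) (ι-basis i j))
    conj : ∀ i → fr ((ℓ ◃ ιM M) i) ≡ (frV ℓ ◃ ιM M) i
    conj i = trans (fr-· ℓ (λ j → ιM M j i)) (·-cong {frV ℓ} {frV ℓ} {frV (λ j → ιM M j i)} {λ j → ιM M j i} (λ _ → refl) (λ j → fr-ι (M j i)))
    prodLin-cong : ∀ p → prodLin (ℓ ◃ ιM M) (frV ℓ ◃ ιM M) p ≡ prodLin (ℓ ◃ ιM M) (frV (ℓ ◃ ιM M)) p
    prodLin-cong = ∀Pair (term i0 i0) (term i1 i1) (term i2 i2) (cong₂ _+_ (term i0 i1) (term i1 i0))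
      (cong₂ _+_ (term i0 i2) (term i2 i0)) (cong₂ _+_ (term i1 i2) (term i2 i1))
      where
      term : ∀ i j → (ℓ ◃ ιM M) i * (frV ℓ ◃ ιM M) j ≡ (ℓ ◃ ιM M) i * fr ((ℓ ◃ ιM M) j)
      term i j = cong ((ℓ ◃ ιM M) i *_) (sym (conj j))

  ImBiLine-centered⁺ : ∀ {Q A} → G.ImBiLine Q → F.Singular Q A → G.ImBiLineCenteredAt A Q
  ImBiLine-centered⁺ {Q} {A} (c , ℓ , c≢0 , ℓ≢0 , independent , e) s =
    let a , b = singular⇒centered {ιF Q} {c} {ℓ} {frV ℓ} {ιV A} c≢0 ℓ≢0 (σ≢0 {ℓ} ℓ≢0) independent e (ι-Singular⁺ {Q} {A} s) in
    c , ℓ , c≢0 , ℓ≢0 , independent , e , a , b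

  ImBiLine-centered⁻ : ∀ {Q A} → G.ImBiLineCenteredAt A Q → F.Singular Q A
  ImBiLine-centered⁻ {Q} {A} (c , ℓ , _ , _ , _ , e , a , b) = ι-Singular⁻ {Q} {A} (centered⇒singular {ιF Q} {c} {ℓ} {frV ℓ} {ιV A} e a b)

  BiLine⇒center : ∀ {Q} → F.BiLine Q → Σ F.Vec3 λ A → F.NonZero3 A × F.Singular Q A
  BiLine⇒center {Q} (c , ℓ , m , c≢0 , ℓ≢0 , m≢0 , independent , e) =
    let n , a , b = F.biLine-center {ℓ} {m} ℓ≢0 m≢0 independent in
    F.cross ℓ m , n , F.centered⇒singular {Q} {c} {ℓ} {m} {F.cross ℓ m} e a b

  BiLine⇒nonrepeated : ∀ {Q} → F.BiLine Q → F.NonRepeated Q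
  BiLine⇒nonrepeated {Q} (c , ℓ , m , c≢0 , ℓ≢0 , m≢0 , independent , e) =
    F.biLine⇒nonzero {Q} {c} {ℓ} {m} c≢0 ℓ≢0 m≢0 independent e ,
    λ (d , n , _ , n≢0 , f) → F.biLine⇒¬repeated {Q} {c} {ℓ} {m} {d} {n} c≢0 ℓ≢0 m≢0 independent e n≢0 f

  BiLine-substForm : ∀ {Q M} → F.Invertible M → F.BiLine Q → F.BiLine (F.substForm Q M)
  BiLine-substForm {Q} {M} inv (c , ℓ , m , c≢0 , ℓ≢0 , m≢0 , independent , e) =
    c , ℓ F.◃ M , m F.◃ M , c≢0 , F.◃-nonzero {M} inv {ℓ} ℓ≢0 , F.◃-nonzero {M} inv {m} m≢0 ,
    (λ pr → independent (F.◃-Prop3⁻ {M} inv {ℓ} {m} pr)) , F.substForm-multiple {Q} {c} {ℓ} {m} M e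

  BiLine-centered⁺ : ∀ {Q A} → F.BiLine Q → F.Singular Q A → F.BiLineCenteredAt A Q
  BiLine-centered⁺ {Q} {A} (c , ℓ , m , c≢0 , ℓ≢0 , m≢0 , independent , e) s =
    let a , b = F.singular⇒centered {Q} {c} {ℓ} {m} {A} c≢0 ℓ≢0 m≢0 independent e s in
    c , ℓ , m , c≢0 , ℓ≢0 , m≢0 , independent , e , a , b

  BiLine-centered⁻ : ∀ {Q A} → F.BiLineCenteredAt A Q → F.Singular Q A
  BiLine-centered⁻ {Q} {A} (c , ℓ , m , _ , _ , _ , _ , e , a , b) = F.centered⇒singular {Q} {c} {ℓ} {m} {A} e a b

  RepeatedLine⇒singular : ∀ {Q} → F.RepeatedLine Q → Σ F.Vec3 λ A → F.NonZero3 A × F.Singular Q A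
  RepeatedLine⇒singular {Q} (c , n , _ , n≢0 , e) = let A , A≢0 , on = point n≢0 in A , A≢0 , F.centered⇒singular {Q} {c} {n} {n} {A} e on on
    where
    point : F.NonZero3 n → Σ F.Vec3 λ A → F.NonZero3 A × n F.· A ≡ F.0#
    point (i0 , ne) = F.vec3 (n i1) (F.- n i0) F.0# , (i1 , F.-‿nonzero ne) ,
      F.solveFor (vector ∷ []) (λ n → n :· (λ { i0 → n i1 ; i1 → :- n i0 ; i2 → :0 }) := :0) n
    point (i1 , ne) = F.vec3 (n i1) (F.- n i0) F.0# , (i0 , ne) ,
      F.solveFor (vector ∷ []) (λ n → n :· (λ { i0 → n i1 ; i1 → :- n i0 ; i2 → :0 }) := :0) n
    point (i2 , ne) = F.vec3 F.0# (n i2) (F.- n i1) , (i1 , ne) ,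
      F.solveFor (vector ∷ []) (λ n → n :· (λ { i0 → :0 ; i1 → n i2 ; i2 → :- n i1 }) := :0) n

  -- Two repeated lines through A and the bi-line formed by them already span.
  singular-span : ∀ {A} → F.NonZero3 A →
    F._≐_ (F.Span (λ v → F.RepeatedLineThrough A v ⊎ (F.BiLineCenteredAt A v ⊎ G.ImBiLineCenteredAt A v))) (λ Q → F.Singular Q A)
  singular-span {A} A≢0 Q = F.IsSubspace.span⊆ (F.singular-subspace A) generators {Q} ,
      (λ s → let E₁ , E₂ , D≢0 = F.complete₂ {A} A≢0 in spanned E₁ E₂ D≢0 s)
    where
    generators : ∀ v → F.RepeatedLineThrough A v ⊎ (F.BiLineCenteredAt A v ⊎ G.ImBiLineCenteredAt A v) → F.Singular v A
    generators v (inj₁ (c , ℓ , _ , _ , e , on)) = F.centered⇒singular {v} {c} {ℓ} {ℓ} {A} e on on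
    generators v (inj₂ (inj₁ b)) = BiLine-centered⁻ {v} {A} b
    generators v (inj₂ (inj₂ b)) = ImBiLine-centered⁻ {v} {A} b
    spanned : ∀ E₁ E₂ → F.det A E₁ E₂ ≢ F.0# → F.Singular Q A →
      F.Span (λ v → F.RepeatedLineThrough A v ⊎ (F.BiLineCenteredAt A v ⊎ G.ImBiLineCenteredAt A v)) Q
    spanned E₁ E₂ D≢0 s = F.span-three {_} {Q} {F.prodLin m₁ m₁} {F.prodLin m₁ m₂} {F.prodLin m₂ m₂} (F.eval Q E₁) (F.polar Q E₁ E₂) (F.eval Q E₂)
        (inj₁ (F.1# , m₁ , F.1≢0 , m₁≢0 , (λ _ → sym (F.*-identityˡ _)) , m₁A))
        (inj₂ (inj₁ (F.1# , m₁ , m₂ , F.1≢0 , m₁≢0 , m₂≢0 , independent , (λ _ → sym (F.*-identityˡ _)) , m₁A , m₂A)))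
        (inj₁ (F.1# , m₂ , F.1≢0 , m₂≢0 , (λ _ → sym (F.*-identityˡ _)) , m₂A))
        (singular≗pencil {Q} s)
      where
      open F.Pencil A E₁ E₂ D≢0
      m₁≢0 : F.NonZero3 m₁
      m₁≢0 = [ id , (λ z → ⊥-elim (F.1≢0 (trans (sym m₁E₁) (F.·-zero {m₁} {E₁} z)))) ]′ (F.nonzero? m₁)
      m₂≢0 : F.NonZero3 m₂
      m₂≢0 = [ id , (λ z → ⊥-elim (F.1≢0 (trans (sym m₂E₂) (F.·-zero {m₂} {E₂} z)))) ]′ (F.nonzero? m₂)
      independent : ¬ F.Prop3 m₁ m₂
      independent (c , c≢0 , e) = c≢0 (trans (sym (F.*-identityʳ c)) (trans (cong (c F.*_) (sym m₁E₁)) (trans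
        (sym (F.solveFor (scalar ∷ vector ∷ vector ∷ []) (λ c m x → (λ i → c :* m i) :· x := c :* (m :· x)) c m₁ E₁))
        (trans (F.·-cong {c F.*V m₁} {m₂} {E₁} {E₁} (λ i → sym (e i)) (λ _ → refl)) m₂E₁))))

  -- A non-repeated form singular at A is a binary form in m₁, m₂, split over F or over L.
  classify : ∀ {Q A} → F.NonRepeated Q → F.NonZero3 A → F.Singular Q A → F.BiLine Q ⊎ G.ImBiLine Q
  classify {Q} {A} nr A≢0 s = let E₁ , E₂ , D≢0 = F.complete₂ {A} A≢0 in go E₁ E₂ D≢0
    where
    go : ∀ E₁ E₂ → F.det A E₁ E₂ ≢ F.0# → F.BiLine Q ⊎ G.ImBiLine Q
    go E₁ E₂ D≢0 = decide (r F.≟ F.0#)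
      where
      open F.Pencil A E₁ E₂ D≢0
      r t u : F.C
      r = F.eval Q E₁
      t = F.polar Q E₁ E₂
      u = F.eval Q E₂
      evalQ : ∀ x → F.eval Q x ≡ r F.* ((m₁ F.· x) F.* (m₁ F.· x)) F.+ (t F.* ((m₁ F.· x) F.* (m₂ F.· x)) F.+ u F.* ((m₂ F.· x) F.* (m₂ F.· x)))
      evalQ x = trans (F.eval-cong {Q} {pencil r t u} {x} {x} (singular≗pencil {Q} s) (λ _ → refl)) (eval-pencil r t u x)
      line : F.C → F.C → F.Vec3
      line a b i = a F.* m₁ i F.+ b F.* m₂ i
      line-· : ∀ a b x → line a b F.· x ≡ a F.* (m₁ F.· x) F.+ b F.* (m₂ F.· x)
      line-· a b x = F.solveFor (scalar ∷ scalar ∷ vector ∷ vector ∷ vector ∷ []) (λ a b m n x → (λ i → a :* m i :+ b :* n i) :· x := a :* (m :· x) :+ b :* (n :· x)) a b m₁ m₂ x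
      line-E₁ : ∀ a b → line a b F.· E₁ ≡ a
      line-E₁ a b = trans (line-· a b E₁) (trans (cong₂ (λ x y → a F.* x F.+ b F.* y) m₁E₁ m₂E₁) (F.solve 2 (λ a b → a :* :1 :+ b :* :0 := a) a b))
      line-E₂ : ∀ a b → line a b F.· E₂ ≡ b
      line-E₂ a b = trans (line-· a b E₂) (trans (cong₂ (λ x y → a F.* x F.+ b F.* y) m₁E₂ m₂E₂) (F.solve 2 (λ a b → a :* :0 :+ b :* :1 := b) a b))
      nonzero-by : ∀ {ℓ x y} → ℓ F.· x ≡ y → y ≢ F.0# → F.NonZero3 ℓ
      nonzero-by {ℓ} {x} e y≢0 = [ id , (λ z → ⊥-elim (y≢0 (trans (sym e) (F.·-zero {ℓ} {x} z)))) ]′ (F.nonzero? ℓ)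
      Prop3-value : ∀ {ℓ m} ((c , _) : F.Prop3 ℓ m) x → m F.· x ≡ c F.* (ℓ F.· x)
      Prop3-value {ℓ} {m} (c , _ , e) x = trans (F.·-cong {m} {c F.*V ℓ} {x} {x} e (λ _ → refl))
        (F.solveFor (scalar ∷ vector ∷ vector ∷ []) (λ c m x → (λ i → c :* m i) :· x := c :* (m :· x)) c ℓ x)
      ext-product : ∀ {c ℓ m} → (∀ x → F.eval Q x ≡ c F.* ((ℓ F.· x) F.* (m F.· x))) → Q F.≗F F.scaleF c (F.prodLin ℓ m)
      ext-product {c} {ℓ} {m} e = F.form-ext Q (F.scaleF c (F.prodLin ℓ m)) λ x → trans (e x)
        (sym (F.eval-multiple {F.scaleF c (F.prodLin ℓ m)} {c} {ℓ} {m} (λ _ → refl) x))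
      module Split (r≢0 : r ≢ F.0#) where
        d : F.C
        d = r F.⁻¹
        rd : r F.* d ≡ F.1#
        rd = F.*-inverseʳ r≢0
        factor : ∀ ρ → r F.* (ρ F.* ρ) F.+ t F.* ρ F.+ u ≡ F.0# → let ρ′ = F.- (d F.* t) F.- ρ in
          ∀ x y → r F.* (x F.* x) F.+ (t F.* (x F.* y) F.+ u F.* (y F.* y)) ≡
            r F.* ((F.1# F.* x F.+ (F.- ρ) F.* y) F.* (F.1# F.* x F.+ (F.- ρ′) F.* y))
        factor ρ e x y = F.linear₂ (y F.* y) e (F.- (t F.* (x F.* y) F.- t F.* (ρ F.* (y F.* y)))) rd
          (F.solve 7 (λ r t u d ρ x y → r :* (x :* x) :+ (t :* (x :* y) :+ u :* (y :* y)) :-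
              r :* ((:1 :* x :+ (:- ρ) :* y) :* (:1 :* x :+ (:- (:- (d :* t) :- ρ)) :* y)) :=
            (y :* y) :* (r :* (ρ :* ρ) :+ t :* ρ :+ u :- :0) :+ (:- (t :* (x :* y) :- t :* (ρ :* (y :* y)))) :* (r :* d :- :1)) r t u d ρ x y)
        split : Dec (Σ F.C λ ρ → r F.* (ρ F.* ρ) F.+ t F.* ρ F.+ u ≡ F.0#) → F.BiLine Q ⊎ G.ImBiLine Q
        -- The second root is -t/r - ρ. If it equalled ρ, the form would be a repeated line.
        split (yes (ρ , e)) = distinct (ρ F.≟ ρ′)
          where
          ρ′ : F.C
          ρ′ = F.- (d F.* t) F.- ρ
          ℓ m : F.Vec3
          ℓ = line F.1# (F.- ρ)
          m = line F.1# (F.- ρ′)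
          ℓ≢0 : F.NonZero3 ℓ
          ℓ≢0 = nonzero-by {ℓ} {E₁} (line-E₁ F.1# (F.- ρ)) F.1≢0
          m≢0 : F.NonZero3 m
          m≢0 = nonzero-by {m} {E₁} (line-E₁ F.1# (F.- ρ′)) F.1≢0
          Q≗ : Q F.≗F F.scaleF r (F.prodLin ℓ m)
          Q≗ = ext-product {r} {ℓ} {m} λ x → trans (evalQ x) (trans (factor ρ e (m₁ F.· x) (m₂ F.· x))
            (cong₂ (λ a b → r F.* (a F.* b)) (sym (line-· F.1# (F.- ρ) x)) (sym (line-· F.1# (F.- ρ′) x))))
          distinct : Dec (ρ ≡ ρ′) → F.BiLine Q ⊎ G.ImBiLine Q
          distinct (yes ρ≡ρ′) = ⊥-elim (proj₂ nr (r , ℓ , r≢0 , ℓ≢0 , λ p → trans (Q≗ p)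
            (cong (λ z → r F.* F.prodLin ℓ (line F.1# (F.- z)) p) (sym ρ≡ρ′))))
          distinct (no ρ≢ρ′) = inj₁ (r , ℓ , m , r≢0 , ℓ≢0 , m≢0 , independent , Q≗)
            where
            independent : ¬ F.Prop3 ℓ m
            independent pr@(c , _) = ρ≢ρ′ (F.linear₂ F.1# value₂ (F.- ρ) value₁
                (F.solve 3 (λ c ρ ρ′ → ρ :- ρ′ := :1 :* (:- ρ′ :- c :* :- ρ) :+ (:- ρ) :* (c :- :1)) c ρ ρ′))
              where
              value₁ : c ≡ F.1#
              value₁ = trans (sym (F.*-identityʳ c)) (sym (trans (sym (line-E₁ F.1# (F.- ρ′))) (trans (Prop3-value {ℓ} {m} pr E₁) (cong (c F.*_) (line-E₁ F.1# (F.- ρ))))))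
              value₂ : F.- ρ′ ≡ c F.* (F.- ρ)
              value₂ = trans (sym (line-E₂ F.1# (F.- ρ′))) (trans (Prop3-value {ℓ} {m} pr E₂) (cong (c F.*_) (line-E₂ F.1# (F.- ρ))))
        split (no none) = inj₂ (ι r , ℓ , ι-nonzero r≢0 , ℓ≢0 , independent , ιQ≗)
          where
          -- Trace -t/r and norm u/r of the roots of rX² + tX + u.
          open QuadraticRoot {p = p} {k = k} p-prime q≡ F L ιL (F.- (d F.* t)) (d F.* u) using (root)
          irreducible : ∀ x → x F.* x F.- (F.- (d F.* t)) F.* x F.+ d F.* u ≢ F.0#
          irreducible x e = none (x , F.linear₂ r e (F.- (t F.* x F.+ u)) rd
            (F.solve 5 (λ r t u d x → r :* (x :* x) :+ t :* x :+ u :- :0 := r :* (x :* x :- (:- (d :* t)) :* x :+ d :* u :- :0) :+ (:- (t :* x :+ u)) :* (r :* d :- :1)) r t u d x))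
          ρ : C
          ρ = proj₁ (root irreducible)
          ρ-root : ρ * ρ - ι (F.- (d F.* t)) * ρ + ι (d F.* u) ≡ 0#
          ρ-root = proj₂ (root irreducible)
          R T U D : C
          R = ι r
          T = ι t
          U = ι u
          D = ι d
          RD : R * D ≡ 1#
          RD = trans (sym (ι-* r d)) (trans (cong ι rd) ι-1)
          ρ-root′ : R * (ρ * ρ) + T * ρ + U ≡ 0#
          ρ-root′ = linear₂ R (trans (sym (cong₂ (λ a b → ρ * ρ - a * ρ + b) (trans (ι-neg (d F.* t)) (cong -_ (ι-* d t))) (ι-* d u))) ρ-root) (- (T * ρ + U)) RD
            (solve 5 (λ r t u d x → r :* (x :* x) :+ t :* x :+ u :- :0 := r :* (x :* x :- (:- (d :* t)) :* x :+ d :* u :- :0) :+ (:- (t :* x :+ u)) :* (r :* d :- :1)) R T U D ρ)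
          ρ-irrational : fr ρ ≢ ρ
          ρ-irrational fixed = let x , ιx≡ = fr-fixed⇒ι fixed in none (x , ι-zero (trans (ι-+ _ _) (trans (cong (_+ U) (trans (ι-+ _ _)
            (cong₂ _+_ (trans (ι-* r _) (cong (R *_) (ι-* x x))) (ι-* t x)))) (trans (cong (λ y → R * (y * y) + T * y + U) ιx≡) ρ-root′))))
          fr-root : R * (fr ρ * fr ρ) + T * fr ρ + U ≡ 0#
          fr-root = trans (cong₂ _+_ (cong₂ _+_ (cong₂ _*_ (sym (fr-ι r)) (sym (fr-* ρ ρ))) (cong (_* fr ρ) (sym (fr-ι t)))) (sym (fr-ι u)))
            (trans (cong₂ _+_ (cong₂ _+_ (sym (fr-* R (ρ * ρ))) (sym (fr-* T ρ))) refl) (trans (cong (_+ fr U) (sym (fr-+ _ _)))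
              (trans (sym (fr-+ _ _)) (trans (cong fr ρ-root′) fr-0))))
          -- The quadratic vanishes at ρ and at its conjugate; the difference of the two equations
          -- is divisible by their nonzero difference. This identifies the conjugate as the second
          -- root.
          conjugate : R * (ρ + fr ρ) + T ≡ 0#
          conjugate = *-cancelˡ-0 {ρ - fr ρ} (λ z → ρ-irrational (sym (x-y≡0⇒x≡y z)))
            (linear₂ 1# ρ-root′ (- 1#) fr-root (solve 5 (λ r t u x y → (x :- y) :* (r :* (x :+ y) :+ t) :- :0 := :1 :* (r :* (x :* x) :+ t :* x :+ u :- :0) :+ (:- :1) :* (r :* (y :* y) :+ t :* y :+ u :- :0)) R T U ρ (fr ρ)))
          ℓ : Vec3
          ℓ i = ι (m₁ i) - ρ * ι (m₂ i)
          fr-ℓ : ∀ i → fr (ℓ i) ≡ ι (m₁ i) - fr ρ * ι (m₂ i)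
          fr-ℓ i = trans (fr-sub _ _) (cong₂ _-_ (fr-ι (m₁ i)) (trans (fr-* ρ _) (cong (fr ρ *_) (fr-ι (m₂ i)))))
          combination-· : ∀ ρ x → (λ i → ι (m₁ i) - ρ * ι (m₂ i)) · x ≡ ιV m₁ · x - ρ * (ιV m₂ · x)
          combination-· ρ x = solveFor (scalar ∷ vector ∷ vector ∷ vector ∷ []) (λ r m n x → (λ i → m i :- r :* n i) :· x := m :· x :- r :* (n :· x)) ρ (ιV m₁) (ιV m₂) x
          at : ∀ ρ {e a b} → m₁ F.· e ≡ a → m₂ F.· e ≡ b → (λ i → ι (m₁ i) - ρ * ι (m₂ i)) · ιV e ≡ ι a - ρ * ι b
          at ρ {e} x y = trans (combination-· ρ (ιV e)) (cong₂ (λ a b → a - ρ * b) (trans (sym (ι-· m₁ e)) (cong ι x)) (trans (sym (ι-· m₂ e)) (cong ι y)))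
          atE₁ : ∀ ρ → (λ i → ι (m₁ i) - ρ * ι (m₂ i)) · ιV E₁ ≡ 1#
          atE₁ ρ = trans (at ρ {E₁} m₁E₁ m₂E₁) (trans (cong₂ (λ a b → a - ρ * b) ι-1 ι-0) (solve 1 (λ r → :1 :- r :* :0 := :1) ρ))
          atE₂ : ∀ ρ → (λ i → ι (m₁ i) - ρ * ι (m₂ i)) · ιV E₂ ≡ - ρ
          atE₂ ρ = trans (at ρ {E₂} m₁E₂ m₂E₂) (trans (cong₂ (λ a b → a - ρ * b) ι-0 ι-1) (solve 1 (λ r → :0 :- r :* :1 := :- r) ρ))
          ℓ≢0 : NonZero3 ℓ
          ℓ≢0 = [ id , (λ z → ⊥-elim (1≢0 (trans (sym (atE₁ ρ)) (·-zero {ℓ} {ιV E₁} z)))) ]′ (nonzero? ℓ)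
          independent : ¬ Prop3 ℓ (frV ℓ)
          independent (c , _ , e) = ρ-irrational (linear₂ (- 1#) value₂ ρ value₁
              (solve 3 (λ c ρ ρ′ → ρ′ :- ρ := (:- :1) :* (:- ρ′ :- c :* :- ρ) :+ ρ :* (c :- :1)) c ρ (fr ρ)))
            where
            scaled : ∀ x → (λ i → ι (m₁ i) - fr ρ * ι (m₂ i)) · x ≡ c * (ℓ · x)
            scaled x = trans (·-cong {λ i → ι (m₁ i) - fr ρ * ι (m₂ i)} {c *V ℓ} {x} {x} (λ i → trans (sym (fr-ℓ i)) (e i)) (λ _ → refl))
              (solveFor (scalar ∷ vector ∷ vector ∷ []) (λ c m x → (λ i → c :* m i) :· x := c :* (m :· x)) c ℓ x)
            value₁ : c ≡ 1#
            value₁ = trans (sym (*-identityʳ c)) (sym (trans (sym (atE₁ (fr ρ))) (trans (scaled (ιV E₁)) (cong (c *_) (atE₁ ρ)))))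
            value₂ : - fr ρ ≡ c * (- ρ)
            value₂ = trans (sym (atE₂ (fr ρ))) (trans (scaled (ιV E₂)) (cong (c *_) (atE₂ ρ)))
          ιQ≗ : ∀ p → ι (Q p) ≡ R * prodLin ℓ (frV ℓ) p
          ιQ≗ p = trans (cong ι (singular≗pencil {Q} s p)) (trans (expandι p) (factored p))
            where
            expandι : ∀ p → ι (pencil r t u p) ≡ R * prodLin (ιV m₁) (ιV m₁) p + (T * prodLin (ιV m₁) (ιV m₂) p + U * prodLin (ιV m₂) (ιV m₂) p)
            expandι p = trans (ι-+ _ _) (cong₂ _+_ (trans (ι-* r _) (cong (R *_) (ι-prodLin m₁ m₁ p))) (trans (ι-+ _ _)
              (cong₂ _+_ (trans (ι-* t _) (cong (T *_) (ι-prodLin m₁ m₂ p))) (trans (ι-* u _) (cong (U *_) (ι-prodLin m₂ m₂ p))))))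
            square : ∀ i → R * (ι (m₁ i) * ι (m₁ i)) + (T * (ι (m₁ i) * ι (m₂ i)) + U * (ι (m₂ i) * ι (m₂ i))) ≡ R * (ℓ i * fr (ℓ i))
            square i = trans (linear₂ (ι (m₁ i) * ι (m₂ i) - ρ * (ι (m₂ i) * ι (m₂ i))) conjugate (ι (m₂ i) * ι (m₂ i)) ρ-root′
                (solve 7 (λ r t u x y a b → r :* (a :* a) :+ (t :* (a :* b) :+ u :* (b :* b)) :- r :* ((a :- x :* b) :* (a :- y :* b)) :=
                  (a :* b :- x :* (b :* b)) :* (r :* (x :+ y) :+ t :- :0) :+ (b :* b) :* (r :* (x :* x) :+ t :* x :+ u :- :0)) R T U ρ (fr ρ) (ι (m₁ i)) (ι (m₂ i))))
              (cong (λ z → R * (ℓ i * z)) (sym (fr-ℓ i)))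
            mixed : ∀ i j → R * (ι (m₁ i) * ι (m₁ j) + ι (m₁ j) * ι (m₁ i)) + (T * (ι (m₁ i) * ι (m₂ j) + ι (m₁ j) * ι (m₂ i)) + U * (ι (m₂ i) * ι (m₂ j) + ι (m₂ j) * ι (m₂ i))) ≡
              R * (ℓ i * fr (ℓ j) + ℓ j * fr (ℓ i))
            mixed i j = trans (linear₂ (ι (m₁ i) * ι (m₂ j) + ι (m₁ j) * ι (m₂ i) - (1# + 1#) * ρ * (ι (m₂ i) * ι (m₂ j))) conjugate ((1# + 1#) * (ι (m₂ i) * ι (m₂ j))) ρ-root′
                (solve 9 (λ r t u x y a b e f → r :* (a :* e :+ e :* a) :+ (t :* (a :* f :+ e :* b) :+ u :* (b :* f :+ f :* b)) :- r :* ((a :- x :* b) :* (e :- y :* f) :+ (e :- x :* f) :* (a :- y :* b)) :=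
                  (a :* f :+ e :* b :- (:1 :+ :1) :* x :* (b :* f)) :* (r :* (x :+ y) :+ t :- :0) :+ ((:1 :+ :1) :* (b :* f)) :* (r :* (x :* x) :+ t :* x :+ u :- :0))
                  R T U ρ (fr ρ) (ι (m₁ i)) (ι (m₂ i)) (ι (m₁ j)) (ι (m₂ j))))
              (cong₂ (λ y z → R * (ℓ i * y + ℓ j * z)) (sym (fr-ℓ j)) (sym (fr-ℓ i)))
            factored : ∀ p → R * prodLin (ιV m₁) (ιV m₁) p + (T * prodLin (ιV m₁) (ιV m₂) p + U * prodLin (ιV m₂) (ιV m₂) p) ≡ R * prodLin ℓ (frV ℓ) p
            factored = ∀Pair (square i0) (square i1) (square i2) (mixed i0 i1) (mixed i0 i2) (mixed i1 i2)
      decide : Dec (r ≡ F.0#) → F.BiLine Q ⊎ G.ImBiLine Q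
      decide (no r≢0) = Split.split r≢0 (Finₚ.any? (λ ρ → r F.* (ρ F.* ρ) F.+ t F.* ρ F.+ u F.≟ F.0#))
      decide (yes r≡0) = inj₁ (F.1# , line t u , m₂ , F.1≢0 , nonzero-by {line t u} {E₁} (line-E₁ t u) t≢0 , m₂≢0 , independent ,
          ext-product {F.1#} {line t u} {m₂} λ x → trans (evalQ x) (trans
            (F.linear₁ ((m₁ F.· x) F.* (m₁ F.· x)) r≡0 (F.solve 5 (λ r t u a b → r :* (a :* a) :+ (t :* (a :* b) :+ u :* (b :* b)) :- :1 :* ((t :* a :+ u :* b) :* b) := (a :* a) :* (r :- :0))
              r t u (m₁ F.· x) (m₂ F.· x)))
            (cong (λ z → F.1# F.* (z F.* (m₂ F.· x))) (sym (line-· t u x)))))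
        where
        m₂≢0 : F.NonZero3 m₂
        m₂≢0 = nonzero-by {m₂} {E₂} m₂E₂ F.1≢0
        t≢0 : t ≢ F.0#
        t≢0 t≡0 = square-case (u F.≟ F.0#)
          where
          Q≗um₂² : Q F.≗F F.scaleF u (F.prodLin m₂ m₂)
          Q≗um₂² = ext-product {u} {m₂} {m₂} λ x → trans (evalQ x) (F.linear₂ ((m₁ F.· x) F.* (m₁ F.· x)) r≡0 ((m₁ F.· x) F.* (m₂ F.· x)) t≡0
            (F.solve 5 (λ r t u a b → r :* (a :* a) :+ (t :* (a :* b) :+ u :* (b :* b)) :- u :* (b :* b) := (a :* a) :* (r :- :0) :+ (a :* b) :* (t :- :0)) r t u (m₁ F.· x) (m₂ F.· x)))
          square-case : Dec (u ≡ F.0#) → ⊥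
          square-case (no u≢0) = proj₂ nr (u , m₂ , u≢0 , m₂≢0 , Q≗um₂²)
          square-case (yes u≡0) = let p , n = proj₁ nr in n (trans (Q≗um₂² p) (trans (cong (F._* F.prodLin m₂ m₂ p) u≡0) (F.zeroˡ _)))
        independent : ¬ F.Prop3 (line t u) m₂
        independent pr@(c , c≢0 , _) = F.*-nonzero c≢0 t≢0 (trans (cong (c F.*_) (sym (line-E₁ t u))) (trans (sym (Prop3-value {line t u} {m₂} pr E₁)) m₂E₁))

-- Counting with duplicate-free lists

sameLength : ∀ {A : Set} {xs ys : List A} → Unique xs → Unique ys →
  (∀ {x} → x ∈ xs → x ∈ ys) → (∀ {x} → x ∈ ys → x ∈ xs) → length xs ≡ length ys
sameLength u v f g = ↭-length (sameMembers⇒↭ u v f g)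

length-cartesianProduct : ∀ {A B : Set} (xs : List A) (ys : List B) → length (cartesianProduct xs ys) ≡ length xs ℕ.* length ys
length-cartesianProduct []       ys = refl
length-cartesianProduct (x ∷ xs) ys = trans (Listₚ.length-++ (map (x ,_) ys)) (cong₂ ℕ._+_ (Listₚ.length-map (x ,_) ys) (length-cartesianProduct xs ys))

length-allFin : ∀ n → length (allFin n) ≡ n
length-allFin n = Listₚ.length-tabulate {n = n} (λ i → i)

length-complement : ∀ {A : Set} {P : A → Set} (P? : Decidable P) xs → length (filter P? xs) ℕ.+ length (filter (λ x → ¬? (P? x)) xs) ≡ length xs
length-complement P? []       = refl
length-complement P? (x ∷ xs) with P? x
... | yes _ = cong suc (length-complement P? xs)
... | no _  = trans (ℕₚ.+-suc _ _) (cong suc (length-complement P? xs))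

module OrbitsOfThree {A : Set} (σ : A → A) (σ³ : ∀ x → σ (σ (σ x)) ≡ x) (code : A → ℕ) (code-injective : ∀ {x y} → code x ≡ code y → x ≡ y)
  (xs : List A) (xs-unique : Unique xs) (closed : ∀ {x} → x ∈ xs → σ x ∈ xs) (free : ∀ {x} → x ∈ xs → σ x ≢ x) where

  -- Codes are injective and orbits have three elements, so exactly one element of each orbit
  -- qualifies.
  Least : A → Set
  Least x = code x ℕ.≤ code (σ x) × code x ℕ.≤ code (σ (σ x))

  least? : Decidable Least
  least? x = (code x ℕ.≤? code (σ x)) ×-dec (code x ℕ.≤? code (σ (σ x)))

  representatives : List A
  representatives = filter least? xs

  representatives-unique : Unique representatives
  representatives-unique = Uniqueₚ.filter⁺ least? xs-unique

  representative⁻ : ∀ {x} → x ∈ representatives → x ∈ xs × Least x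
  representative⁻ = ∈-filter⁻ least? {xs = xs}

  σ-injective : ∀ {x y} → σ x ≡ σ y → x ≡ y
  σ-injective {x} {y} e = trans (sym (σ³ x)) (trans (cong (σ ∘ σ) e) (σ³ y))

  -- Exchange of x and y also excludes x = σ (σ y), since σ has order three.
  apart : ∀ {x y} → x ∈ representatives → y ∈ representatives → x ≢ σ y
  apart {x} {y} x∈ y∈ refl = free (proj₁ (representative⁻ y∈)) (code-injective (ℕₚ.≤-antisym
    (ℕₚ.≤-trans (proj₂ (proj₂ (representative⁻ x∈))) (ℕₚ.≤-reflexive (cong code (σ³ y)))) (proj₁ (proj₂ (representative⁻ y∈)))))

  orbit-of : ∀ {x} → x ∈ xs → Σ A λ r → r ∈ representatives × (x ≡ r ⊎ (x ≡ σ r ⊎ x ≡ σ (σ r)))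
  orbit-of {x} x∈ with ℕₚ.≤-total (code x) (code (σ x)) | ℕₚ.≤-total (code x) (code (σ (σ x))) | ℕₚ.≤-total (code (σ x)) (code (σ (σ x)))
  ... | inj₁ a | inj₁ b | _      = x , ∈-filter⁺ least? x∈ (a , b) , inj₁ refl
  ... | inj₂ a | _      | inj₁ c = σ x , ∈-filter⁺ least? (closed x∈) (c , subst (λ y → code (σ x) ℕ.≤ code y) (sym (σ³ x)) a) , inj₂ (inj₂ (sym (σ³ x)))
  ... | _      | inj₂ b | inj₂ c = σ (σ x) , ∈-filter⁺ least? (closed (closed x∈))
          (subst (λ y → code (σ (σ x)) ℕ.≤ code y) (sym (σ³ x)) b , subst (λ y → code (σ (σ x)) ℕ.≤ code y) (sym (cong σ (σ³ x))) c) , inj₂ (inj₁ (sym (σ³ x)))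
  -- In the last two cases the inequalities form a cycle, so all three codes agree.
  ... | inj₁ a | inj₂ b | inj₁ c = x , ∈-filter⁺ least? x∈ (a , ℕₚ.≤-trans a c) , inj₁ refl
  ... | inj₂ a | inj₁ b | inj₂ c = x , ∈-filter⁺ least? x∈ (ℕₚ.≤-trans b c , b) , inj₁ refl

  length-representatives : length xs ≡ length representatives ℕ.* 3
  length-representatives = trans (sameLength xs-unique all-unique to from)
      (trans (Listₚ.length-++ R) (trans (cong (length R ℕ.+_) (trans (Listₚ.length-++ (map σ R)) (cong₂ ℕ._+_ (Listₚ.length-map σ R) (Listₚ.length-map (σ ∘ σ) R))))
        (solveℕ 1 (λ r → r +ℕ (r +ℕ r) =ℕ r *ℕ conℕ 3) refl (length R))))
    where
    open +-*-Solver renaming (solve to solveℕ; _:+_ to _+ℕ_; _:*_ to _*ℕ_; _:=_ to _=ℕ_; con to conℕ)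
    R = representatives
    all-unique : Unique (R ++ (map σ R ++ map (σ ∘ σ) R))
    all-unique = Uniqueₚ.++⁺ representatives-unique (Uniqueₚ.++⁺ (Uniqueₚ.map⁺ σ-injective representatives-unique)
        (Uniqueₚ.map⁺ (σ-injective ∘ σ-injective) representatives-unique) disjoint₂) disjoint₁
      where
      disjoint₂ : ∀ {x} → ¬ (x ∈ map σ R × x ∈ map (σ ∘ σ) R)
      disjoint₂ (a , b) = let y , y∈ , e = ∈-map⁻ σ a ; z , z∈ , f = ∈-map⁻ (σ ∘ σ) b in apart y∈ z∈ (σ-injective (trans (sym e) f))
      disjoint₁ : ∀ {x} → ¬ (x ∈ R × x ∈ map σ R ++ map (σ ∘ σ) R)
      disjoint₁ (a , b) = [ (λ c → let y , y∈ , e = ∈-map⁻ σ c in apart a y∈ e) ,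
        (λ c → let y , y∈ , e = ∈-map⁻ (σ ∘ σ) c in apart y∈ a (trans (sym (σ³ y)) (cong σ (sym e)))) ]′ (∈-++⁻ (map σ R) b)
    to : ∀ {x} → x ∈ xs → x ∈ R ++ (map σ R ++ map (σ ∘ σ) R)
    to x∈ with orbit-of x∈
    ... | r , r∈ , inj₁ refl        = ∈-++⁺ˡ r∈
    ... | r , r∈ , inj₂ (inj₁ refl) = ∈-++⁺ʳ R (∈-++⁺ˡ (∈-map⁺ σ r∈))
    ... | r , r∈ , inj₂ (inj₂ refl) = ∈-++⁺ʳ R (∈-++⁺ʳ (map σ R) (∈-map⁺ (σ ∘ σ) r∈))
    from : ∀ {x} → x ∈ R ++ (map σ R ++ map (σ ∘ σ) R) → x ∈ xs
    from x∈ with ∈-++⁻ R x∈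
    ... | inj₁ a = proj₁ (representative⁻ a)
    ... | inj₂ b with ∈-++⁻ (map σ R) b
    ...   | inj₁ c with y , y∈ , refl ← ∈-map⁻ σ c = closed (proj₁ (representative⁻ y∈))
    ...   | inj₂ c with y , y∈ , refl ← ∈-map⁻ (σ ∘ σ) c = closed (closed (proj₁ (representative⁻ y∈)))

-- Enumeration of points and of degenerate forms

module Enumerations {q : ℕ} (F : FiniteField q) where
  open DegenerateForms F

  pairs : List (C × C)
  pairs = cartesianProduct (allFin q) (allFin q)

  pairs-unique : Unique pairs
  pairs-unique = Uniqueₚ.cartesianProduct⁺ (Uniqueₚ.allFin⁺ q) (Uniqueₚ.allFin⁺ q)

  ∈-pairs : ∀ x → x ∈ pairs
  ∈-pairs (a , b) = ∈-cartesianProduct⁺ (∈-allFin a) (∈-allFin b)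

  length-pairs : length pairs ≡ q ℕ.* q
  length-pairs = trans (length-cartesianProduct (allFin q) (allFin q)) (cong₂ ℕ._*_ (length-allFin q) (length-allFin q))

  -- codes for the normalised points (1,a,b), (0,1,b), (0,0,1)
  PointCode : Set
  PointCode = (C × C) ⊎ (C ⊎ ⊤)

  point : PointCode → Vec3
  point (inj₁ (a , b))   = vec3 1# a b
  point (inj₂ (inj₁ b))  = vec3 0# 1# b
  point (inj₂ (inj₂ tt)) = vec3 0# 0# 1#

  point≢0 : ∀ c → NonZero3 (point c)
  point≢0 (inj₁ _)        = i0 , 1≢0
  point≢0 (inj₂ (inj₁ _)) = i1 , 1≢0
  point≢0 (inj₂ (inj₂ _)) = i2 , 1≢0

  pointCodes : List PointCode
  pointCodes = map inj₁ pairs ++ (map (inj₂ ∘ inj₁) (allFin q) ++ (inj₂ (inj₂ tt) ∷ []))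

  ∈-pointCodes : ∀ c → c ∈ pointCodes
  ∈-pointCodes (inj₁ x)         = ∈-++⁺ˡ (∈-map⁺ inj₁ (∈-pairs x))
  ∈-pointCodes (inj₂ (inj₁ b))  = ∈-++⁺ʳ (map inj₁ pairs) (∈-++⁺ˡ (∈-map⁺ (inj₂ ∘ inj₁) (∈-allFin b)))
  ∈-pointCodes (inj₂ (inj₂ tt)) = ∈-++⁺ʳ (map inj₁ pairs) (∈-++⁺ʳ (map (inj₂ ∘ inj₁) (allFin q)) (here refl))

  pointCodes-unique : Unique pointCodes
  pointCodes-unique = Uniqueₚ.++⁺ (Uniqueₚ.map⁺ (λ { refl → refl }) pairs-unique)
    (Uniqueₚ.++⁺ (Uniqueₚ.map⁺ (λ { refl → refl }) (Uniqueₚ.allFin⁺ q)) ([] ∷ []) disjoint₂) disjoint₁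
    where
    disjoint₂ : ∀ {x} → ¬ (x ∈ map (inj₂ ∘ inj₁) (allFin q) × x ∈ (inj₂ (inj₂ tt) ∷ []))
    disjoint₂ (a , here refl) with _ , _ , () ← ∈-map⁻ (inj₂ ∘ inj₁) a
    disjoint₁ : ∀ {x} → ¬ (x ∈ map inj₁ pairs × x ∈ map (inj₂ ∘ inj₁) (allFin q) ++ (inj₂ (inj₂ tt) ∷ []))
    disjoint₁ (a , b) with _ , _ , refl ← ∈-map⁻ inj₁ a with ∈-++⁻ (map (inj₂ ∘ inj₁) (allFin q)) b
    ... | inj₁ c with _ , _ , () ← ∈-map⁻ (inj₂ ∘ inj₁) c
    ... | inj₂ (here ())

  length-pointCodes : length pointCodes ≡ q ℕ.* q ℕ.+ q ℕ.+ 1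
  length-pointCodes = trans (Listₚ.length-++ (map inj₁ pairs)) (trans (cong₂ ℕ._+_ (trans (Listₚ.length-map inj₁ pairs) length-pairs)
    (trans (Listₚ.length-++ (map (inj₂ ∘ inj₁) (allFin q))) (cong (ℕ._+ 1) (trans (Listₚ.length-map (inj₂ ∘ inj₁) (allFin q)) (length-allFin q)))))
    (sym (ℕₚ.+-assoc (q ℕ.* q) q 1)))

  private
    equal-one : ∀ {c} → 1# ≡ c * 1# → c ≡ 1#
    equal-one {c} e = trans (sym (*-identityʳ c)) (sym e)
    same : ∀ {c x y} → c ≡ 1# → y ≡ c * x → x ≡ y
    same {c} {x} e f = sym (trans f (trans (cong (_* x) e) (*-identityˡ x)))
    impossible : ∀ {c} → 1# ≡ c * 0# → ⊥
    impossible {c} e = 1≢0 (trans e (zeroʳ c))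
    impossible′ : ∀ {c} → c ≢ 0# → 0# ≡ c * 1# → ⊥
    impossible′ {c} c≢0 e = c≢0 (trans (sym (*-identityʳ c)) (sym e))

  point-injective : ∀ {c d} → Prop3 (point c) (point d) → c ≡ d
  point-injective {inj₁ (a , b)} {inj₁ (a′ , b′)} (c , _ , e) = cong inj₁ (cong₂ _,_ (same (equal-one (e i0)) (e i1)) (same (equal-one (e i0)) (e i2)))
  point-injective {inj₁ _} {inj₂ (inj₁ _)} (c , c≢0 , e) = ⊥-elim (impossible′ c≢0 (e i0))
  point-injective {inj₁ _} {inj₂ (inj₂ _)} (c , c≢0 , e) = ⊥-elim (impossible′ c≢0 (e i0))
  point-injective {inj₂ (inj₁ _)} {inj₁ _} (c , c≢0 , e) = ⊥-elim (impossible (e i0))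
  point-injective {inj₂ (inj₂ _)} {inj₁ _} (c , c≢0 , e) = ⊥-elim (impossible (e i0))
  point-injective {inj₂ (inj₁ b)} {inj₂ (inj₁ b′)} (c , _ , e) = cong (inj₂ ∘ inj₁) (same (equal-one (e i1)) (e i2))
  point-injective {inj₂ (inj₁ _)} {inj₂ (inj₂ _)} (c , c≢0 , e) = ⊥-elim (impossible′ c≢0 (e i1))
  point-injective {inj₂ (inj₂ _)} {inj₂ (inj₁ _)} (c , c≢0 , e) = ⊥-elim (impossible (e i1))
  point-injective {inj₂ (inj₂ tt)} {inj₂ (inj₂ tt)} _ = refl

  scale-back : ∀ {x} → x ≢ 0# → ∀ y → y ≡ x * (x ⁻¹ * y)
  scale-back {x} x≢0 y = sym (trans (sym (*-assoc _ _ _)) (trans (cong (_* y) (*-inverseʳ x≢0)) (*-identityˡ y)))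

  point-surjective : ∀ {v} → NonZero3 v → Σ PointCode λ c → Prop3 (point c) v
  point-surjective {v} v≢0 = decide (v i0 ≟ 0#) (v i1 ≟ 0#)
    where
    scaled-zero : ∀ {x y} → y ≡ 0# → y ≡ x * 0#
    scaled-zero {x} e = trans e (sym (zeroʳ x))
    decide : Dec (v i0 ≡ 0#) → Dec (v i1 ≡ 0#) → Σ PointCode λ c → Prop3 (point c) v
    decide (no n) _ = inj₁ (v i0 ⁻¹ * v i1 , v i0 ⁻¹ * v i2) , v i0 , n , ∀Fin3 (sym (*-identityʳ _)) (scale-back n (v i1)) (scale-back n (v i2))
    decide (yes z) (no n) = inj₂ (inj₁ (v i1 ⁻¹ * v i2)) , v i1 , n , ∀Fin3 (scaled-zero z) (sym (*-identityʳ _)) (scale-back n (v i2))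
    decide (yes z) (yes z′) = inj₂ (inj₂ tt) , v i2 , last v≢0 , ∀Fin3 (scaled-zero z) (scaled-zero z′) (sym (*-identityʳ _))
      where
      last : NonZero3 v → v i2 ≢ 0#
      last (i0 , n) = λ _ → n z
      last (i1 , n) = λ _ → n z′
      last (i2 , n) = n

  -- codes for the binary forms X² + sXY + tY² and XY + tY²
  Square : C × C → Set
  Square (s , t) = Σ C λ n → s ≡ n + n × t ≡ n * n

  square? : Decidable Square
  square? (s , t) = Finₚ.any? (λ n → (s ≟ n + n) ×-dec (t ≟ n * n))

  BinaryCode : Set
  BinaryCode = (C × C) ⊎ C

  NonSquare : BinaryCode → Set
  NonSquare (inj₁ st) = ¬ Square st
  NonSquare (inj₂ _)  = ⊤

  binaryCodes : List BinaryCode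
  binaryCodes = map inj₁ (filter (λ x → ¬? (square? x)) pairs) ++ map inj₂ (allFin q)

  ∈-binaryCodes : ∀ c → NonSquare c → c ∈ binaryCodes
  ∈-binaryCodes (inj₁ x) n = ∈-++⁺ˡ (∈-map⁺ inj₁ (∈-filter⁺ (λ x → ¬? (square? x)) (∈-pairs x) n))
  ∈-binaryCodes (inj₂ t) _ = ∈-++⁺ʳ (map inj₁ (filter (λ x → ¬? (square? x)) pairs)) (∈-map⁺ inj₂ (∈-allFin t))

  binaryCodes⇒nonSquare : ∀ {c} → c ∈ binaryCodes → NonSquare c
  binaryCodes⇒nonSquare c∈ with ∈-++⁻ (map inj₁ (filter (λ x → ¬? (square? x)) pairs)) c∈
  ... | inj₁ a with x , x∈ , refl ← ∈-map⁻ inj₁ a = proj₂ (∈-filter⁻ (λ x → ¬? (square? x)) {xs = pairs} x∈)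
  ... | inj₂ b with t , _ , refl ← ∈-map⁻ inj₂ b = tt

  binaryCodes-unique : Unique binaryCodes
  binaryCodes-unique = Uniqueₚ.++⁺ (Uniqueₚ.map⁺ (λ { refl → refl }) (Uniqueₚ.filter⁺ (λ x → ¬? (square? x)) pairs-unique))
    (Uniqueₚ.map⁺ (λ { refl → refl }) (Uniqueₚ.allFin⁺ q)) disjoint
    where
    disjoint : ∀ {x} → ¬ (x ∈ map inj₁ (filter (λ x → ¬? (square? x)) pairs) × x ∈ map inj₂ (allFin q))
    disjoint (a , b) with _ , _ , refl ← ∈-map⁻ inj₁ a with _ , _ , () ← ∈-map⁻ inj₂ b

  -- The map n ↦ (2n, n²) is injective in every characteristic, because (n - m)² = (n² - m²) - m(2n
  -- - 2m).
  length-squares : length (filter square? pairs) ≡ q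
  length-squares = trans (sameLength (Uniqueₚ.filter⁺ square? pairs-unique) (Uniqueₚ.map⁺ injective (Uniqueₚ.allFin⁺ q))
      (λ x∈ → to (proj₂ (∈-filter⁻ square? {xs = pairs} x∈)))
      (λ {x} x∈ → let n , _ , e = ∈-map⁻ double-square x∈ in ∈-filter⁺ square? (∈-pairs x) (n , cong proj₁ e , cong proj₂ e)))
    (trans (Listₚ.length-map double-square (allFin q)) (length-allFin q))
    where
    double-square : C → C × C
    double-square n = n + n , n * n
    to : ∀ {x} → Square x → x ∈ map double-square (allFin q)
    to {s , t} (n , refl , refl) = ∈-map⁺ double-square (∈-allFin n)
    injective : ∀ {n m} → double-square n ≡ double-square m → n ≡ m
    injective {n} {m} e = x-y≡0⇒x≡y ([ id , id ]′ (*-zero-product {n - m} {n - m} (linear₂ 1# (cong proj₂ e) (- m) (cong proj₁ e)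
      (solve 2 (λ n m → (n :- m) :* (n :- m) :- :0 := :1 :* (n :* n :- m :* m) :+ (:- m) :* (n :+ n :- (m :+ m))) n m))))

  -- The q² forms X² + sXY + tY² lose q squares, and the q forms XY + tY² make up for them.
  length-binaryCodes : length binaryCodes ≡ q ℕ.* q
  length-binaryCodes = trans (Listₚ.length-++ (map inj₁ (filter (λ x → ¬? (square? x)) pairs)))
    (trans (cong₂ ℕ._+_ (Listₚ.length-map inj₁ (filter (λ x → ¬? (square? x)) pairs)) (trans (Listₚ.length-map inj₂ (allFin q)) (length-allFin q)))
      (trans (ℕₚ.+-comm _ q) (trans (cong (ℕ._+ length (filter (λ x → ¬? (square? x)) pairs)) (sym length-squares))
        (trans (length-complement square? pairs) length-pairs))))

  coefficient₁ coefficient₂ coefficient₃ : BinaryCode → C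
  coefficient₁ (inj₁ _) = 1#
  coefficient₁ (inj₂ _) = 0#
  coefficient₂ (inj₁ (s , _)) = s
  coefficient₂ (inj₂ _) = 1#
  coefficient₃ (inj₁ (_ , t)) = t
  coefficient₃ (inj₂ t) = t

  FormCode : Set
  FormCode = PointCode × BinaryCode

  formCodes : List FormCode
  formCodes = cartesianProduct pointCodes binaryCodes

  formCodes-unique : Unique formCodes
  formCodes-unique = Uniqueₚ.cartesianProduct⁺ pointCodes-unique binaryCodes-unique

  length-formCodes : length formCodes ≡ (q ℕ.* q ℕ.+ q ℕ.+ 1) ℕ.* (q ℕ.* q)
  length-formCodes = trans (length-cartesianProduct pointCodes binaryCodes) (cong₂ ℕ._*_ length-pointCodes length-binaryCodes)

  module PencilAt (c : PointCode) where
    private completion = complete₂ {point c} (point≢0 c)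
    E₁ E₂ : Vec3
    E₁ = proj₁ completion
    E₂ = proj₁ (proj₂ completion)
    open Pencil (point c) E₁ E₂ (proj₂ (proj₂ completion)) public

  formOf : FormCode → Form
  formOf (c , b) = PencilAt.pencil c (coefficient₁ b) (coefficient₂ b) (coefficient₃ b)

  formOf-singular : ∀ x → Singular (formOf x) (point (proj₁ x))
  formOf-singular (c , b) = PencilAt.pencil-singular c (coefficient₁ b) (coefficient₂ b) (coefficient₃ b)

  formOf-E₁ : ∀ c b → eval (formOf (c , b)) (PencilAt.E₁ c) ≡ coefficient₁ b
  formOf-E₁ c b = PencilAt.pencil-E₁ c (coefficient₁ b) (coefficient₂ b) (coefficient₃ b)

  formOf-E₂ : ∀ c b → eval (formOf (c , b)) (PencilAt.E₂ c) ≡ coefficient₃ b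
  formOf-E₂ c b = PencilAt.pencil-E₂ c (coefficient₁ b) (coefficient₂ b) (coefficient₃ b)

  formOf-polar : ∀ c b → polar (formOf (c , b)) (PencilAt.E₁ c) (PencilAt.E₂ c) ≡ coefficient₂ b
  formOf-polar c b = PencilAt.polar-pencil c (coefficient₁ b) (coefficient₂ b) (coefficient₃ b)

  formOf-nonrepeated : ∀ {c b} → NonSquare b → NonRepeated (formOf (c , b))
  formOf-nonrepeated {c} {b} nonsquare = [ id , (λ z → ⊥-elim (nonzero b (vanish z))) ]′ (nonzeroForm? (formOf (c , b))) , λ (d , n , d≢0 , n≢0 , e) →
      absurd b nonsquare d (n · E₁) (n · E₂)
        (trans (sym (formOf-E₁ c b)) (eval-multiple {formOf (c , b)} {d} {n} {n} e E₁))
        (trans (sym (formOf-polar c b)) (polar-multiple {formOf (c , b)} {d} {n} {n} e E₁ E₂))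
        (trans (sym (formOf-E₂ c b)) (eval-multiple {formOf (c , b)} {d} {n} {n} e E₂)) d≢0
    where
    open PencilAt c using (E₁; E₂)
    vanish : (∀ p → formOf (c , b) p ≡ 0#) → coefficient₁ b ≡ 0# × coefficient₂ b ≡ 0#
    vanish z = trans (sym (formOf-E₁ c b)) (trans (eval-cong {formOf (c , b)} {zeroF} {E₁} {E₁} z (λ _ → refl)) (eval-zeroF E₁)) ,
      trans (sym (formOf-polar c b)) (trans (polar-cong {formOf (c , b)} {zeroF} {E₁} {E₂} {E₁} {E₂} z (λ _ → refl) (λ _ → refl)) (polar-zeroF E₁ E₂))
    nonzero : ∀ b → ¬ (coefficient₁ b ≡ 0# × coefficient₂ b ≡ 0#)
    nonzero (inj₁ _) (e , _) = 1≢0 e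
    nonzero (inj₂ _) (_ , e) = 1≢0 e
    absurd : ∀ b → NonSquare b → ∀ d x y → coefficient₁ b ≡ d * (x * x) → coefficient₂ b ≡ d * (x * y + y * x) → coefficient₃ b ≡ d * (y * y) → d ≢ 0# → ⊥
    -- Since dx² = 1, the form d(xX + yY)² equals (X + nY)² with n = dxy.
    absurd (inj₁ (s , t)) ns d x y e₁ e₂ e₃ _ = ns (d * (x * y) , trans e₂ (solve 3 (λ d x y → d :* (x :* y :+ y :* x) := d :* (x :* y) :+ d :* (x :* y)) d x y) ,
      trans e₃ (linear₁ (d * (y * y)) e₁ (solve 3 (λ d x y → d :* (y :* y) :- d :* (x :* y) :* (d :* (x :* y)) := d :* (y :* y) :* (:1 :- d :* (x :* x))) d x y)))
    absurd (inj₂ t) _ d x y e₁ e₂ e₃ d≢0 = 1≢0 (trans e₂ (linear₁ (d * (y + y)) x≡0 (solve 3 (λ d x y → d :* (x :* y :+ y :* x) :- :0 := d :* (y :+ y) :* (x :- :0)) d x y)))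
      where
      x≡0 : x ≡ 0#
      x≡0 = [ id , id ]′ (*-zero-product {x} {x} (*-cancelˡ-0 d≢0 (sym e₁)))

  formOf-injective : ∀ {x y} → NonSquare (proj₂ x) → NonSquare (proj₂ y) → PropForm (formOf y) (formOf x) → x ≡ y
  formOf-injective {c , b} {c′ , b′} nb nb′ (d , d≢0 , e) = go (point-injective (center-unique {formOf (c , b)} {point c} {point c′}
      (formOf-nonrepeated {c} {b} nb) (point≢0 c) (point≢0 c′) (formOf-singular (c , b))
      (Singular-cong {scaleF d (formOf (c′ , b′))} {formOf (c , b)} {point c′} {point c′} (λ p → sym (e p)) (λ _ → refl)
        (IsSubspace.has-* (singular-subspace (point c′)) d {formOf (c′ , b′)} (formOf-singular (c′ , b′))))))
    where
    codes-equal : ∀ b b′ → coefficient₁ b ≡ d * coefficient₁ b′ → coefficient₂ b ≡ d * coefficient₂ b′ → coefficient₃ b ≡ d * coefficient₃ b′ → b ≡ b′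
    codes-equal (inj₁ _) (inj₁ _) e₁ e₂ e₃ = cong inj₁ (cong₂ _,_ (sym (same (equal-one e₁) e₂)) (sym (same (equal-one e₁) e₃)))
    codes-equal (inj₁ _) (inj₂ _) e₁ _ _ = ⊥-elim (impossible e₁)
    codes-equal (inj₂ _) (inj₁ _) e₁ _ _ = ⊥-elim (impossible′ d≢0 e₁)
    codes-equal (inj₂ _) (inj₂ _) _ e₂ e₃ = cong inj₂ (sym (same (equal-one e₂) e₃))
    go : c ≡ c′ → (c , b) ≡ (c′ , b′)
    go refl = cong (c ,_) (codes-equal b b′
        (trans (sym (formOf-E₁ c b)) (trans (eval-cong {formOf (c , b)} {scaleF d (formOf (c , b′))} {E₁} {E₁} e (λ _ → refl))
          (trans (eval-scaleF d (formOf (c , b′)) E₁) (cong (d *_) (formOf-E₁ c b′)))))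
        (trans (sym (formOf-polar c b)) (trans (polar-cong {formOf (c , b)} {scaleF d (formOf (c , b′))} {E₁} {E₂} {E₁} {E₂} e (λ _ → refl) (λ _ → refl))
          (trans (polar-scaleF d (formOf (c , b′)) E₁ E₂) (cong (d *_) (formOf-polar c b′)))))
        (trans (sym (formOf-E₂ c b)) (trans (eval-cong {formOf (c , b)} {scaleF d (formOf (c , b′))} {E₂} {E₂} e (λ _ → refl))
          (trans (eval-scaleF d (formOf (c , b′)) E₂) (cong (d *_) (formOf-E₂ c b′))))))
      where open PencilAt c using (E₁; E₂)

  formOf-surjective : ∀ {B A} → NonRepeated B → NonZero3 A → Singular B A → Σ FormCode λ x → x ∈ formCodes × PropForm (formOf x) B
  formOf-surjective {B} {A} nr A≢0 s = let c , pr = point-surjective {A} A≢0 in go c (Singular-Prop3 {B} {A} {point c} (Prop3-sym {point c} {A} pr) s)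
    where
    go : ∀ c → Singular B (point c) → Σ FormCode λ x → x ∈ formCodes × PropForm (formOf x) B
    go c s = decide (r ≟ 0#) (t ≟ 0#)
      where
      open PencilAt c
      r t u : C
      r = eval B E₁
      t = polar B E₁ E₂
      u = eval B E₂
      B≗ : B ≗F pencil r t u
      B≗ = singular≗pencil {B} s
      member : ∀ b → NonSquare b → (c , b) ∈ formCodes
      member b nb = ∈-cartesianProduct⁺ (∈-pointCodes c) (∈-binaryCodes b nb)
      line : C → Vec3
      line n i = m₁ i + n * m₂ i
      line-· : ∀ n x → line n · x ≡ (m₁ · x) + n * (m₂ · x)
      line-· n x = solveFor (scalar ∷ vector ∷ vector ∷ vector ∷ []) (λ n m m′ x → (λ i → m i :+ n :* m′ i) :· x := m :· x :+ n :* (m′ :· x)) n m₁ m₂ x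
      line≢0 : ∀ n → NonZero3 (line n)
      line≢0 n = [ id , (λ z → ⊥-elim (1≢0 (trans (sym (trans (line-· n E₁) (trans (cong₂ (λ a b → a + n * b) m₁E₁ m₂E₁)
        (solve 1 (λ n → :1 :+ n :* :0 := :1) n)))) (·-zero {line n} {E₁} z)))) ]′ (nonzero? (line n))
      m₂≢0 : NonZero3 m₂
      m₂≢0 = [ id , (λ z → ⊥-elim (1≢0 (trans (sym m₂E₂) (·-zero {m₂} {E₂} z)))) ]′ (nonzero? m₂)
      nonsquare : r ≢ 0# → ¬ Square (r ⁻¹ * t , r ⁻¹ * u)
      nonsquare r≢0 (n , e , f) = proj₂ nr (r , line n , r≢0 , line≢0 n , form-ext B (scaleF r (prodLin (line n) (line n))) λ x →
        trans (eval-cong {B} {pencil r t u} {x} {x} B≗ (λ _ → refl)) (trans (eval-pencil r t u x)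
          (trans (linear₂ ((m₁ · x) * (m₂ · x)) (trans (scale-back r≢0 t) (cong (r *_) e)) ((m₂ · x) * (m₂ · x)) (trans (scale-back r≢0 u) (cong (r *_) f))
            (solve 6 (λ r t u a b n → r :* (a :* a) :+ (t :* (a :* b) :+ u :* (b :* b)) :- r :* ((a :+ n :* b) :* (a :+ n :* b)) :=
              (a :* b) :* (t :- r :* (n :+ n)) :+ (b :* b) :* (u :- r :* (n :* n))) r t u (m₁ · x) (m₂ · x) n))
            (sym (trans (eval-multiple {scaleF r (prodLin (line n) (line n))} {r} {line n} {line n} (λ _ → refl) x)
              (cong (λ z → r * (z * z)) (line-· n x)))))))
      decide : Dec (r ≡ 0#) → Dec (t ≡ 0#) → Σ FormCode λ x → x ∈ formCodes × PropForm (formOf x) B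
      decide (no r≢0) _ = (c , b) , member b (nonsquare r≢0) , r , r≢0 , λ p → trans (B≗ p)
          (linear₂ (prodLin m₁ m₂ p) (scale-back r≢0 t) (prodLin m₂ m₂ p) (scale-back r≢0 u)
            (solve 8 (λ r t u t′ u′ x y z → r :* x :+ (t :* y :+ u :* z) :- r :* (:1 :* x :+ (t′ :* y :+ u′ :* z)) := y :* (t :- r :* t′) :+ z :* (u :- r :* u′))
              r t u (r ⁻¹ * t) (r ⁻¹ * u) (prodLin m₁ m₁ p) (prodLin m₁ m₂ p) (prodLin m₂ m₂ p)))
        where
        b : BinaryCode
        b = inj₁ (r ⁻¹ * t , r ⁻¹ * u)
      decide (yes r≡0) (no t≢0) = (c , b) , member b tt , t , t≢0 , λ p → trans (B≗ p)
          (linear₂ (prodLin m₁ m₁ p) r≡0 (prodLin m₂ m₂ p) (scale-back t≢0 u)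
            (solve 7 (λ r t u u′ x y z → r :* x :+ (t :* y :+ u :* z) :- t :* (:0 :* x :+ (:1 :* y :+ u′ :* z)) := x :* (r :- :0) :+ z :* (u :- t :* u′))
              r t u (t ⁻¹ * u) (prodLin m₁ m₁ p) (prodLin m₁ m₂ p) (prodLin m₂ m₂ p)))
        where
        b : BinaryCode
        b = inj₂ (t ⁻¹ * u)
      decide (yes r≡0) (yes t≡0) = ⊥-elim (square-case (u ≟ 0#))
        where
        B≗um₂² : B ≗F scaleF u (prodLin m₂ m₂)
        B≗um₂² p = trans (B≗ p) (linear₂ (prodLin m₁ m₁ p) r≡0 (prodLin m₁ m₂ p) t≡0
          (solve 6 (λ r t u x y z → r :* x :+ (t :* y :+ u :* z) :- u :* z := x :* (r :- :0) :+ y :* (t :- :0)) r t u (prodLin m₁ m₁ p) (prodLin m₁ m₂ p) (prodLin m₂ m₂ p)))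
        square-case : Dec (u ≡ 0#) → ⊥
        square-case (no u≢0) = proj₂ nr (u , m₂ , u≢0 , m₂≢0 , B≗um₂²)
        square-case (yes u≡0) = let p , n = proj₁ nr in n (trans (B≗um₂² p) (trans (cong (_* prodLin m₂ m₂ p) u≡0) (zeroˡ _)))

pairwise-map : ∀ {ℓ ℓ′ : Level} {A : Set} {B : Set ℓ} {R : B → B → Set ℓ′} {f : A → B} {xs : List A} → Unique xs →
  (∀ {x y} → x ∈ xs → y ∈ xs → x ≢ y → R (f x) (f y)) → AllPairs R (map f xs)
pairwise-map {R = R} {f} {xs} u h = AllPairsₚ.map⁺ (go u h)
  where
  go : ∀ {xs} → Unique xs → (∀ {x y} → x ∈ xs → y ∈ xs → x ≢ y → R (f x) (f y)) → AllPairs (λ x y → R (f x) (f y)) xs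
  go []       h = []
  go (n ∷ ns) h = All.tabulate (λ y∈ → h (here refl) (there y∈) (All.lookup n y∈)) ∷ go ns (λ x∈ y∈ → h (there x∈) (there y∈))

cross-map : ∀ {ℓ ℓ′ : Level} {A A′ : Set} {B : Set ℓ} {R : B → B → Set ℓ′} {f : A → B} {f′ : A′ → B} {xs : List A} {ys : List A′} →
  (∀ {x y} → x ∈ xs → y ∈ ys → R (f x) (f′ y)) → All (λ b → All (R b) (map f′ ys)) (map f xs)
cross-map h = Allₚ.map⁺ (All.tabulate λ x∈ → Allₚ.map⁺ (All.tabulate λ y∈ → h x∈ y∈))

lookupAll : ∀ {ℓ ℓ′ : Level} {A : Set ℓ} {P : A → Set ℓ′} {xs : List A} → All P xs → ∀ i → P (lookup xs i)
lookupAll (p ∷ _)  zero    = p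
lookupAll (_ ∷ ps) (suc i) = lookupAll ps i

lookupPairs : ∀ {ℓ ℓ′ : Level} {A : Set ℓ} {R : A → A → Set ℓ′} → (∀ {x y} → R x y → R y x) → ∀ {xs : List A} → AllPairs R xs →
  ∀ i j → i ≢ j → R (lookup xs i) (lookup xs j)
lookupPairs symm (_ ∷ _)  zero    zero    i≢j = ⊥-elim (i≢j refl)
lookupPairs symm (p ∷ _)  zero    (suc j) i≢j = lookupAll p j
lookupPairs symm (p ∷ _)  (suc i) zero    i≢j = symm (lookupAll p i)
lookupPairs symm (_ ∷ ps) (suc i) (suc j) i≢j = lookupPairs symm ps i j (i≢j ∘ cong suc)

unique-map-on : ∀ {A B : Set} {f : A → B} {xs : List A} → Unique xs → (∀ {x y} → x ∈ xs → y ∈ xs → f x ≡ f y → x ≡ y) → Unique (map f xs)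
unique-map-on u h = pairwise-map u (λ x∈ y∈ x≢y e → x≢y (h x∈ y∈ e))

-- Here n = q³ - q counts the elements outside F, and the subtraction is q⁶ - q⁴ - (q³ - q)q². With
-- q = r + 1 the truncated differences become polynomials in r.
independent-pairs-count : ∀ q n m → 0 ℕ.< q → q ℕ.+ n ≡ q ℕ.^ 3 → (q ℕ.* q ℕ.^ 3 ℕ.+ n ℕ.* (q ℕ.* q)) ℕ.+ m ≡ q ℕ.^ 3 ℕ.* q ℕ.^ 3 →
  m ≡ q ℕ.^ 3 ℕ.* (q ℕ.^ 2 ℕ.∸ 1) ℕ.* (q ℕ.∸ 1)
independent-pairs-count (suc r) n m _ e f = ℕₚ.+-cancelˡ-≡ (q ℕ.* q ℕ.^ 3 ℕ.+ n ℕ.* (q ℕ.* q)) m _ (trans f (trans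
    (solveℕ 1 (λ r → let q = conℕ 1 +ℕ r ; q³ = q *ℕ (q *ℕ (q *ℕ conℕ 1)) in q³ *ℕ q³ =ℕ
      (q *ℕ q³ +ℕ (q *ℕ (r *ℕ (conℕ 2 +ℕ r))) *ℕ (q *ℕ q)) +ℕ q³ *ℕ (r *ℕ (conℕ 2 +ℕ r)) *ℕ r) refl r)
    (cong₂ ℕ._+_ (cong (λ x → q ℕ.* q ℕ.^ 3 ℕ.+ x ℕ.* (q ℕ.* q)) (sym n≡)) (cong (λ x → q ℕ.^ 3 ℕ.* x ℕ.* r) (sym q²∸1)))))
  where
  open +-*-Solver renaming (solve to solveℕ; _:+_ to _+ℕ_; _:*_ to _*ℕ_; _:=_ to _=ℕ_; con to conℕ)
  q = suc r
  n≡ : n ≡ q ℕ.* (r ℕ.* (2 ℕ.+ r))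
  n≡ = ℕₚ.+-cancelˡ-≡ q n _ (trans e (solveℕ 1 (λ r → let q = conℕ 1 +ℕ r in q *ℕ (q *ℕ (q *ℕ conℕ 1)) =ℕ q +ℕ q *ℕ (r *ℕ (conℕ 2 +ℕ r))) refl r))
  q²∸1 : q ℕ.^ 2 ℕ.∸ 1 ≡ r ℕ.* (2 ℕ.+ r)
  q²∸1 = cong (ℕ._∸ 1) (solveℕ 1 (λ r → let q = conℕ 1 +ℕ r in q *ℕ (q *ℕ conℕ 1) =ℕ conℕ 1 +ℕ r *ℕ (conℕ 2 +ℕ r)) refl r)

-- Counting the conjugate triangles

module Triangles {q : ℕ} {p k : ℕ} (p-prime : Prime p) (q≡ : q ≡ p ℕ.^ suc k)
  (F : FiniteField q) (K : FiniteField (q ℕ.^ 3)) (ι-hom : FieldHom F K) where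

  open Planes {p = p} {k = k} p-prime q≡ F K ι-hom
  private
    module EF = Enumerations F
    module EK = Enumerations K

  -- Every independent point has one multiple of this form: if its first coordinate were zero, the
  -- same would hold for its conjugates, and the three would be dependent.
  vertex : C × C → Vec3
  vertex (y , z) = vec3 1# y z

  σ : C × C → C × C
  σ (y , z) = y ′ , z ′

  σ³ : ∀ x → σ (σ (σ x)) ≡ x
  σ³ (y , z) = cong₂ _,_ (fr³ y) (fr³ z)

  frV-vertex : ∀ x i → frV (vertex x) i ≡ vertex (σ x) i
  frV-vertex x i0 = fr-1
  frV-vertex x i1 = refl
  frV-vertex x i2 = refl

  volume : C × C → C
  volume x = det (vertex x) (frV (vertex x)) (frV (frV (vertex x)))

  volume≡ : ∀ y z → volume (y , z) ≡ (y ′ - y) * (z ″ - z ′) - (y ″ - y ′) * (z ′ - z)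
  volume≡ y z = trans (det-cong {vertex (y , z)} {vertex (y , z)} {frV (vertex (y , z))} {vertex (y ′ , z ′)} {frV (frV (vertex (y , z)))} {vertex (y ″ , z ″)}
      (λ _ → refl) (frV-vertex (y , z)) (λ i → trans (cong fr (frV-vertex (y , z) i)) (frV-vertex (y ′ , z ′) i)))
    (solve 6 (λ y y′ y″ z z′ z″ → detE (λ { i0 → :1 ; i1 → y ; i2 → z }) (λ { i0 → :1 ; i1 → y′ ; i2 → z′ }) (λ { i0 → :1 ; i1 → y″ ; i2 → z″ }) :=
      (y′ :- y) :* (z″ :- z′) :- (y″ :- y′) :* (z′ :- z)) y (y ′) (y ″) z (z ′) (z ″))

  dependent? : Decidable (λ x → volume x ≡ 0#)
  dependent? x = volume x ≟ 0#

  candidates : List (C × C)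
  candidates = filter (λ x → ¬? (dependent? x)) EK.pairs

  candidates-unique : Unique candidates
  candidates-unique = Uniqueₚ.filter⁺ (λ x → ¬? (dependent? x)) EK.pairs-unique

  ∈-candidates : ∀ {x} → Independent (vertex x) → x ∈ candidates
  ∈-candidates {x} ind = ∈-filter⁺ (λ x → ¬? (dependent? x)) (EK.∈-pairs x) ind

  candidates⇒independent : ∀ {x} → x ∈ candidates → Independent (vertex x)
  candidates⇒independent {x} x∈ = proj₂ (∈-filter⁻ (λ x → ¬? (dependent? x)) {xs = EK.pairs} x∈)

  independent-cong : ∀ {S R} → (∀ i → S i ≡ R i) → Independent S → Independent R
  independent-cong {S} {R} e ind z = ind (trans (det-cong {S} {R} {frV S} {frV R} {frV (frV S)} {frV (frV R)} e (λ i → cong fr (e i)) (λ i → cong (fr ∘ fr) (e i))) z)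

  independent-fr : ∀ {S} → Independent S → Independent (frV S)
  independent-fr {S} ind z = fr-nonzero ind (trans (fr-det S (frV S) (frV (frV S))) z)

  independent-scale : ∀ {S R} → Prop3 S R → Independent S → Independent R
  independent-scale {S} {R} (c , c≢0 , e) ind z = *-nonzero (*-nonzero c≢0 (*-nonzero (fr-nonzero c≢0) (fr-nonzero (fr-nonzero c≢0)))) ind
    (trans (solveFor (scalar ∷ scalar ∷ scalar ∷ vector ∷ vector ∷ vector ∷ []) (λ c d e u v w →
        c :* (d :* e) :* detE u v w := detE (λ i → c :* u i) (λ i → d :* v i) (λ i → e :* w i)) c (c ′) (c ″) S (frV S) (frV (frV S)))
      (trans (sym (det-cong {R} {c *V S} {frV R} {(c ′) *V frV S} {frV (frV R)} {(c ″) *V frV (frV S)} e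
        (λ i → trans (cong fr (e i)) (fr-* c (S i))) (λ i → trans (cong fr (trans (cong fr (e i)) (fr-* c (S i)))) (fr-* (c ′) (frV S i))))) z))

  normalise : ∀ {S} → Independent S → Σ (C × C) λ x → Prop3 (vertex x) S
  normalise {S} ind = (S i0 ⁻¹ * S i1 , S i0 ⁻¹ * S i2) , S i0 , S₀≢0 , ∀Fin3 (sym (*-identityʳ _)) (EK.scale-back S₀≢0 (S i1)) (EK.scale-back S₀≢0 (S i2))
    where
    S₀≢0 : S i0 ≢ 0#
    S₀≢0 z = ind (linear₃ (cross (frV S) (frV (frV S)) i0) z (S i2 * frV (frV S) i1 - S i1 * frV (frV S) i2) (trans (cong fr z) fr-0)
        (S i1 * frV S i2 - S i2 * frV S i1) (trans (cong fr (trans (cong fr z) fr-0)) fr-0)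
      (solveFor (vector ∷ vector ∷ vector ∷ []) (λ u v w → detE u v w :- :0 := crossE v w i0 :* (u i0 :- :0) :+ (u i2 :* w i1 :- u i1 :* w i2) :* (v i0 :- :0)
        :+ (u i1 :* v i2 :- u i2 :* v i1) :* (w i0 :- :0)) S (frV S) (frV (frV S))))

  vertex-injective : ∀ {x y} → Prop3 (vertex x) (vertex y) → x ≡ y
  vertex-injective {a , b} {a′ , b′} (c , _ , e) = cong₂ _,_ (same (e i1)) (same (e i2))
    where
    c≡1 : c ≡ 1#
    c≡1 = trans (sym (*-identityʳ c)) (sym (e i0))
    same : ∀ {x y} → y ≡ c * x → x ≡ y
    same {x} f = sym (trans f (trans (cong (_* x) c≡1) (*-identityˡ x)))

  closed : ∀ {x} → x ∈ candidates → σ x ∈ candidates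
  closed {x} x∈ = ∈-candidates (independent-cong {frV (vertex x)} {vertex (σ x)} (frV-vertex x) (independent-fr {vertex x} (candidates⇒independent x∈)))

  free : ∀ {x} → x ∈ candidates → σ x ≢ x
  free {x} x∈ e = candidates⇒independent x∈ (trans (det-cong {vertex x} {vertex x} {frV (vertex x)} {vertex x} {frV (frV (vertex x))} {frV (frV (vertex x))}
      (λ _ → refl) (λ i → trans (frV-vertex x i) (cong (λ y → vertex y i) e)) (λ _ → refl))
    (solveFor (vector ∷ vector ∷ []) (λ u v → detE u u v := :0) (vertex x) (frV (frV (vertex x)))))

  code : C × C → ℕ
  code (y , z) = toℕ (Fin.combine y z)

  code-injective : ∀ {x y} → code x ≡ code y → x ≡ y
  code-injective {a , b} {c , d} e = let f , h = Finₚ.combine-injective a b c d (Finₚ.toℕ-injective e) in cong₂ _,_ f h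

  open OrbitsOfThree σ σ³ code code-injective candidates candidates-unique closed free public
    using (representatives; representatives-unique; representative⁻; apart; orbit-of; length-representatives)

  private
    E : List F.C
    E = allFin q
    rational? : Decidable (λ y → fr y ≡ y)
    rational? y = fr y ≟ y
    irrationals : List C
    irrationals = filter (λ y → ¬? (rational? y)) (allFin (q ℕ.^ 3))

    irrational : ∀ {y} → y ∈ irrationals → fr y ≢ y
    irrational y∈ = proj₂ (∈-filter⁻ (λ y → ¬? (rational? y)) {xs = allFin (q ℕ.^ 3)} y∈)

    length-rationals : length (filter rational? (allFin (q ℕ.^ 3))) ≡ q
    length-rationals = trans (sameLength (Uniqueₚ.filter⁺ rational? (Uniqueₚ.allFin⁺ (q ℕ.^ 3))) (Uniqueₚ.map⁺ ι-injective (Uniqueₚ.allFin⁺ q))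
        (λ {y} y∈ → let a , e = fr-fixed⇒ι (proj₂ (∈-filter⁻ rational? {xs = allFin (q ℕ.^ 3)} y∈)) in subst (_∈ map ι E) e (∈-map⁺ ι (∈-allFin a)))
        (λ {y} y∈ → let a , _ , e = ∈-map⁻ ι y∈ in ∈-filter⁺ rational? (∈-allFin y) (trans (cong fr e) (trans (fr-ι a) (sym e)))))
      (trans (Listₚ.length-map ι E) (length-allFin q))

    length-irrationals : q ℕ.+ length irrationals ≡ q ℕ.^ 3
    length-irrationals = trans (cong (ℕ._+ length irrationals) (sym length-rationals)) (trans (length-complement rational? (allFin (q ℕ.^ 3))) (length-allFin (q ℕ.^ 3)))

    f₁ : F.C × C → C × C
    f₁ (a , z) = ι a , z
    f₂ : C × (F.C × F.C) → C × C
    f₂ (y , (r , s)) = y , ι r * y + ι s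

    list₁ : List (F.C × C)
    list₁ = cartesianProduct E (allFin (q ℕ.^ 3))
    list₂ : List (C × (F.C × F.C))
    list₂ = cartesianProduct irrationals EF.pairs

    -- (1,y,z) is dependent over F when y ∈ F, or when z = ry + s with r, s ∈ F
    dependents : List (C × C)
    dependents = map f₁ list₁ ++ map f₂ list₂

    list₂⇒irrational : ∀ {x} → x ∈ list₂ → fr (proj₁ x) ≢ proj₁ x
    list₂⇒irrational x∈ = irrational (proj₁ (∈-cartesianProduct⁻ irrationals EF.pairs x∈))

    dependents-unique : Unique dependents
    dependents-unique = Uniqueₚ.++⁺
        (Uniqueₚ.map⁺ (λ e → cong₂ _,_ (ι-injective (cong proj₁ e)) (cong proj₂ e)) (Uniqueₚ.cartesianProduct⁺ (Uniqueₚ.allFin⁺ q) (Uniqueₚ.allFin⁺ (q ℕ.^ 3))))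
        (unique-map-on (Uniqueₚ.cartesianProduct⁺ (Uniqueₚ.filter⁺ (λ y → ¬? (rational? y)) (Uniqueₚ.allFin⁺ (q ℕ.^ 3))) EF.pairs-unique)
          (λ {x} {y} x∈ _ e → injective {x} {y} (list₂⇒irrational x∈) e)) disjoint
      where
      injective : ∀ {x y} → fr (proj₁ x) ≢ proj₁ x → f₂ x ≡ f₂ y → x ≡ y
      injective {y , (r , s)} {y₂ , (r₂ , s₂)} irr e with refl ← cong proj₁ e = cong (y ,_) (cong₂ _,_ r≡ s≡)
        where
        equation : ι r * y + ι s ≡ ι r₂ * y + ι s₂
        equation = cong proj₂ e
        r≡ : r ≡ r₂
        r≡ = decide (r F.≟ r₂)
          where
          decide : Dec (r ≡ r₂) → r ≡ r₂
          decide (yes e) = e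
          decide (no ne) = ⊥-elim (irr (x-y≡0⇒x≡y (*-cancelˡ-0 {ι r - ι r₂} (λ z → ne (ι-injective (x-y≡0⇒x≡y z)))
            (linear₂ (- 1#) equation 1# (trans (sym (conj r s)) (trans (cong fr equation) (conj r₂ s₂)))
              (solve 6 (λ r r₂ y y′ s s₂ → (r :- r₂) :* (y′ :- y) :- :0 := (:- :1) :* (r :* y :+ s :- (r₂ :* y :+ s₂)) :+ :1 :* (r :* y′ :+ s :- (r₂ :* y′ :+ s₂))) (ι r) (ι r₂) y (y ′) (ι s) (ι s₂))))))
            where
            conj : ∀ r s → fr (ι r * y + ι s) ≡ ι r * y ′ + ι s
            conj r s = trans (fr-+ _ _) (cong₂ _+_ (trans (fr-* (ι r) y) (cong (_* y ′) (fr-ι r))) (fr-ι s))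
        s≡ : s ≡ s₂
        s≡ = ι-injective (linear₂ 1# equation (- y) (cong ι r≡) (solve 5 (λ r r₂ y s s₂ → s :- s₂ := :1 :* (r :* y :+ s :- (r₂ :* y :+ s₂)) :+ (:- y) :* (r :- r₂)) (ι r) (ι r₂) y (ι s) (ι s₂)))
      disjoint : ∀ {x} → ¬ (x ∈ map f₁ list₁ × x ∈ map f₂ list₂)
      disjoint (a , b) = let (c , z) , _ , e = ∈-map⁻ f₁ a ; (y , rs) , y∈ , f = ∈-map⁻ f₂ b in
        list₂⇒irrational y∈ (trans (cong fr (trans (sym (cong proj₁ f)) (cong proj₁ e))) (trans (fr-ι c) (trans (sym (cong proj₁ e)) (cong proj₁ f))))

    dependents-sound : ∀ {x} → x ∈ dependents → volume x ≡ 0#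
    dependents-sound {x} x∈ = [ first , second ]′ (∈-++⁻ (map f₁ list₁) x∈)
      where
      first : x ∈ map f₁ list₁ → volume x ≡ 0#
      first a = let (c , z) , _ , e = ∈-map⁻ f₁ a in subst (λ y → volume y ≡ 0#) (sym e) (trans (volume≡ (ι c) z)
        (linear₂ (z ″ - z ′) (fr-ι c) (- (z ′ - z)) (cong fr (fr-ι c))
          (solve 6 (λ y y′ y″ z z′ z″ → (y′ :- y) :* (z″ :- z′) :- (y″ :- y′) :* (z′ :- z) :- :0 := (z″ :- z′) :* (y′ :- y) :+ (:- (z′ :- z)) :* (y″ :- y′)) (ι c) (ι c ′) (ι c ″) z (z ′) (z ″))))
      second : x ∈ map f₂ list₂ → volume x ≡ 0#
      second b = let (y , (r , s)) , _ , e = ∈-map⁻ f₂ b in subst (λ y → volume y ≡ 0#) (sym e) (trans (volume≡ y (ι r * y + ι s)) (vanish y r s))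
        where
        conj : ∀ y r s → fr (ι r * y + ι s) ≡ ι r * y ′ + ι s
        conj y r s = trans (fr-+ _ _) (cong₂ _+_ (trans (fr-* (ι r) y) (cong (_* y ′) (fr-ι r))) (fr-ι s))
        vanish : ∀ y r s → let z = ι r * y + ι s in (y ′ - y) * (z ″ - z ′) - (y ″ - y ′) * (z ′ - z) ≡ 0#
        vanish y r s = trans (cong₂ (λ a b → (y ′ - y) * (b - a) - (y ″ - y ′) * (a - (ι r * y + ι s))) (conj y r s) (trans (cong fr (conj y r s)) (conj (y ′) r s)))
          (solve 5 (λ y y′ y″ r s → (y′ :- y) :* (r :* y″ :+ s :- (r :* y′ :+ s)) :- (y″ :- y′) :* (r :* y′ :+ s :- (r :* y :+ s)) := :0) y (y ′) (y ″) (ι r) (ι s))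

    -- If y is not in F, the vanishing determinant says that the slope (z′ - z)/(y′ - y) is fixed by
    -- Frobenius. It is the required r, and z - ry is then fixed as well.
    dependents-complete : ∀ {x} → volume x ≡ 0# → x ∈ dependents
    dependents-complete {y , z} e = decide (rational? y)
      where
      decide : Dec (fr y ≡ y) → (y , z) ∈ dependents
      decide (yes fixed) = let a , ιa≡ = fr-fixed⇒ι fixed in
        ∈-++⁺ˡ (subst (λ w → (w , z) ∈ map f₁ list₁) ιa≡ (∈-map⁺ f₁ (∈-cartesianProduct⁺ (∈-allFin a) (∈-allFin z))))
      decide (no irr) = ∈-++⁺ʳ (map f₁ list₁) (subst (λ w → (y , w) ∈ map f₂ list₂) (sym z≡)
          (∈-map⁺ f₂ (∈-cartesianProduct⁺ (∈-filter⁺ (λ y → ¬? (rational? y)) (∈-allFin y) irr) (EF.∈-pairs (r , s)))))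
        where
        δ : C
        δ = y ′ - y
        δ≢0 : δ ≢ 0#
        δ≢0 w = irr (x-y≡0⇒x≡y w)
        ρ : C
        ρ = (z ′ - z) * δ ⁻¹
        ρδ : ρ * δ ≡ z ′ - z
        ρδ = linear₁ (z ′ - z) (*-inverseˡ δ≢0) (solve 3 (λ w d e → w :* d :* e :- w := w :* (d :* e :- :1)) (z ′ - z) (δ ⁻¹) δ)
        fr-ρδ : fr ρ * (y ″ - y ′) ≡ z ″ - z ′
        fr-ρδ = trans (cong (fr ρ *_) (sym (fr-sub (y ′) y))) (trans (sym (fr-* ρ δ)) (trans (cong fr ρδ) (fr-sub (z ′) z)))
        fixed : fr ρ ≡ ρ
        fixed = *-cancelˡ (*-nonzero δ≢0 (λ w → δ≢0 (fr-zero (trans (fr-sub (y ′) y) w))))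
          (linear₃ δ fr-ρδ (- (y ″ - y ′)) ρδ 1# (trans (sym (volume≡ y z)) e)
            (solve 6 (λ δ η u v f ρ → δ :* η :* f :- δ :* η :* ρ := δ :* (f :* η :- u) :+ (:- η) :* (ρ :* δ :- v) :+ :1 :* (δ :* u :- η :* v :- :0)) δ (y ″ - y ′) (z ″ - z ′) (z ′ - z) (fr ρ) ρ))
        r : F.C
        r = proj₁ (fr-fixed⇒ι fixed)
        ι-r : ι r ≡ ρ
        ι-r = proj₂ (fr-fixed⇒ι fixed)
        fixed′ : fr (z - ρ * y) ≡ z - ρ * y
        fixed′ = trans (fr-sub z (ρ * y)) (trans (cong (z ′ -_) (trans (fr-* ρ y) (cong (_* y ′) fixed)))
          (linear₁ (- 1#) ρδ (solve 5 (λ z z′ r y y′ → z′ :- r :* y′ :- (z :- r :* y) := (:- :1) :* (r :* (y′ :- y) :- (z′ :- z))) z (z ′) ρ y (y ′))))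
        s : F.C
        s = proj₁ (fr-fixed⇒ι fixed′)
        z≡ : z ≡ ι r * y + ι s
        z≡ = trans (solve 3 (λ z r y → z := r :* y :+ (z :- r :* y)) z ρ y) (sym (cong₂ (λ a b → a * y + b) ι-r (proj₂ (fr-fixed⇒ι fixed′))))

    length-dependents : length dependents ≡ q ℕ.* q ℕ.^ 3 ℕ.+ length irrationals ℕ.* (q ℕ.* q)
    length-dependents = trans (Listₚ.length-++ (map f₁ list₁)) (cong₂ ℕ._+_
      (trans (Listₚ.length-map f₁ list₁) (trans (length-cartesianProduct E (allFin (q ℕ.^ 3))) (cong₂ ℕ._*_ (length-allFin q) (length-allFin (q ℕ.^ 3)))))
      (trans (Listₚ.length-map f₂ list₂) (trans (length-cartesianProduct irrationals EF.pairs) (cong (length irrationals ℕ.*_) EF.length-pairs))))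

    length-total : length dependents ℕ.+ length candidates ≡ q ℕ.^ 3 ℕ.* q ℕ.^ 3
    length-total = trans (cong (ℕ._+ length candidates) (sym (sameLength (Uniqueₚ.filter⁺ dependent? EK.pairs-unique) dependents-unique
        (λ x∈ → dependents-complete (proj₂ (∈-filter⁻ dependent? {xs = EK.pairs} x∈)))
        (λ {x} x∈ → ∈-filter⁺ dependent? (EK.∈-pairs x) (dependents-sound x∈)))))
      (trans (length-complement dependent? EK.pairs) EK.length-pairs)

  length-triangles : length representatives ≡ (q ℕ.^ 3 ℕ.* (q ℕ.^ 2 ℕ.∸ 1) ℕ.* (q ℕ.∸ 1)) Data.Nat.DivMod./ 3
  length-triangles = sym (trans (cong (Data.Nat.DivMod._/ 3) (trans (sym (independent-pairs-count q (length irrationals) (length candidates)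
      (ℕₚ.<-trans (ℕ.s≤s ℕ.z≤n) 1<q) length-irrationals (trans (cong (ℕ._+ length candidates) (sym length-dependents)) length-total))) length-representatives))
    (m*n/n≡m (length representatives) 3))

-- The list of all planes and its properties

module Main {q : ℕ} {p k : ℕ} (p-prime : Prime p) (q≡ : q ≡ p ℕ.^ suc k)
  (F : FiniteField q) (L : FiniteField (q ℕ.^ 2)) (ιL : FieldHom F L) (K : FiniteField (q ℕ.^ 3)) (ιK : FieldHom F K)
  (g : LinAlg.Mat F) (singer : Geometry.IsSingerGenerator F L ιL K ιK g) where

  private
    module G = Geometry F L ιL K ιK
    module Im = Imaginary {p = p} {k = k} p-prime q≡ F L ιL K ιK
    module EF = Enumerations F
    module Tri = Triangles {p = p} {k = k} p-prime q≡ F K ιK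
  open Singer {p = p} {k = k} p-prime q≡ F K ιK g (proj₁ singer) (proj₁ (proj₂ singer)) (proj₂ (proj₂ (proj₂ singer)))

  -- A nonzero form of the net has no singular point, while repeated lines, bi-lines and imaginary
  -- bi-lines all have a rational one; hence it is a conic.
  inB⁺ : ∀ {Q} → Through T Q → F.NonZeroForm Q → G.InB g Q
  inB⁺ {Q} TQ Q≢0 = (Q≢0 , (λ rep → singular-absurd (Im.RepeatedLine⇒singular {Q} rep)) , (λ bi → singular-absurd (Im.BiLine⇒center {Q} bi)) ,
      (λ im → singular-absurd (Im.ImBiLine⇒center {Q} im))) , λ R (R≢0 , fixed) → through-fixed-points {Q} TQ R R≢0 fixed
    where
    singular-absurd : ¬ (Σ F.Vec3 λ A → F.NonZero3 A × F.Singular Q A)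
    singular-absurd (A , A≢0 , s) = let p , n = Q≢0 in n (through-nonsingular {Q} {ιV A} TQ (ιV-nonzero {A} A≢0) (ι-Singular⁺ {Q} {A} s) p)

  inB⁻ : ∀ {Q} → G.InB g Q → Through T Q
  inB⁻ (_ , h) = h T (T≢0 , T-fixed)

  inB-β : ∀ {Q} → G.InB g Q → β Q ≢ 0#
  inB-β {Q} inB z = let p , n = proj₁ (proj₁ inB) in n (coordinates-zero {Q} (inB⁻ {Q} inB) z p)

  biLineClass : DegenerateClass F.BiLine F.BiLineCenteredAt
  biLineClass = record
    { nonrepeated = λ {Q} → Im.BiLine⇒nonrepeated {Q}
    ; center = λ {Q} → Im.BiLine⇒center {Q}
    ; translate = λ {Q} b m → Im.BiLine-substForm {Q} {g F.^M m} (FM.^M-invertible {g} (proj₁ singer) m) b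
    ; centered⁺ = λ {Q} {A} → Im.BiLine-centered⁺ {Q} {A}
    ; centered⁻ = λ {Q} {A} → Im.BiLine-centered⁻ {Q} {A} }

  imBiLineClass : DegenerateClass G.ImBiLine G.ImBiLineCenteredAt
  imBiLineClass = record
    { nonrepeated = λ {Q} → Im.ImBiLine⇒nonrepeated {Q}
    ; center = λ {Q} → Im.ImBiLine⇒center {Q}
    ; translate = λ {Q} b m → Im.ImBiLine-substForm {Q} {g F.^M m} (FM.^M-invertible {g} (proj₁ singer) m) b
    ; centered⁺ = λ {Q} {A} → Im.ImBiLine-centered⁺ {Q} {A}
    ; centered⁻ = λ {Q} {A} → Im.ImBiLine-centered⁻ {Q} {A} }

  ≐-sym : ∀ {W W′} → F._≐_ W W′ → F._≐_ W′ W
  ≐-sym e Q = proj₂ (e Q) , proj₁ (e Q)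

  ≐-trans : ∀ {W W′ W″} → F._≐_ W W′ → F._≐_ W′ W″ → F._≐_ W W″
  ≐-trans e f Q = (λ x → proj₁ (f Q) (proj₁ (e Q) x)) , (λ x → proj₂ (e Q) (proj₂ (f Q) x))

  planeOf : F.Form → F.Subset6
  planeOf B = Plane (α B) (β B)

  planeOf-PropForm : ∀ {B B′} → F.PropForm B B′ → F._≐_ (planeOf B′) (planeOf B)
  planeOf-PropForm {B} {B′} (c , c≢0 , e) Q =
    plane-scale {α B′} {β B′} {α B} {β B} (c F.⁻¹) (F.⁻¹-nonzero c≢0) (unscale α≡) (unscale β≡) {Q} ,
    plane-scale {α B} {β B} {α B′} {β B′} c c≢0 α≡ β≡ {Q}
    where
    α≡ : α B′ ≡ ι c * α B
    α≡ = trans (α-cong {B′} {F.scaleF c B} e) (α-* c B)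
    β≡ : β B′ ≡ ι c * β B
    β≡ = trans (β-cong {B′} {F.scaleF c B} e) (β-* c B)
    unscale : ∀ {x y} → y ≡ ι c * x → x ≡ ι (c F.⁻¹) * y
    unscale {x} {y} f = sym (trans (cong (ι (c F.⁻¹) *_) f) (trans (sym (*-assoc _ _ _))
      (trans (cong (_* x) (trans (sym (ι-* (c F.⁻¹) c)) (trans (cong ι (F.*-inverseˡ c≢0)) ι-1))) (*-identityˡ x))))

  through-cong : ∀ {S R} → (∀ i → S i ≡ R i) → F._≐_ (Through S) (Through R)
  through-cong {S} {R} e Q = (λ z → trans (sym equal) z) , (λ z → trans equal z)
    where
    equal : eval (ιF Q) S ≡ eval (ιF Q) R
    equal = eval-cong {ιF Q} {ιF Q} {S} {R} (λ _ → refl) e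

  through-Prop3 : ∀ {S R} → Prop3 S R → F._≐_ (Through R) (Through S)
  through-Prop3 {S} {R} (c , c≢0 , e) Q = (λ z → *-cancelˡ-0 (*-nonzero c≢0 c≢0) (trans (sym scaled) z)) , (λ z → trans scaled (trans (cong (c * c *_) z) (zeroʳ _)))
    where
    scaled : eval (ιF Q) R ≡ c * c * eval (ιF Q) S
    scaled = trans (eval-cong {ιF Q} {ιF Q} {R} {c *V S} (λ _ → refl) e)
      (solveFor (form ∷ vector ∷ scalar ∷ []) (λ a x c → evalE a (λ i → c :* x i) := c :* c :* evalE a x) (ιF Q) S c)

  through-conjugate : ∀ S → F._≐_ (Through (frV S)) (Through S)
  through-conjugate S Q = (λ z → fr-zero (trans conj z)) , (λ z → trans (sym conj) (trans (cong fr z) fr-0))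
    where
    conj : fr (eval (ιF Q) S) ≡ eval (ιF Q) (frV S)
    conj = trans (fr-eval (ιF Q) S) (eval-cong {frF (ιF Q)} {ιF Q} {frV S} {frV S} (λ p → fr-ι (Q p)) (λ _ → refl))

  singular-Prop3 : ∀ {A B} → F.Prop3 A B → F._≐_ (λ Q → F.Singular Q B) (λ Q → F.Singular Q A)
  singular-Prop3 {A} {B} pr Q = F.Singular-Prop3 {Q} {B} {A} (F.Prop3-sym {A} {B} pr) , F.Singular-Prop3 {Q} {A} {B} pr

  triangle : C × C → F.Subset6
  triangle x = Through (Tri.vertex x)

  degenerate : EF.FormCode → F.Subset6
  degenerate x = planeOf (EF.formOf x)

  -- The plane π_A, by `singular-span`.
  nucleus : EF.PointCode → F.Subset6
  nucleus c Q = F.Singular Q (EF.point c)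

  Ws : List F.Subset6
  Ws = map triangle Tri.representatives ++ (map degenerate EF.formCodes ++ map nucleus EF.pointCodes)

  -- The last two blocks have q²(q²+q+1) and q²+q+1 members, together (q²+1)(q²+q+1).
  length-Ws : length Ws ≡ G.count g
  length-Ws = trans (Listₚ.length-++ (map triangle Tri.representatives)) (cong₂ ℕ._+_
      (trans (Listₚ.length-map triangle Tri.representatives) Tri.length-triangles)
      (trans (Listₚ.length-++ (map degenerate EF.formCodes)) (trans (cong₂ ℕ._+_ (trans (Listₚ.length-map degenerate EF.formCodes) EF.length-formCodes)
        (trans (Listₚ.length-map nucleus EF.pointCodes) EF.length-pointCodes))
        (solveℕ 1 (λ q → (q *ℕ q +ℕ q +ℕ conℕ 1) *ℕ (q *ℕ q) +ℕ (q *ℕ q +ℕ q +ℕ conℕ 1) =ℕ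
          (q *ℕ (q *ℕ conℕ 1) +ℕ conℕ 1) *ℕ (q *ℕ (q *ℕ conℕ 1) +ℕ q +ℕ conℕ 1)) refl q))))
    where open +-*-Solver renaming (solve to solveℕ; _:+_ to _+ℕ_; _:*_ to _*ℕ_; _:=_ to _=ℕ_; con to conℕ)

  representative-independent : ∀ {x} → x ∈ Tri.representatives → Independent (Tri.vertex x)
  representative-independent x∈ = Tri.candidates⇒independent (proj₁ (Tri.representative⁻ x∈))

  formCode-nonSquare : ∀ {x} → x ∈ EF.formCodes → EF.NonSquare (proj₂ x)
  formCode-nonSquare x∈ = EF.binaryCodes⇒nonSquare (proj₂ (∈-cartesianProduct⁻ EF.pointCodes EF.binaryCodes x∈))

  formCode-nonrepeated : ∀ {x} → x ∈ EF.formCodes → F.NonRepeated (EF.formOf x)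
  formCode-nonrepeated {c , b} x∈ = EF.formOf-nonrepeated {c} {b} (formCode-nonSquare x∈)

  Meet : F.Subset6 → F.Subset6 → Set
  Meet = F.MeetInAtMostOnePoint

  meet-sym : ∀ {W W′} → Meet W W′ → Meet W′ W
  meet-sym m x y x≢0 y≢0 a b c d = m x y x≢0 y≢0 b a d c

  triangles-meet : ∀ {x y} → x ∈ Tri.representatives → y ∈ Tri.representatives → x ≢ y → Meet (triangle x) (triangle y)
  triangles-meet {x} {y} x∈ y∈ x≢y = Frm.through-meet {Tri.vertex y} (representative-independent y∈)
      (λ pr → x≢y (Tri.vertex-injective {x} {y} pr))
      (λ pr → Tri.apart y∈ x∈ (sym (Tri.vertex-injective {Tri.σ x} {y} (move (Tri.frV-vertex x) pr))))
      (λ pr → Tri.apart x∈ y∈ (trans (sym (Tri.σ³ x)) (cong Tri.σ (Tri.vertex-injective {Tri.σ (Tri.σ x)} {y}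
        (move (λ i → trans (cong fr (Tri.frV-vertex x i)) (Tri.frV-vertex (Tri.σ x) i)) pr)))))
    where
    module Frm = FramePlanes (Tri.vertex x) (representative-independent x∈)
    move : ∀ {S R P} → (∀ i → S i ≡ R i) → Prop3 S P → Prop3 R P
    move e (c , c≢0 , f) = c , c≢0 , λ i → trans (f i) (cong (c *_) (e i))

  allMeet : AllPairs Meet Ws
  allMeet = AllPairsₚ.++⁺ (pairwise-map Tri.representatives-unique triangles-meet)
    (AllPairsₚ.++⁺ (pairwise-map EF.formCodes-unique (λ {x} {y} x∈ y∈ x≢y → planes-meet {EF.formOf x} {EF.point (proj₁ x)} {EF.formOf y} {EF.point (proj₁ y)}
        (formCode-nonrepeated x∈) (EF.point≢0 (proj₁ x)) (EF.formOf-singular x) (formCode-nonrepeated y∈) (EF.point≢0 (proj₁ y)) (EF.formOf-singular y)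
        (λ pr → x≢y (EF.formOf-injective {x} {y} (formCode-nonSquare x∈) (formCode-nonSquare y∈) pr))))
      (pairwise-map EF.pointCodes-unique (λ {c} {d} _ _ c≢d → F.singular-planes-meet {EF.point c} {EF.point d} (EF.point≢0 c) (EF.point≢0 d) (c≢d ∘ EF.point-injective)))
      (cross-map (λ {x} {c} x∈ _ → plane-singular-meet {EF.formOf x} {EF.point (proj₁ x)} {EF.point c} (formCode-nonrepeated x∈) (EF.point≢0 (proj₁ x)) (EF.formOf-singular x) (EF.point≢0 c))))
    (All.zipWith (λ (a , b) → Allₚ.++⁺ a b)
      ( cross-map (λ {x} {y} x∈ y∈ → meet-sym {degenerate y} {triangle x} (plane-through-meet {EF.formOf y} {EF.point (proj₁ y)} {Tri.vertex x}
          (formCode-nonrepeated y∈) (EF.point≢0 (proj₁ y)) (EF.formOf-singular y) (representative-independent x∈)))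
      , cross-map (λ {x} {c} x∈ _ → triangle-nucleus {x} {c} x∈)))
    where
    -- These planes are disjoint: a nonzero form of the net has no singular point.
    triangle-nucleus : ∀ {x c} → x ∈ Tri.representatives → Meet (triangle x) (nucleus c)
    triangle-nucleus {x} {c} x∈ Q R (p , Qp≢0) _ SQ cQ _ _ = ⊥-elim (Qp≢0 (FramePlanes.through-nonsingular (Tri.vertex x) (representative-independent x∈) {Q} {ιV (EF.point c)} SQ
      (ιV-nonzero {EF.point c} (EF.point≢0 c)) (ι-Singular⁺ {Q} {EF.point c} cQ) p))

  allPlanes : All F.IsPlane Ws
  allPlanes = Allₚ.++⁺ (Allₚ.map⁺ (All.tabulate λ {x} x∈ → FramePlanes.through-plane (Tri.vertex x) (representative-independent x∈)))
    (Allₚ.++⁺ (Allₚ.map⁺ (All.tabulate λ {x} x∈ → Degenerate.isPlaneB {EF.formOf x} {EF.point (proj₁ x)} (formCode-nonrepeated x∈) (EF.point≢0 (proj₁ x)) (EF.formOf-singular x)))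
      (Allₚ.map⁺ (All.tabulate λ {c} _ → EF.PencilAt.singular-plane c)))

  triangle-inC : ∀ {S} → Independent S → G.InC g (Through S)
  triangle-inC {S} ind = let M , N , MN , NT = moving-matrix {S} ind in
    M , (N , MN) , ≐-sym (≐-trans (conic-span {G.InB g} (λ {Q} → inB⁺ {Q}) (λ {Q} → inB⁻ {Q}) {M} {N} MN) (through-cong {apply (ιM N) T} {S} NT))

  module _ {Member : F.Form → Set} {CenteredAt : F.Vec3 → F.Form → Set} (class : DegenerateClass Member CenteredAt) where
    open DegenerateClass class

    InΠ : F.Subset6 → Set
    InΠ W = Σ F.Form λ B → Member B × Σ F.Form λ Cn → G.InB g Cn × F._≐_ W (F.Span (OrbitPart CenteredAt B Cn))

    -- For the conic of `matching-conic` the factor κ is 1, so the orbit part of B spans the plane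
    -- with the coordinates of B itself.
    planeOf-inΠ : ∀ {B A} → Member B → F.NonZero3 A → F.Singular B A → InΠ (planeOf B)
    planeOf-inΠ {B} {A} B∈ A≢0 s = let Cn , TCn , c≢0 , γ≡ = matching-conic {A} A≢0 in B , B∈ , Cn ,
        inB⁺ {Cn} TCn (nonzero Cn c≢0) , ≐-sym (span Cn TCn c≢0 γ≡)
      where
      nonzero : ∀ Cn → β Cn ≢ 0# → F.NonZeroForm Cn
      nonzero Cn c≢0 = [ id , (λ z → ⊥-elim (c≢0 (trans (β-cong {Cn} {F.zeroF} z) β-zero))) ]′ (F.nonzeroForm? Cn)
      span : ∀ Cn (TCn : Through T Cn) (c≢0 : β Cn ≢ 0#) → β Cn ′ ≡ X (ιV A) → F._≐_ (F.Span (OrbitPart CenteredAt B Cn)) (planeOf B)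
      span Cn TCn c≢0 γ≡ = ≐-trans O.orbit-span (λ Q →
          plane-scale {O.a*} {O.b*} {α B} {β B} F.1# F.1≢0 (one a*≡) (one b*≡) {Q} ,
          plane-scale {α B} {β B} {O.a*} {O.b*} F.1# F.1≢0 (one (sym a*≡)) (one (sym b*≡)) {Q})
        where
        module O = OrbitSpan class {B} B∈ {A} A≢0 s {Cn} TCn c≢0
        one : ∀ {x y} → x ≡ y → y ≡ ι F.1# * x
        one {x} e = trans (sym e) (sym (trans (cong (_* x) ι-1) (*-identityˡ x)))
        κ≡1 : O.κ ≡ 1#
        κ≡1 = trans (cong (_* O.γ ⁻¹) (sym γ≡)) (*-inverseʳ O.γ≢0)
        a*≡ : O.a* ≡ α B
        a*≡ = trans (cong (λ z → z * z * α B) κ≡1) (solve 1 (λ a → :1 :* :1 :* a := a) (α B))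
        b*≡ : O.b* ≡ β B
        b*≡ = trans (cong (λ z → z * fr z * β B) κ≡1) (trans (cong (λ z → 1# * z * β B) fr-1) (solve 1 (λ a → :1 :* :1 :* a := a) (β B)))

    -- The plane is determined by the translate of B centered at γ, and a multiple of that translate
    -- is in the enumeration.
    inΠ⇒planeOf : ∀ {W} → InΠ W → Σ EF.FormCode λ x → x ∈ EF.formCodes × F._≐_ W (degenerate x)
    inΠ⇒planeOf {W} (B , B∈ , Cn , inB , W≐) = let A , A≢0 , s = center B∈ in go A A≢0 s
      where
      go : ∀ A → F.NonZero3 A → F.Singular B A → Σ EF.FormCode λ x → x ∈ EF.formCodes × F._≐_ W (degenerate x)
      go A A≢0 s =
        let m , sing , e = O.orbit-plane
            x , x∈ , pr = EF.formOf-surjective {F.substForm B (g F.^M m)} {pointOf O.γ} (nonrepeated (translate B∈ m)) (pointOf-nonzero O.γ≢0) sing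
        in x , x∈ , ≐-trans W≐ (≐-trans O.orbit-span (≐-trans e (planeOf-PropForm {EF.formOf x} {F.substForm B (g F.^M m)} pr)))
        where module O = OrbitSpan class {B} B∈ {A} A≢0 s {Cn} (inB⁻ {Cn} inB) (inB-β {Cn} inB)

  allInUnion : All (G.InUnion g) Ws
  allInUnion = Allₚ.++⁺ (Allₚ.map⁺ (All.tabulate λ {x} x∈ → inj₁ (triangle-inC {Tri.vertex x} (representative-independent x∈))))
    (Allₚ.++⁺ (Allₚ.map⁺ (All.tabulate λ {x} x∈ → degenerate-inUnion x∈))
      (Allₚ.map⁺ (All.tabulate λ {c} _ → inj₂ (inj₂ (inj₂ (EF.point c , EF.point≢0 c , ≐-sym (Im.singular-span {EF.point c} (EF.point≢0 c))))))))
    where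
    degenerate-inUnion : ∀ {x} → x ∈ EF.formCodes → G.InUnion g (degenerate x)
    degenerate-inUnion {x} x∈ = [ (λ bi → inj₂ (inj₂ (inj₁ (planeOf-inΠ biLineClass {EF.formOf x} {EF.point (proj₁ x)} bi (EF.point≢0 (proj₁ x)) (EF.formOf-singular x))))) ,
        (λ im → inj₂ (inj₁ (planeOf-inΠ imBiLineClass {EF.formOf x} {EF.point (proj₁ x)} im (EF.point≢0 (proj₁ x)) (EF.formOf-singular x)))) ]′
      (Im.classify {EF.formOf x} {EF.point (proj₁ x)} (formCode-nonrepeated x∈) (EF.point≢0 (proj₁ x)) (EF.formOf-singular x))

  complete : ∀ W → G.InUnion g W → Any (F._≐_ W) Ws
  complete W (inj₁ (M , (N , MN) , W≐)) = Anyₚ.++⁺ˡ (Anyₚ.map⁺ found)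
    where
    S : Vec3
    S = apply (ιM N) T
    ind : Independent S
    ind = inverse-image-independent {M} {N} MN
    W≐S : F._≐_ W (Through S)
    W≐S = ≐-trans W≐ (conic-span {G.InB g} (λ {Q} → inB⁺ {Q}) (λ {Q} → inB⁻ {Q}) {M} {N} MN)
    found : Any (λ x → F._≐_ W (triangle x)) Tri.representatives
    found = let x , pr = Tri.normalise {S} ind
                r , r∈ , which = Tri.orbit-of (Tri.∈-candidates {x} (Tri.independent-scale {S} {Tri.vertex x} (Prop3-sym {Tri.vertex x} {S} pr) ind))
            in lose r∈ (≐-trans W≐S (≐-trans (through-Prop3 {Tri.vertex x} {S} pr) (conjugates x r which)))
      where
      step : ∀ r → F._≐_ (triangle (Tri.σ r)) (triangle r)
      step r = ≐-trans (≐-sym (through-cong {frV (Tri.vertex r)} {Tri.vertex (Tri.σ r)} (Tri.frV-vertex r))) (through-conjugate (Tri.vertex r))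
      conjugates : ∀ x r → x ≡ r ⊎ (x ≡ Tri.σ r ⊎ x ≡ Tri.σ (Tri.σ r)) → F._≐_ (triangle x) (triangle r)
      conjugates x r (inj₁ refl)        = λ Q → id , id
      conjugates x r (inj₂ (inj₁ refl)) = step r
      conjugates x r (inj₂ (inj₂ refl)) = ≐-trans (step (Tri.σ r)) (step r)
  complete W (inj₂ (inj₁ h)) = Anyₚ.++⁺ʳ (map triangle Tri.representatives) (Anyₚ.++⁺ˡ (Anyₚ.map⁺
    (let x , x∈ , e = inΠ⇒planeOf imBiLineClass h in lose x∈ e)))
  complete W (inj₂ (inj₂ (inj₁ h))) = Anyₚ.++⁺ʳ (map triangle Tri.representatives) (Anyₚ.++⁺ˡ (Anyₚ.map⁺
    (let x , x∈ , e = inΠ⇒planeOf biLineClass h in lose x∈ e)))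
  complete W (inj₂ (inj₂ (inj₂ (A , A≢0 , W≐)))) = Anyₚ.++⁺ʳ (map triangle Tri.representatives) (Anyₚ.++⁺ʳ (map degenerate EF.formCodes) (Anyₚ.map⁺
    (let c , pr = EF.point-surjective {A} A≢0 in lose (EF.∈-pointCodes c) (≐-trans W≐ (≐-trans (Im.singular-span {A} A≢0) (singular-Prop3 {EF.point c} {A} pr))))))

  -- If the planes were equal, two independent forms of the first would be common to both and so
  -- proportional. This derives distinctness from the bound on intersections.
  plane-not-point : ∀ {W W′} → F.IsPlane W → Meet W W′ → ¬ F._≐_ W W′
  plane-not-point {W} {W′} (u , v , w , ind , W≐) meet e = F.1≢0 (proj₁ (proj₂ (ind (F.- c) F.1# F.0# relation)))
    where
    u∈ : W u
    u∈ = proj₂ (W≐ u) (F.span-three {_} {u} {u} {v} {w} F.1# F.0# F.0# (inj₁ (λ _ → refl)) (inj₂ (inj₁ (λ _ → refl))) (inj₂ (inj₂ (λ _ → refl)))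
      (λ p → F.solve 3 (λ u v w → u := :1 :* u :+ (:0 :* v :+ :0 :* w)) (u p) (v p) (w p)))
    v∈ : W v
    v∈ = proj₂ (W≐ v) (F.span-three {_} {v} {u} {v} {w} F.0# F.1# F.0# (inj₁ (λ _ → refl)) (inj₂ (inj₁ (λ _ → refl))) (inj₂ (inj₂ (λ _ → refl)))
      (λ p → F.solve 3 (λ u v w → v := :0 :* u :+ (:1 :* v :+ :0 :* w)) (u p) (v p) (w p)))
    u≢0 : F.NonZeroForm u
    u≢0 = [ id , (λ z → ⊥-elim (F.1≢0 (proj₁ (ind F.1# F.0# F.0# (λ p → F.linear₁ F.1# (z p)
      (F.solve 3 (λ u v w → :1 :* u :+ (:0 :* v :+ :0 :* w) :- :0 := :1 :* (u :- :0)) (u p) (v p) (w p))))))) ]′ (F.nonzeroForm? u)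
    v≢0 : F.NonZeroForm v
    v≢0 = [ id , (λ z → ⊥-elim (F.1≢0 (proj₁ (proj₂ (ind F.0# F.1# F.0# (λ p → F.linear₁ F.1# (z p)
      (F.solve 3 (λ u v w → :0 :* u :+ (:1 :* v :+ :0 :* w) :- :0 := :1 :* (v :- :0)) (u p) (v p) (w p)))))))) ]′ (F.nonzeroForm? v)
    proportion : F.PropForm u v
    proportion = meet u v u≢0 v≢0 u∈ (proj₁ (e u) u∈) v∈ (proj₁ (e v) v∈)
    c : F.C
    c = proj₁ proportion
    relation : ∀ p → F.- c F.* u p F.+ (F.1# F.* v p F.+ F.0# F.* w p) ≡ F.0#
    relation p = F.linear₁ F.1# (proj₂ (proj₂ proportion) p) (F.solve 4 (λ c u v w → :- c :* u :+ (:1 :* v :+ :0 :* w) :- :0 := :1 :* (v :- c :* u)) c (u p) (v p) (w p))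

  conclusion : G.Conclusion g
  conclusion = Ws , length-Ws , lookupAll allInUnion ,
    (λ W W∈ → let found = complete W W∈ in Any.index found , Anyₚ.lookup-index found) ,
    (λ i j i≢j → plane-not-point (lookupAll allPlanes i) (meets i j i≢j)) , lookupAll allPlanes , meets
    where
    meets : ∀ i j → i ≢ j → Meet (lookup Ws i) (lookup Ws j)
    meets = lookupPairs (λ {W} {W′} → meet-sym {W} {W′}) allMeet

open import Data.Nat using (_^_)

theorem7p3 : (q : ℕ) → IsPrimePower q →
    (F : FiniteField q) →
    (L : FiniteField (q ^ 2)) (ιL : FieldHom F L) →
    (K : FiniteField (q ^ 3)) (ιK : FieldHom F K) →
    (g : LinAlg.Mat F) → Geometry.IsSingerGenerator F L ιL K ιK g →
    Geometry.Conclusion F L ιL K ιK g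
theorem7p3 q (p , k , p-prime , q≡) F L ιL K ιK g singer = Main.conclusion {p = p} {k = k} p-prime q≡ F L ιL K ιK g singer
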